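{- Let $G$ be a (finite, simple) graph and let $X\subseteq V(G)$ be such that $|X|\le 5$ and $(G,X)$ is $5$-massed. Suppose $(G,X)$ is not cycle-linked. Then $|X|=5$, $\rho(V(G)\setminus X)=5|V(G)\setminus X|+1$, the vertices of $X$ can be labeled $x_1,\dots,x_5$ so that $x_ix_{i+1}\notin E(G)$ for all $i\in\{1,\dots,5\}$ (with $x_6=x_1$), and there exist vertices $a,b\in V(G)\setminus X$ such that (1) $ab\in E(G)$ and both $a$ and $b$ are adjacent to $x_i$ for every $i\in\{1,\dots,5\}$; and (2) for every connected component $C$ of $G-(X\cup\{a,b\})$ we have $\rho_G(V(C))=5|V(C)|$ and $N_G(V(C))\subseteq\{a,b,x_i,x_{i+2}\}$ for some $i\in\{1,\dots,5\}$ (indices modulo $5$, so $x_6=x_1$, $x_7=x_2$).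
   Context: Graphs are finite and simple. For $Y\subseteq V(G)$, $\rho_G(Y)$ (or $\rho(Y)$) denotes the number of edges of $G$ with at least one end in $Y$; $N_G(Y)$ denotes the set of vertices outside $Y$ adjacent to some vertex of $Y$; $G[Y]$ is the induced subgraph; $G-S$ is the graph obtained by deleting the vertex set $S$. Cycle-linked: for $X\subseteq V(G)$, $(G,X)$ is cycle-linked if either $|X|\ge 3$ and for every ordering $x_1,\dots,x_k$ of $X$ ($k=|X|$) there exist pairwise disjoint sets $X_1,\dots,X_k\subseteq V(G)$ with each $G[X_i]$ connected, $x_i\in X_i$, and $G$ having an edge between $X_i$ and $X_{i+1}$ for all $i\in\{1,\dots,k\}$ (where $X_{k+1}=X_1$); or $|X|\in\{1,2\}$ and $G$ contains a path between the vertices of $X$. Separation: an ordered pair $(A,B)$ of subsets of $V(G)$ is a separation of $(G,X)$ if $A\cup B=V(G)$, $X\subseteq A$, and there is no edge of $G$ between $A\setminus B$ and $B\setminus A$; its order is $|A\cap B|$. $5$-massed: $(G,X)$ is $5$-massed if (M1) $\rho(V(G)\setminus X)>5|V(G)\setminus X|$, and (M2) $\rho(B\setminus A)\le 5|B\setminus A|$ for every separation $(A,B)$ of $(G,X)$ of order less than $|X|$.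
   Formalization: The formal theorem additionally assumes that X is nonempty; for X empty the claim is false, since for example K_20 with X empty is 5-massed and not cycle-linked, but |X| is not 5. -}

module Defs where

open import Data.Nat using (ℕ; zero; suc; _+_; _*_; _<_; _<ᵇ_)
open import Data.Bool using (Bool; true; false; _∧_; _∨_; if_then_else_)
open import Data.Fin using (Fin; toℕ)
open import Data.Fin.Subset using (Subset; _∈_; _∉_; _⊆_; _∩_; _∪_; ∁; _─_; ∣_∣; ⁅_⁆; ⊤; Nonempty)
open import Data.Vec using (lookup)
open import Data.List using (List; []; _∷_; allFin; concatMap)
open import Data.Product using (Σ; ∃; _×_; _,_)
open import Data.Sum using (_⊎_)
open import Relation.Binary.PropositionalEquality using (_≡_)
open import Relation.Nullary using (¬_)
open import Function.Definitions using (Injective)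

record Graph : Set where
  field
    n     : ℕ
    E     : Fin n → Fin n → Bool
    sym   : ∀ u v → E u v ≡ E v u
    irrefl : ∀ v → E v v ≡ false
open Graph public

V : Graph → Set
V G = Fin (n G)

VSet : Graph → Set
VSet G = Subset (n G)

Adj : (G : Graph) → V G → V G → Set
Adj G u v = E G u v ≡ true

memb : ∀ {m} → Fin m → Subset m → Bool
memb v Y = lookup Y v

countB : ∀ {A : Set} → (A → Bool) → List A → ℕ
countB p [] = 0
countB p (x ∷ xs) = if p x then suc (countB p xs) else countB p xs

allPairs : (m : ℕ) → List (Fin m × Fin m)
allPairs m = concatMap (λ i → Data.List.map (λ j → (i , j)) (allFin m)) (allFin m)

ρ : (G : Graph) → VSet G → ℕ
ρ G Y = countB (λ { (u , v) → (toℕ u <ᵇ toℕ v) ∧ E G u v ∧ (memb u Y ∨ memb v Y) })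
               (allPairs (n G))

data Reach (G : Graph) (S : VSet G) : V G → V G → Set where
  here : ∀ {u} → u ∈ S → Reach G S u u
  step : ∀ {u w v} → u ∈ S → Adj G u w → Reach G S w v → Reach G S u v

Connected : (G : Graph) → VSet G → Set
Connected G S = ∀ u v → u ∈ S → v ∈ S → Reach G S u v

EdgeBetween : (G : Graph) → VSet G → VSet G → Set
EdgeBetween G A B = ∃ λ u → ∃ λ v → u ∈ A × v ∈ B × Adj G u v

IsOrdering : (G : Graph) (X : VSet G) {k : ℕ} → (Fin k → V G) → Set
IsOrdering G X {k} x = k ≡ ∣ X ∣ × Injective _≡_ _≡_ x × (∀ v → v ∈ X → ∃ λ i → x i ≡ v) × (∀ i → x i ∈ X)

CycSucc : ∀ {k} → Fin k → Fin k → Set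
CycSucc {k} i j = (suc (toℕ i) ≡ toℕ j) ⊎ (suc (toℕ i) ≡ k × toℕ j ≡ 0)

CycleLinked : (G : Graph) → VSet G → Set
CycleLinked G X =
  (3 Data.Nat.≤ ∣ X ∣ ×
    (∀ (x : Fin ∣ X ∣ → V G) → IsOrdering G X x →
       Σ (Fin ∣ X ∣ → VSet G) λ Xs →
         (∀ i j → ¬ i ≡ j → ∀ v → v ∈ Xs i → v ∉ Xs j)
         × (∀ i → Connected G (Xs i))
         × (∀ i → x i ∈ Xs i)
         × (∀ i j → CycSucc i j → EdgeBetween G (Xs i) (Xs j))))
  ⊎ ((∣ X ∣ ≡ 1 ⊎ ∣ X ∣ ≡ 2) × (∀ u v → u ∈ X → v ∈ X → Reach G ⊤ u v))

record Separation (G : Graph) (X : VSet G) (A B : VSet G) : Set where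
  field
    cover  : ∀ v → v ∈ A ⊎ v ∈ B
    X⊆A    : X ⊆ A
    noEdge : ∀ u v → u ∈ A → u ∉ B → v ∈ B → v ∉ A → ¬ Adj G u v

order : ∀ {m} → Subset m → Subset m → ℕ
order A B = ∣ A ∩ B ∣

FiveMassed : (G : Graph) → VSet G → Set
FiveMassed G X =
  (5 * ∣ ∁ X ∣ < ρ G (∁ X))
  × (∀ A B → Separation G X A B → order A B < ∣ X ∣ → ρ G (B ─ A) Data.Nat.≤ 5 * ∣ B ─ A ∣)

InN : (G : Graph) → VSet G → V G → Set
InN G Y v = v ∉ Y × ∃ λ u → u ∈ Y × Adj G u v

IsComponent : (G : Graph) → VSet G → VSet G → Set
IsComponent G R C =
  C ⊆ R × Nonempty C × Connected G C
  × (∀ u v → u ∈ C → v ∈ R → v ∉ C → ¬ Adj G u v)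

sh : Fin 5 → Fin 5
sh Fin.zero = Fin.suc Fin.zero
sh (Fin.suc Fin.zero) = Fin.suc (Fin.suc Fin.zero)
sh (Fin.suc (Fin.suc Fin.zero)) = Fin.suc (Fin.suc (Fin.suc Fin.zero))
sh (Fin.suc (Fin.suc (Fin.suc Fin.zero))) = Fin.suc (Fin.suc (Fin.suc (Fin.suc Fin.zero)))
sh (Fin.suc (Fin.suc (Fin.suc (Fin.suc Fin.zero)))) = Fin.zero

{-# OPTIONS --safe #-}
-- A minimal counterexample is sought among graphs with boundary X, where edges are counted twice and the cycle-linkage is
-- generalised to a labelling of X by the vertices of a cycle, so that separations may identify roots.
-- (1) A separation of order < |X| whose far side realises every labelling of the separator is replaced by a clique on it, and
-- by minimality every massed pair of smaller order realises all labellings. (2) A massed far side behind a separator of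
-- order |X| is joined to X by Menger's theorem, so it is exceptional, and then contracting an edge at the pair a, b gives a
-- contradiction. (3) Hence an edge uv with v outside X can be contracted unless u and v have at least five common neighbours,
-- where two vertices of X count as adjacent. (4) After deleting surplus edges the average degree gives a vertex v outside X of
-- degree at most 9, and its neighbourhood has minimum degree 5; it is linked to X by Menger's theorem, and a decision tree
-- shows that v and its neighbours contain every rooted 5-cycle. (5) The one obstacle to contraction and to finding v is a pair
-- of adjacent vertices a, b complete to X. Then each two roots are linked through a or b, only one link of the cycle is
-- missing, and no component of the rest touches two consecutive roots; counting its edges behind {a, b, x_i, x_i+2}
-- gives equality everywhere.
module Submission where

import Defs
open import Defs using (Graph; V; VSet; Adj; countB; allPairs; ρ; Reach; here; step; Connected; EdgeBetween; IsOrdering; CycSucc; CycleLinked; Separation; FiveMassed; InN; IsComponent; sh)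
import Data.Bool as B
open import Data.Bool using (Bool; true; false; _∧_; _∨_; not; T; if_then_else_)
import Data.Char as Char
open import Data.Empty using (⊥; ⊥-elim)
import Data.Fin as F
open import Data.Fin using (Fin; zero; suc; toℕ)
open import Data.Fin.Patterns using (0F; 1F; 2F; 3F; 4F)
open import Data.Fin.Properties using (any?; injective⇒≤; toℕ<n; toℕ-injective; toℕ-fromℕ<)
open import Data.Fin.Subset using (Subset; _∈_; _∉_; _∩_; _∪_; ∁; _─_; ∣_∣; ⁅_⁆; ⊤)
open import Data.Fin.Subset.Properties using (x∈⁅x⁆; x∈⁅y⁆⇒x≡y; x∈p∪q⁺; ∈⊤)
open import Data.List using (List; []; _∷_; _++_; length; map; concatMap; foldl; head; tabulate)
import Data.Maybe as M
open import Data.Maybe using (Maybe; just; nothing; fromMaybe)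
import Data.Maybe.Properties as MP
open import Data.Maybe.Properties using (just-injective)
import Data.Nat as N
open import Data.Nat using (ℕ; zero; suc; _+_; _*_; _∸_; _≤_; _<_; z≤n; s≤s; _≤ᵇ_; _<ᵇ_; _≤?_; _<?_; _≡ᵇ_; _/_)
open import Data.Nat.DivMod using (_mod_)
open import Data.Nat.Induction using (<-wellFounded)
open import Data.Nat.Properties
open import Algebra.Properties.CommutativeMonoid.Sum +-0-commutativeMonoid using (sum; sum-cong-≗; ∑-distrib-+; ∑-comm)
open import Data.Nat.Tactic.RingSolver using (solve-∀)
open import Data.Product using (Σ; ∃; _×_; _,_; proj₁; proj₂)
open import Data.String using (String; toList)
open import Data.Sum using (_⊎_; inj₁; inj₂)
open import Data.Unit using (tt)
import Data.Vec as Vec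
open import Data.Vec using (Vec; []; _∷_; lookup)
open import Data.Vec.Properties using ([]=⇒lookup; lookup⇒[]=; lookup-map; lookup-zipWith; lookup∘tabulate)
open import Induction.WellFounded using (Acc; acc)
open import Relation.Binary.PropositionalEquality using (_≡_; _≢_; refl; sym; trans; cong; cong₂; subst; subst₂)
open import Relation.Nullary using (¬_; Dec; yes; no; does)

-- Propositional tautologies, decided by evaluation: a sequent h₁ ⊃ … ⊃ [ c ] is checked on all truth assignments.

-- The generality of labellings is what makes the replacement by cliques close up: a model found
-- after the replacement may put several separator vertices into one bag and skip others, so the far
-- side must serve arbitrary maps to a cycle whose length c stays fixed. An exception needs c = 5
-- and five distinctly labelled roots, so for separators of order at most four the induction
-- hypothesis is unconditional. All graphs share the vertex set `Fin n`; S and X are predicates, and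
-- contraction only drops a vertex from S, so models of different stages are compared without
-- reindexing. Stray labelled vertices do no harm, because bags only have to connect roots. The
-- induction uses models only negatively; the vertices named in the conclusion are recovered by
-- finite search. The constant five enters three times. Contracting an edge with at most four common
-- neighbours costs at most five edges, the budget of one vertex. A vertex has at most five edges to
-- X. Two adjacent vertices complete to X carry eleven edges, one above their budget, and this is
-- the surplus of the exceptional case.

data Sequent : Set where
  [_] : Bool → Sequent
  _⊃_ : Bool → Sequent → Sequent

infixr 3 _⊃_

⊢_ : Sequent → Set
⊢ [ b ] = b ≡ true
⊢ (h ⊃ s) = h ≡ true → ⊢ s

evalS : Sequent → Bool
evalS [ b ] = b
evalS (h ⊃ s) = not h ∨ evalS s

evalS-sound : ∀ s → evalS s ≡ true → ⊢ s
evalS-sound [ b ] e = e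
evalS-sound (true ⊃ s) e h = evalS-sound s e
evalS-sound (false ⊃ s) e ()

BoolFun : ℕ → Set
BoolFun zero = Sequent
BoolFun (suc k) = Bool → BoolFun k

allB : ∀ k → BoolFun k → Bool
allB zero s = evalS s
allB (suc k) f = allB k (f true) ∧ allB k (f false)

Valid : ∀ k → BoolFun k → Set
Valid zero s = ⊢ s
Valid (suc k) f = ∀ b → Valid k (f b)

∧-left : ∀ {a b} → a ∧ b ≡ true → a ≡ true
∧-left {true} h = refl

∧-right : ∀ {a b} → a ∧ b ≡ true → b ≡ true
∧-right {true} h = h

∧-intro : ∀ {a b} → a ≡ true → b ≡ true → a ∧ b ≡ true
∧-intro refl refl = refl

∨-elim : ∀ {a b} → a ∨ b ≡ true → a ≡ true ⊎ b ≡ true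
∨-elim {true} h = inj₁ refl
∨-elim {false} h = inj₂ h

allB-sound : ∀ k f → allB k f ≡ true → Valid k f
allB-sound zero s e = evalS-sound s e
allB-sound (suc k) f e true = allB-sound k (f true) (∧-left e)
allB-sound (suc k) f e false = allB-sound k (f false) (∧-right {allB k (f true)} e)

T⇒≡ : ∀ {b} → T b → b ≡ true
T⇒≡ {true} _ = refl

≡⇒T : ∀ {b} → b ≡ true → T b
≡⇒T refl = tt

taut : ∀ k (f : BoolFun k) {_ : T (allB k f)} → Valid k f
taut k f {t} = allB-sound k f (T⇒≡ t)

infixr 4 _⇒_
_⇒_ : Bool → Bool → Bool
a ⇒ b = not a ∨ b

⇒-elim : ∀ a b → (a ⇒ b) ≡ true → a ≡ true → b ≡ true
⇒-elim a b h refl = h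

⇒-intro : ∀ a b → (a ≡ true → b ≡ true) → (a ⇒ b) ≡ true
⇒-intro true b h = h refl
⇒-intro false b h = refl

bool-ext : ∀ {a b} → (a ≡ true → b ≡ true) → (b ≡ true → a ≡ true) → a ≡ b
bool-ext {true} {b} f g = sym (f refl)
bool-ext {false} {true} f g = g refl
bool-ext {false} {false} f g = refl

absurdB : ∀ {ℓ} {A : Set ℓ} {b} → b ≡ true → not b ≡ true → A
absurdB {b = true} _ ()

notB : ∀ {b} → (b ≡ true → ⊥) → not b ≡ true
notB {true} h = ⊥-elim (h refl)
notB {false} h = refl

not⁻ : ∀ {b} → not b ≡ true → b ≡ false
not⁻ {false} _ = refl

false≢true : ∀ {ℓ} {A : Set ℓ} {b} → b ≡ false → b ≡ true → A
false≢true refl ()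

case-bool : ∀ b → (b ≡ true) ⊎ (not b ≡ true)
case-bool true = inj₁ refl
case-bool false = inj₂ refl

≤! : ∀ {m k} → (m ≤ᵇ k) ≡ true → m ≤ k
≤! {m} {k} e = ≤ᵇ⇒≤ m k (≡⇒T e)

⟦_⟧ : Bool → ℕ
⟦ true ⟧ = 1
⟦ false ⟧ = 0

⟦⟧≤1 : ∀ b → ⟦ b ⟧ ≤ 1
⟦⟧≤1 true = ≤-refl
⟦⟧≤1 false = z≤n

⟦⟧-mono : ∀ {a b} → (a ≡ true → b ≡ true) → ⟦ a ⟧ ≤ ⟦ b ⟧
⟦⟧-mono {true} {b} h rewrite h refl = ≤-refl
⟦⟧-mono {false} h = z≤n

-- Vertex sets as Boolean predicates, sums and cardinalities

VertexSet : ℕ → Set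
VertexSet n = Fin n → Bool

infix 7 _≟ᵇ_
_≟ᵇ_ : ∀ {n} → Fin n → Fin n → Bool
u ≟ᵇ v = does (u F.≟ v)

≟ᵇ-refl : ∀ {n} (u : Fin n) → u ≟ᵇ u ≡ true
≟ᵇ-refl u with u F.≟ u
... | yes _ = refl
... | no p = ⊥-elim (p refl)

≟ᵇ⇒≡ : ∀ {n} (u v : Fin n) → u ≟ᵇ v ≡ true → u ≡ v
≟ᵇ⇒≡ u v e with u F.≟ v
... | yes p = p

≡⇒≟ᵇ : ∀ {n} {u v : Fin n} → u ≡ v → u ≟ᵇ v ≡ true
≡⇒≟ᵇ {u = u} refl = ≟ᵇ-refl u

≢⇒≟ᵇ : ∀ {n} (u v : Fin n) → u ≢ v → not (u ≟ᵇ v) ≡ true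
≢⇒≟ᵇ u v ne with u F.≟ v
... | yes p = ⊥-elim (ne p)
... | no _ = refl

≟ᵇ⇒≢ : ∀ {n} (u v : Fin n) → not (u ≟ᵇ v) ≡ true → u ≢ v
≟ᵇ⇒≢ u v h e = absurdB (≡⇒≟ᵇ e) h

∑ : ∀ {n} → (Fin n → ℕ) → ℕ
∑ = sum

∑-mono : ∀ {n} {f g : Fin n → ℕ} → (∀ i → f i ≤ g i) → ∑ f ≤ ∑ g
∑-mono {zero} h = z≤n
∑-mono {suc n} h = +-mono-≤ (h zero) (∑-mono (λ i → h (suc i)))

∑-cong : ∀ {n} {f g : Fin n → ℕ} → (∀ i → f i ≡ g i) → ∑ f ≡ ∑ g
∑-cong = sum-cong-≗

∑-+ : ∀ {n} (f g : Fin n → ℕ) → ∑ (λ i → f i + g i) ≡ ∑ f + ∑ g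
∑-+ = ∑-distrib-+

∑-* : ∀ {n} k (f : Fin n → ℕ) → ∑ (λ i → k * f i) ≡ k * ∑ f
∑-* {zero} k f = sym (*-zeroʳ k)
∑-* {suc n} k f = trans (cong (k * f zero +_) (∑-* k (λ i → f (suc i)))) (sym (*-distribˡ-+ k (f zero) _))

∑-zero : ∀ {n} {f : Fin n → ℕ} → (∀ i → f i ≡ 0) → ∑ f ≡ 0
∑-zero {zero} h = refl
∑-zero {suc n} h rewrite h zero = ∑-zero (λ i → h (suc i))

∑-one : ∀ {n} (u : Fin n) → ∑ (λ i → ⟦ i ≟ᵇ u ⟧) ≡ 1
∑-one {suc n} zero = cong suc (∑-zero {n} {λ i → ⟦ suc i ≟ᵇ zero ⟧} (λ i → refl))
∑-one {suc n} (suc u) = trans (∑-cong (λ i → cong ⟦_⟧ (eq i))) (∑-one u)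
  where
  eq : ∀ i → suc i ≟ᵇ suc u ≡ i ≟ᵇ u
  eq i with i F.≟ u
  ... | yes _ = refl
  ... | no _ = refl

term≤∑ : ∀ {n} (f : Fin n → ℕ) i → f i ≤ ∑ f
term≤∑ f zero = m≤m+n _ _
term≤∑ f (suc i) = ≤-trans (term≤∑ (λ j → f (suc j)) i) (m≤n+m _ _)

∑-positive : ∀ {n} (f : Fin n → ℕ) → 0 < ∑ f → ∃ λ i → 0 < f i
∑-positive {suc n} f h with f zero in eq
... | suc k = zero , subst (0 <_) (sym eq) (s≤s z≤n)
... | zero with ∑-positive (λ i → f (suc i)) h
...   | i , p = suc i , p

card : ∀ {n} → VertexSet n → ℕ
card P = ∑ (λ v → ⟦ P v ⟧)

card-mono : ∀ {n} {P Q : VertexSet n} → (∀ v → P v ≡ true → Q v ≡ true) → card P ≤ card Q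
card-mono h = ∑-mono (λ v → ⟦⟧-mono (h v))

card-cong : ∀ {n} {P Q : VertexSet n} → (∀ v → P v ≡ Q v) → card P ≡ card Q
card-cong h = ∑-cong (λ v → cong ⟦_⟧ (h v))

card-positive : ∀ {n} (P : VertexSet n) → 0 < card P → ∃ λ v → P v ≡ true
card-positive P h with ∑-positive _ h
... | v , p = v , lem (P v) p
  where
  lem : ∀ b → 0 < ⟦ b ⟧ → b ≡ true
  lem true _ = refl

member⇒card : ∀ {n} (P : VertexSet n) v → P v ≡ true → 0 < card P
member⇒card P v h = ≤-trans (≤-reflexive (sym (cong ⟦_⟧ h))) (term≤∑ (λ w → ⟦ P w ⟧) v)

card-+ : ∀ {n} (P Q R : VertexSet n) → (∀ v → ⟦ P v ⟧ ≡ ⟦ Q v ⟧ + ⟦ R v ⟧) → card P ≡ card Q + card R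
card-+ P Q R h = trans (∑-cong h) (∑-+ (λ v → ⟦ Q v ⟧) (λ v → ⟦ R v ⟧))

card-+≤ : ∀ {n} (P Q R : VertexSet n) → (∀ v → ⟦ P v ⟧ ≤ ⟦ Q v ⟧ + ⟦ R v ⟧) → card P ≤ card Q + card R
card-+≤ P Q R h = ≤-trans (∑-mono h) (≤-reflexive (∑-+ (λ v → ⟦ Q v ⟧) (λ v → ⟦ R v ⟧)))

card-split : ∀ {n} (P Q : VertexSet n) → (∀ v → (Q v ⇒ P v) ≡ true) → card P ≡ card Q + card (λ v → P v ∧ not (Q v))
card-split P Q h = card-+ P Q _ (λ v → ≡ᵇ⇒≡ _ _ (≡⇒T (taut 2 (λ p q → (q ⇒ p) ⊃ [ ⟦ p ⟧ ≡ᵇ ⟦ q ⟧ + ⟦ p ∧ not q ⟧ ]) (P v) (Q v) (h v))))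

insert : ∀ {n} → Fin n → VertexSet n → VertexSet n
insert u P v = v ≟ᵇ u ∨ P v

delete : ∀ {n} → Fin n → VertexSet n → VertexSet n
delete u P v = P v ∧ not (v ≟ᵇ u)

delete-self : ∀ {n} (P : VertexSet n) u → delete u P u ≡ false
delete-self P u rewrite ≟ᵇ-refl u with P u
... | true = refl
... | false = refl

card-insert : ∀ {n} (P : VertexSet n) u → P u ≡ false → card (insert u P) ≡ suc (card P)
card-insert P u pu = trans (card-+ (insert u P) (λ v → v ≟ᵇ u) P pt) (cong (_+ card P) (∑-one u))
  where
  pt : ∀ v → ⟦ insert u P v ⟧ ≡ ⟦ v ≟ᵇ u ⟧ + ⟦ P v ⟧
  pt v with v F.≟ u
  ... | yes refl rewrite pu = refl
  ... | no _ = refl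

card-insert≤ : ∀ {n} (P : VertexSet n) u → card (insert u P) ≤ suc (card P)
card-insert≤ P u = ≤-trans (card-+≤ (insert u P) (λ v → v ≟ᵇ u) P (λ v → ≤! (taut 2 (λ a b → [ ⟦ a ∨ b ⟧ ≤ᵇ ⟦ a ⟧ + ⟦ b ⟧ ]) (v ≟ᵇ u) (P v))))
  (≤-reflexive (cong (_+ card P) (∑-one u)))

card-delete : ∀ {n} (P : VertexSet n) u → P u ≡ true → card P ≡ suc (card (delete u P))
card-delete P u pu = trans (card-split P (λ v → v ≟ᵇ u) (λ v → ⇒-intro (v ≟ᵇ u) (P v) (λ e → subst (λ w → P w ≡ true) (sym (≟ᵇ⇒≡ v u e)) pu)))
  (cong (_+ card (delete u P)) (∑-one u))

card-empty : ∀ {n} (P : VertexSet n) → (∀ v → P v ≡ true → ⊥) → card P ≡ 0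
card-empty P h = ∑-zero (λ v → cong ⟦_⟧ (not⁻ (notB (h v))))

card-strict : ∀ {n} {P Q : VertexSet n} → (∀ v → P v ≡ true → Q v ≡ true) → ∀ u → Q u ≡ true → P u ≡ false → card P < card Q
card-strict {P = P} {Q} h u qu pu = ≤-trans
  (s≤s (card-mono {P = P} {delete u Q} (λ v pv → ∧-intro (h v pv) (≢⇒≟ᵇ v u λ { refl → false≢true pu pv }))))
  (≤-reflexive (sym (card-delete Q u qu)))

∃-outside : ∀ {n} (P Q : VertexSet n) → card Q < card P → ∃ λ v → P v ≡ true × Q v ≡ false
∃-outside P Q lt with any? (λ v → Data.Bool._≟_ (P v ∧ not (Q v)) true)
  where import Data.Bool
... | yes (v , e) = v , ∧-left e , not⁻ (∧-right {P v} e)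
... | no none = ⊥-elim (<⇒≱ lt (card-mono {P = P} {Q} λ v pv → lem (P v) (Q v) pv (λ e → none (v , e))))
  where
  lem : ∀ p q → p ≡ true → ¬ (p ∧ not q ≡ true) → q ≡ true
  lem true true _ _ = refl
  lem true false _ k = ⊥-elim (k refl)

card-subset-≡ : ∀ {n} {P Q : VertexSet n} → (∀ v → P v ≡ true → Q v ≡ true) → card Q ≤ card P → ∀ v → Q v ≡ true → P v ≡ true
card-subset-≡ {P = P} {Q} h le v qv with case-bool (P v)
... | inj₁ p = p
... | inj₂ p = ⊥-elim (<⇒≱ (card-strict {P = P} {Q} h v qv (not⁻ p)) le)

Injective : ∀ {m n} → (Fin m → Fin n) → Set
Injective r = ∀ i j → r i ≡ r j → i ≡ j

image : ∀ {m n} → (Fin m → Fin n) → VertexSet n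
image r v = does (any? (λ i → r i F.≟ v))

image-intro : ∀ {m n} (r : Fin m → Fin n) i → image r (r i) ≡ true
image-intro r i with any? (λ j → r j F.≟ r i)
... | yes _ = refl
... | no p = ⊥-elim (p (i , refl))

image-elim : ∀ {m n} (r : Fin m → Fin n) v → image r v ≡ true → ∃ λ i → r i ≡ v
image-elim r v e with any? (λ i → r i F.≟ v)
... | yes p = p

card-image : ∀ {m n} (r : Fin m → Fin n) → Injective r → card (image r) ≡ m
card-image {zero} r inj = card-empty (image r) (λ v e → lem (image-elim r v e))
  where
  lem : ∀ {v} → (∃ λ (i : Fin 0) → r i ≡ v) → ⊥
  lem (() , _)
card-image {suc m} r inj = trans (card-cong {P = image r} {insert (r zero) (image r′)} eq)
  (trans (card-insert (image r′) (r zero) notin) (cong suc (card-image r′ λ i j e → suc-inj (inj (suc i) (suc j) e))))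
  where
  r′ : Fin m → Fin _
  r′ i = r (suc i)
  suc-inj : ∀ {i j : Fin m} → suc i ≡ suc j → i ≡ j
  suc-inj refl = refl
  notin : image r′ (r zero) ≡ false
  notin = not⁻ (notB λ e → bad (image-elim r′ (r zero) e))
    where
    bad : (∃ λ i → r (suc i) ≡ r zero) → ⊥
    bad (i , e) with inj (suc i) zero e
    ... | ()
  eq : ∀ v → image r v ≡ insert (r zero) (image r′) v
  eq v = bool-ext to from
    where
    to : image r v ≡ true → insert (r zero) (image r′) v ≡ true
    to e with image-elim r v e
    ... | zero , refl rewrite ≟ᵇ-refl (r zero) = refl
    ... | suc i , refl rewrite image-intro r′ i with v ≟ᵇ r zero
    ...   | true = refl
    ...   | false = refl
    from : insert (r zero) (image r′) v ≡ true → image r v ≡ true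
    from e with ∨-elim {v ≟ᵇ r zero} e
    ... | inj₁ p rewrite ≟ᵇ⇒≡ v (r zero) p = image-intro r zero
    ... | inj₂ p with image-elim r′ v p
    ...   | i , refl = image-intro r (suc i)

prolong : ∀ {n} (P : VertexSet n) m (r : Fin m → Fin n) → Injective r → (∀ i → P (r i) ≡ true) → m < card P →
  ∃ λ (v : Fin n) → P v ≡ true × (∀ i → r i ≢ v)
prolong P m r inj mem lt with ∃-outside P (image r) (subst (_< card P) (sym (card-image r inj)) lt)
... | v , pv , out = v , pv , λ i e → false≢true out (subst (λ w → image r w ≡ true) e (image-intro r i))

exhausts : ∀ {m n} (P : VertexSet n) (r : Fin m → Fin n) → Injective r → (∀ i → P (r i) ≡ true) → card P ≤ m →
  ∀ v → P v ≡ true → ∃ λ i → r i ≡ v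
exhausts P r inj mem le v pv = image-elim r v (card-subset-≡ {P = image r} {P}
  (λ w e → lem (image-elim r w e)) (subst (card P ≤_) (sym (card-image r inj)) le) v pv)
  where
  lem : ∀ {w} → (∃ λ i → r i ≡ w) → P w ≡ true
  lem (i , refl) = mem i

snoc : ∀ {A : Set} {m} → A → (Fin m → A) → Fin (suc m) → A
snoc a f zero = a
snoc a f (suc i) = f i

enumerate : ∀ {n} (P : VertexSet n) → ∃ λ (r : Fin (card P) → Fin n) → Injective r × (∀ i → P (r i) ≡ true)
enumerate P = go (card P) ≤-refl
  where
  go : ∀ m → m ≤ card P → ∃ λ (r : Fin m → Fin _) → Injective r × (∀ i → P (r i) ≡ true)
  go zero _ = (λ ()) , (λ ()) , (λ ())
  go (suc m) le with go m (<⇒≤ le)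
  ... | r , inj , mem with prolong P m r inj mem le
  ...   | v , pv , new = snoc v r , inj′ , mem′
    where
    inj′ : Injective (snoc v r)
    inj′ zero zero e = refl
    inj′ zero (suc j) e = ⊥-elim (new j (sym e))
    inj′ (suc i) zero e = ⊥-elim (new i e)
    inj′ (suc i) (suc j) e = cong suc (inj i j e)
    mem′ : ∀ i → P (snoc v r i) ≡ true
    mem′ zero = pv
    mem′ (suc i) = mem i

-- Graphs with boundary and rooted minors

-- Symmetry is a Boolean implication so that it can be handed to `taut` as a hypothesis.
record Graph′ (n : ℕ) : Set where
  field
    E : Fin n → Fin n → Bool
    symE : ∀ u v → (E u v ⇒ E v u) ≡ true
    irrE : ∀ v → E v v ≡ false

open Graph′ public

adjacent-sym : ∀ {n} (G : Graph′ n) u v → E G u v ≡ true → E G v u ≡ true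
adjacent-sym G u v = ⇒-elim _ _ (symE G u v)

∑∑ : ∀ {n} → (Fin n → Fin n → ℕ) → ℕ
∑∑ f = ∑ (λ u → ∑ (λ v → f u v))

∑∑-mono : ∀ {n} {f g : Fin n → Fin n → ℕ} → (∀ u v → f u v ≤ g u v) → ∑∑ f ≤ ∑∑ g
∑∑-mono h = ∑-mono (λ u → ∑-mono (h u))

∑∑-+ : ∀ {n} (f g : Fin n → Fin n → ℕ) → ∑∑ (λ u v → f u v + g u v) ≡ ∑∑ f + ∑∑ g
∑∑-+ f g = trans (∑-cong (λ u → ∑-+ (f u) (g u))) (∑-+ (λ u → ∑ (f u)) (λ u → ∑ (g u)))

-- A function of Booleans rather than of vertices: inequalities between edge counts then reduce,
-- pair by pair, to tautologies.
counted : Bool → Bool → Bool → Bool → Bool → Bool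
counted e su xu sv xv = e ∧ ((su ∧ (sv ∨ xv)) ∨ (xu ∧ sv))

countedPair : ∀ {n} → Graph′ n → VertexSet n → VertexSet n → Fin n → Fin n → Bool
countedPair G S X u v = counted (E G u v) (S u) (X u) (S v) (X v)

-- Twice the number of edges inside S ∪ X with an end in S.
D : ∀ {n} → Graph′ n → VertexSet n → VertexSet n → ℕ
D G S X = ∑∑ (λ u v → ⟦ countedPair G S X u v ⟧)

-- (S′ , Q) stands for the separation with B ∖ A = S′ and A ∩ B = Q.
record Sep {n} (G : Graph′ n) (S X S′ Q : VertexSet n) : Set where
  field
    inner : ∀ v → (S′ v ⇒ S v) ≡ true
    outer : ∀ v → (Q v ⇒ S v ∨ X v) ≡ true
    apart : ∀ v → (S′ v ⇒ not (Q v)) ≡ true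
    closed : ∀ u v → (S′ u ∧ E G u v ∧ (S v ∨ X v) ⇒ S′ v ∨ Q v) ≡ true

open Sep public

record Massed {n} (G : Graph′ n) (S X : VertexSet n) : Set where
  field
    dense : 10 * card S < D G S X
    sparse : ∀ S′ Q → Sep G S X S′ Q → card Q < card X → D G S′ Q ≤ 10 * card S′

open Massed public

Disjoint : ∀ {n} → VertexSet n → VertexSet n → Set
Disjoint S X = ∀ v → (S v ⇒ not (X v)) ≡ true

_∪ˢ_ _∖ˢ_ : ∀ {n} → VertexSet n → VertexSet n → VertexSet n
(P ∪ˢ Q) v = P v ∨ Q v
(P ∖ˢ Q) v = P v ∧ not (Q v)

sep-trans : ∀ {n} (G : Graph′ n) {S X S₁ Q₁ S₂ Q₂ : VertexSet n} → Sep G S X S₁ Q₁ → Sep G S₁ Q₁ S₂ Q₂ → Sep G S X S₂ Q₂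
sep-trans G {S} {X} {S₁} {Q₁} {S₂} {Q₂} a b = record
  { inner = λ v → taut 3 (λ s s₁ s₂ → (s₁ ⇒ s) ⊃ (s₂ ⇒ s₁) ⊃ [ s₂ ⇒ s ]) (S v) (S₁ v) (S₂ v) (inner a v) (inner b v)
  ; outer = λ v → taut 5 (λ s x s₁ q₁ q₂ → (s₁ ⇒ s) ⊃ (q₁ ⇒ s ∨ x) ⊃ (q₂ ⇒ s₁ ∨ q₁) ⊃ [ q₂ ⇒ s ∨ x ])
      (S v) (X v) (S₁ v) (Q₁ v) (Q₂ v) (inner a v) (outer a v) (outer b v)
  ; apart = apart b
  ; closed = λ u v → taut 8 (λ s₂u s₁u e sx s₁v q₁v s₂v q₂v →
      (s₂u ⇒ s₁u) ⊃ (s₁u ∧ e ∧ sx ⇒ s₁v ∨ q₁v) ⊃ (s₂u ∧ e ∧ (s₁v ∨ q₁v) ⇒ s₂v ∨ q₂v) ⊃ [ s₂u ∧ e ∧ sx ⇒ s₂v ∨ q₂v ])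
      (S₂ u) (S₁ u) (E G u v) (S v ∨ X v) (S₁ v) (Q₁ v) (S₂ v) (Q₂ v) (inner b u) (closed a u v) (closed b u v)
  }

-- (M2) is inherited by the far side, because a separation of the far side of order below `card Q`
-- is a separation of the whole pair of order below `card X`. Only density has to be supplied.
sub-massed : ∀ {n} (G : Graph′ n) {S X S′ Q : VertexSet n} → Massed G S X → Sep G S X S′ Q → card Q ≤ card X →
  10 * card S′ < D G S′ Q → Massed G S′ Q
sub-massed G m s le d = record { dense = d ; sparse = λ S″ Q″ s″ lt → sparse m S″ Q″ (sep-trans G s s″) (≤-trans lt le) }

-- By closedness an edge with an end in S₁ stays in S₁ ∪ Q₁ and is counted there; every other
-- counted edge avoids S₁ altogether.
D-split : ∀ {n} (G : Graph′ n) {S X S₁ Q₁ : VertexSet n} → Sep G S X S₁ Q₁ → D G S X ≤ D G (S ∖ˢ S₁) X + D G S₁ Q₁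
D-split G {S} {X} {S₁} {Q₁} s = ≤-trans (∑∑-mono pt) (≤-reflexive (∑∑-+ (λ u v → ⟦ countedPair G (S ∖ˢ S₁) X u v ⟧) (λ u v → ⟦ countedPair G S₁ Q₁ u v ⟧)))
  where
  pt : ∀ u v → ⟦ countedPair G S X u v ⟧ ≤ ⟦ countedPair G (S ∖ˢ S₁) X u v ⟧ + ⟦ countedPair G S₁ Q₁ u v ⟧
  pt u v = ≤! (taut 10 (λ e e′ su xu sv xv s₁u q₁u s₁v q₁v → (e ⇒ e′) ⊃ (s₁u ∧ e ∧ (sv ∨ xv) ⇒ s₁v ∨ q₁v) ⊃ (s₁v ∧ e′ ∧ (su ∨ xu) ⇒ s₁u ∨ q₁u) ⊃
      [ ⟦ counted e su xu sv xv ⟧ ≤ᵇ ⟦ counted e (su ∧ not s₁u) xu (sv ∧ not s₁v) xv ⟧ + ⟦ counted e s₁u q₁u s₁v q₁v ⟧ ])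
      (E G u v) (E G v u) (S u) (X u) (S v) (X v) (S₁ u) (Q₁ u) (S₁ v) (Q₁ v) (symE G u v) (closed s u v) (closed s v u))

D-mono : ∀ {n} (G H : Graph′ n) (S X : VertexSet n) →
  (∀ u v → (countedPair G S X u v ⇒ E H u v) ≡ true) → D G S X ≤ D H S X
D-mono G H S X h = ∑∑-mono (λ u v → ⟦⟧-mono (λ c → taut 6 (λ e e′ a b c d → (counted e a b c d ⇒ e′) ⊃ counted e a b c d ⊃ [ counted e′ a b c d ])
  (E G u v) (E H u v) (S u) (X u) (S v) (X v) (h u v) c))

-- The groups W i partition the part of S outside the core K.
D-groups : ∀ {n m} (G : Graph′ n) {S X : VertexSet n} (K : VertexSet n) (g : Fin n → Fin m) (Q : Fin m → VertexSet n) →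
  let W = λ i v → S v ∧ not (K v) ∧ (g v ≟ᵇ i) in
  (∀ v → (K v ⇒ S v) ≡ true) →
  (∀ i u v → (W i u ∧ E G u v ∧ (S v ∨ X v) ⇒ W i v ∨ Q i v) ≡ true) →
  (∀ i → D G (W i) (Q i) ≤ 10 * card (W i)) →
  D G S X ≤ 10 * card (S ∖ˢ K) + D G K X
D-groups {n} {m} G {S} {X} K g Q K⊆S cl sp = begin
  D G S X ≤⟨ ∑∑-mono pt ⟩
  ∑∑ (λ u v → ∑ (λ i → cW i u v) + ⟦ countedPair G K X u v ⟧) ≡⟨ ∑∑-+ (λ u v → ∑ (λ i → cW i u v)) _ ⟩
  ∑∑ (λ u v → ∑ (λ i → cW i u v)) + D G K X ≡⟨ cong (_+ D G K X) (trans (∑-cong (λ u → ∑-comm′ (λ v i → cW i u v))) (∑-comm′ (λ u i → ∑ (λ v → cW i u v)))) ⟩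
  ∑ (λ i → D G (W i) (Q i)) + D G K X ≤⟨ +-monoˡ-≤ _ (∑-mono sp) ⟩
  ∑ (λ i → 10 * card (W i)) + D G K X ≡⟨ cong (_+ D G K X) (trans (∑-* 10 (λ i → card (W i))) (cong (10 *_) total)) ⟩
  10 * card (S ∖ˢ K) + D G K X ∎
  where
  open ≤-Reasoning
  ∑-comm′ : ∀ {a b} (f : Fin a → Fin b → ℕ) → ∑ (λ i → ∑ (f i)) ≡ ∑ (λ j → ∑ (λ i → f i j))
  ∑-comm′ = ∑-comm
  W : Fin m → VertexSet n
  W i v = S v ∧ not (K v) ∧ (g v ≟ᵇ i)
  cW : Fin m → Fin n → Fin n → ℕ
  cW i u v = ⟦ countedPair G (W i) (Q i) u v ⟧
  pick : ∀ i u v → countedPair G (W i) (Q i) u v ≡ true → 1 ≤ ∑ (λ j → cW j u v)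
  pick i u v h = ≤-trans (≤-reflexive (sym (cong ⟦_⟧ h))) (term≤∑ (λ j → cW j u v) i)
  pt : ∀ u v → ⟦ countedPair G S X u v ⟧ ≤ ∑ (λ i → cW i u v) + ⟦ countedPair G K X u v ⟧
  pt u v with case-bool (countedPair G S X u v)
  ... | inj₂ h = ≤-trans (≤-reflexive (cong ⟦_⟧ (not⁻ h))) z≤n
  -- An edge with an end in S outside K is charged to the group of such an end; closedness puts its
  -- other end into the same group or its separator. All remaining edges are counted at the core.
  ... | inj₁ h with case-bool (S u ∧ not (K u))
  ...   | inj₁ k = ≤-trans (⟦⟧≤1 _) (≤-trans (pick (g u) u v
            (taut 10 (λ e su xu ku sv xv i wv qv ij → counted e su xu sv xv ⊃ (su ∧ not ku) ⊃ i ⊃ ((su ∧ not ku ∧ i) ∧ e ∧ (sv ∨ xv) ⇒ wv ∨ qv) ⊃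
               [ counted e (su ∧ not ku ∧ i) ij wv qv ])
              (E G u v) (S u) (X u) (K u) (S v) (X v) (g u ≟ᵇ g u) (W (g u) v) (Q (g u) v) (Q (g u) u) h k (≟ᵇ-refl (g u)) (cl (g u) u v))) (m≤m+n _ _))
  ...   | inj₂ k with case-bool (S v ∧ not (K v))
  ...     | inj₁ l = ≤-trans (⟦⟧≤1 _) (≤-trans (pick (g v) u v
            (taut 11 (λ e e′ sv xv kv su xu i wu qu qv → counted e su xu sv xv ⊃ (e ⇒ e′) ⊃ (sv ∧ not kv) ⊃ i ⊃ ((sv ∧ not kv ∧ i) ∧ e′ ∧ (su ∨ xu) ⇒ wu ∨ qu) ⊃
               [ counted e wu qu (sv ∧ not kv ∧ i) qv ])
              (E G u v) (E G v u) (S v) (X v) (K v) (S u) (X u) (g v ≟ᵇ g v) (W (g v) u) (Q (g v) u) (Q (g v) v) h (symE G u v) l (≟ᵇ-refl (g v)) (cl (g v) v u))) (m≤m+n _ _))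
  ...     | inj₂ l = ≤-trans (⟦⟧-mono (λ _ → taut 7 (λ e su xu ku sv xv kv → counted e su xu sv xv ⊃ not (su ∧ not ku) ⊃ not (sv ∧ not kv) ⊃ [ counted e ku xu kv xv ])
            (E G u v) (S u) (X u) (K u) (S v) (X v) (K v) h k l)) (m≤n+m _ _)
  one : ∀ a (i : Fin m) → ∑ (λ j → ⟦ a ∧ (i ≟ᵇ j) ⟧) ≡ ⟦ a ⟧
  one true i = trans (∑-cong (λ j → cong ⟦_⟧ (flip i j))) (∑-one i)
    where
    flip : ∀ i j → i ≟ᵇ j ≡ j ≟ᵇ i
    flip i j with i F.≟ j | j F.≟ i
    ... | yes _ | yes _ = refl
    ... | yes p | no q = ⊥-elim (q (sym p))
    ... | no p | yes q = ⊥-elim (p (sym q))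
    ... | no _ | no _ = refl
  one false i = ∑-zero {f = λ (j : Fin m) → 0} (λ j → refl)
  assoc : ∀ a b c → a ∧ b ∧ c ≡ (a ∧ b) ∧ c
  assoc true b c = refl
  assoc false b c = refl
  total : ∑ (λ i → card (W i)) ≡ card (S ∖ˢ K)
  total = trans (∑-comm′ (λ i v → ⟦ W i v ⟧)) (∑-cong (λ v → trans (∑-cong (λ i → cong ⟦_⟧ (assoc (S v) (not (K v)) (g v ≟ᵇ i)))) (one (S v ∧ not (K v)) (g v))))

-- Whether u and w may be regarded as adjacent when X is regarded as a clique.
virtual : ∀ {n} → Graph′ n → VertexSet n → Fin n → Fin n → Bool
virtual G X u w = E G u w ∨ (X u ∧ X w ∧ not (u ≟ᵇ w))

Labelling : ℕ → ℕ → Set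
Labelling n c = Fin n → Maybe (Fin c)

data Walk {n c} (E : Fin n → Fin n → Bool) (β : Labelling n c) : Fin n → Fin n → Set where
  done : ∀ {u} → Walk E β u u
  hop : ∀ {u w v} → E u w ≡ true → β u ≡ β w → Walk E β w v → Walk E β u v

_++ʷ_ : ∀ {n c E} {β : Labelling n c} {u v w} → Walk E β u v → Walk E β v w → Walk E β u w
done ++ʷ q = q
hop e b p ++ʷ q = hop e b (p ++ʷ q)

walk-label : ∀ {n c E} {β : Labelling n c} {u v} → Walk E β u v → β u ≡ β v
walk-label done = refl
walk-label (hop _ b p) = trans b (walk-label p)

Link : ∀ {n c} (E : Fin n → Fin n → Bool) (β : Labelling n c) → Fin n → Fin n → Set
Link E β x y = ∃ λ u → ∃ λ v → Walk E β x u × E u v ≡ true × Walk E β v y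

reverse : ∀ {n c} (G : Graph′ n) {β : Labelling n c} {u v} → Walk (E G) β u v → Walk (E G) β v u
reverse G done = done
reverse G (hop {u} {w} e b p) = reverse G p ++ʷ hop (adjacent-sym G u w e) (sym b) done

-- Labels are the vertices of a cycle of length c; the bag of a label is the set of vertices carrying it.
-- Connectivity is only required between roots.
record Model {n c} (E : Fin n → Fin n → Bool) (P X : VertexSet n) (lab : Fin n → Fin c) : Set where
  field
    β : Labelling n c
    supp : ∀ v l → β v ≡ just l → P v ≡ true
    root : ∀ x → X x ≡ true → β x ≡ just (lab x)
    same : ∀ x y → X x ≡ true → X y ≡ true → lab x ≡ lab y → Walk E β x y
    link : ∀ x y → X x ≡ true → X y ≡ true → CycSucc (lab x) (lab y) → Link E β x y

open Model public

walk-bind : ∀ {n c c′ E E′} {β : Labelling n c} {β′ : Labelling n c′} {l u v} →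
  (∀ u v → E u v ≡ true → β u ≡ just l → β v ≡ just l → Walk E′ β′ u v) →
  β u ≡ just l → Walk E β u v → Walk E′ β′ u v
walk-bind f b done = done
walk-bind f b (hop {u} {w} e b′ p) = f u w e b (trans (sym b′) b) ++ʷ walk-bind f (trans (sym b′) b) p

walk-relabel : ∀ {n c c′ E} {β : Labelling n c} {β′ : Labelling n c′} {l u v} (l′ : Fin c′) →
  (∀ w → β w ≡ just l → β′ w ≡ just l′) → β u ≡ just l → Walk E β u v → Walk E β′ u v
walk-relabel l′ f = walk-bind (λ u v e bu bv → hop e (trans (f u bu) (sym (f v bv))) done)

-- The common form of all surgeries on models: it is enough to say what replaces one edge inside a
-- bag and one edge between consecutive bags.
transport : ∀ {n c E E′} {P P′ X : VertexSet n} {lab : Fin n → Fin c} (M : Model E P X lab) (β′ : Labelling n c) →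
  (∀ v l → β′ v ≡ just l → P′ v ≡ true) →
  (∀ v l → β M v ≡ just l → β′ v ≡ just l) →
  (∀ u v l → E u v ≡ true → β M u ≡ just l → β M v ≡ just l → Walk E′ β′ u v) →
  (∀ u v l l′ → E u v ≡ true → β M u ≡ just l → β M v ≡ just l′ → CycSucc l l′ → Link E′ β′ u v) →
  Model E′ P′ X lab
transport {lab = lab} M β′ sup ext st cr = record
  { β = β′
  ; supp = sup
  ; root = λ x h → ext x _ (root M x h)
  ; same = λ x y hx hy e → walk-bind (λ u v → st u v _) (root M x hx) (same M x y hx hy e)
  ; link = λ x y hx hy r → lnk x y hx hy r (link M x y hx hy r)
  }
  where
  lnk : ∀ x y → _ → _ → CycSucc (lab x) (lab y) → Link _ (β M) x y → Link _ β′ x y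
  lnk x y hx hy r (u , v , p , e , q) with cr u v _ _ e (trans (sym (walk-label p)) (root M x hx)) (trans (walk-label q) (root M y hy)) r
  ... | u′ , v′ , p′ , e′ , q′ = u′ , v′ , walk-bind (λ a b → st a b _) (root M x hx) p ++ʷ p′ , e′ ,
      q′ ++ʷ walk-bind (λ a b → st a b _) (trans (walk-label q) (root M y hy)) q

enlarge : ∀ {n c E E′} {P P′ X : VertexSet n} {lab : Fin n → Fin c} → (∀ u v → E u v ≡ true → E′ u v ≡ true) →
  (∀ v → P v ≡ true → P′ v ≡ true) → Model E P X lab → Model E′ P′ X lab
enlarge f g M = transport M (β M) (λ v l h → g v (supp M v l h)) (λ v l h → h)
  (λ u v l e bu bv → hop (f u v e) (trans bu (sym bv)) done) (λ u v l l′ e bu bv r → u , v , done , f u v e , done)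

cliqueOn : ∀ {n} → Graph′ n → VertexSet n → Graph′ n
cliqueOn G Q = record
  { E = λ u v → E G u v ∨ (Q u ∧ Q v ∧ not (u ≟ᵇ v))
  ; symE = λ u v → taut 6 (λ e e′ q q′ d d′ → (e ⇒ e′) ⊃ (d ⇒ d′) ⊃ [ e ∨ (q ∧ q′ ∧ d) ⇒ e′ ∨ (q′ ∧ q ∧ d′) ])
      (E G u v) (E G v u) (Q u) (Q v) (not (u ≟ᵇ v)) (not (v ≟ᵇ u)) (symE G u v)
      (⇒-intro _ _ (λ h → ≢⇒≟ᵇ v u (λ e → ≟ᵇ⇒≢ u v h (sym e))))
  ; irrE = λ v → not⁻ (taut 3 (λ e q d → not e ⊃ d ⊃ [ not (e ∨ (q ∧ q ∧ not d)) ]) (E G v v) (Q v) (v ≟ᵇ v) (cong not (irrE G v)) (≟ᵇ-refl v))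
  }

-- A clique edge between two vertices of Q matters to M only if their labels are equal or
-- consecutive. In the first case N supplies a walk, in the second a link, both behind Q. Separator
-- vertices without a label in M receive the arbitrary label l₀ in N.
fillClique : ∀ {n c} (G : Graph′ n) {P S Q X : VertexSet n} {lab : Fin n → Fin c} (l₀ : Fin c) →
  Disjoint S P → (M : Model (E (cliqueOn G Q)) P X lab) → Model (E G) (S ∪ˢ Q) Q (λ v → fromMaybe l₀ (β M v)) →
  (∀ v → (Q v ⇒ P v) ≡ true) → Model (E G) (P ∪ˢ S) X lab
fillClique {n} {c} G {P} {S} {Q} {X} {lab} l₀ dis M N Q⊆P = transport M β′ sup ext st cr
  where
  β′ : Labelling n c
  β′ v = if S v ∨ Q v then β N v else β M v
  inN : ∀ v l → β N v ≡ just l → β′ v ≡ just l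
  inN v l h rewrite supp N v l h = h
  sup : ∀ v l → β′ v ≡ just l → (P v ∨ S v) ≡ true
  sup v l h with S v ∨ Q v in eq
  ... | true = taut 3 (λ s q p → (s ∨ q) ⊃ (q ⇒ p) ⊃ [ p ∨ s ]) (S v) (Q v) (P v) eq (Q⊆P v)
  ... | false = taut 2 (λ p s → p ⊃ [ p ∨ s ]) (P v) (S v) (supp M v l h)
  ext : ∀ v l → β M v ≡ just l → β′ v ≡ just l
  ext v l h with S v ∨ Q v in eq
  ... | false = h
  ... | true = trans (root N v (taut 3 (λ s q p → (s ∨ q) ⊃ (s ⇒ not p) ⊃ p ⊃ [ q ]) (S v) (Q v) (P v) eq (dis v) (supp M v l h)))
                (cong (λ m → just (fromMaybe l₀ m)) h)
  lab≡ : ∀ v l → β M v ≡ just l → fromMaybe l₀ (β M v) ≡ l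
  lab≡ v l h = cong (fromMaybe l₀) h
  edge : ∀ u v → E (cliqueOn G Q) u v ≡ true → E G u v ≡ true ⊎ (Q u ≡ true × Q v ≡ true)
  edge u v e with ∨-elim {E G u v} e
  ... | inj₁ h = inj₁ h
  ... | inj₂ h = inj₂ (∧-left h , ∧-left (∧-right {Q u} h))
  lift : ∀ {u v} l → β N u ≡ just l → Walk (E G) (β N) u v → Walk (E G) β′ u v
  lift l = walk-relabel l (λ w → inN w l)
  st : ∀ u v l → E (cliqueOn G Q) u v ≡ true → β M u ≡ just l → β M v ≡ just l → Walk (E G) β′ u v
  st u v l e bu bv with edge u v e
  ... | inj₁ h = hop h (trans (ext u l bu) (sym (ext v l bv))) done
  ... | inj₂ (qu , qv) = lift _ (root N u qu) (same N u v qu qv (trans (lab≡ u l bu) (sym (lab≡ v l bv))))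
  cr : ∀ u v l l′ → E (cliqueOn G Q) u v ≡ true → β M u ≡ just l → β M v ≡ just l′ → CycSucc l l′ → Link (E G) β′ u v
  cr u v l l′ e bu bv r with edge u v e
  ... | inj₁ h = u , v , done , h , done
  ... | inj₂ (qu , qv) with link N u v qu qv (subst₂ CycSucc (sym (lab≡ u l bu)) (sym (lab≡ v l′ bv)) r)
  ...   | a , b , p , h , q = a , b , lift _ (root N u qu) p , h , lift _ (trans (walk-label q) (root N v qv)) q

-- v is merged into u; v itself keeps its edges and is meant to be discarded.
contract : ∀ {n} → Graph′ n → Fin n → Fin n → Graph′ n
contract G v u = record
  { E = λ z w → not (z ≟ᵇ w) ∧ (E G z w ∨ (z ≟ᵇ u ∧ E G v w) ∨ (w ≟ᵇ u ∧ E G z v))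
  ; symE = λ z w → taut 10 (λ d d′ e e′ zu wu a a′ b b′ → (d ⇒ d′) ⊃ (e ⇒ e′) ⊃ (a ⇒ a′) ⊃ (b ⇒ b′) ⊃
        [ d ∧ (e ∨ (zu ∧ a) ∨ (wu ∧ b)) ⇒ d′ ∧ (e′ ∨ (wu ∧ b′) ∨ (zu ∧ a′)) ])
      (not (z ≟ᵇ w)) (not (w ≟ᵇ z)) (E G z w) (E G w z) (z ≟ᵇ u) (w ≟ᵇ u) (E G v w) (E G w v) (E G z v) (E G v z)
      (⇒-intro _ _ (λ h → ≢⇒≟ᵇ w z (λ e → ≟ᵇ⇒≢ z w h (sym e)))) (symE G z w) (symE G v w) (symE G z v)
  ; irrE = λ z → not⁻ (taut 2 (λ d x → d ⊃ [ not (not d ∧ x) ]) (z ≟ᵇ z) _ (≟ᵇ-refl z))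
  }

-- The vertex v joins the bag of u, and an edge at u that was inherited from v becomes a detour
-- through v.
uncontract : ∀ {n c} (G : Graph′ n) v u {P X : VertexSet n} {lab : Fin n → Fin c} → E G u v ≡ true →
  P v ≡ false → (M : Model (E (contract G v u)) P X lab) → Model (E G) (λ w → P w ∨ (P u ∧ (w ≟ᵇ v))) X lab
uncontract {n} {c} G v u {P} {X} {lab} uv v∉P M = transport M β′ sup ext st cr
  where
  β′ : Labelling n c
  β′ w = if w ≟ᵇ v then β M u else β M w
  sup : ∀ w l → β′ w ≡ just l → (P w ∨ (P u ∧ (w ≟ᵇ v))) ≡ true
  sup w l h with w F.≟ v
  ... | yes refl = taut 2 (λ a b → b ⊃ [ a ∨ (b ∧ true) ]) (P w) (P u) (supp M u l h)
  ... | no _ = taut 2 (λ a b → a ⊃ [ a ∨ b ]) (P w) (P u ∧ false) (supp M w l h)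
  ext : ∀ w l → β M w ≡ just l → β′ w ≡ just l
  ext w l h with w F.≟ v
  ... | yes refl = false≢true v∉P (supp M w l h)
  ... | no _ = h
  atv : β′ v ≡ β M u
  atv rewrite ≟ᵇ-refl v = refl
  vu : E G v u ≡ true
  vu = adjacent-sym G u v uv
  edge : ∀ z w → E (contract G v u) z w ≡ true → E G z w ≡ true ⊎ (z ≡ u × E G v w ≡ true) ⊎ (w ≡ u × E G z v ≡ true)
  edge z w e with ∨-elim {E G z w} (∧-right {not (z ≟ᵇ w)} e)
  ... | inj₁ h = inj₁ h
  ... | inj₂ h with ∨-elim {z ≟ᵇ u ∧ E G v w} h
  ...   | inj₁ k = inj₂ (inj₁ (≟ᵇ⇒≡ z u (∧-left k) , ∧-right {z ≟ᵇ u} k))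
  ...   | inj₂ k = inj₂ (inj₂ (≟ᵇ⇒≡ w u (∧-left k) , ∧-right {w ≟ᵇ u} k))
  st : ∀ z w l → E (contract G v u) z w ≡ true → β M z ≡ just l → β M w ≡ just l → Walk (E G) β′ z w
  st z w l e bz bw with edge z w e
  ... | inj₁ h = hop h (trans (ext z l bz) (sym (ext w l bw))) done
  ... | inj₂ (inj₁ (refl , h)) = hop uv (trans (ext u l bz) (sym (trans atv bz))) (hop h (trans (trans atv bz) (sym (ext w l bw))) done)
  ... | inj₂ (inj₂ (refl , h)) = hop h (trans (ext z l bz) (sym (trans atv bw))) (hop vu (trans (trans atv bw) (sym (ext u l bw))) done)
  cr : ∀ z w l l′ → E (contract G v u) z w ≡ true → β M z ≡ just l → β M w ≡ just l′ → CycSucc l l′ → Link (E G) β′ z w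
  cr z w l l′ e bz bw r with edge z w e
  ... | inj₁ h = z , w , done , h , done
  ... | inj₂ (inj₁ (refl , h)) = v , w , hop uv (trans (ext u l bz) (sym (trans atv bz))) done , h , done
  ... | inj₂ (inj₂ (refl , h)) = z , v , done , h , hop vu (trans (trans atv bw) (sym (ext u l′ bw))) done

index : ∀ {m n} → (Fin m → Fin n) → Fin n → Maybe (Fin m)
index r v with any? (λ i → r i F.≟ v)
... | yes (i , _) = just i
... | no _ = nothing

index-sound : ∀ {m n} (r : Fin m → Fin n) v i → index r v ≡ just i → r i ≡ v
index-sound r v i h with any? (λ i → r i F.≟ v)
index-sound r v i refl | yes (_ , p) = p

index-complete : ∀ {m n} (r : Fin m → Fin n) → Injective r → ∀ i → index r (r i) ≡ just i
index-complete r inj i with any? (λ j → r j F.≟ r i)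
... | yes (j , p) = cong just (inj j i p)
... | no p = ⊥-elim (p (i , refl))

-- Menger's theorem

-- Disjoint paths from the vertices r i to vertices of Y, having no other vertex in Y.
record Linkage {n} (E : Fin n → Fin n → Bool) (U Y : VertexSet n) m (r : Fin m → Fin n) : Set where
  field
    γ : Labelling n m
    end : Fin m → Fin n
    end∈Y : ∀ i → Y (end i) ≡ true
    γ-supp : ∀ v i → γ v ≡ just i → U v ≡ true
    γ-start : ∀ i → γ (r i) ≡ just i
    γ-end : ∀ i → γ (end i) ≡ just i
    path : ∀ i → Walk E γ (r i) (end i)
    γ-Y : ∀ v i → γ v ≡ just i → Y v ≡ true → v ≡ end i

open Linkage public

end-injective : ∀ {n E m} {U Y : VertexSet n} {r : Fin m → Fin n} (L : Linkage E U Y m r) → Injective (end L)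
end-injective L i j e = just-injective (trans (sym (γ-end L i)) (trans (cong (γ L) e) (γ-end L j)))

record Cut {n} (E : Fin n → Fin n → Bool) (U X Y A B : VertexSet n) : Set where
  field
    cover : ∀ v → (U v ⇒ A v ∨ B v) ≡ true
    A⊆ : ∀ v → (A v ⇒ U v) ≡ true
    B⊆ : ∀ v → (B v ⇒ U v) ≡ true
    X⊆ : ∀ v → (X v ⇒ A v) ≡ true
    Y⊆ : ∀ v → (Y v ⇒ B v) ≡ true
    noEdge : ∀ u v → (A u ∧ E u v ∧ B v ⇒ B u ∨ A v) ≡ true

open Cut public

_∩ˢ_ : ∀ {n} → VertexSet n → VertexSet n → VertexSet n
(A ∩ˢ B) v = A v ∧ B v

trivialLinkage : ∀ {n E m} {U Y : VertexSet n} (r : Fin m → Fin n) → Injective r → (∀ i → U (r i) ≡ true) → (∀ i → Y (r i) ≡ true) → Linkage E U Y m r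
trivialLinkage {U = U} r inj inU inY = record
  { γ = index r ; end = r ; end∈Y = inY
  ; γ-supp = λ v i h → subst (λ w → U w ≡ true) (index-sound r v i h) (inU i)
  ; γ-start = index-complete r inj ; γ-end = index-complete r inj ; path = λ i → done
  ; γ-Y = λ v i h _ → sym (index-sound r v i h) }

-- Moving the start of path i to a neighbour y of r i, in the graph without r i.
update : ∀ {m n} → (Fin m → Fin n) → Fin m → Fin n → Fin m → Fin n
update r i y j = if j ≟ᵇ i then y else r j

update-same : ∀ {m n} (r : Fin m → Fin n) i y → update r i y i ≡ y
update-same r i y rewrite ≟ᵇ-refl i = refl

update-other : ∀ {m n} (r : Fin m → Fin n) i y j → j ≢ i → update r i y j ≡ r j
update-other r i y j ne with j F.≟ i
... | yes e = ⊥-elim (ne e)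
... | no _ = refl

-- The old start is put in front of path i. Disjointness survives because the given linkage avoids
-- it, and no new meeting with Y arises because it lies outside Y.
extendLinkage : ∀ {n E m} {U Y : VertexSet n} (r : Fin m → Fin n) i y → Injective r → U (r i) ≡ true → Y (r i) ≡ false → E (r i) y ≡ true →
  Linkage E (delete (r i) U) Y m (update r i y) → Linkage E U Y m r
extendLinkage {n} {E} {m} {U} {Y} r i y inj inU outY xy L = record
  { γ = γ′ ; end = end L ; end∈Y = end∈Y L
  ; γ-supp = supp′
  ; γ-start = start′
  ; γ-end = λ j → old (end L j) j (γ-end L j)
  ; path = path′
  ; γ-Y = γ-Y′ }
  where
  γ′ : Labelling n m
  γ′ v = if v ≟ᵇ r i then just i else γ L v
  old : ∀ v j → γ L v ≡ just j → γ′ v ≡ just j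
  old v j h with v F.≟ r i
  ... | yes refl = false≢true (delete-self U (r i)) (γ-supp L (r i) j h)
  ... | no _ = h
  supp′ : ∀ v j → γ′ v ≡ just j → U v ≡ true
  supp′ v j h with v F.≟ r i
  ... | yes refl = inU
  ... | no _ = ∧-left {U v} (γ-supp L v j h)
  start′ : ∀ j → γ′ (r j) ≡ just j
  start′ j with r j F.≟ r i
  ... | yes e = cong just (sym (inj j i e))
  ... | no ne = subst (λ w → γ L w ≡ just j) (update-other r i y j (λ e → ne (cong r e))) (γ-start L j)
  path′ : ∀ j → Walk E γ′ (r j) (end L j)
  path′ j with j F.≟ i
  ... | yes refl = hop xy (trans (start′ j) (sym (old y j (subst (λ w → γ L w ≡ just j) (update-same r i y) (γ-start L j)))))
          (subst (λ w → Walk E γ′ w (end L j)) (update-same r i y) (walk-relabel j (λ w → old w j) (γ-start L j) (path L j)))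
  ... | no ne = subst (λ w → Walk E γ′ w (end L j)) (update-other r i y j ne) (walk-relabel j (λ w → old w j) (γ-start L j) (path L j))
  γ-Y′ : ∀ v j → γ′ v ≡ just j → Y v ≡ true → v ≡ end L j
  γ-Y′ v j h hy with v F.≟ r i
  ... | yes refl = false≢true outY hy
  ... | no _ = γ-Y L v j h hy

-- Induction on the size of U by uncrossing. A start x outside Y is deleted, and a cut (A , B) of
-- the remaining graph with order below m keeps the other starts in A. If A contains all neighbours
-- of x, then x may be added to A. Otherwise the start x is moved to a neighbour y outside A: a
-- linkage from there extends to x, and a small cut (A′ , B′) is uncrossed with (A , B).
menger : ∀ {n} (G : Graph′ n) k (U Y : VertexSet n) {m} (r : Fin m → Fin n) → card U ≤ k → Injective r →
  (∀ i → U (r i) ≡ true) → (∀ v → (Y v ⇒ U v) ≡ true) →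
  Linkage (E G) U Y m r ⊎ (∃ λ A → ∃ λ B → Cut (E G) U (image r) Y A B × card (A ∩ˢ B) < m)
menger {n} G k U Y {m} r le inj inU Y⊆U with any? (λ i → Y (r i) B.≟ false)
... | no none = inj₁ (trivialLinkage r inj inU (λ i → lem (Y (r i)) (λ h → none (i , h))))
  where
  lem : ∀ b → (b ≡ false → ⊥) → b ≡ true
  lem true _ = refl
  lem false f = ⊥-elim (f refl)
menger {n} G zero U Y {m} r le inj inU Y⊆U | yes (i , outY) = ⊥-elim (<⇒≱ (member⇒card U (r i) (inU i)) le)
menger {n} G (suc k) U Y {m} r le inj inU Y⊆U | yes (i , outY) = grow (card U) A₀ U′ (card-mono {P = U ∖ˢ A₀} {U} (λ v h → ∧-left {U v} h)) cut₀ small₀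
  where
  x = r i
  -- The set A grows until it contains all neighbours of x or a recursive call succeeds.
  U′ A₀ : VertexSet n
  U′ = delete x U
  A₀ = delete x (image r)
  Goal = Linkage (E G) U Y m r ⊎ (∃ λ A → ∃ λ B → Cut (E G) U (image r) Y A B × card (A ∩ˢ B) < m)
  im : ∀ v → (image r v ⇒ U v) ≡ true
  im v = ⇒-intro (image r v) (U v) (λ h → let (j , e) = image-elim r v h in subst (λ w → U w ≡ true) e (inU j))
  Y≠x : ∀ v → (Y v ⇒ not (v ≟ᵇ x)) ≡ true
  Y≠x v = ⇒-intro (Y v) _ (λ h → ≢⇒≟ᵇ v x (λ { refl → false≢true outY h }))
  cut₀ : Cut (E G) U′ A₀ Y A₀ U′
  cut₀ = record
    { cover = λ v → taut 2 (λ a u → [ u ⇒ a ∨ u ]) (A₀ v) (U′ v)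
    ; A⊆ = λ v → taut 3 (λ a u d → (a ⇒ u) ⊃ [ a ∧ d ⇒ u ∧ d ]) (image r v) (U v) (not (v ≟ᵇ x)) (im v)
    ; B⊆ = λ v → taut 1 (λ u → [ u ⇒ u ]) (U′ v)
    ; X⊆ = λ v → taut 1 (λ u → [ u ⇒ u ]) (A₀ v)
    ; Y⊆ = λ v → taut 3 (λ y u d → (y ⇒ u) ⊃ (y ⇒ d) ⊃ [ y ⇒ u ∧ d ]) (Y v) (U v) (not (v ≟ᵇ x)) (Y⊆U v) (Y≠x v)
    ; noEdge = λ u v → taut 7 (λ a U d e U′ d′ a′ → (a ⇒ U) ⊃ [ (a ∧ d) ∧ e ∧ (U′ ∧ d′) ⇒ (U ∧ d) ∨ a′ ]) (image r u) (U u) (not (u ≟ᵇ x)) (E G u v) (U v) (not (v ≟ᵇ x)) (A₀ v) (im u) }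
  -- The first cut is trivial: its middle consists of the m - 1 other starts.
  small₀ : suc (card (A₀ ∩ˢ U′)) ≤ m
  small₀ = ≤-trans (s≤s (card-mono {P = A₀ ∩ˢ U′} {A₀} (λ v h → ∧-left {A₀ v} h)))
    (≤-reflexive (trans (sym (card-delete (image r) x (image-intro r i))) (card-image r inj)))
  grow : ∀ j A B → card (U ∖ˢ A) ≤ j → Cut (E G) U′ A₀ Y A B → suc (card (A ∩ˢ B)) ≤ m → Goal
  grow j A B leA c sm with any? (λ y → (E G x y ∧ U′ y ∧ not (A y)) B.≟ true)
  ... | no none = inj₂ (insert x A , B , cut , ≤-trans (s≤s (card-mono {P = insert x A ∩ˢ B} {A ∩ˢ B}
          (λ v h → taut 5 (λ e a b u d → (e ⇒ not d) ⊃ (b ⇒ u ∧ d) ⊃ ((e ∨ a) ∧ b) ⊃ [ a ∧ b ]) (v ≟ᵇ x) (A v) (B v) (U v) (not (v ≟ᵇ x))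
             (taut 1 (λ e → [ e ⇒ not (not e) ]) (v ≟ᵇ x)) (B⊆ c v) h))) sm)
    where
    nb : ∀ v → (E G x v ∧ U′ v ⇒ A v) ≡ true
    nb v = taut 3 (λ e u a → not (e ∧ u ∧ not a) ⊃ [ e ∧ u ⇒ a ]) (E G x v) (U′ v) (A v) (notB (λ h → none (v , h)))
    nb′ : ∀ u v → (u ≟ᵇ x ∧ E G u v ∧ U′ v ⇒ A v) ≡ true
    nb′ u v with u F.≟ x
    ... | yes refl = nb v
    ... | no _ = refl
    Ux : ∀ v → (v ≟ᵇ x ⇒ U v) ≡ true
    Ux v = ⇒-intro (v ≟ᵇ x) (U v) (λ h → subst (λ w → U w ≡ true) (sym (≟ᵇ⇒≡ v x h)) (inU i))
    cut : Cut (E G) U (image r) Y (insert x A) B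
    cut = record
      { cover = λ v → taut 4 (λ u e a b → (u ∧ not e ⇒ a ∨ b) ⊃ [ u ⇒ (e ∨ a) ∨ b ]) (U v) (v ≟ᵇ x) (A v) (B v) (cover c v)
      ; A⊆ = λ v → taut 3 (λ u e a → (a ⇒ u ∧ not e) ⊃ (e ⇒ u) ⊃ [ e ∨ a ⇒ u ]) (U v) (v ≟ᵇ x) (A v) (A⊆ c v) (Ux v)
      ; B⊆ = λ v → taut 3 (λ u e b → (b ⇒ u ∧ not e) ⊃ [ b ⇒ u ]) (U v) (v ≟ᵇ x) (B v) (B⊆ c v)
      ; X⊆ = λ v → taut 3 (λ i e a → (i ∧ not e ⇒ a) ⊃ [ i ⇒ e ∨ a ]) (image r v) (v ≟ᵇ x) (A v) (X⊆ c v)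
      ; Y⊆ = Y⊆ c
      ; noEdge = λ u v → taut 8 (λ ux au bu e uv av bv vx → (au ∧ e ∧ bv ⇒ bu ∨ av) ⊃ (ux ∧ e ∧ uv ⇒ av) ⊃ (bv ⇒ uv) ⊃
           [ (ux ∨ au) ∧ e ∧ bv ⇒ bu ∨ (vx ∨ av) ]) (u ≟ᵇ x) (A u) (B u) (E G u v) (U′ v) (A v) (B v) (v ≟ᵇ x) (noEdge c u v) (nb′ u v) (B⊆ c v) }
  ... | yes (y , h) = try (menger G k U′ Y r′ leU′ inj′ inU′ Y⊆U′)
    where
    xy : E G x y ≡ true
    xy = ∧-left h
    yU′ : U′ y ≡ true
    yU′ = ∧-left (∧-right {E G x y} h)
    yA : not (A y) ≡ true
    yA = ∧-right {U′ y} (∧-right {E G x y} h)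
    r′ = update r i y
    leU′ : card U′ ≤ k
    leU′ = ≤-pred (≤-trans (≤-reflexive (sym (card-delete U x (inU i)))) le)
    inA₀ : ∀ j → j ≢ i → A₀ (r j) ≡ true
    inA₀ j ne = ∧-intro (image-intro r j) (≢⇒≟ᵇ (r j) x (λ e → ne (inj j i e)))
    fresh : ∀ j → j ≢ i → r j ≢ y
    fresh j ne e = absurdB (⇒-elim (A₀ y) (A y) (X⊆ c y) (subst (λ w → A₀ w ≡ true) e (inA₀ j ne))) yA
    inj′ : Injective r′
    inj′ a b e with a F.≟ i | b F.≟ i
    ... | yes p | yes q = trans p (sym q)
    ... | yes p | no q = ⊥-elim (fresh b q (sym e))
    ... | no p | yes q = ⊥-elim (fresh a p e)
    ... | no p | no q = inj a b e
    inU′ : ∀ j → U′ (r′ j) ≡ true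
    inU′ j with j F.≟ i
    ... | yes p = yU′
    ... | no p = ∧-intro (inU j) (≢⇒≟ᵇ (r j) x (λ e → p (inj j i e)))
    Y⊆U′ : ∀ v → (Y v ⇒ U′ v) ≡ true
    Y⊆U′ v = taut 3 (λ y u d → (y ⇒ u) ⊃ (y ⇒ d) ⊃ [ y ⇒ u ∧ d ]) (Y v) (U v) (not (v ≟ᵇ x)) (Y⊆U v) (Y≠x v)
    r⊆r′ : ∀ v → (A₀ v ⇒ image r′ v) ≡ true
    r⊆r′ v = ⇒-intro (A₀ v) (image r′ v) (λ h → lem (image-elim r v (∧-left {image r v} h)) (∧-right {image r v} h))
      where
      lem : (∃ λ j → r j ≡ v) → not (v ≟ᵇ x) ≡ true → image r′ v ≡ true
      lem (j , refl) d = subst (λ w → image r′ w ≡ true) (update-other r i y j (λ e → ≟ᵇ⇒≢ (r j) x d (cong r e))) (image-intro r′ j)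
    try : Linkage (E G) U′ Y m r′ ⊎ (∃ λ A′ → ∃ λ B′ → Cut (E G) U′ (image r′) Y A′ B′ × card (A′ ∩ˢ B′) < m) → Goal
    try (inj₁ L) = inj₁ (extendLinkage r i y inj (inU i) outY xy L)
    try (inj₂ (A′ , B′ , c′ , sm′)) with 2 + card ((A ∩ˢ A′) ∩ˢ (B ∪ˢ B′)) ≤? m
    -- The corner (A ∩ A′ , B ∪ B′) has order at most m - 2, so x can be put on both sides. It
    -- contains all starts, since the other ones lie in A and in A′.
    ... | yes lt = inj₂ (insert x (A ∩ˢ A′) , insert x (B ∪ˢ B′) , cut , ≤-trans (s≤s small) lt)
      where
      small : card (insert x (A ∩ˢ A′) ∩ˢ insert x (B ∪ˢ B′)) ≤ suc (card ((A ∩ˢ A′) ∩ˢ (B ∪ˢ B′)))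
      small = ≤-trans (card-mono {P = insert x (A ∩ˢ A′) ∩ˢ insert x (B ∪ˢ B′)} {insert x ((A ∩ˢ A′) ∩ˢ (B ∪ˢ B′))}
        (λ v → taut 3 (λ e a b → ((e ∨ a) ∧ (e ∨ b)) ⊃ [ e ∨ (a ∧ b) ]) (v ≟ᵇ x) ((A ∩ˢ A′) v) ((B ∪ˢ B′) v)))
        (card-insert≤ _ x)
      Ux : ∀ v → (v ≟ᵇ x ⇒ U v) ≡ true
      Ux v = ⇒-intro (v ≟ᵇ x) (U v) (λ h → subst (λ w → U w ≡ true) (sym (≟ᵇ⇒≡ v x h)) (inU i))
      cut : Cut (E G) U (image r) Y (insert x (A ∩ˢ A′)) (insert x (B ∪ˢ B′))
      cut = record
        { cover = λ v → taut 6 (λ u e a b a′ b′ → (u ∧ not e ⇒ a ∨ b) ⊃ (u ∧ not e ⇒ a′ ∨ b′) ⊃ [ u ⇒ (e ∨ (a ∧ a′)) ∨ (e ∨ (b ∨ b′)) ])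
             (U v) (v ≟ᵇ x) (A v) (B v) (A′ v) (B′ v) (cover c v) (cover c′ v)
        ; A⊆ = λ v → taut 4 (λ u e a a′ → (a ⇒ u ∧ not e) ⊃ (e ⇒ u) ⊃ [ e ∨ (a ∧ a′) ⇒ u ]) (U v) (v ≟ᵇ x) (A v) (A′ v) (A⊆ c v) (Ux v)
        ; B⊆ = λ v → taut 4 (λ u e a a′ → (a ⇒ u ∧ not e) ⊃ (a′ ⇒ u ∧ not e) ⊃ (e ⇒ u) ⊃ [ e ∨ (a ∨ a′) ⇒ u ]) (U v) (v ≟ᵇ x) (B v) (B′ v) (B⊆ c v) (B⊆ c′ v) (Ux v)
        ; X⊆ = λ v → taut 5 (λ i e i′ a a′ → (i ∧ not e ⇒ a) ⊃ (i ∧ not e ⇒ i′) ⊃ (i′ ⇒ a′) ⊃ [ i ⇒ e ∨ (a ∧ a′) ])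
             (image r v) (v ≟ᵇ x) (image r′ v) (A v) (A′ v) (X⊆ c v) (r⊆r′ v) (X⊆ c′ v)
        ; Y⊆ = λ v → taut 4 (λ y b b′ e → (y ⇒ b) ⊃ [ y ⇒ e ∨ (b ∨ b′) ]) (Y v) (B v) (B′ v) (v ≟ᵇ x) (Y⊆ c v)
        ; noEdge = λ u v → taut 11 (λ e ux vx au av bu bv au′ av′ bu′ bv′ → (au ∧ e ∧ bv ⇒ bu ∨ av) ⊃ (au′ ∧ e ∧ bv′ ⇒ bu′ ∨ av′) ⊃ 
             ((bv ∨ bv′) ⇒ (av ∨ bv) ∧ (av′ ∨ bv′)) ⊃
             [ (ux ∨ (au ∧ au′)) ∧ e ∧ (vx ∨ (bv ∨ bv′)) ⇒ (ux ∨ (bu ∨ bu′)) ∨ (vx ∨ (av ∧ av′)) ])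
             (E G u v) (u ≟ᵇ x) (v ≟ᵇ x) (A u) (A v) (B u) (B v) (A′ u) (A′ v) (B′ u) (B′ v) (noEdge c u v) (noEdge c′ u v)
             (taut 5 (λ U a b a′ b′ → (U ⇒ a ∨ b) ⊃ (U ⇒ a′ ∨ b′) ⊃ (b ⇒ U) ⊃ (b′ ⇒ U) ⊃ [ (b ∨ b′) ⇒ (a ∨ b) ∧ (a′ ∨ b′) ])
               (U′ v) (A v) (B v) (A′ v) (B′ v) (cover c v) (cover c′ v) (B⊆ c v) (B⊆ c′ v)) }
    -- By submodularity the opposite corner (A ∪ A′ , B ∩ B′) has order below m. It replaces (A ,
    -- B), and its first side is larger because it contains y.
    ... | no nlt = next j leA
      where
      o₁ = card ((A ∪ˢ A′) ∩ˢ (B ∩ˢ B′))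
      o₂ = card ((A ∩ˢ A′) ∩ˢ (B ∪ˢ B′))
      submodular : o₁ + o₂ ≤ card (A ∩ˢ B) + card (A′ ∩ˢ B′)
      submodular = ≤-trans (≤-reflexive (sym (∑-+ (λ v → ⟦ ((A ∪ˢ A′) ∩ˢ (B ∩ˢ B′)) v ⟧) (λ v → ⟦ ((A ∩ˢ A′) ∩ˢ (B ∪ˢ B′)) v ⟧))))
        (≤-trans (∑-mono (λ v → ≤! (taut 4 (λ a b a′ b′ → [ ⟦ (a ∨ a′) ∧ (b ∧ b′) ⟧ + ⟦ (a ∧ a′) ∧ (b ∨ b′) ⟧ ≤ᵇ ⟦ a ∧ b ⟧ + ⟦ a′ ∧ b′ ⟧ ]) (A v) (B v) (A′ v) (B′ v))))
          (≤-reflexive (∑-+ (λ v → ⟦ (A ∩ˢ B) v ⟧) (λ v → ⟦ (A′ ∩ˢ B′) v ⟧))))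
      small : suc o₁ ≤ m
      small = +-cancelʳ-≤ (suc o₂) (suc o₁) m (begin
        suc o₁ + suc o₂ ≡⟨ cong suc (+-suc o₁ o₂) ⟩
        suc (suc (o₁ + o₂)) ≤⟨ s≤s (s≤s submodular) ⟩
        suc (suc (card (A ∩ˢ B) + card (A′ ∩ˢ B′))) ≡⟨ cong suc (sym (+-suc (card (A ∩ˢ B)) (card (A′ ∩ˢ B′)))) ⟩
        suc (card (A ∩ˢ B)) + suc (card (A′ ∩ˢ B′)) ≤⟨ +-mono-≤ sm sm′ ⟩
        m + m ≤⟨ +-monoʳ-≤ m (≤-pred (≰⇒> nlt)) ⟩
        m + suc o₂ ∎)
        where open ≤-Reasoning
      cut : Cut (E G) U′ A₀ Y (A ∪ˢ A′) (B ∩ˢ B′)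
      cut = record
        { cover = λ v → taut 5 (λ u a b a′ b′ → (u ⇒ a ∨ b) ⊃ (u ⇒ a′ ∨ b′) ⊃ [ u ⇒ (a ∨ a′) ∨ (b ∧ b′) ])
             (U′ v) (A v) (B v) (A′ v) (B′ v) (cover c v) (cover c′ v)
        ; A⊆ = λ v → taut 3 (λ u a a′ → (a ⇒ u) ⊃ (a′ ⇒ u) ⊃ [ a ∨ a′ ⇒ u ]) (U′ v) (A v) (A′ v) (A⊆ c v) (A⊆ c′ v)
        ; B⊆ = λ v → taut 3 (λ u a a′ → (a ⇒ u) ⊃ (a′ ⇒ u) ⊃ [ a ∧ a′ ⇒ u ]) (U′ v) (B v) (B′ v) (B⊆ c v) (B⊆ c′ v)
        ; X⊆ = λ v → taut 3 (λ i a a′ → (i ⇒ a) ⊃ [ i ⇒ a ∨ a′ ]) (A₀ v) (A v) (A′ v) (X⊆ c v)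
        ; Y⊆ = λ v → taut 3 (λ y b b′ → (y ⇒ b) ⊃ (y ⇒ b′) ⊃ [ y ⇒ b ∧ b′ ]) (Y v) (B v) (B′ v) (Y⊆ c v) (Y⊆ c′ v)
        ; noEdge = λ u v → taut 9 (λ e au av bu bv au′ av′ bu′ bv′ → (au ∧ e ∧ bv ⇒ bu ∨ av) ⊃ (au′ ∧ e ∧ bv′ ⇒ bu′ ∨ av′) ⊃ 
             ((au ∨ au′) ⇒ (au ∨ bu) ∧ (au′ ∨ bu′)) ⊃
             [ (au ∨ au′) ∧ e ∧ (bv ∧ bv′) ⇒ (bu ∧ bu′) ∨ (av ∨ av′) ])
             (E G u v) (A u) (A v) (B u) (B v) (A′ u) (A′ v) (B′ u) (B′ v) (noEdge c u v) (noEdge c′ u v)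
             (taut 5 (λ U a b a′ b′ → (U ⇒ a ∨ b) ⊃ (U ⇒ a′ ∨ b′) ⊃ (a ⇒ U) ⊃ (a′ ⇒ U) ⊃ [ (a ∨ a′) ⇒ (a ∨ b) ∧ (a′ ∨ b′) ])
               (U′ u) (A u) (B u) (A′ u) (B′ u) (cover c u) (cover c′ u) (A⊆ c u) (A⊆ c′ u)) }
      yA′ : A′ y ≡ true
      yA′ = ⇒-elim (image r′ y) (A′ y) (X⊆ c′ y) (subst (λ w → image r′ w ≡ true) (update-same r i y) (image-intro r′ i))
      fewer : card (U ∖ˢ (A ∪ˢ A′)) < card (U ∖ˢ A)
      fewer = card-strict {P = U ∖ˢ (A ∪ˢ A′)} {U ∖ˢ A} (λ v → taut 3 (λ u a a′ → (u ∧ not (a ∨ a′)) ⊃ [ u ∧ not a ]) (U v) (A v) (A′ v)) y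
        (∧-intro (∧-left {U y} yU′) yA) (not⁻ (taut 3 (λ u a a′ → a′ ⊃ [ not (u ∧ not (a ∨ a′)) ]) (U y) (A y) (A′ y) yA′))
      next : ∀ j → card (U ∖ˢ A) ≤ j → Goal
      next zero le′ = ⊥-elim (<⇒≱ fewer (≤-trans le′ z≤n))
      next (suc j) le′ = grow j (A ∪ˢ A′) (B ∩ˢ B′) (≤-pred (≤-trans fewer le′)) cut small

-- Labellings of five roots

allF : ∀ {m} → (Fin m → Bool) → Bool
allF {zero} f = true
allF {suc m} f = f zero ∧ allF (λ i → f (suc i))

anyF : ∀ {m} → (Fin m → Bool) → Bool
anyF {zero} f = false
anyF {suc m} f = f zero ∨ anyF (λ i → f (suc i))

allF-sound : ∀ {m} (f : Fin m → Bool) → allF f ≡ true → ∀ i → f i ≡ true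
allF-sound f h zero = ∧-left h
allF-sound f h (suc i) = allF-sound (λ i → f (suc i)) (∧-right {f zero} h) i

anyF-sound : ∀ {m} (f : Fin m → Bool) → anyF f ≡ true → ∃ λ i → f i ≡ true
anyF-sound {suc m} f h with ∨-elim {f zero} h
... | inj₁ k = zero , k
... | inj₂ k with anyF-sound (λ i → f (suc i)) k
...   | i , e = suc i , e

allPairsᵇ : ∀ {m} → (Fin m → Fin m → Bool) → Bool
allPairsᵇ P = allF λ i → allF λ j → P i j

allPairsᵇ-sound : ∀ {m} (P : Fin m → Fin m → Bool) → allPairsᵇ P ≡ true → ∀ i j → P i j ≡ true
allPairsᵇ-sound P h i j = allF-sound (P i) (allF-sound (λ i → allF (P i)) h i) j

tuple : ∀ {A : Set} → A → A → A → A → A → Fin 5 → A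
tuple a b c d e zero = a
tuple a b c d e (suc zero) = b
tuple a b c d e (suc (suc zero)) = c
tuple a b c d e (suc (suc (suc zero))) = d
tuple a b c d e (suc (suc (suc (suc zero)))) = e

tuple-η : ∀ {A : Set} (f : Fin 5 → A) i →
  tuple (f zero) (f (suc zero)) (f (suc (suc zero))) (f (suc (suc (suc zero)))) (f (suc (suc (suc (suc zero))))) i ≡ f i
tuple-η f zero = refl
tuple-η f (suc zero) = refl
tuple-η f (suc (suc zero)) = refl
tuple-η f (suc (suc (suc zero))) = refl
tuple-η f (suc (suc (suc (suc zero)))) = refl

allTuples : ∀ {m} → ((Fin 5 → Fin m) → Bool) → Bool
allTuples P = allF λ a → allF λ b → allF λ c → allF λ d → allF λ e → P (tuple a b c d e)

-- The check concerns the tuple of the values of f, which agrees with f only pointwise; hence the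
-- witness g.
allTuples-sound : ∀ {m} (P : (Fin 5 → Fin m) → Bool) → allTuples P ≡ true → (f : Fin 5 → Fin m) →
  ∃ λ g → (∀ i → g i ≡ f i) × P g ≡ true
allTuples-sound P h f = _ , tuple-η f ,
  allF-sound (λ e → P (tuple _ _ _ _ e)) (allF-sound (λ d → allF λ e → P (tuple _ _ _ d e)) (allF-sound (λ c → allF λ d → allF λ e → P (tuple _ _ c d e))
    (allF-sound (λ b → allF λ c → allF λ d → allF λ e → P (tuple _ b c d e)) (allF-sound (λ a → allF λ b → allF λ c → allF λ d → allF λ e → P (tuple a b c d e))
    h (f zero)) (f (suc zero))) (f (suc (suc zero)))) (f (suc (suc (suc zero))))) (f (suc (suc (suc (suc zero)))))

succᵇ : ∀ {c} → Fin c → Fin c → Bool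
succᵇ {c} i j = (suc (toℕ i) ≡ᵇ toℕ j) ∨ ((suc (toℕ i) ≡ᵇ c) ∧ (toℕ j ≡ᵇ 0))

≡ᵇ-complete : ∀ {m n} → m ≡ n → (m ≡ᵇ n) ≡ true
≡ᵇ-complete {m} refl = T⇒≡ (≡⇒≡ᵇ m m refl)

succᵇ-complete : ∀ {c} (i j : Fin c) → CycSucc i j → succᵇ i j ≡ true
succᵇ-complete {c} i j (inj₁ h) = subst (λ b → (b ∨ ((suc (toℕ i) ≡ᵇ c) ∧ (toℕ j ≡ᵇ 0))) ≡ true) (sym (≡ᵇ-complete h)) refl
succᵇ-complete i j (inj₂ (h , k)) = lem _ _ _ (≡ᵇ-complete h) (≡ᵇ-complete k)
  where
  lem : ∀ a b c → b ≡ true → c ≡ true → (a ∨ (b ∧ c)) ≡ true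
  lem true _ _ _ _ = refl
  lem false _ _ refl refl = refl

sh-succ : ∀ p → CycSucc p (sh p)
sh-succ zero = inj₁ refl
sh-succ (suc zero) = inj₁ refl
sh-succ (suc (suc zero)) = inj₁ refl
sh-succ (suc (suc (suc zero))) = inj₁ refl
sh-succ (suc (suc (suc (suc zero)))) = inj₂ (refl , refl)

unsh : Fin 5 → Fin 5
unsh p = sh (sh (sh (sh p)))

unsh-sh : ∀ p → unsh (sh p) ≡ p
unsh-sh zero = refl
unsh-sh (suc zero) = refl
unsh-sh (suc (suc zero)) = refl
unsh-sh (suc (suc (suc zero))) = refl
unsh-sh (suc (suc (suc (suc zero)))) = refl

sh-unsh : ∀ p → sh (unsh p) ≡ p
sh-unsh p = unsh-sh p

sh-injective : ∀ p q → sh p ≡ sh q → p ≡ q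
sh-injective p q e = trans (sym (unsh-sh p)) (trans (cong unsh e) (unsh-sh q))

succ⇒sh : ∀ (p q : Fin 5) → CycSucc p q → sh p ≡ q
succ⇒sh p q h = ≟ᵇ⇒≡ (sh p) q (⇒-elim _ _ (allPairsᵇ-sound (λ p q → succᵇ p q ⇒ (sh p ≟ᵇ q)) refl p q) (succᵇ-complete p q h))

data Chain {c} (μ : Fin 5 → Fin c) : Fin 5 → Fin 5 → Set where
  stop : ∀ {p} → Chain μ p p
  up : ∀ {p q} → μ p ≡ μ (sh p) → Chain μ (sh p) q → Chain μ p q
  down : ∀ {p q} → μ p ≡ μ (sh p) → Chain μ p q → Chain μ (sh p) q

-- Merging cyclically consecutive bags according to μ turns a rooted 5-cycle into a model for μ.
record Good {c} (μ : Fin 5 → Fin c) : Set where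
  field
    together : ∀ p q → μ p ≡ μ q → Chain μ p q
    adjacent : ∀ p q → CycSucc (μ p) (μ q) → ∃ λ t → (μ t ≡ μ p × μ (sh t) ≡ μ q) ⊎ (μ t ≡ μ q × μ (sh t) ≡ μ p)

open Good public

good-cong : ∀ {c} {μ ν : Fin 5 → Fin c} → (∀ i → μ i ≡ ν i) → Good μ → Good ν
good-cong {c} {μ} {ν} e g = record { together = λ p q h → chain (together g p q (trans (e p) (trans h (sym (e q))))) ; adjacent = adj }
  where
  chain : ∀ {p q} → Chain μ p q → Chain ν p q
  chain stop = stop
  chain (up {p} h k) = up (trans (sym (e p)) (trans h (e (sh p)))) (chain k)
  chain (down {p} h k) = down (trans (sym (e p)) (trans h (e (sh p)))) (chain k)
  adj : ∀ p q → CycSucc (ν p) (ν q) → _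
  adj p q r with adjacent g p q (subst₂ CycSucc (sym (e p)) (sym (e q)) r)
  ... | t , inj₁ (a , b) = t , inj₁ (trans (sym (e t)) (trans a (e p)) , trans (sym (e (sh t))) (trans b (e q)))
  ... | t , inj₂ (a , b) = t , inj₂ (trans (sym (e t)) (trans a (e q)) , trans (sym (e (sh t))) (trans b (e p)))

good-rotate : ∀ {c} {μ : Fin 5 → Fin c} → Good μ → Good (λ p → μ (sh p))
good-rotate {c} {μ} g = record { together = λ p q h → subst₂ (Chain _) (unsh-sh p) (unsh-sh q) (chain (together g (sh p) (sh q) h)) ; adjacent = adj }
  where
  shift : ∀ p → μ p ≡ μ (sh p) → μ (sh (unsh p)) ≡ μ (sh (sh (unsh p)))
  shift p h = subst (λ t → μ t ≡ μ (sh t)) (sym (sh-unsh p)) h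
  chain : ∀ {p q} → Chain μ p q → Chain (λ p → μ (sh p)) (unsh p) (unsh q)
  chain stop = stop
  chain (up {p} h k) = up (shift p h) (chain k)
  chain (down {p} h k) = down (shift p h) (chain k)
  adj : ∀ p q → CycSucc (μ (sh p)) (μ (sh q)) → _
  adj p q r with adjacent g (sh p) (sh q) r
  ... | t , h = unsh t , subst (λ s → (μ s ≡ μ (sh p) × μ (sh s) ≡ μ (sh q)) ⊎ (μ s ≡ μ (sh q) × μ (sh s) ≡ μ (sh p))) (sym (sh-unsh t)) h

climb : ∀ {c} → (Fin 5 → Fin c) → ℕ → Fin 5 → Fin 5 → Bool
climb μ zero p q = p ≟ᵇ q
climb μ (suc k) p q = p ≟ᵇ q ∨ (μ p ≟ᵇ μ (sh p) ∧ climb μ k (sh p) q)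

climb-sound : ∀ {c} (μ : Fin 5 → Fin c) k p q → climb μ k p q ≡ true → Chain μ p q
climb-sound μ zero p q h rewrite ≟ᵇ⇒≡ p q h = stop
climb-sound μ (suc k) p q h with ∨-elim {p ≟ᵇ q} h
... | inj₁ e rewrite ≟ᵇ⇒≡ p q e = stop
... | inj₂ e = up (≟ᵇ⇒≡ (μ p) (μ (sh p)) (∧-left e)) (climb-sound μ k (sh p) q (∧-right {μ p ≟ᵇ μ (sh p)} e))

chain-sym : ∀ {c} {μ : Fin 5 → Fin c} {p q} → Chain μ p q → Chain μ q p
chain-sym c = go c stop
  where
  go : ∀ {c} {μ : Fin 5 → Fin c} {p q r} → Chain μ p q → Chain μ p r → Chain μ q r
  go stop a = a
  go (up h k) a = go k (down h a)
  go (down h k) a = go k (up h a)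

togetherᵇ adjacentᵇ : ∀ {c} → (Fin 5 → Fin c) → Fin 5 → Fin 5 → Bool
togetherᵇ μ p q = (μ p ≟ᵇ μ q) ⇒ (climb μ 4 p q ∨ climb μ 4 q p)
adjacentᵇ μ p q = succᵇ (μ p) (μ q) ⇒ anyF (λ t → (μ t ≟ᵇ μ p ∧ μ (sh t) ≟ᵇ μ q) ∨ (μ t ≟ᵇ μ q ∧ μ (sh t) ≟ᵇ μ p))

goodᵇ : ∀ {c} → (Fin 5 → Fin c) → Bool
goodᵇ μ = allPairsᵇ (λ p q → togetherᵇ μ p q ∧ adjacentᵇ μ p q)

goodᵇ-sound : ∀ {c} (μ : Fin 5 → Fin c) → goodᵇ μ ≡ true → Good μ
goodᵇ-sound {c} μ h = record { together = tog ; adjacent = adj }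
  where
  at : ∀ p q → (togetherᵇ μ p q ∧ adjacentᵇ μ p q) ≡ true
  at p q = allPairsᵇ-sound (λ p q → togetherᵇ μ p q ∧ adjacentᵇ μ p q) h p q
  tog : ∀ p q → μ p ≡ μ q → Chain μ p q
  tog p q e with ∨-elim {climb μ 4 p q} (⇒-elim (μ p ≟ᵇ μ q) (climb μ 4 p q ∨ climb μ 4 q p) (∧-left (at p q)) (≡⇒≟ᵇ e))
  ... | inj₁ k = climb-sound μ 4 p q k
  ... | inj₂ k = chain-sym (climb-sound μ 4 q p k)
  both : ∀ (a b a′ b′ : Fin c) → (a ≟ᵇ b ∧ a′ ≟ᵇ b′) ≡ true → a ≡ b × a′ ≡ b′
  both a b a′ b′ k = ≟ᵇ⇒≡ a b (∧-left k) , ≟ᵇ⇒≡ a′ b′ (∧-right {a ≟ᵇ b} k)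
  adj : ∀ p q → CycSucc (μ p) (μ q) → _
  adj p q r with anyF-sound (λ t → (μ t ≟ᵇ μ p ∧ μ (sh t) ≟ᵇ μ q) ∨ (μ t ≟ᵇ μ q ∧ μ (sh t) ≟ᵇ μ p))
        (⇒-elim (succᵇ (μ p) (μ q)) _ (∧-right {togetherᵇ μ p q} (at p q)) (succᵇ-complete (μ p) (μ q) r))
  ... | t , k with ∨-elim {μ t ≟ᵇ μ p ∧ μ (sh t) ≟ᵇ μ q} k
  ...   | inj₁ l = t , inj₁ (both _ _ _ _ l)
  ...   | inj₂ l = t , inj₂ (both _ _ _ _ l)

-- A counting sort of the five positions by label. That the result is a sorted permutation is
-- checked by evaluation through `sortedBy`.
positions : ∀ {c} → (Fin 5 → Fin c) → List (Fin 5)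
positions {c} f = go c (λ i → i)
  where
  with-label : ∀ m → Fin c → (Fin m → Fin 5) → List (Fin 5)
  with-label zero l r = []
  with-label (suc m) l r = if f (r zero) ≟ᵇ l then r zero ∷ with-label m l (λ i → r (suc i)) else with-label m l (λ i → r (suc i))
  go : ∀ m → (Fin m → Fin c) → List (Fin 5)
  go zero r = []
  go (suc m) r = with-label 5 (r zero) (λ i → i) ++ go m (λ i → r (suc i))

monotoneᵇ : ∀ {c} → (Fin 5 → Fin c) → Bool
monotoneᵇ μ = le 0F 1F ∧ le 1F 2F ∧ le 2F 3F ∧ le 3F 4F
  where
  le : Fin 5 → Fin 5 → Bool
  le i j = toℕ (μ i) ≤ᵇ toℕ (μ j)

injectiveᵇ : ∀ {c} → (Fin 5 → Fin c) → Bool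
injectiveᵇ f = allPairsᵇ (λ i j → (f i ≟ᵇ f j) ⇒ (i ≟ᵇ j))

injectiveᵇ-sound : ∀ {c} (f : Fin 5 → Fin c) → injectiveᵇ f ≡ true → Injective f
injectiveᵇ-sound f h i j e = ≟ᵇ⇒≡ i j (⇒-elim (f i ≟ᵇ f j) _ (allPairsᵇ-sound (λ i j → (f i ≟ᵇ f j) ⇒ (i ≟ᵇ j)) h i j) (≡⇒≟ᵇ e))

permutationᵇ : (Fin 5 → Fin 5) → Bool
permutationᵇ σ = injectiveᵇ σ ∧ allF (λ j → anyF λ i → σ i ≟ᵇ j)

sortedBy : ∀ {c} → (Fin 5 → Fin c) → List (Fin 5) → Bool
sortedBy f (a ∷ b ∷ c ∷ d ∷ e ∷ []) = monotoneᵇ (tuple (f a) (f b) (f c) (f d) (f e)) ∧ permutationᵇ (tuple a b c d e)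
sortedBy f _ = false

Sortable : ℕ → Set
Sortable c = ∀ (f : Fin 5 → Fin c) → ∃ λ (σ : Fin 5 → Fin 5) → Injective σ × (∀ j → ∃ λ i → σ i ≡ j) × Good (λ i → f (σ i))

-- With the roots read in the order of their labels, equal labels fill an interval of the 5-cycle,
-- and consecutive labels that both occur meet at an end of their intervals, the last and the first
-- label across the closing edge. Both facts are evaluated on all labellings.
sortable : ∀ c → allTuples {c} (λ f → sortedBy f (positions f)) ≡ true → allTuples {c} (λ f → monotoneᵇ f ⇒ goodᵇ f) ≡ true → Sortable c
sortable c h h′ f with allTuples-sound _ h f
... | g , g≡f , ok = lem (positions g) ok
  where
  lem : ∀ ps → sortedBy g ps ≡ true → ∃ λ (σ : Fin 5 → Fin 5) → Injective σ × (∀ j → ∃ λ i → σ i ≡ j) × Good (λ i → f (σ i))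
  lem (a ∷ b ∷ c ∷ d ∷ e ∷ []) ok = σ , inj , sur , good
    where
    σ = tuple a b c d e
    μ = tuple (g a) (g b) (g c) (g d) (g e)
    perm : permutationᵇ σ ≡ true
    perm = ∧-right {monotoneᵇ μ} ok
    inj : Injective σ
    inj = injectiveᵇ-sound σ (∧-left {injectiveᵇ σ} perm)
    sur : ∀ j → ∃ λ i → σ i ≡ j
    sur j with anyF-sound (λ i → σ i ≟ᵇ j) (allF-sound (λ j → anyF λ i → σ i ≟ᵇ j) (∧-right {injectiveᵇ σ} perm) j)
    ... | i , e = i , ≟ᵇ⇒≡ (σ i) j e
    eq : ∀ i → μ i ≡ f (σ i)
    eq 0F = g≡f a
    eq 1F = g≡f b
    eq 2F = g≡f c
    eq 3F = g≡f d
    eq 4F = g≡f e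
    good : Good (λ i → f (σ i))
    good with allTuples-sound _ h′ μ
    ... | ν , ν≡μ , k = good-cong (λ i → trans (ν≡μ i) (eq i)) (goodᵇ-sound ν (⇒-elim (monotoneᵇ ν) _ k (subst (_≡ true) (sym mono) (∧-left {monotoneᵇ μ} ok))))
      where
      mono : monotoneᵇ ν ≡ monotoneᵇ μ
      mono rewrite ν≡μ 0F | ν≡μ 1F | ν≡μ 2F | ν≡μ 3F | ν≡μ 4F = refl

sort≤5 : ∀ c → 2 ≤ c → c ≤ 5 → Sortable c
sort≤5 (suc zero) (s≤s ()) _
sort≤5 2 _ _ = sortable 2 refl refl
sort≤5 3 _ _ = sortable 3 refl refl
sort≤5 4 _ _ = sortable 4 refl refl
sort≤5 5 _ _ = sortable 5 refl refl
sort≤5 (suc (suc (suc (suc (suc (suc _)))))) _ (s≤s (s≤s (s≤s (s≤s (s≤s ())))))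

related : ∀ {c} → Fin c → Fin c → Bool
related i j = i ≟ᵇ j ∨ succᵇ i j

metBy : ∀ {c} → (Fin 5 → Fin c) → Fin c → Fin c → Fin 5 → Fin 5 → Bool
metBy f k l p q = (not (p ≟ᵇ q) ∧ related (f p) (f q)) ⇒ ((k ≟ᵇ f p ∨ k ≟ᵇ f q) ∨ (l ≟ᵇ f p ∨ l ≟ᵇ f q))

coverable : ∀ {c} → (Fin 5 → Fin c) → Bool
coverable f = injectiveᵇ f ∨ anyF (λ k → anyF λ l → allPairsᵇ (metBy f k l))

-- Unless f is injective, two labels meet all pairs of roots that have to be connected.
cover-labels : ∀ c → 2 ≤ c → c ≤ 5 → (f : Fin 5 → Fin c) → Injective f ⊎ (∃ λ k → ∃ λ l → ∀ p q → p ≢ q → related (f p) (f q) ≡ true →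
  ((k ≡ f p ⊎ k ≡ f q) ⊎ (l ≡ f p ⊎ l ≡ f q)))
cover-labels c lo hi f with allTuples-sound (coverable {c}) (table c lo hi) f
  where
  table : ∀ c → 2 ≤ c → c ≤ 5 → allTuples (coverable {c}) ≡ true
  table (suc zero) (s≤s ()) _
  table 2 _ _ = refl
  table 3 _ _ = refl
  table 4 _ _ = refl
  table 5 _ _ = refl
  table (suc (suc (suc (suc (suc (suc _)))))) _ (s≤s (s≤s (s≤s (s≤s (s≤s ())))))
... | g , e , h with ∨-elim {injectiveᵇ g} h
...   | inj₁ k = inj₁ (λ i j fe → injectiveᵇ-sound g k i j (trans (e i) (trans fe (sym (e j)))))
...   | inj₂ m with anyF-sound (λ k → anyF λ l → allPairsᵇ (metBy g k l)) m
...     | k , m′ with anyF-sound (λ l → allPairsᵇ (metBy g k l)) m′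
...       | l , cov = inj₂ (k , l , λ p q ne r → dec p q (⇒-elim (not (p ≟ᵇ q) ∧ related (g p) (g q)) _ (allPairsᵇ-sound (metBy g k l) cov p q)
              (∧-intro (≢⇒≟ᵇ p q ne) (subst₂ (λ a b → related a b ≡ true) (sym (e p)) (sym (e q)) r))))
  where
  dec2 : ∀ m a b → (m ≟ᵇ a ∨ m ≟ᵇ b) ≡ true → m ≡ a ⊎ m ≡ b
  dec2 m a b h with ∨-elim {m ≟ᵇ a} h
  ... | inj₁ x = inj₁ (≟ᵇ⇒≡ m a x)
  ... | inj₂ x = inj₂ (≟ᵇ⇒≡ m b x)
  dec : ∀ p q → ((k ≟ᵇ g p ∨ k ≟ᵇ g q) ∨ (l ≟ᵇ g p ∨ l ≟ᵇ g q)) ≡ true → (k ≡ f p ⊎ k ≡ f q) ⊎ (l ≡ f p ⊎ l ≡ f q)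
  dec p q h with ∨-elim {k ≟ᵇ g p ∨ k ≟ᵇ g q} h
  ... | inj₁ x = inj₁ (subst₂ (λ a b → k ≡ a ⊎ k ≡ b) (e p) (e q) (dec2 k (g p) (g q) x))
  ... | inj₂ x = inj₂ (subst₂ (λ a b → l ≡ a ⊎ l ≡ b) (e p) (e q) (dec2 l (g p) (g q) x))

record Enumerates {n m} (r : Fin m → Fin n) (P : VertexSet n) : Set where
  field
    injective : Injective r
    member : ∀ i → P (r i) ≡ true
    hits : ∀ v → P v ≡ true → ∃ λ i → r i ≡ v

open Enumerates public

enumeration : ∀ {n} (P : VertexSet n) → ∃ λ (r : Fin (card P) → Fin n) → Enumerates r P
enumeration P with enumerate P
... | r , inj , mem = r , record { injective = inj ; member = mem ; hits = exhausts P r inj mem ≤-refl }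

enumeration′ : ∀ {n m} (P : VertexSet n) → card P ≡ m → ∃ λ (r : Fin m → Fin n) → Enumerates r P
enumeration′ P refl = enumeration P

image⇔ : ∀ {n m} {r : Fin m → Fin n} {P : VertexSet n} → Enumerates r P → ∀ v → (P v ⇒ image r v) ≡ true × (image r v ⇒ P v) ≡ true
image⇔ {r = r} {P} en v = ⇒-intro _ _ (λ h → let (i , e) = hits en v h in subst (λ w → image r w ≡ true) e (image-intro r i)) ,
  ⇒-intro _ _ (λ h → let (i , e) = image-elim r v h in subst (λ w → P w ≡ true) e (member en i))

enumerates-card : ∀ {n m} {r : Fin m → Fin n} {P : VertexSet n} → Enumerates r P → card P ≡ m
enumerates-card {r = r} {P} en = trans (≤-antisym (card-mono {P = P} {image r} (λ v → ⇒-elim _ _ (proj₁ (image⇔ en v)))) (card-mono {P = image r} {P} (λ v → ⇒-elim _ _ (proj₂ (image⇔ en v)))))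
  (card-image r (injective en))

SmallCut : ∀ {n} (G : Graph′ n) (U Y : VertexSet n) {m} (r : Fin m → Fin n) → Set
SmallCut {n} G U Y {m} r = ∃ λ A → ∃ λ B → Cut (E G) U (image r) Y A B ×
  (∃ λ m′ → ∃ λ (r′ : Fin m′ → Fin n) → m′ < m × Enumerates r′ (A ∩ˢ B) × Linkage (E G) B Y m′ r′)

-- A smallest cut is linked to Y behind it.
linkage-or-cut : ∀ {n} (G : Graph′ n) (U Y : VertexSet n) {m} (r : Fin m → Fin n) → Injective r →
  (∀ i → U (r i) ≡ true) → (∀ v → (Y v ⇒ U v) ≡ true) → Linkage (E G) U Y m r ⊎ SmallCut G U Y r
linkage-or-cut {n} G U Y {m} r = go (<-wellFounded m) U r
  where
  go : ∀ {m} → Acc _<_ m → (U : VertexSet n) (r : Fin m → Fin n) → Injective r →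
    (∀ i → U (r i) ≡ true) → (∀ v → (Y v ⇒ U v) ≡ true) → Linkage (E G) U Y m r ⊎ SmallCut G U Y r
  go {m} (acc rec) U r inj inU Y⊆U with menger G (card U) U Y r ≤-refl inj inU Y⊆U
  ... | inj₁ L = inj₁ L
  ... | inj₂ (A , B , c , lt) with enumeration (A ∩ˢ B)
  ...   | r₁ , en with go (rec lt) B r₁ (injective en) (λ i → ∧-right {A (r₁ i)} (member en i)) (Y⊆ c)
  ...     | inj₁ L = inj₂ (A , B , c , _ , r₁ , lt , en , L)
  -- A cut found inside B separates the middle of the first cut from Y, so joining the first sides
  -- gives a cut of U whose middle is that of the second.
  ...     | inj₂ (A₂ , B₂ , c₂ , m₂ , r₂ , lt₂ , en₂ , L₂) = inj₂ (A ∪ˢ A₂ , B₂ , cut , m₂ , r₂ , <-trans lt₂ lt , en′ , L₂)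
    where
    Q⊆A₂ : ∀ v → (A v ∧ B v ⇒ A₂ v) ≡ true
    Q⊆A₂ v = taut 3 (λ q i a → (q ⇒ i) ⊃ (i ⇒ a) ⊃ [ q ⇒ a ]) (A v ∧ B v) (image r₁ v) (A₂ v) (proj₁ (image⇔ en v)) (X⊆ c₂ v)
    cut : Cut (E G) U (image r) Y (A ∪ˢ A₂) B₂
    cut = record
      { cover = λ v → taut 5 (λ u a b a₂ b₂ → (u ⇒ a ∨ b) ⊃ (b ⇒ a₂ ∨ b₂) ⊃ [ u ⇒ (a ∨ a₂) ∨ b₂ ]) (U v) (A v) (B v) (A₂ v) (B₂ v) (cover c v) (cover c₂ v)
      ; A⊆ = λ v → taut 4 (λ u a b a₂ → (a ⇒ u) ⊃ (b ⇒ u) ⊃ (a₂ ⇒ b) ⊃ [ a ∨ a₂ ⇒ u ]) (U v) (A v) (B v) (A₂ v) (A⊆ c v) (B⊆ c v) (A⊆ c₂ v)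
      ; B⊆ = λ v → taut 3 (λ u b b₂ → (b ⇒ u) ⊃ (b₂ ⇒ b) ⊃ [ b₂ ⇒ u ]) (U v) (B v) (B₂ v) (B⊆ c v) (B⊆ c₂ v)
      ; X⊆ = λ v → taut 3 (λ i a a₂ → (i ⇒ a) ⊃ [ i ⇒ a ∨ a₂ ]) (image r v) (A v) (A₂ v) (X⊆ c v)
      ; Y⊆ = Y⊆ c₂
      ; noEdge = λ u v → taut 9 (λ e au av bu bv au₂ av₂ bu₂ bv₂ → (au ∧ e ∧ bv ⇒ bu ∨ av) ⊃ (au₂ ∧ e ∧ bv₂ ⇒ bu₂ ∨ av₂) ⊃ (au ∧ bu ⇒ au₂) ⊃ (bv₂ ⇒ bv) ⊃
           [ (au ∨ au₂) ∧ e ∧ bv₂ ⇒ bu₂ ∨ (av ∨ av₂) ]) (E G u v) (A u) (A v) (B u) (B v) (A₂ u) (A₂ v) (B₂ u) (B₂ v)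
           (noEdge c u v) (noEdge c₂ u v) (Q⊆A₂ u) (B⊆ c₂ v) }
    same-middle : ∀ v → ((A ∪ˢ A₂) ∩ˢ B₂) v ≡ true → (A₂ ∩ˢ B₂) v ≡ true
    same-middle v = taut 4 (λ a b a₂ b₂ → (a ∧ b ⇒ a₂) ⊃ (b₂ ⇒ b) ⊃ ((a ∨ a₂) ∧ b₂) ⊃ [ a₂ ∧ b₂ ]) (A v) (B v) (A₂ v) (B₂ v) (Q⊆A₂ v) (B⊆ c₂ v)
    en′ : Enumerates r₂ ((A ∪ˢ A₂) ∩ˢ B₂)
    en′ = record { injective = injective en₂
                 ; member = λ i → taut 3 (λ a a₂ b₂ → (a₂ ∧ b₂) ⊃ [ (a ∨ a₂) ∧ b₂ ]) (A (r₂ i)) (A₂ (r₂ i)) (B₂ (r₂ i)) (member en₂ i)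
                 ; hits = λ v h → hits en₂ v (same-middle v h) }

cut⇒sep : ∀ {n} (G : Graph′ n) {S X Y A B : VertexSet n} → Cut (E G) (S ∪ˢ X) X Y A B → Sep G S X (B ∖ˢ A) (A ∩ˢ B)
cut⇒sep G {S} {X} {Y} {A} {B} c = record
  { inner = λ v → taut 4 (λ s x a b → (x ⇒ a) ⊃ (b ⇒ s ∨ x) ⊃ [ b ∧ not a ⇒ s ]) (S v) (X v) (A v) (B v) (X⊆ c v) (B⊆ c v)
  ; outer = λ v → taut 3 (λ u a b → (b ⇒ u) ⊃ [ a ∧ b ⇒ u ]) (S v ∨ X v) (A v) (B v) (B⊆ c v)
  ; apart = λ v → taut 2 (λ a b → [ b ∧ not a ⇒ not (a ∧ b) ]) (A v) (B v)
  ; closed = λ u v → taut 7 (λ e e′ au bu av bv uv → (uv ⇒ av ∨ bv) ⊃ (av ∧ e′ ∧ bu ⇒ bv ∨ au) ⊃ (e ⇒ e′) ⊃ [ (bu ∧ not au) ∧ e ∧ uv ⇒ (bv ∧ not av) ∨ (av ∧ bv) ])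
      (E G u v) (E G v u) (A u) (B u) (A v) (B v) (S v ∨ X v) (cover c v) (noEdge c v u) (symE G u v) }

-- Each path is added to the bag of its end. Since U meets B only within Y, the paths meet the
-- region of M only in their ends, and there both labellings agree; the labels required at the
-- starts are thus carried back from the ends.
followLinkage : ∀ {n c m} (G : Graph′ n) {U B Y R P X : VertexSet n} {r : Fin m → Fin n} (L : Linkage (E G) U Y m r) {labY lab : Fin n → Fin c} →
  Model (E G) B R labY → (∀ i → R (end L i) ≡ true) → (∀ i → labY (end L i) ≡ lab (r i)) → (∀ v → X v ≡ true → ∃ λ i → r i ≡ v) →
  (∀ v → (U v ∧ B v ⇒ Y v) ≡ true) → (∀ v → (U v ∨ B v ⇒ P v) ≡ true) → Model (E G) P X lab
followLinkage {n} {c} {m} G {U} {B} {Y} {R} {P} {X} {r} L {labY} {lab} M end∈R ends hit UB P⊇ = record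
  { β = β′ ; supp = sup ; root = rt
  ; same = λ x y hx hy e → let (i , p) = hit x hx ; (j , q) = hit y hy in subst₂ (Walk (E G) β′) p q (sm i j (trans (cong lab p) (trans e (cong lab (sym q)))))
  ; link = λ x y hx hy e → let (i , p) = hit x hx ; (j , q) = hit y hy in subst₂ (Link (E G) β′) p q (lk i j (subst₂ CycSucc (cong lab (sym p)) (cong lab (sym q)) e)) }
  where
  β′ : Labelling n c
  β′ v = if B v then β M v else M.map (λ i → lab (r i)) (γ L v)
  inM : ∀ v l → β M v ≡ just l → β′ v ≡ just l
  inM v l h rewrite supp M v l h = h
  inL : ∀ v i → γ L v ≡ just i → β′ v ≡ just (lab (r i))
  inL v i h with B v in eq
  ... | false rewrite h = refl
  ... | true with γ-Y L v i h (taut 3 (λ u b y → (u ∧ b ⇒ y) ⊃ u ⊃ b ⊃ [ y ]) (U v) (B v) (Y v) (UB v) (γ-supp L v i h) eq)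
  ...   | refl = trans (root M v (end∈R i)) (cong just (ends i))
  sup : ∀ v l → β′ v ≡ just l → P v ≡ true
  sup v l h with B v in eq
  ... | true = taut 3 (λ u b p → (u ∨ b ⇒ p) ⊃ b ⊃ [ p ]) (U v) (B v) (P v) (P⊇ v) eq
  ... | false with γ L v in g
  ...   | just i = taut 3 (λ u b p → (u ∨ b ⇒ p) ⊃ u ⊃ [ p ]) (U v) (B v) (P v) (P⊇ v) (γ-supp L v i g)
  rt : ∀ x → X x ≡ true → β′ x ≡ just (lab x)
  rt x h with hit x h
  ... | i , refl = inL x i (γ-start L i)
  out : ∀ i → Walk (E G) β′ (r i) (end L i)
  out i = walk-relabel _ (λ w → inL w i) (γ-start L i) (path L i)
  lift : ∀ {u v} l → β M u ≡ just l → Walk (E G) (β M) u v → Walk (E G) β′ u v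
  lift l = walk-relabel l (λ w → inM w l)
  sm : ∀ i j → lab (r i) ≡ lab (r j) → Walk (E G) β′ (r i) (r j)
  sm i j e = out i ++ʷ (lift _ (root M _ (end∈R i)) (same M _ _ (end∈R i) (end∈R j) (trans (ends i) (trans e (sym (ends j))))) ++ʷ reverse G (out j))
  lk : ∀ i j → CycSucc (lab (r i)) (lab (r j)) → Link (E G) β′ (r i) (r j)
  lk i j e with link M _ _ (end∈R i) (end∈R j) (subst₂ CycSucc (sym (ends i)) (sym (ends j)) e)
  ... | u , v , p , uv , q = u , v , out i ++ʷ lift _ (root M _ (end∈R i)) p , uv , lift _ (trans (walk-label q) (root M _ (end∈R j))) q ++ʷ reverse G (out j)

-- Merging the bags of a rooted 5-cycle with roots y 0, …, y 4.
mergeBags : ∀ {n c} (G : Graph′ n) {P X : VertexSet n} {lab : Fin n → Fin c} (y : Fin 5 → Fin n) (pos : Fin n → Fin 5) →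
  (∀ i → pos (y i) ≡ i) → Model (E G) P (image y) pos → Good (λ i → lab (y i)) → (∀ v → X v ≡ true → ∃ λ i → y i ≡ v) → Model (E G) P X lab
mergeBags {n} {c} G {P} {X} {lab} y pos posy M good hit = record
  { β = β′ ; supp = sup ; root = rt
  ; same = λ x z hx hz e → let (i , p) = hit x hx ; (j , q) = hit z hz in subst₂ (Walk (E G) β′) p q (chain (together good i j (trans (cong lab p) (trans e (cong lab (sym q))))))
  ; link = λ x z hx hz e → let (i , p) = hit x hx ; (j , q) = hit z hz in subst₂ (Link (E G) β′) p q (lk i j (subst₂ CycSucc (cong lab (sym p)) (cong lab (sym q)) e)) }
  where
  μ : Fin 5 → Fin c
  μ i = lab (y i)
  β′ : Labelling n c
  β′ v = M.map μ (β M v)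
  at : ∀ i → β M (y i) ≡ just i
  at i = trans (root M (y i) (image-intro y i)) (cong just (posy i))
  sup : ∀ v l → β′ v ≡ just l → P v ≡ true
  sup v l h with β M v in eq
  ... | just i = supp M v i eq
  rt : ∀ x → X x ≡ true → β′ x ≡ just (lab x)
  rt x h with hit x h
  ... | i , refl = cong (M.map μ) (at i)
  lift : ∀ {u v} i → β M u ≡ just i → Walk (E G) (β M) u v → Walk (E G) β′ u v
  lift i = walk-relabel (μ i) (λ w h → cong (M.map μ) h)
  lnk : ∀ i → Link (E G) β′ (y i) (y (sh i))
  lnk i with link M (y i) (y (sh i)) (image-intro y i) (image-intro y (sh i)) (subst₂ CycSucc (sym (posy i)) (sym (posy (sh i))) (sh-succ i))
  ... | u , v , p , e , q = u , v , lift i (at i) p , e , lift (sh i) (trans (walk-label q) (at (sh i))) q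
  crossing : ∀ i → μ i ≡ μ (sh i) → Walk (E G) β′ (y i) (y (sh i))
  crossing i e with lnk i
  ... | u , v , p , uv , q = p ++ʷ hop uv (trans (sym (walk-label p)) (trans (rt′ i) (trans (cong just e) (trans (sym (rt′ (sh i))) (sym (walk-label q)))))) q
    where
    rt′ : ∀ i → β′ (y i) ≡ just (μ i)
    rt′ i = cong (M.map μ) (at i)
  chain : ∀ {i j} → Chain μ i j → Walk (E G) β′ (y i) (y j)
  chain stop = done
  chain (up {i} e k) = crossing i e ++ʷ chain k
  chain (down {i} e k) = reverse G (crossing i e) ++ʷ chain k
  lk : ∀ i j → CycSucc (μ i) (μ j) → Link (E G) β′ (y i) (y j)
  lk i j e with adjacent good i j e
  ... | t , inj₁ (a , b) with lnk t
  ...   | u , v , p , uv , q = u , v , chain (together good i t (sym a)) ++ʷ p , uv , q ++ʷ chain (together good (sh t) j b)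
  lk i j e | t , inj₂ (a , b) with lnk t
  ...   | u , v , p , uv , q = v , u , chain (together good i (sh t) (sym b)) ++ʷ reverse G q , adjacent-sym G u v uv , reverse G p ++ʷ chain (together good t j a)

-- Models in which every bag consists of a root and neighbours of it.
module _ {n m k c : ℕ} (G : Graph′ n) (y : Fin m → Fin n) (h : Fin k → Fin n) (label : Fin m → Fin c) (hlabel : Fin k → Fin c) where

  data Join (i j : Fin m) : Set where
    direct : E G (y i) (y j) ≡ true → Join i j
    via : ∀ t → hlabel t ≡ label i ⊎ hlabel t ≡ label j → E G (y i) (h t) ≡ true → E G (h t) (y j) ≡ true → Join i j
    via₂ : ∀ t t′ → hlabel t ≡ label i → hlabel t′ ≡ label j → E G (y i) (h t) ≡ true → E G (h t) (h t′) ≡ true → E G (h t′) (y j) ≡ true → Join i j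

  helperModel : ∀ {P : VertexSet n} (lab : Fin n → Fin c) → Injective y → Injective h → (∀ i t → y i ≢ h t) →
    (∀ i → P (y i) ≡ true) → (∀ t → P (h t) ≡ true) → (∀ i → lab (y i) ≡ label i) →
    (∀ i j → i ≢ j → label i ≡ label j → ∃ λ t → hlabel t ≡ label i × E G (y i) (h t) ≡ true × E G (h t) (y j) ≡ true) →
    (∀ i j → CycSucc (label i) (label j) → Join i j) → Model (E G) P (image y) lab
  helperModel {P} lab yinj hinj y≢h yP hP laby sm jn = record
    { β = β′ ; supp = sup
    ; root = λ x hx → let (i , e) = image-elim y x hx in subst (λ v → β′ v ≡ just (lab v)) e (trans (aty i) (cong just (sym (laby i))))
    ; same = λ x z hx hz e → let (i , p) = image-elim y x hx ; (j , q) = image-elim y z hz in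
        subst₂ (Walk (E G) β′) p q (tog i j (trans (sym (laby i)) (trans (cong lab p) (trans e (trans (cong lab (sym q)) (laby j))))))
    ; link = λ x z hx hz e → let (i , p) = image-elim y x hx ; (j , q) = image-elim y z hz in
        subst₂ (Link (E G) β′) p q (lk i j (jn i j (subst₂ CycSucc (trans (cong lab (sym p)) (laby i)) (trans (cong lab (sym q)) (laby j)) e))) }
    where
    β′ : Labelling n c
    β′ v with index y v
    ... | just i = just (label i)
    ... | nothing = M.map hlabel (index h v)
    aty : ∀ i → β′ (y i) ≡ just (label i)
    aty i rewrite index-complete y yinj i = refl
    none : ∀ t → index y (h t) ≡ nothing
    none t with index y (h t) in eq
    ... | nothing = refl
    ... | just i = ⊥-elim (y≢h i t (index-sound y (h t) i eq))
    ath : ∀ t → β′ (h t) ≡ just (hlabel t)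
    ath t rewrite none t | index-complete h hinj t = refl
    sup : ∀ v l → β′ v ≡ just l → P v ≡ true
    sup v l e with index y v in iy
    ... | just i = subst (λ w → P w ≡ true) (index-sound y v i iy) (yP i)
    ... | nothing with index h v in ih
    ...   | just t = subst (λ w → P w ≡ true) (index-sound h v t ih) (hP t)
    tog : ∀ i j → label i ≡ label j → Walk (E G) β′ (y i) (y j)
    tog i j e with i F.≟ j
    ... | yes refl = done
    ... | no ne with sm i j ne e
    ...   | t , l , a , b = hop a (trans (aty i) (trans (cong just (sym l)) (sym (ath t)))) (hop b (trans (ath t) (trans (cong just (trans l e)) (sym (aty j)))) done)
    lk : ∀ i j → Join i j → Link (E G) β′ (y i) (y j)
    lk i j (direct e) = _ , _ , done , e , done
    lk i j (via t (inj₁ l) a b) = _ , _ , hop a (trans (aty i) (trans (cong just (sym l)) (sym (ath t)))) done , b , done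
    lk i j (via t (inj₂ l) a b) = _ , _ , done , a , hop b (trans (ath t) (trans (cong just l) (sym (aty j)))) done
    lk i j (via₂ t t′ l l′ a b d) = _ , _ , hop a (trans (aty i) (trans (cong just (sym l)) (sym (ath t)))) done , b ,
      hop d (trans (ath t′) (trans (cong just l′) (sym (aty j)))) done

-- Certificates for dense neighbourhoods

-- Decision trees querying adjacencies of a graph on d + 1 vertices, vertex d being adjacent to all others.
-- The leaf excess u claims that u has too many non-neighbours; the digits to base 5 of the argument of a leaf win
-- are the bags of the non-roots in a rooted 5-cycle.
data Tree : Set where
  ask : ℕ → ℕ → Tree → Tree → Tree
  excess : ℕ → Tree
  win : ℕ → Tree

-- A true value of `countable u w` stands for the knowledge that u and w do not both lie in X. A
-- missing edge between them is then not excused by regarding X as a clique, and counts against the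
-- degree condition.
record Config : Set where
  constructor config
  field
    size helpers : ℕ
    rootOf : Fin 5 → ℕ
    helperOf : Fin helpers → ℕ
    countable : ℕ → ℕ → Bool

open Config public

Facts : Set
Facts = List (ℕ × ℕ)

has : Facts → ℕ → ℕ → Bool
has [] u w = false
has ((a , b) ∷ f) u w = ((a ≡ᵇ u) ∧ (b ≡ᵇ w)) ∨ ((a ≡ᵇ w) ∧ (b ≡ᵇ u)) ∨ has f u w

nonNeighbours : ℕ → Facts → List ℕ
nonNeighbours u [] = []
nonNeighbours u ((a , b) ∷ f) = if a ≡ᵇ u then b ∷ nonNeighbours u f else (if b ≡ᵇ u then a ∷ nonNeighbours u f else nonNeighbours u f)

elemᵇ : ℕ → List ℕ → Bool
elemᵇ x [] = false
elemᵇ x (y ∷ ys) = (x ≡ᵇ y) ∨ elemᵇ x ys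

distinctᵇ : List ℕ → Bool
distinctᵇ [] = true
distinctᵇ (x ∷ xs) = not (elemᵇ x xs) ∧ distinctᵇ xs

allᵇ : ∀ {A : Set} → (A → Bool) → List A → Bool
allᵇ p [] = true
allᵇ p (x ∷ xs) = p x ∧ allᵇ p xs

digit : ℕ → Fin 5
digit k = k mod 5

digits : ∀ {m} → ℕ → Fin m → Fin 5
digits k zero = digit k
digits k (suc t) = digits (k / 5) t

joinᵇ : (C : Config) → (ℕ → ℕ → Bool) → (Fin (helpers C) → Fin 5) → Fin 5 → Bool
joinᵇ C K hl p = K x y ∨ anyF (λ t → ((hl t ≟ᵇ p) ∨ (hl t ≟ᵇ sh p)) ∧ K x (helperOf C t) ∧ K (helperOf C t) y) ∨
  anyF (λ t → (hl t ≟ᵇ p) ∧ K x (helperOf C t) ∧ anyF (λ s → (hl s ≟ᵇ sh p) ∧ K (helperOf C t) (helperOf C s) ∧ K (helperOf C s) y))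
  where
  x = rootOf C p
  y = rootOf C (sh p)

missᵇ : Config → ℕ → ℕ → Bool
missᵇ C u w = (w <ᵇ size C) ∧ not (u ≡ᵇ w) ∧ countable C u w

-- A vertex of the neighbourhood has `size C` - 1 others, at least five of them virtual neighbours.
-- So `size C` - 5 genuine non-neighbours are one too many.
overfull : Config → ℕ → List ℕ → Bool
overfull C u ws = (size C ≤ᵇ length ws + 5) ∧ distinctᵇ ws ∧ allᵇ (missᵇ C u) ws

check : Config → Tree → Facts → Facts → Bool
check C (ask u w s t) ys ns = check C s ((u , w) ∷ ys) ns ∧ check C t ys ((u , w) ∷ ns)
check C (excess u) ys ns = (u <ᵇ size C) ∧ overfull C u (nonNeighbours u ns)
check C (win k) ys ns = allF (joinᵇ C (has ys) (digits k))

universal : ℕ → ℕ → Facts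
universal d zero = []
universal d (suc i) = (i , d) ∷ universal d i

≡ᵇ-sound : ∀ {m n} → (m ≡ᵇ n) ≡ true → m ≡ n
≡ᵇ-sound {m} {n} h = ≡ᵇ⇒≡ m n (≡⇒T h)

anyF-mono : ∀ {m} (f g : Fin m → Bool) → (∀ i → f i ≡ true → g i ≡ true) → anyF f ≡ true → anyF g ≡ true
anyF-mono {suc m} f g h e with ∨-elim {f zero} e
... | inj₁ x rewrite h zero x = refl
... | inj₂ x = taut 2 (λ a b → b ⊃ [ a ∨ b ]) (g zero) _ (anyF-mono (λ i → f (suc i)) (λ i → g (suc i)) (λ i → h (suc i)) x)

joinᵇ-mono : ∀ C (K A : ℕ → ℕ → Bool) hl p → (∀ u w → K u w ≡ true → A u w ≡ true) → joinᵇ C K hl p ≡ true → joinᵇ C A hl p ≡ true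
joinᵇ-mono C K A hl p h e with ∨-elim {K (rootOf C p) (rootOf C (sh p))} e
... | inj₁ x rewrite h _ _ x = refl
... | inj₂ e′ with ∨-elim {anyF (λ t → ((hl t ≟ᵇ p) ∨ (hl t ≟ᵇ sh p)) ∧ K (rootOf C p) (helperOf C t) ∧ K (helperOf C t) (rootOf C (sh p)))} e′
...   | inj₁ x = taut 3 (λ a b c → b ⊃ [ a ∨ b ∨ c ]) (A (rootOf C p) (rootOf C (sh p))) _ _ (anyF-mono _ _ (λ t k →
          taut 5 (λ l a b a′ b′ → (l ∧ a ∧ b) ⊃ (a ⇒ a′) ⊃ (b ⇒ b′) ⊃ [ l ∧ a′ ∧ b′ ]) ((hl t ≟ᵇ p) ∨ (hl t ≟ᵇ sh p)) (K (rootOf C p) (helperOf C t)) (K (helperOf C t) (rootOf C (sh p))) _ _ k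
            (⇒-intro _ _ (h (rootOf C p) (helperOf C t))) (⇒-intro _ _ (h (helperOf C t) (rootOf C (sh p))))) x)
...   | inj₂ x = taut 3 (λ a b c → c ⊃ [ a ∨ b ∨ c ]) (A (rootOf C p) (rootOf C (sh p))) _ _ (anyF-mono _ _ (λ t k →
          taut 5 (λ l a b a′ b′ → (l ∧ a ∧ b) ⊃ (a ⇒ a′) ⊃ (b ⇒ b′) ⊃ [ l ∧ a′ ∧ b′ ]) (hl t ≟ᵇ p) (K (rootOf C p) (helperOf C t)) _ _ _ k
            (⇒-intro _ _ (h (rootOf C p) (helperOf C t))) (⇒-intro _ _ (anyF-mono _ _ (λ s k′ →
              taut 5 (λ l a b a′ b′ → (l ∧ a ∧ b) ⊃ (a ⇒ a′) ⊃ (b ⇒ b′) ⊃ [ l ∧ a′ ∧ b′ ]) (hl s ≟ᵇ sh p) (K (helperOf C t) (helperOf C s)) (K (helperOf C s) (rootOf C (sh p))) _ _ k′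
                (⇒-intro _ _ (h (helperOf C t) (helperOf C s))) (⇒-intro _ _ (h (helperOf C s) (rootOf C (sh p)))))))) x)

-- The degree condition enters only through `budget`, which is exactly what refutes a leaf `excess`;
-- evaluating a tree therefore involves no particular graph.
module Soundness (C : Config) (A : ℕ → ℕ → Bool) (A-sym : ∀ u w → A u w ≡ A w u)
  (budget : ∀ u → (u <ᵇ size C) ≡ true → ∀ ws → distinctᵇ ws ≡ true → allᵇ (missᵇ C u) ws ≡ true → allᵇ (λ w → not (A u w)) ws ≡ true → length ws + 5 < size C) where

  Yes No : Facts → Set
  Yes ys = allᵇ (λ f → A (proj₁ f) (proj₂ f)) ys ≡ true
  No ns = allᵇ (λ f → not (A (proj₁ f) (proj₂ f))) ns ≡ true

  has-sound : ∀ ys → Yes ys → ∀ u w → has ys u w ≡ true → A u w ≡ true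
  has-sound ((a , b) ∷ f) h u w e with ∨-elim {(a ≡ᵇ u) ∧ (b ≡ᵇ w)} e
  ... | inj₁ x rewrite sym (≡ᵇ-sound {a} {u} (∧-left x)) | sym (≡ᵇ-sound {b} {w} (∧-right {a ≡ᵇ u} x)) = ∧-left h
  ... | inj₂ e′ with ∨-elim {(a ≡ᵇ w) ∧ (b ≡ᵇ u)} e′
  ...   | inj₁ x rewrite sym (≡ᵇ-sound {a} {w} (∧-left x)) | sym (≡ᵇ-sound {b} {u} (∧-right {a ≡ᵇ w} x)) = trans (A-sym b a) (∧-left h)
  ...   | inj₂ x = has-sound f (∧-right {A a b} h) u w x

  others-sound : ∀ u ns → No ns → allᵇ (λ w → not (A u w)) (nonNeighbours u ns) ≡ true
  others-sound u [] h = refl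
  others-sound u ((a , b) ∷ f) h with a ≡ᵇ u in e
  ... | true rewrite sym (≡ᵇ-sound {a} {u} e) = ∧-intro (∧-left h) (others-sound a f (∧-right {not (A a b)} h))
  ... | false with b ≡ᵇ u in e′
  ...   | true rewrite sym (≡ᵇ-sound {b} {u} e′) = ∧-intro (trans (cong not (A-sym b a)) (∧-left h)) (others-sound b f (∧-right {not (A a b)} h))
  ...   | false = others-sound u f (∧-right {not (A a b)} h)

  sound : ∀ t ys ns → Yes ys → No ns → check C t ys ns ≡ true → ∃ λ (hl : Fin (helpers C) → Fin 5) → ∀ p → joinᵇ C A hl p ≡ true
  sound (ask u w s t) ys ns hy hn e with case-bool (A u w)
  ... | inj₁ x = sound s ((u , w) ∷ ys) ns (∧-intro x hy) hn (∧-left e)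
  ... | inj₂ x = sound t ys ((u , w) ∷ ns) hy (∧-intro x hn) (∧-right {check C s ((u , w) ∷ ys) ns} e)
  sound (excess u) ys ns hy hn e = ⊥-elim (<⇒≱ (budget u (∧-left e) (nonNeighbours u ns) (∧-left (∧-right {size C ≤ᵇ length (nonNeighbours u ns) + 5} of))
      (∧-right {distinctᵇ (nonNeighbours u ns)} (∧-right {size C ≤ᵇ length (nonNeighbours u ns) + 5} of)) (others-sound u ns hn)) (≤! (∧-left of)))
    where
    of : overfull C u (nonNeighbours u ns) ≡ true
    of = ∧-right {u <ᵇ size C} e
  sound (win k) ys ns hy hn e = digits k , λ p → joinᵇ-mono C (has ys) A (digits k) p (has-sound ys hy) (allF-sound (joinᵇ C (has ys) (digits k)) e p)

nonRoot : Bool → ℕ → Bool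
nonRoot vr u = not (u <ᵇ (if vr then 4 else 5))

countableᵇ : Bool → (Fin 5 → Bool) → ℕ → ℕ → Bool
countableᵇ vr ex u w = (nonRoot vr u ∨ nonRoot vr w) ∨
  anyF (λ p → not (ex p) ∧ (((toℕ p ≡ᵇ u) ∧ (toℕ (sh p) ≡ᵇ w)) ∨ ((toℕ p ≡ᵇ w) ∧ (toℕ (sh p) ≡ᵇ u))))

-- vr tells whether the universal vertex is the root at position 4.
-- ex p exempts the pair of roots p , sh p: its adjacency is neither used nor counted.
configOf : ℕ → Bool → (Fin 5 → Bool) → Config
configOf d vr ex = config d (d ∸ 4) (tuple 0 1 2 3 (if vr then d else 4)) (λ t → (if vr then 4 else 5) + toℕ t) (countableᵇ vr ex)

-- Trees are written in postfix notation: two digits for ask, an upper-case letter for excess, three lower-case letters for win,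
-- standing for the digits to base 25 of its argument, lowest first.
reduce : List Tree × List ℕ → ℕ → List Tree × List ℕ
reduce (ts , ps) c = if 97 ≤ᵇ c then lower ps else (if 65 ≤ᵇ c then (excess (c ∸ 65) ∷ ts , []) else digitsOf ts ps)
  where
  lower : List ℕ → List Tree × List ℕ
  lower (b ∷ a ∷ []) = win (a + 25 * b + 625 * (c ∸ 97)) ∷ ts , []
  lower _ = ts , c ∸ 97 ∷ ps
  digitsOf : List Tree → List ℕ → List Tree × List ℕ
  digitsOf (t ∷ s ∷ us) (u ∷ []) = ask u (c ∸ 48) s t ∷ us , []
  digitsOf _ _ = ts , c ∸ 48 ∷ ps

-- A malformed string falls back to `excess 0`, which `check` rejects for sizes above five, so a
-- parsing error can only make `valid` fail.
parse : List String → Tree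
parse ls = fromMaybe (excess 0) (head (proj₁ (foldl reduce ([] , []) (concatMap (λ s → map Char.toℕ (toList s)) ls))))

record Certificate (d : ℕ) (vr : Bool) : Set where
  constructor certificate
  field
    ex : Fin 5 → Bool
    tree : List String
    {valid} : check (configOf d vr ex) (parse tree) (universal d d) [] ≡ true

open Certificate public

-- A neighbourhood of size d contains at most 10 - d vertices of X, hence at most 9 - d consecutive
-- pairs of roots in X. The exempt pairs range over the paths with 9 - d edges in the 5-cycle of
-- positions; if the last root is the universal vertex, which is outside X, only paths on the first
-- four positions occur.
certificates : (d : ℕ) (vr : Bool) → List (Certificate d vr)
certificates 6 false =
  certificate (tuple true true true false false) ("iaaC25D34D35A04" ∷ []) {refl} ∷
  certificate (tuple false true true true false) ("raaB15A01C25A04" ∷ []) {refl} ∷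
  certificate (tuple false false true true true) ("oaaA01D35E45A05" ∷ []) {refl} ∷
  certificate (tuple true false false true true) ("jaaD35A05C23E45" ∷ []) {refl} ∷
  certificate (tuple true true false false true) ("kaaE45A05B15D34" ∷ []) {refl} ∷
  []
certificates 6 true =
  certificate (tuple true true true false false) ("laaB15B14D35A04C25" ∷ []) {refl} ∷
  []
certificates 7 false =
  certificate (tuple true true false false false) ("abaubaE46A0604ebaD35E04E4534cbacaaxbaA06E461504D35C25D3423" ∷ []) {refl} ∷
  certificate (tuple false true true false false) ("acabcaA05B1501dbaecaobaC26D360125D35E4534acaA01E46E34A0604" ∷ []) {refl} ∷
  certificate (tuple false false true true false) ("adabdaB15C2512adaecajdaB16C263512E45A0504fdaB12A04A06B1601" ∷ []) {refl} ∷
  certificate (tuple false false false true true) ("aeabeaB15A0501feaB16B01C2612deadaadeaA06B164501C12C25D3523" ∷ []) {refl} ∷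
  certificate (tuple true false false false true) ("aaauaaD36E4634paaD36D34C2623feakaanaaD35E453406C26C23B1612" ∷ []) {refl} ∷
  []
certificates 7 true =
  certificate (tuple true true false false false) ("faabaahaaE4514C2425kbafaaF5616A06F2505baabbaB16C2624caaE24B16A0604B1415iaaiaaiaaF5616A0605laalaaB16A0604B14D3515D34C25C2423" ∷ []) {refl} ∷
  certificate (tuple false true true false false) ("acafcaB15A0501fcafcaF5625B15B0116cbadcaE4624cbakbaD35C2524A0601G16D3436kaanaaD34C2435iaahdaD36E4634C24A0501laaC24B01F35B1415C2526" ∷ []) {refl} ∷
  []
certificates 8 false =
  certificate (tuple true false false false false) 
    ("aaaacacaadcapaaD36C265725D3537paacaaC25D3536C262723afaacafaakbaafaG06G466716C2627kaacaaB15C2526B161704caalaaC26D3635dfadcaC27B1704kaaD36C26B" ∷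
    "163515C252312aiaufauiadfaE45D356736E4647aiadhaE45D3547pfapiaE4746C26D362723ajakjaadaC27C1226D3623aeauiaA06E4612adauiaA06E4612deaD35C25C1227" ∷
    "2307E4704daadfaefaefaA07E47050412ufaE04E46D3645D35D233734" ∷ []) {refl} ∷
  certificate (tuple false true false false false) 
    ("afaakaalaakaalafkaA06B165715A0507akabkaB15A0506B16170123dfaaiadjaufaE46D365737E4745ajaufaD36E4647D3735dfaekanfaC26D360125aoaaiaciaC252701E47" ∷
    "D3745D352334ukaafaakaakaB17A07162301akaukaakaA05E456747A07A0106akaafaakapjabkaB15A0536boaA05B1526172301ekaE45A01A0507E4746ukaukaA07E4706uoa" ∷
    "aoaA0706E47D3736ufauiaD37E4736wfavkaulaA07B1715A0525D36D3523A0601E463404" ∷ []) {refl} ∷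
  certificate (tuple false false true false false) 
    ("apaakabpaaqacqakpaB16C265727B1715kpapkaaraC27B1736araB17C274616C26253412bpabkabpafpaC26B16253412akaapacpaaqaC27251234bpaapaB16A0657B1217A07" ∷
    "05apaapaB17A0706B12B161501ekaekaepaenaD37E47123534upaukaukaxkaD35363412epaekaE3412akaE34E47A075646A0605akaakaE46A0607E34E4745apaakaukaekaE45" ∷
    "D3536E463412aoaapaB1234B16A0617elaakaB1517E34E45A0547A070104" ∷ []) {refl} ∷
  certificate (tuple false false false true false) 
    ("auaawakuakvabuaC25B156716C2627cuakuaC26B1625B151712apacuakuaruaaxaC27D375626D3635axaupapaaD36C2606kuaD36C264637C272504araawakvaD36C263704bxa" ∷
    "C25B15cuaC25B15D353717C271223aqaaqabpaB15C252712avaapaaqaA05E454723avacvaB15C2527cvacpamuaD36C2647B1535C27C25231204fpaaqabpaB15A056716fraB16" ∷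
    "fpaB16C262712A04A0607apaapaauaupaE46A06234504auaapaA0423B16A0605B15B121701" ∷ []) {refl} ∷
  certificate (tuple false false false false true) 
    ("auaaaauaaeaataaaeaD37E475635E4546adaeaaD35E4547D37363401caadaaduadeaE47D37014534paaraaacaC27D375626D34D3635acaawaadapdaD36E46470134kaaD34C26" ∷
    "D3637C272523avakuakvabuaB15C256716C2627abaavaecaavaB16A0635avaA06B16450734kaafuafuaA060734B16C262701buafuaB16C2625B15B0117cuamuaC26D3635caa" ∷
    "waahuanaaC26E4506B1646D3634quamaaD3405D36C263501awadwaD3537B17C27B0115C252312" ∷ []) {refl} ∷
  []
certificates 8 true =
  certificate (tuple true false false false false) 
    ("aaaafacaacfaagaB16C264714C242712baabaaaaabaaE4616aaabaaE4515A05064704abaabaaaafaaH5705B156706B1614abaabafcafbaH5705B156706caabaabaabbaG6747" ∷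
    "0406C24B1426B161217aaaaaaababaaabaG4614A045606baabaaafaF57B174504B141615faaabafcagaaC24B145616C2625baabcaB16C2624baabaaA06B1645bbaC26B16E45" ∷
    "2404B141512baabaaafabkaH4717C272412aaafaafaaF4556B1516abakbaB15C2526B1612A0614A040507apafpaaqabkaaqaG4614bpacaaA07B17E24E3414F45045615akaaqa" ∷
    "fpaahaA07B17G26G3615E454614A040506bpaapabkabkaaiaA07B17G36G2606E464515bpafpacaaB17A07E24E3415G5646A060504apafkafkadfaB17A07E24E3456A0604fka" ∷
    "adaB17A07G26G3606F564505B151416aqafmaalaalablaF4504B145615alaaqafraE45B154614A040506aiafhabhaB14A0405B1507akabkafkaG56A0604B1405B1536B1716C" ∷
    "2612dfadgadfaH6716dfadfaH5715A050607iaadbadbaH67A0706haaH07H571605cbacbaH07H6706B1615caacaahaaH57A0705B1506B14B161217dlaaiaaiafmaaiaH5715A05" ∷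
    "0407bnabcaH07B1204B1417D3616aiabdafdafdaH5705B1514C1217bmaahaH1714A0407D3606ahaH07D36H1747C2624D3437acapfaD35C2536acafcaH5705acabdaH4704B14" ∷
    "15kaalaaH4704kbapbaG6706B1614D35C253617bdaacaaiaH57B1715fdaaiaH17E4745ahaH47B17150514laakbapbaG4606kfaH47B171614D35C2536adaahaH57H1715daacba" ∷
    "cfaG67B1716A0615C24D3436A050407C12C262723" ∷ []) {refl} ∷
  certificate (tuple false true false false false) 
    ("caaafabkaacabcaE4616faalaaE4515C25264717acabcafaalaaE4515C254616C262724afaabaahakaafcaG5625B156716kaakfacfaC24H475715C252627kaaabacbahaaE45" ∷
    "46C2426B1625B151714baaafaababcaahaG674616C2627acakaaC25B1526B161724baabaabbaA06B164515faafkabkaE4717C2725bkalaaC25A0727B17E451524A0504abakba" ∷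
    "akaC27B1725B1526agaafaffaB15C252726A07B1706B161401caahaacbahaacaaA07B175616A0605cfacaaB16A0607B171501dfahaahkahaaF455725B1517cfahfaB15A0507B" ∷
    "1701iaahaanfaA07B170501dcaB01B16C2615C252714laalaarbalaaE4616A060401kaakaakbaA06B1607B1701kcarbaE4626B16B011514raarfarbarfabkaA04C27D376716A" ∷
    "0607raarbabdaA04C26D3667A0706B161701rkarfargaA06B160701rcaB16B01C2617C2714cdabdaE0401C26E14D364525D3534acafcabcafcaE4514A0405bcaahaB17A0704B" ∷
    "141501ahaaiaaiaA04B140701fdaB15B01C2517C2716kbakbapcapbaG6717A070601kaakaakaaA07B1704B1401kfaB01B17C271516D35C2536C262423" ∷ []) {refl} ∷
  certificate (tuple false false true false false) 
    ("paaapakpacaanaaF4524acakdaF5626D36345727adakdacaanaaF4524D345626D363735kaafdanaanaancaE464524D3436kpamaaD34C2437C272635maalaapcaC26B164524" ∷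
    "caacpampaF5727D3734lkaldaC26D3637C27F452435B141512adacaadcaakadkaE4737C274624apaarapcaG56D356727D373436daaapapkaraaF4557D3537C2734C2426aka" ∷
    "aiacfaD34C2436C2637acaaradbaC24D343736B16C2617C271225akakbapkacbadkaH4724raaacaD36C26H07H1724F45345725daadlanbafcaD36C26F15F0525E454724D3435" ∷
    "37paadaakqacqaH4757D3734nbakpaadaC26D36H07H1757D3734kpafcaD36C26F15F0537F57452435cbaraacpaaiaC26D36H17H0747D3735cpafdaC26D36F15F0537E474534C" ∷
    "242527kaanbafkakqampaH475727D3734flankanaaE4547D3437C272435aqadbaplarbaF4557D3534C2437C27C2625B1512acaqaakdaG5635akaanaG6737C2725laakdaG5635" ∷
    "C25B151226ahacaacdaE4634pfakdaG5635C2524B1226A07B1714paaakaqcaG56C2627pcaG26G563725kaaB15qcaG56C262512apabraG67G2627arabraG6727G2612D3735kba" ∷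
    "aqaplaiaadkaE4724D34B15A055737daaraaE4534A07B17C242725aqakqacaadcaC2624D34B17A0757haaC24A05B15D342527D3735B12G461436A0406fcaapaaraG6727caa" ∷
    "icaG4624D343736caafpahpacdaG36E464727hdaG46D363734fpafnaG36G6737C272426bpabdabraG6736laalpaF5735C252627bdalaaanaC27G6725analdaF56C2527G6735" ∷
    "26laaqcaG26F5625D353637A04B1405B15B121601" ∷ []) {refl} ∷
  []
certificates 9 false =
  certificate (tuple false false false false false) 
    ("aadfadaadbadafdbadaadabdabdaabdaaF45F3534akaapaI4834I28I3823677807B175818abdbadafdafdaabakbI38I2823uabpaaG2623G36G46346878B185717A07085605" ∷
    "aadabdaadafdafdabdaaaeaaF45F3534acbadaH4734H27H37235758A056808B186707B171516aadaadabdabdabdfadfadaaapaaG36G2623adbadaH2723H47H37345668B1657" ∷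
    "7807B1718aadafdafdfadfadaaacaaF35F2523paapaaG2623G36G46346756B167858B1817A070815afdaadbadbadfadfadaaacabF35F2523aeaadbH2723H37H47346867B1657" ∷
    "58B1517A0718A08050601aacakdfadfkdadcapbatcI7848cadhaddacdecF5745D355615acdfcdpacG46D366717C27253837abdfcdcadbcdH5725B156717badhadaldcbdH5778" ∷
    "B175615C2527476826cadbkdabdaldapcI38I487827B175825B151618aecpacudcapcupcdacepcI5835E456848eacxacaxcducI5878E485645D35386736eacedcaucaxctac" ∷
    "pucI6856D367838E485735E454647uacauckaeoacopbtaclaeF25F15565835E4516dacepctacacdatcI78E4717C27565835E452648fadradlaeoacpcdlcdF5717C2745D3556" ∷
    "25abdkbesacnucpucG6858E4845D356727B171516abdcaddacicdhadG5667B1645D3515C2517C27263846aucacdeackadatcdecH5778E4716xacupcG6856E462645D3517fad" ∷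
    "baddaccfemfdI6858B1845D3515C2516C262748D3836372834aabdabaubdubpabxabaebaxbudbafeI28I08I18677847D375636aebdebpebpubafdI08I28I186867D365737E47" ∷
    "465838uabxabaebdebupbatbbadF25F05F157868D385737E475636E464845uabadbapbpubaxbtabedbbaeF25F05F155756E45786838E4847apbatbpebtabepbfadG06G26G16" ∷
    "5856E456778E4748D383746adbaubudbupbepbedbabeH27H07H175758E456867E4648D3847D37363534afdaacbfdcfdajcacdC27B1747ahdC27B17375815C253428bkdafdbkd" ∷
    "afdfkdA06B16785717A0705aldafdA06B1607B1715fadkadkfdfadfadB15A05677817A0706pabpabkubsabopbI5835E4548pdboabE45D3547D37384634kfdafccfdC2534A06" ∷
    "05aacaacA07B1705badcbdA07B1705C253468B153616C262808fadaacadcdacaceC27B1745fbdC27B173547fpcdacacdC27B1745D3548D38373426fadfadA07B1705badC25" ∷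
    "bbdC25A07B170526B1506B1618230112aaeabeakeahebaebcefaelaekfeaacaucI3834I48I08685616C265725kaefcehaecfeaaceacF3534F45F055856C256726B16157828" ∷
    "kaefcecaebcefkebkeaabaebH3734H47H075868C285725B156726B161817kaeakekfebaecfekbecbeaaceacF3534F45F055767B175815C256828caelaebkekbealeaabeabF35" ∷
    "34F05F457867B1758C285625B151816baeafealecbehaefkeaebaebH3734H07H476856B165778B1718C2815C25262712eacaaceacaucaucuaceacaucadeacaH1712H27H3768" ∷
    "5646A067808uacuaceacuaccaacaeF1512F25F356858A086706E46485747uaceacaaceacaecaecadaacaH1712H37H277867E475848A085646A060705aucaecaucaacuacauc" ∷
    "uacaceaceH1712H27H375658A056706E467847aacaucaucaecaecapeakeI1812I28I386757E4758A056846A060708uacaecaecuacaecuaccaacaeF1512F35F256878A085657A" ∷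
    "0507E4706E464845aadaedaadaeduadeadA05E45687848A0807audeadA05E4508E484706uacpacuacyactacpecE47A075805E456848uacuactacA05E456747A070806ucdauc" ∷
    "upcudbD37E476848D3817acefcefceG6726aheaheaecedcudbG5645A0507cceB15C25477828B181617D3706xaceacdacyaceacdacA07E47586848A080506xacxecxucA08E48" ∷
    "07E4706caeiaedkeB18C2816C2615C255645D35273612aadaadaedA07E4705E4508aucatcaucA05E4507E4708axcaecaecE45A050708E47D373812E48463423aaaapadaadka" ∷
    "acadcakaapcapkaaadH17H47H07686726D365737paanaakdaanaaadF15F45F057867D375636C26275825paapkaadaanaraacdaaadF45F15F055756C257827D376826D363538" ∷
    "adapaacaadcanaaarakpaaacI18I48I086878D38565725D3536caacpaararaapcaaacH47H17H076756D367858D3835C252637paadaacpakpacdakdaaadG46G16G066757D3768" ∷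
    "58D3835C2536C26272823aadaedfadfadfadaadB18A08675606B1615afdfedB16A0618A080517abeabduadabdE48A086706E4623aadeadfadfadeadB18A08566706B1615daa" ∷
    "daadpadkaddadnaH7827D375838ddadcaH5737C27282523aadaadB16A0618E48A083505E451747aadfadaadA08B1816A0615baeaudA08E4823aaduadA08B1816E46A061545A" ∷
    "050734aacbucaucuacbucaecE47A076846A065808uacuacaecE47A075606E464845baebfebkegaegkebceB17C276826B165818abebcekaeB16C265717C272825apcaecatcpac" ∷
    "D36E467837E4748aucaucvpcA06E465808E4845pacafdadcD37E4718laeC25C262846vacuacuacA07E475606E4645D36382334aabeabyabtabaubpubaebD37E476838E485646" ∷
    "epbepbadbE47D375848D38363534fadfadjbdA07B175606facjacjkdB18C283534facfcdB17C2734ebcabdC2734B17A07560626B1623aacavcaucaucubcA06E46587808E4847" ∷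
    "abeafefbeB16C2628B1827akdajcufcD36E4637kadC26B160828B18E472334abeabdubdA06E4648A0823ubcubcuqcagdwbdA08C2528B1838E483634aecE34B16E4746A0627" ∷
    "acaacakcapcaH6726alaaraH7828D38363723abdE46A06B1634aacufcA06E4648afekaeC26B1628kadC26E48B162334A08B18275707B174515aacapcakdcadfudC26A0825pac" ∷
    "fudavdC27B172636A081528dacducbadF25B155845aecaxcedcaceH27B1757E457847D37351838aecdacatcepcakdI28I185878D3835E4537E474834faefudfedA07E4748A08" ∷
    "23aucfucfdccadhuddabE45D355615eacD35E452537E473834fecE34E47A0748A082646aabuabupbeabxubxabF565845D3538udbyabE45D3537E47483634aacuacubddacxac" ∷
    "upcE48D385645D35273634B17A0723aacaucA08E4847abecbealeC28B1825B1527akdbadB15C2528E47B182334B17A074616A0605120104" ∷ []) {refl} ∷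
  []
certificates 9 true =
  certificate (tuple false false false false false) 
    ("aaaacaaacacddaadcaapadkaakdpaaD35C25784737C274624paapcaapaC27D375625D35346828akaarakaapcacaaD34C245625D356727D373836kaaapakpaaadapcdaaD34C24" ∷
    "7838C285727daanaaaacD38C284524D343735caaaacapaD37C2738C2834C24252623faaakaaadakdiaadkafcaicaacdpaaC25D35E04E14684636C264724adaanahdacadpaaC" ∷
    "25D35I08I184846C246726D36347828fdaanahaadkafdciacqaaC25D35E04E144868C284724D346726D363837aaccaafdacdaadchpaapcpbaD35C25G16G067847D37684626D" ∷
    "3634acafraapcdcadacpaaC25D35G06G164846D347867D3736C262438caafcaacdcadfrahpakbaD35C25G06G164767D374868D3836C2634C24282723aaapaaacbkdbdaanaaF" ∷
    "4524akakpaF5727D37345626akakpbcabnaaF4524D345727D373635akbcabadbcdaanbpkbrabF4557D35674626D3634acbpcbpkbF5756D3536C262437adbcabcpbarapcarabF" ∷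
    "4556D356747D3734C2436C26272523faafcaiaaicafkafrakaakbdD3835C25G06G166727ikakaapacC2825E04E14D3547bacaacfadG5616A0604aacabdB16A0607B1714C28D" ∷
    "3827374624fkafrahpakaapfaH7807laalaaA0704B1417C25D3524laapacC2825kbapacC2825kbafcdD38E4525G6806B1614kfapfcC2825H17A0704D35476727D373436fpa" ∷
    "iaaikafnakaapaapbaE4606B1614paapbaB1617A0704C25D3536paakfdD3835C25H17H07674724fnahdaaadabcA0406afdaacA04B1407B1716D38C2824kaapacC2825G16G06D" ∷
    "354667D363437iaahdahpaqaaqaaE4804kaapbaG6806B1614D35C2537afcadcpfcD356838fadfdcqacD35E04B146838H5717bacbdcpacD356838E14A0407C284746hpapaalaa" ∷
    "qaaE4604B1416kfakaaA04B1417A0706D35C2547D373634C24272623abaabccaacbdI4834akaaldI7837C272428paaapapkaF5737dbarbaF4534C242725dbaalaaqcI78C2827" ∷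
    "D3724D34353823abaaqapbaplaF5725dbadlanbaF25F454724D343537dbakbarbaF4525cqakqaF25F5747D373534kbanbakqaF57D3734F4535C25242723aaapaaafcI28I3835" ∷
    "daaaacI28I3834aacI38C28242523abaabdI38I2823faafdaG36G2623aaaacaG36G2623A04B14576717A076806aaabkalaapkaF5725aacakdI7828D383537laabadadaldaF56" ∷
    "26D3638adaaralpaF5767D3736C262835badacaqcaF56D3536C2638C28252723baabcaqaaldaF5635bkabnaqkaF57F356737C272526laabpaqcaC26F5627qkaqcaC26F5627F" ∷
    "573725bkalpaF57F2527D37353623afaadacfadhaE4624afdI28D383436paaaadI28I3835aadI38C28252623B17A074804B14165818aaaakakaapkaadapcaF5636aadpacF58" ∷
    "38C28265725acabnaaadakdladC25I587828D386726D363537badpaapacacaqcaF5636C265825adaadcapcD37I786826D363538bdakaaladbcdI6858D3835C2536C26282723" ∷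
    "faafcafacfdcfkafpcI7827fnacfadbaB1617D34C24A0727pfaraaC2425kbaraaC2425B16A0617D35A0767376838fkafnafkdcaahaaH5717C24D34A0738daaciaraaD354634C" ∷
    "24H17A07786737C272826facfpafkdfcdcaadabB1816C24D34A0626I687837fcdfradaadbaB1617C24D34A0737dfacfdI4834haahadI4834H5717C24A076768C262728fpafpc" ∷
    "fradbacfaB1716C24D34A0626kaaraaC2425D35H17A076778frapfapaaA06B1617C25D35A0767C262827D37383623abaalapaakpaF5735aacaqccbacpaE4734C247838C2825" ∷
    "27cbakbaaadkadF5828D3835aaddbcE4838C282524abcpaacadE48C2425D3528D38343723faafpaiaahpaE4734fadfpciacE34E487838C282427fadhaafkdikaE4778C2724" ∷
    "hadE24E483428iaaiacikaE47C2728E4824D34383723afaafcpaaF25F3538acakaaF35F2536pfaF35C25262823B17A075616A064514A040805aaaqaabdapcabpaarabadpacF" ∷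
    "5838C286727aacbcdakdpkaF5778C276828D38375636badqacbkaqkaF5737C275838C282625bdabadbdcakabpckdakpaF5756C257827D376838apabnaakdkdakadF5856C2578" ∷
    "D386737C272826bacbkabcdarakadkpaF5758C256768C2627D3728D38363523abaapakaakpaaackbdF5828dbanaaF4524D34385735dbacpaaacaqcrbaD35E457838C284734C" ∷
    "242527caakaanaaabckadF5828D384535aacdbcpbcpkaC27F5758D354838C282524kaaaadplaaldcbdraaE4548C247857C2728D3825D35343723aaacaaahadhaaacahdG6828" ∷
    "kfapcaG5625D35384636aaddackfanaaE4535C254838C282624pfaafdpfcadaadccdaG46C246826D365838adapcaacdG68D385636C262825aacaiakiakadF5856C2526D3628D" ∷
    "38353423abacbaabdcbdpbakbdbcaldaF5626D36E475835rbabkaC27D37A0535E45254828pbarbapbcbcaE47C26D3628F584525D353834kbaabckbdnbabpaD37C27A0534F45" ∷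
    "5828nbadbcbcaC26D36A0828E4845D343835abcpbcdbcbcaqcaF5636C26E4748bdaC26D36E473458dbcbdaE47D36C2648D343538C28252423baalaabadladbcabcdG6836ldaG" ∷
    "36F56265828bcaldaG5626D363835badbdabdcG6826qacqcaG26F5658D353638bdaqcabcdD38G6835G5636C26282523aaaakbH27H3723A08B18476717A0706afadfaaacdfc" ∷
    "paapacacaphaF5636C265825adaadckiaC25G566826D36354838aiadcakaanaaE4535C254636C262824paaacaafcadcpfcraaC24F45586838C2826aacpcaacdG6856C2628D38" ∷
    "3625afcacaciacfdE4846C2426D3628D38353423aabkabcabnabapbdkaE4737acbdcbE4636C26274524adakdaakbkpaF5727D375626D363435adbdaadcaakadkbE4737C2746" ∷
    "24apaarapcaD35G566727D373436akbdabpkarabF4557D3534C2437C27262523B18A0807B171604aaadabacacdakaaraaE4525apbcpaE4727D37354626paaraaapbcpbE4727D" ∷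
    "374525D353634kaaapakpbacaaranaaD34F456736C265727adakdaananabD34F4567C275626D363735adbapbpkapcbF5657D3537C2736C26252423afacfapaaraaadacdaE46" ∷
    "26aaccadE4828D38364525afccadacaciaE4626D364828D383534paaafdadaaickianfaF45D34566826D3638aiakfdacdI6858D3836C262835afcahadacdcaE4648D3436C26" ∷
    "38C28252423abaaaddaadbcaladlaE4737paanaaE4535C25274824kbapbcapaapcI7827D375825D353438akapaacaanbadlaE474524D3435daaraaplaF5745D3534C242537" ∷
    "kaacaacpakpaH5747D3734C2435C25272823B16A0607B1708B18141501kaakaakcakdafpafnafacD38C286737C275626fpakpakadD38C285727D37363523afapfaakaamakia" ∷
    "anaafcD38C28675626D36373523kfabaacfaabakbacbaaacB18C28465626B164714aacafcacaC26B167818C282457kfamaamfapbaC26B164714C2457caanfacfadacC28B1847" ∷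
    "5714acabcaB1416C26D3634C24352327aackabbaalaaacaC26B164524B145828kabaacdacnacdacaccC26D36484524D343835kabmabkkbD37C2734C2435laacaaccaC26D3634" ∷
    "35B14C24582823B181715acaaacafaahaafcbaaB14C24786727B1718afabaaB14C2417C272816akaaabbaaC24B1418C2817C2726caacbadkaB17C2716C2614cdaacaacbB18C" ∷
    "281614acdaacbadB141816C28D3836C2634C242325ababbacbafbahbaabcB18C284525B154614aacabcfbaB15C256818C282426dbaalacqapbakqaabdD38C285735C254727" ∷
    "abccbdpbaC25D354828D383734caabparaaC25D3537C2734cbacbdcqaD37C2738C2834cacaacaqcC27D373834B18C28461426abdkbaalaC27D3735C2538C28C262423agaaha" ∷
    "dgaabdccdahdphaD35C25684828D3834pgaagdC28D3835C25243623afaaacafcagckaaB15C25687818C2827kfaafcdfaC24D3438C2835C25C272326akaaababaC262827acb" ∷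
    "arackbdhadlakbaC25D35474624D3437pbadcaC24D3435C252736akbpfbcfbD34C2435C2537C272623agaahakhaphacgargaalaC27G68D374534C245625dhadhangaalaG68C" ∷
    "27D3745C254624D34353623abapbaalacganbadlaH474524D3437cbacqaH47D3734C242735aqadbarbaplaH5745D3534C2437C272523fcaacaicadcaG4624amaaraG6727D37" ∷
    "343623B15A056878alaalapladlaC24D3435C253723afadfapfakiaG56D3635C2534C2423akaakahkaffdC28D3834C243723B15A057868faaC25C23A05B15272618A0807baa" ∷
    "laabcaldabkabnaG6737C275626badladbpaC27D375828D383635acabadbmaD37C2738C2836C262523bcaacabcdbmaC27D3738C283623gaaC23C25B152624cabcaabdacpbcqb" ∷
    "crbH674727D3736cpalaaD35C2537C27263423aabpabakbacaC26D3637C2735C2523acaC23C262824A08B1804B141706faafdafaciaaiacicafkaD37C27464824D3438iaafpa" ∷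
    "D37C2734C242836faciaafpaC27D3734C2438C282623kaakfamaakfdhadkadfhaD36C26584828D3834fhaffdD38C2836C26243523kabkaakcaiaancbnaafkbC27D37454624D" ∷
    "3436fpbcfaD34C2437C27263523A08B1807B1705baabaabaaB18A080405babfacaabA080504B18C2824caabachdaC26D3638C2834caaccbckaD37C2736C2634caabfdbiaC26D" ∷
    "3638C2834A07B1708B1805C2423B1425B15160112" ∷ []) {refl} ∷
  []
certificates _ _ = []

InjectiveBelow : ∀ {n} → ℕ → (ℕ → Fin n) → Set
InjectiveBelow k f = ∀ i j → i < k → j < k → f i ≡ f j → i ≡ j

override : ∀ {n} → (ℕ → Fin n) → ℕ → Fin n → ℕ → Fin n
override f k v i = if i ≡ᵇ k then v else f i

override-at : ∀ {n} (f : ℕ → Fin n) k v → override f k v k ≡ v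
override-at f k v rewrite ≡ᵇ-complete {k} refl = refl

override-below : ∀ {n} (f : ℕ → Fin n) k v i → i < k → override f k v i ≡ f i
override-below f k v i lt with i ≡ᵇ k in e
... | false = refl
... | true = ⊥-elim (<⇒≢ lt (≡ᵇ-sound {i} {k} e))

override-inj : ∀ {n} (f : ℕ → Fin n) k v → InjectiveBelow k f → (∀ i → i < k → f i ≢ v) → InjectiveBelow (suc k) (override f k v)
override-inj f k v inj new i j li lj e with i ≡ᵇ k in ei | j ≡ᵇ k in ej
... | true | true = trans (≡ᵇ-sound {i} ei) (sym (≡ᵇ-sound {j} ej))
... | true | false = ⊥-elim (new j (≤∧≢⇒< (≤-pred lj) λ { refl → false≢true ej (≡ᵇ-complete {k} refl) }) (sym e))
... | false | true = ⊥-elim (new i (≤∧≢⇒< (≤-pred li) λ { refl → false≢true ei (≡ᵇ-complete {k} refl) }) e)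
... | false | false = inj i j (≤∧≢⇒< (≤-pred li) λ { refl → false≢true ei (≡ᵇ-complete {k} refl) }) (≤∧≢⇒< (≤-pred lj) λ { refl → false≢true ej (≡ᵇ-complete {k} refl) }) e

-- Continues a numbering whose first k values are prescribed. It is a function on ℕ because the
-- decision trees name vertices by numbers.
complete : ∀ {n} (P : VertexSet n) t k (f : ℕ → Fin n) → t + k ≡ card P → InjectiveBelow k f → (∀ i → i < k → P (f i) ≡ true) →
  ∃ λ (g : ℕ → Fin n) → InjectiveBelow (card P) g × (∀ i → i < card P → P (g i) ≡ true) × (∀ i → i < k → g i ≡ f i)
complete P zero k f refl inj mem = f , inj , mem , λ _ _ → refl
complete {n} P (suc t) k f eq inj mem with prolong P k (λ i → f (toℕ i)) (λ i j e → toℕ-injective (inj _ _ (toℕ<n i) (toℕ<n j) e)) (λ i → mem _ (toℕ<n i)) (subst (k <_) eq (s≤s (m≤n+m k t)))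
... | v , pv , new with complete P t (suc k) (override f k v) (trans (+-suc t k) eq) (override-inj f k v inj (λ i lt e → new (F.fromℕ< lt) (trans (cong f (toℕ-from lt)) e))) mem′
  where
  toℕ-from : ∀ {i} (lt : i < k) → toℕ (F.fromℕ< lt) ≡ i
  toℕ-from lt = toℕ-fromℕ< lt
  mem′ : ∀ i → i < suc k → P (override f k v i) ≡ true
  mem′ i lt with i ≡ᵇ k in e
  ... | true = pv
  ... | false = mem i (≤∧≢⇒< (≤-pred lt) λ { refl → false≢true e (≡ᵇ-complete {k} refl) })
...   | g , ginj , gmem , agree = g , ginj , gmem , λ i lt → trans (agree i (m≤n⇒m≤1+n lt)) (override-below f k v i lt)

distinct⇒≤card : ∀ {n} d (f : ℕ → Fin n) → InjectiveBelow d f → ∀ ws → distinctᵇ ws ≡ true → allᵇ (_<ᵇ d) ws ≡ true →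
  ∀ (P : VertexSet n) → allᵇ (λ w → P (f w)) ws ≡ true → length ws ≤ card P
distinct⇒≤card d f inj [] _ _ P _ = z≤n
distinct⇒≤card d f inj (w ∷ ws) dis lt P mem = ≤-trans (s≤s (distinct⇒≤card d f inj ws (∧-right {not (elemᵇ w ws)} dis) (∧-right {w <ᵇ d} lt) (delete (f w) P)
    (rest ws (∧-left dis) (∧-right {w <ᵇ d} lt) (∧-right {P (f w)} mem)))) (≤-reflexive (sym (card-delete P (f w) (∧-left mem))))
  where
  below : ∀ {a} → (a <ᵇ d) ≡ true → a < d
  below {a} h = <ᵇ⇒< a d (≡⇒T h)
  rest : ∀ us → not (elemᵇ w us) ≡ true → allᵇ (_<ᵇ d) us ≡ true → allᵇ (λ u → P (f u)) us ≡ true → allᵇ (λ u → delete (f w) P (f u)) us ≡ true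
  rest [] _ _ _ = refl
  rest (u ∷ us) ne l m = ∧-intro (∧-intro (∧-left m) (≢⇒≟ᵇ (f u) (f w) λ e →
      absurdB (≡ᵇ-complete (sym (inj u w (below (∧-left l)) (below (∧-left lt)) e))) (taut 2 (λ a b → not (a ∨ b) ⊃ [ not a ]) (w ≡ᵇ u) (elemᵇ w us) ne)))
    (rest us (taut 2 (λ a b → not (a ∨ b) ⊃ [ not b ]) (w ≡ᵇ u) (elemᵇ w us) ne) (∧-right {u <ᵇ d} l) (∧-right {P (f u)} m))

exempts : (Fin 5 → Bool) → (Fin 5 → Bool) → Bool
exempts ex x = allF λ p → (x p ∧ x (sh p)) ⇒ ex p

anyᵇ : ∀ {A : Set} → (A → Bool) → List A → Bool
anyᵇ p [] = false
anyᵇ p (x ∷ xs) = p x ∨ anyᵇ p xs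

anyᵇ-sound : ∀ {A : Set} (p : A → Bool) xs → anyᵇ p xs ≡ true → ∃ λ x → p x ≡ true
anyᵇ-sound p (x ∷ xs) h with ∨-elim {p x} h
... | inj₁ e = x , e
... | inj₂ e = anyᵇ-sound p xs e

exempts-cong : ∀ ex {x y : Fin 5 → Bool} → (∀ p → x p ≡ y p) → exempts ex x ≡ exempts ex y
exempts-cong ex {x} {y} e rewrite e 0F | e 1F | e 2F | e 3F | e 4F = refl

certificate-for : ∀ d → 6 ≤ d → d ≤ 9 → ∀ vr (x : Fin 5 → Bool) → d + ∑ (λ p → ⟦ x p ⟧) ≤ 10 → (vr ⇒ not (x 4F)) ≡ true →
  ∃ λ (C : Certificate d vr) → exempts (ex C) x ≡ true
certificate-for d lo hi vr x few nv = anyᵇ-sound _ (certificates d vr) (select d lo hi vr few nv)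
  where
  pattern-of : Fin 5 → Bool
  pattern-of = tuple (x 0F) (x 1F) (x 2F) (x 3F) (x 4F)
  move : ∀ d vr → anyᵇ (λ C → exempts (ex C) pattern-of) (certificates d vr) ≡ true → anyᵇ (λ C → exempts (ex C) x) (certificates d vr) ≡ true
  move d vr h = go (certificates d vr) h
    where
    go : ∀ Cs → anyᵇ (λ C → exempts (ex {d} {vr} C) pattern-of) Cs ≡ true → anyᵇ (λ C → exempts (ex C) x) Cs ≡ true
    go (C ∷ Cs) h with ∨-elim {exempts (ex C) pattern-of} h
    ... | inj₁ e rewrite trans (exempts-cong (ex C) (λ p → sym (tuple-η x p))) e = refl
    ... | inj₂ e = taut 2 (λ a b → b ⊃ [ a ∨ b ]) (exempts (ex C) x) _ (go Cs e)
  bound : ∀ {a b} → a ≤ b → (a ≤ᵇ b) ≡ true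
  bound le = T⇒≡ (≤⇒≤ᵇ le)
  select : ∀ d → 6 ≤ d → d ≤ 9 → ∀ vr → d + ∑ (λ p → ⟦ x p ⟧) ≤ 10 → (vr ⇒ not (x 4F)) ≡ true → anyᵇ (λ C → exempts (ex C) x) (certificates d vr) ≡ true
  select 6 _ _ vr few nv = move 6 vr (taut 6 (λ vr a b c d e → (6 + ∑ (λ p → ⟦ tuple a b c d e p ⟧) ≤ᵇ 10) ⊃ (vr ⇒ not e) ⊃ [ anyᵇ (λ C → exempts (ex C) (tuple a b c d e)) (certificates 6 vr) ]) vr (x 0F) (x 1F) (x 2F) (x 3F) (x 4F) (bound few) nv)
  select 7 _ _ vr few nv = move 7 vr (taut 6 (λ vr a b c d e → (7 + ∑ (λ p → ⟦ tuple a b c d e p ⟧) ≤ᵇ 10) ⊃ (vr ⇒ not e) ⊃ [ anyᵇ (λ C → exempts (ex C) (tuple a b c d e)) (certificates 7 vr) ]) vr (x 0F) (x 1F) (x 2F) (x 3F) (x 4F) (bound few) nv)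
  select 8 _ _ vr few nv = move 8 vr (taut 6 (λ vr a b c d e → (8 + ∑ (λ p → ⟦ tuple a b c d e p ⟧) ≤ᵇ 10) ⊃ (vr ⇒ not e) ⊃ [ anyᵇ (λ C → exempts (ex C) (tuple a b c d e)) (certificates 8 vr) ]) vr (x 0F) (x 1F) (x 2F) (x 3F) (x 4F) (bound few) nv)
  select 9 _ _ vr few nv = move 9 vr (taut 6 (λ vr a b c d e → (9 + ∑ (λ p → ⟦ tuple a b c d e p ⟧) ≤ᵇ 10) ⊃ (vr ⇒ not e) ⊃ [ anyᵇ (λ C → exempts (ex C) (tuple a b c d e)) (certificates 9 vr) ]) vr (x 0F) (x 1F) (x 2F) (x 3F) (x 4F) (bound few) nv)
  select 1 (s≤s ()) _ vr few nv
  select 2 (s≤s (s≤s ())) _ vr few nv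
  select 3 (s≤s (s≤s (s≤s ()))) _ vr few nv
  select 4 (s≤s (s≤s (s≤s (s≤s ())))) _ vr few nv
  select (suc (suc (suc (suc (suc zero))))) (s≤s (s≤s (s≤s (s≤s (s≤s ()))))) _ vr few nv
  select (suc (suc (suc (suc (suc (suc (suc (suc (suc (suc _)))))))))) _ (s≤s (s≤s (s≤s (s≤s (s≤s (s≤s (s≤s (s≤s (s≤s ()))))))))) vr few nv

-- The sum bounded in `fewRoots` is the contribution of v to `D`, where edges to X weigh double; its
-- average over S is about ten. The bound in `degree` is what remains when no edge from v to a
-- neighbour can be contracted.
record Dense {n} (G : Graph′ n) (v : Fin n) (N X : VertexSet n) : Set where
  field
    six≤ : 6 ≤ card N
    ≤nine : card N ≤ 9
    fewRoots : card N + card (N ∩ˢ X) ≤ 10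
    nbrs : ∀ w → (N w ⇒ E G v w) ≡ true
    degree : ∀ u → N u ≡ true → 5 ≤ card (λ w → N w ∧ virtual G X u w)

open Dense public

module _ {n} (G : Graph′ n) (v : Fin n) (N X : VertexSet n) (dn : Dense G v N X) (Xv : X v ≡ false)
  (y : Fin 5 → Fin n) (y-inj : Injective y) (X⊆y : ∀ w → (N w ∧ X w ⇒ image y w) ≡ true) where

  private
    d = card N
    vN : N v ≡ false
    vN = not⁻ (notB (λ h → false≢true (irrE G v) (⇒-elim _ _ (nbrs dn v) h)))
    below : ∀ {a b} → (a <ᵇ b) ≡ true → a < b
    below {a} {b} h = <ᵇ⇒< a b (≡⇒T h)
    above : ∀ {a b} → a < b → (a <ᵇ b) ≡ true
    above h = T⇒≡ (<⇒<ᵇ h)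

  -- Carries a certificate over to G: f numbers the neighbourhood with the roots in it first, and v
  -- receives the number d of the universal vertex. The helpers avoid X because all vertices of X in
  -- N are roots.
  rootedCycle-from : ∀ vr (f : ℕ → Fin n) → InjectiveBelow d f → (∀ i → i < d → N (f i) ≡ true) → (vr ⇒ not (X (y 4F))) ≡ true →
    (∀ p → override f d v (rootOf (configOf d vr (λ _ → false)) p) ≡ y p) → (∀ p → N (y p) ∨ (y p ≟ᵇ v) ≡ true) →
    (pos : Fin n → Fin 5) → (∀ p → pos (y p) ≡ p) → Model (E G) (insert v N) (image y) pos
  rootedCycle-from vr f f-inj f-mem v4 f-y y-mem pos pos-y with certificate-for d (six≤ dn) (≤nine dn) vr (λ p → X (y p)) few′ v4
    where
    count : ∑ (λ p → ⟦ X (y p) ⟧) ≤ card (N ∩ˢ X)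
    count = begin
      ∑ (λ p → ⟦ X (y p) ⟧) ≤⟨ ∑-mono (λ p → term p) ⟩
      ∑ (λ p → ∑ (λ w → ⟦ (w ≟ᵇ y p) ∧ (N ∩ˢ X) w ⟧)) ≡⟨ ∑-comm (λ p w → ⟦ (w ≟ᵇ y p) ∧ (N ∩ˢ X) w ⟧) ⟩
      ∑ (λ w → ∑ (λ p → ⟦ (w ≟ᵇ y p) ∧ (N ∩ˢ X) w ⟧)) ≤⟨ ∑-mono (λ w → col w) ⟩
      card (N ∩ˢ X) ∎
      where
      open ≤-Reasoning
      term : ∀ p → ⟦ X (y p) ⟧ ≤ ∑ (λ w → ⟦ (w ≟ᵇ y p) ∧ (N ∩ˢ X) w ⟧)
      term p = ≤-trans (⟦⟧-mono {X (y p)} {(y p ≟ᵇ y p) ∧ (N ∩ˢ X) (y p)} (λ h → ∧-intro (≟ᵇ-refl (y p)) (∧-intro (inN h (∨-elim {N (y p)} (y-mem p))) h)))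
                (term≤∑ (λ w → ⟦ (w ≟ᵇ y p) ∧ (N ∩ˢ X) w ⟧) (y p))
        where
        inN : X (y p) ≡ true → N (y p) ≡ true ⊎ (y p ≟ᵇ v) ≡ true → N (y p) ≡ true
        inN h (inj₁ a) = a
        inN h (inj₂ a) = false≢true Xv (subst (λ w → X w ≡ true) (≟ᵇ⇒≡ (y p) v a) h)
      col : ∀ w → ∑ (λ p → ⟦ (w ≟ᵇ y p) ∧ (N ∩ˢ X) w ⟧) ≤ ⟦ (N ∩ˢ X) w ⟧
      col w with (N ∩ˢ X) w
      ... | false = ≤-reflexive (∑-zero {f = λ (p : Fin 5) → ⟦ (w ≟ᵇ y p) ∧ false ⟧} (λ p → cong ⟦_⟧ (taut′ (w ≟ᵇ y p))))
        where
        taut′ : ∀ b → b ∧ false ≡ false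
        taut′ true = refl
        taut′ false = refl
      ... | true with any? (λ p → y p F.≟ w)
      ...   | no none = ≤-trans (≤-reflexive (∑-zero {f = λ p → ⟦ (w ≟ᵇ y p) ∧ true ⟧} (λ p → cong ⟦_⟧ (not⁻ (notB (λ h → none (p , sym (≟ᵇ⇒≡ w (y p) (∧-left h)))))))))  z≤n
      ...   | yes (q , refl) = ≤-trans (∑-mono {f = λ p → ⟦ (y q ≟ᵇ y p) ∧ true ⟧} {λ p → ⟦ p ≟ᵇ q ⟧} (λ p → ⟦⟧-mono (λ h → ≡⇒≟ᵇ (y-inj p q (sym (≟ᵇ⇒≡ (y q) (y p) (∧-left h))))))) (≤-reflexive (∑-one q))
    few′ : d + ∑ (λ p → ⟦ X (y p) ⟧) ≤ 10
    few′ = ≤-trans (+-monoʳ-≤ d count) (fewRoots dn)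
  ... | C , exm = helperModel G y h (λ i → i) hl pos y-inj h-inj y≢h
                    (λ p → taut 2 (λ a b → (a ∨ b) ⊃ [ b ∨ a ]) (N (y p)) (y p ≟ᵇ v) (y-mem p)) h-mem pos-y
                    (λ i j ne e → ⊥-elim (ne e)) (λ i j r → subst (Join G y h (λ i → i) hl i) (succ⇒sh i j r) (joined i))
    where
    K = configOf d vr (ex C)
    g : ℕ → Fin n
    g = override f d v
    g-below : ∀ i → i < d → g i ≡ f i
    g-below = override-below f d v
    g-inj : InjectiveBelow (suc d) g
    g-inj = override-inj f d v f-inj (λ i lt e → false≢true vN (subst (λ w → N w ≡ true) e (f-mem i lt)))
    A : ℕ → ℕ → Bool
    A i j = E G (g i) (g j)
    A-sym : ∀ i j → A i j ≡ A j i
    A-sym i j = bool-ext (adjacent-sym G _ _) (adjacent-sym G _ _)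
    h : Fin (d ∸ 4) → Fin n
    h t = g (helperOf K t)
    -- If v is the last root, the helpers are 4 to d - 1; otherwise they are 5 to d, with v among
    -- them. Both ranges have d - 4 members.
    hp-bound : ∀ t → helperOf K t < suc d
    hp-bound t = lem vr
      where
      four : 4 ≤ d
      four = ≤-trans (s≤s (s≤s (s≤s (s≤s z≤n)))) (six≤ dn)
      lem : ∀ vr → (if vr then 4 else 5) + toℕ t < suc d
      lem true = m≤n⇒m≤1+n (≤-trans (+-monoʳ-< 4 (toℕ<n t)) (≤-reflexive (m+[n∸m]≡n four)))
      lem false = s≤s (≤-trans (+-monoʳ-< 4 (toℕ<n t)) (≤-reflexive (m+[n∸m]≡n four)))
    h-inj : Injective h
    h-inj s t e = toℕ-injective (+-cancelˡ-≡ (if vr then 4 else 5) _ _ (g-inj _ _ (hp-bound s) (hp-bound t) e))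
    rt-bound : ∀ p → rootOf K p < suc d
    rt-bound p = lem vr p
      where
      six = six≤ dn
      lem : ∀ vr p → tuple 0 1 2 3 (if vr then d else 4) p < suc d
      lem vr 0F = s≤s z≤n
      lem vr 1F = s≤s (≤-trans (s≤s z≤n) six)
      lem vr 2F = s≤s (≤-trans (s≤s (s≤s z≤n)) six)
      lem vr 3F = s≤s (≤-trans (s≤s (s≤s (s≤s z≤n))) six)
      lem true 4F = ≤-refl
      lem false 4F = s≤s (≤-trans (s≤s (s≤s (s≤s (s≤s z≤n)))) six)
    rt≢hp : ∀ p t → rootOf K p ≢ helperOf K t
    rt≢hp p t = lem vr p t
      where
      lem : ∀ vr p (t : Fin (d ∸ 4)) → tuple 0 1 2 3 (if vr then d else 4) p ≢ (if vr then 4 else 5) + toℕ t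
      lem true 4F t e = <⇒≢ (≤-trans (+-monoʳ-< 4 (toℕ<n t)) (≤-reflexive (m+[n∸m]≡n (≤-trans (s≤s (s≤s (s≤s (s≤s z≤n)))) (six≤ dn))))) (sym e)
      lem true 0F t ()
      lem true 1F t ()
      lem true 2F t ()
      lem true 3F t ()
      lem false 0F t ()
      lem false 1F t ()
      lem false 2F t ()
      lem false 3F t ()
      lem false 4F t ()
    y≢h : ∀ p t → y p ≢ h t
    y≢h p t e = rt≢hp p t (g-inj _ _ (rt-bound p) (hp-bound t) (trans (f-y p) e))
    g-mem : ∀ i → i < suc d → insert v N (g i) ≡ true
    g-mem i lt with i ≡ᵇ d in e
    ... | true rewrite ≟ᵇ-refl v = refl
    ... | false = taut 2 (λ a b → b ⊃ [ a ∨ b ]) (f i ≟ᵇ v) (N (f i)) (f-mem i (≤∧≢⇒< (≤-pred lt) λ { refl → false≢true e (≡ᵇ-complete {d} refl) }))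
    h-mem : ∀ t → insert v N (h t) ≡ true
    h-mem t = g-mem _ (hp-bound t)
    nonroot⇒¬X : ∀ u → u < d → nonRoot vr u ≡ true → X (g u) ≡ true → ⊥
    nonroot⇒¬X u lt nr hx with image-elim y (g u) (⇒-elim _ _ (X⊆y (g u)) (∧-intro (subst (λ w → N w ≡ true) (sym (g-below u lt)) (f-mem u lt)) hx))
    ... | p , e = lem vr p nr (g-inj _ _ (rt-bound p) (m≤n⇒m≤1+n lt) (trans (f-y p) e))
      where
      lem : ∀ vr p → nonRoot vr u ≡ true → tuple 0 1 2 3 (if vr then d else 4) p ≡ u → ⊥
      lem true 0F () refl
      lem true 1F () refl
      lem true 2F () refl
      lem true 3F () refl
      lem true 4F nr e = <⇒≢ lt (sym e)
      lem false 0F () refl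
      lem false 1F () refl
      lem false 2F () refl
      lem false 3F () refl
      lem false 4F () refl
    rt-small : ∀ p → nonRoot vr (toℕ p) ≡ false → rootOf K p ≡ toℕ p
    rt-small p = lem vr p
      where
      lem : ∀ vr p → nonRoot vr (toℕ p) ≡ false → tuple 0 1 2 3 (if vr then d else 4) p ≡ toℕ p
      lem vr 0F _ = refl
      lem vr 1F _ = refl
      lem vr 2F _ = refl
      lem vr 3F _ = refl
      lem false 4F _ = refl
    X-at : ∀ p u → nonRoot vr u ≡ false → (toℕ p ≡ᵇ u) ≡ true → X (g u) ≡ true → X (y p) ≡ true
    X-at p u nr e hx with ≡ᵇ-sound {toℕ p} {u} e
    ... | refl = subst (λ w → X w ≡ true) (trans (cong g (sym (rt-small p nr))) (f-y p)) hx
    notBoth : ∀ u w → u < d → w < d → countableᵇ vr (ex C) u w ≡ true → X (g u) ≡ true → X (g w) ≡ true → ⊥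
    notBoth u w lu lw c hu hw with nonRoot vr u in nu | nonRoot vr w in nw
    ... | true | _ = nonroot⇒¬X u lu nu hu
    ... | false | true = nonroot⇒¬X w lw nw hw
    ... | false | false with anyF-sound (λ p → not (ex C p) ∧ (((toℕ p ≡ᵇ u) ∧ (toℕ (sh p) ≡ᵇ w)) ∨ ((toℕ p ≡ᵇ w) ∧ (toℕ (sh p) ≡ᵇ u)))) c
    ...   | p , e = absurdB (⇒-elim _ _ (allF-sound (λ p → (X (y p) ∧ X (y (sh p))) ⇒ ex C p) exm p) (two (∨-elim {(toℕ p ≡ᵇ u) ∧ (toℕ (sh p) ≡ᵇ w)} (∧-right {not (ex C p)} e)))) (∧-left e)
      where
      two : ((toℕ p ≡ᵇ u) ∧ (toℕ (sh p) ≡ᵇ w)) ≡ true ⊎ ((toℕ p ≡ᵇ w) ∧ (toℕ (sh p) ≡ᵇ u)) ≡ true → (X (y p) ∧ X (y (sh p))) ≡ true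
      two (inj₁ k) = ∧-intro (X-at p u nu (∧-left k) hu) (X-at (sh p) w nw (∧-right {toℕ p ≡ᵇ u} k) hw)
      two (inj₂ k) = ∧-intro (X-at p w nw (∧-left k) hw) (X-at (sh p) u nu (∧-right {toℕ p ≡ᵇ w} k) hu)
    -- The listed non-neighbours are not virtual neighbours either, because a countable pair is not
    -- contained in X. They are disjoint from the five virtual neighbours of x within the d - 1
    -- vertices of N other than x.
    budget : ∀ u → (u <ᵇ d) ≡ true → ∀ ws → distinctᵇ ws ≡ true → allᵇ (missᵇ K u) ws ≡ true → allᵇ (λ w → not (A u w)) ws ≡ true → length ws + 5 < d
    budget u lu ws dis ms ns = begin-strict
      length ws + 5 ≤⟨ +-mono-≤ (distinct⇒≤card d g (λ i j li lj → g-inj i j (m≤n⇒m≤1+n li) (m≤n⇒m≤1+n lj)) ws dis (bounds ws ms) missed (inMissed ws ms ns)) (degree dn x Nx) ⟩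
      card missed + card (λ w → N w ∧ virtual G X x w) ≡⟨ sym (card-+ (delete x N) missed _ split) ⟩
      card (delete x N) <⟨ ≤-reflexive (sym (card-delete N x Nx)) ⟩
      d ∎
      where
      open ≤-Reasoning
      x = g u
      Nx : N x ≡ true
      Nx = subst (λ w → N w ≡ true) (sym (g-below u (below lu))) (f-mem u (below lu))
      missed : VertexSet n
      missed w = delete x N w ∧ not (virtual G X x w)
      irr-virtual : virtual G X x x ≡ false
      irr-virtual rewrite irrE G x | ≟ᵇ-refl x with X x
      ... | true = refl
      ... | false = refl
      split : ∀ w → ⟦ delete x N w ⟧ ≡ ⟦ missed w ⟧ + ⟦ N w ∧ virtual G X x w ⟧
      split w with w F.≟ x
      ... | no _ = lem (N w) (virtual G X x w)
        where
        lem : ∀ a b → ⟦ a ∧ true ⟧ ≡ ⟦ (a ∧ true) ∧ not b ⟧ + ⟦ a ∧ b ⟧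
        lem true true = refl
        lem true false = refl
        lem false b = refl
      ... | yes refl rewrite irr-virtual = lem (N x)
        where
        lem : ∀ a → ⟦ a ∧ false ⟧ ≡ ⟦ (a ∧ false) ∧ true ⟧ + ⟦ a ∧ false ⟧
        lem true = refl
        lem false = refl
      bounds : ∀ ws → allᵇ (missᵇ K u) ws ≡ true → allᵇ (_<ᵇ d) ws ≡ true
      bounds [] _ = refl
      bounds (w ∷ ws) h = ∧-intro (∧-left {w <ᵇ d} (∧-left h)) (bounds ws (∧-right {missᵇ K u w} h))
      inMissed : ∀ ws → allᵇ (missᵇ K u) ws ≡ true → allᵇ (λ w → not (A u w)) ws ≡ true → allᵇ (λ w → missed (g w)) ws ≡ true
      inMissed [] _ _ = refl
      inMissed (w ∷ ws) h k = ∧-intro (∧-intro (∧-intro (subst (λ z → N z ≡ true) (sym (g-below w lw)) (f-mem w lw))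
            (≢⇒≟ᵇ (g w) x (λ e → absurdB (≡ᵇ-complete (sym (g-inj w u (m≤n⇒m≤1+n lw) (m≤n⇒m≤1+n (below lu)) e))) (∧-left {not (u ≡ᵇ w)} (∧-right {w <ᵇ d} hm)))))
            (taut 4 (λ e a b c → not e ⊃ not (a ∧ b) ⊃ [ not (e ∨ (a ∧ b ∧ c)) ]) (A u w) (X x) (X (g w)) (not (x ≟ᵇ g w)) (∧-left k)
              (notB (λ q → notBoth u w (below lu) lw (∧-right {not (u ≡ᵇ w)} (∧-right {w <ᵇ d} hm)) (∧-left q) (∧-right {X x} q)))))
          (inMissed ws (∧-right {missᵇ K u w} h) (∧-right {not (A u w)} k))
        where
        hm : missᵇ K u w ≡ true
        hm = ∧-left h
        lw : w < d
        lw = below (∧-left {w <ᵇ d} hm)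
    universal-true : ∀ k → k ≤ d → allᵇ (λ f → A (proj₁ f) (proj₂ f)) (universal d k) ≡ true
    universal-true zero _ = refl
    universal-true (suc i) le = ∧-intro (subst₂ (λ a b → E G a b ≡ true) (sym (g-below i le)) (sym (override-at f d v))
        (adjacent-sym G v (f i) (⇒-elim _ _ (nbrs dn (f i)) (f-mem i le)))) (universal-true i (<⇒≤ le))
    result : ∃ λ (hl : Fin (d ∸ 4) → Fin 5) → ∀ p → joinᵇ K A hl p ≡ true
    result = Soundness.sound K A A-sym budget (parse (tree C)) (universal d d) [] (universal-true d ≤-refl) refl (valid C)
    hl = proj₁ result
    joined : ∀ p → Join G y h (λ i → i) hl p (sh p)
    joined p = go (∨-elim {A (rootOf K p) (rootOf K (sh p))} (proj₂ result p))
      where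
      yy : ∀ {p i j} q → i ≡ rootOf K p → j ≡ q → A i j ≡ true → E G (y p) (g q) ≡ true
      yy {p} q refl refl h = subst (λ w → E G w (g q) ≡ true) (f-y p) h
      hy : ∀ i q → A i (rootOf K q) ≡ true → E G (g i) (y q) ≡ true
      hy i q h = subst (λ w → E G (g i) w ≡ true) (f-y q) h
      lab2 : ∀ t → ((hl t ≟ᵇ p) ∨ (hl t ≟ᵇ sh p)) ≡ true → hl t ≡ p ⊎ hl t ≡ sh p
      lab2 t e with ∨-elim {hl t ≟ᵇ p} e
      ... | inj₁ k = inj₁ (≟ᵇ⇒≡ (hl t) p k)
      ... | inj₂ k = inj₂ (≟ᵇ⇒≡ (hl t) (sh p) k)
      one : ℕ → Bool
      one _ = true
      via₁ᵇ : Fin (d ∸ 4) → Bool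
      via₁ᵇ t = ((hl t ≟ᵇ p) ∨ (hl t ≟ᵇ sh p)) ∧ A (rootOf K p) (helperOf K t) ∧ A (helperOf K t) (rootOf K (sh p))
      inner₂ : Fin (d ∸ 4) → Fin (d ∸ 4) → Bool
      inner₂ t s = (hl s ≟ᵇ sh p) ∧ A (helperOf K t) (helperOf K s) ∧ A (helperOf K s) (rootOf K (sh p))
      via₂ᵇ : Fin (d ∸ 4) → Bool
      via₂ᵇ t = (hl t ≟ᵇ p) ∧ A (rootOf K p) (helperOf K t) ∧ anyF (inner₂ t)
      go : A (rootOf K p) (rootOf K (sh p)) ≡ true ⊎ (anyF via₁ᵇ ∨ anyF via₂ᵇ) ≡ true → Join G y h (λ i → i) hl p (sh p)
      go (inj₁ e) = direct (subst₂ (λ a b → E G a b ≡ true) (f-y p) (f-y (sh p)) e)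
      go (inj₂ e) with ∨-elim {anyF via₁ᵇ} e
      ... | inj₁ k with anyF-sound via₁ᵇ k
      ...   | t , z = via t (lab2 t (∧-left z)) (yy (helperOf K t) refl refl (∧-left (∧-right {(hl t ≟ᵇ p) ∨ (hl t ≟ᵇ sh p)} z))) (hy _ (sh p) (∧-right {A (rootOf K p) (helperOf K t)} (∧-right {(hl t ≟ᵇ p) ∨ (hl t ≟ᵇ sh p)} z)))
      go (inj₂ e) | inj₂ k with anyF-sound via₂ᵇ k
      ...   | t , z with anyF-sound (inner₂ t) (∧-right {A (rootOf K p) (helperOf K t)} (∧-right {hl t ≟ᵇ p} z))
      ...     | s , w = via₂ t s (≟ᵇ⇒≡ (hl t) p (∧-left z)) (≟ᵇ⇒≡ (hl s) (sh p) (∧-left w)) (yy (helperOf K t) refl refl (∧-left (∧-right {hl t ≟ᵇ p} z)))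
                  (∧-left (∧-right {hl s ≟ᵇ sh p} w)) (hy _ (sh p) (∧-right {A (helperOf K t) (helperOf K s)} (∧-right {hl s ≟ᵇ sh p} w)))

pad : ∀ {n} (P : VertexSet n) t {m k} (r : Fin m → Fin n) → t + m ≡ k → k ≤ card P → Injective r → (∀ i → P (r i) ≡ true) →
  ∃ λ (y : Fin k → Fin n) → Injective y × (∀ i → P (y i) ≡ true) × (∀ i → ∃ λ j → y j ≡ r i)
pad P zero r refl le inj mem = r , inj , mem , λ i → i , refl
pad P (suc t) {m} r eq le inj mem with prolong P m r inj mem (≤-trans (≤-trans (s≤s (m≤n+m m t)) (≤-reflexive eq)) le)
... | v , pv , new with pad P t (snoc v r) (trans (+-suc t m) eq) le inj′ mem′
  where
  inj′ : Injective (snoc v r)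
  inj′ zero zero e = refl
  inj′ zero (suc j) e = ⊥-elim (new j (sym e))
  inj′ (suc i) zero e = ⊥-elim (new i e)
  inj′ (suc i) (suc j) e = cong suc (inj i j e)
  mem′ : ∀ i → P (snoc v r i) ≡ true
  mem′ zero = pv
  mem′ (suc i) = mem i
...   | y , yinj , ymem , sup = y , yinj , ymem , λ i → sup (suc i)

-- The certificates allow the universal vertex as a root only in the last position. Rotating the
-- 5-cycle brings any position there and keeps a labelling good.
record Rotation (p : Fin 5) : Set where
  field
    turn : Fin 5 → Fin 5
    turn-last : turn 4F ≡ p
    turn-inj : Injective turn
    turn-onto : ∀ j → ∃ λ i → turn i ≡ j
    turn-good : ∀ {c} {μ : Fin 5 → Fin c} → Good μ → Good (λ i → μ (turn i))

open Rotation public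

rotation : ∀ p → Rotation p
rotation = λ { 0F → r₀ ; 1F → next r₀ ; 2F → next (next r₀) ; 3F → next (next (next r₀)) ; 4F → r₄ }
  where
  next : ∀ {p} → Rotation p → Rotation (sh p)
  next R = record { turn = λ i → sh (turn R i) ; turn-last = cong sh (turn-last R) ; turn-inj = λ i j e → turn-inj R i j (sh-injective _ _ e)
    ; turn-onto = λ j → let (i , e) = turn-onto R (unsh j) in i , trans (cong sh e) (sh-unsh j) ; turn-good = λ g → turn-good R (good-rotate g) }
  r₄ : Rotation 4F
  r₄ = record { turn = λ i → i ; turn-last = refl ; turn-inj = λ i j e → e ; turn-onto = λ j → j , refl ; turn-good = λ g → g }
  r₀ : Rotation 0F
  r₀ = next r₄

module _ {n} (G : Graph′ n) (v : Fin n) (N X : VertexSet n) (dn : Dense G v N X) (Xv : X v ≡ false) where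

  private
    vN : N v ≡ false
    vN = not⁻ (notB (λ h → false≢true (irrE G v) (⇒-elim _ _ (nbrs dn v) h)))

  neighbourOf : ∀ {w} → insert v N w ≡ true → w ≢ v → N w ≡ true
  neighbourOf {w} h ne with ∨-elim {w ≟ᵇ v} h
  ... | inj₁ e = ⊥-elim (ne (≟ᵇ⇒≡ w v e))
  ... | inj₂ e = e

  position : (Fin 5 → Fin n) → Fin n → Fin 5
  position y w = fromMaybe 0F (index y w)

  position-y : ∀ y → Injective y → ∀ p → position y (y p) ≡ p
  position-y y inj p = cong (fromMaybe 0F) (index-complete y inj p)

  -- The vertex v, if it is a root, has to be the last one.
  rootedCycle : (y : Fin 5 → Fin n) → Injective y → (∀ w → (N w ∧ X w ⇒ image y w) ≡ true) → (∀ p → insert v N (y p) ≡ true) →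
    (∀ p → p ≢ 4F → y p ≢ v) → Model (E G) (insert v N) (image y) (position y)
  rootedCycle y inj X⊆ mem first with y 4F F.≟ v
  ... | no ne = run (complete N (card N ∸ 5) 5 (λ i → y (digit i)) (m∸n+n≡m (≤-trans (n≤1+n 5) (six≤ dn))) inj5 mem5)
    where
    away : ∀ p → y p ≢ v
    away 4F = ne
    away 0F = first 0F (λ ())
    away 1F = first 1F (λ ())
    away 2F = first 2F (λ ())
    away 3F = first 3F (λ ())
    digit-inj : ∀ i j → i < 5 → j < 5 → digit i ≡ digit j → i ≡ j
    digit-inj i j li lj e = trans (sym (val i li)) (trans (cong toℕ e) (val j lj))
      where
      val : ∀ i → i < 5 → toℕ (digit i) ≡ i
      val 0 _ = refl
      val 1 _ = refl
      val 2 _ = refl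
      val 3 _ = refl
      val 4 _ = refl
      val (suc (suc (suc (suc (suc _))))) (s≤s (s≤s (s≤s (s≤s (s≤s ())))))
    inj5 : InjectiveBelow 5 (λ i → y (digit i))
    inj5 i j li lj e = digit-inj i j li lj (inj _ _ e)
    mem5 : ∀ i → i < 5 → N (y (digit i)) ≡ true
    mem5 i _ = neighbourOf (mem (digit i)) (away (digit i))
    run : (∃ λ (g : ℕ → Fin n) → InjectiveBelow (card N) g × (∀ i → i < card N → N (g i) ≡ true) × (∀ i → i < 5 → g i ≡ y (digit i))) → _
    run (g , ginj , gmem , agree) = rootedCycle-from G v N X dn Xv y inj X⊆ false g ginj gmem refl at
      (λ p → taut 2 (λ a b → (a ∨ b) ⊃ [ b ∨ a ]) (y p ≟ᵇ v) (N (y p)) (mem p)) (position y) (position-y y inj)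
      where
      early : ∀ i → i < 5 → override g (card N) v i ≡ y (digit i)
      early i lt = trans (override-below g (card N) v i (≤-trans lt (≤-trans (n≤1+n 5) (six≤ dn)))) (agree i lt)
      at : ∀ p → override g (card N) v (tuple 0 1 2 3 4 p) ≡ y p
      at 0F = early 0 (s≤s z≤n)
      at 1F = early 1 (s≤s (s≤s z≤n))
      at 2F = early 2 (s≤s (s≤s (s≤s z≤n)))
      at 3F = early 3 (s≤s (s≤s (s≤s (s≤s z≤n))))
      at 4F = early 4 (s≤s (s≤s (s≤s (s≤s (s≤s z≤n)))))
  ... | yes last = run (complete N (card N ∸ 4) 4 (λ i → y (digit i)) (m∸n+n≡m (≤-trans (≤-trans (n≤1+n 4) (n≤1+n 5)) (six≤ dn))) inj4 mem4)
    where
    val : ∀ i → i < 4 → toℕ (digit i) ≡ i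
    val 0 _ = refl
    val 1 _ = refl
    val 2 _ = refl
    val 3 _ = refl
    val (suc (suc (suc (suc _)))) (s≤s (s≤s (s≤s (s≤s ()))))
    inj4 : InjectiveBelow 4 (λ i → y (digit i))
    inj4 i j li lj e = trans (sym (val i li)) (trans (cong toℕ (inj _ _ e)) (val j lj))
    mem4 : ∀ i → i < 4 → N (y (digit i)) ≡ true
    mem4 i lt = neighbourOf (mem (digit i)) (first (digit i) (λ e → <⇒≢ lt (trans (sym (val i lt)) (cong toℕ e))))
    run : (∃ λ (g : ℕ → Fin n) → InjectiveBelow (card N) g × (∀ i → i < card N → N (g i) ≡ true) × (∀ i → i < 4 → g i ≡ y (digit i))) → _
    run (g , ginj , gmem , agree) = rootedCycle-from G v N X dn Xv y inj X⊆ true g ginj gmem (cong not (trans (cong X last) Xv)) at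
      (λ p → taut 2 (λ a b → (a ∨ b) ⊃ [ b ∨ a ]) (y p ≟ᵇ v) (N (y p)) (mem p)) (position y) (position-y y inj)
      where
      early : ∀ i → i < 4 → override g (card N) v i ≡ y (digit i)
      early i lt = trans (override-below g (card N) v i (≤-trans lt (≤-trans (≤-trans (n≤1+n 4) (n≤1+n 5)) (six≤ dn)))) (agree i lt)
      at : ∀ p → override g (card N) v (tuple 0 1 2 3 (card N) p) ≡ y p
      at 0F = early 0 (s≤s z≤n)
      at 1F = early 1 (s≤s (s≤s z≤n))
      at 2F = early 2 (s≤s (s≤s (s≤s z≤n)))
      at 3F = early 3 (s≤s (s≤s (s≤s (s≤s z≤n))))
      at 4F = trans (override-at g (card N) v) (sym last)

  -- The roots are padded to five by arbitrary vertices, sorted by label and rotated so that v, if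
  -- present, comes last. A rooted 5-cycle for this order exists by the certificates, and merging
  -- its bags yields the labelling.
  denseModel : ∀ {m c} → m ≤ 5 → 2 ≤ c → c ≤ 5 → (r : Fin m → Fin n) → Injective r → (∀ i → insert v N (r i) ≡ true) →
    (∀ w → (N w ∧ X w ⇒ image r w) ≡ true) → (lab : Fin n → Fin c) → Model (E G) (insert v N) (image r) lab
  denseModel {m} {c} le lo hi r inj mem X⊆r lab
    with pad (insert v N) (5 ∸ m) r (m∸n+n≡m le) (≤-trans (≤-trans (n≤1+n 5) (six≤ dn)) (card-mono {P = N} {insert v N} (λ w h → taut 2 (λ a b → b ⊃ [ a ∨ b ]) (w ≟ᵇ v) (N w) h))) inj mem
  ... | y , yinj , ymem , sup with sort≤5 c lo hi (λ p → lab (y p))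
  ...   | σ , σinj , σonto , good = mergeBags G z (position z) (position-y z zinj) cycle zgood hit
    where
    lastPos : ∃ λ p → ∀ q → q ≢ p → y (σ q) ≢ v
    lastPos with any? (λ p → y (σ p) F.≟ v)
    ... | yes (p , e) = p , λ q ne e′ → ne (σinj q p (yinj _ _ (trans e′ (sym e))))
    ... | no none = 4F , λ q _ e → none (q , e)
    R = rotation (proj₁ lastPos)
    z : Fin 5 → Fin n
    z p = y (σ (turn R p))
    zinj : Injective z
    zinj p q e = turn-inj R p q (σinj _ _ (yinj _ _ e))
    zonto : ∀ i → ∃ λ p → z p ≡ r i
    zonto i = let (j , e) = sup i ; (q , f) = σonto j ; (p , g) = turn-onto R q in p , trans (cong (λ t → y (σ t)) g) (trans (cong y f) e)
    zgood : Good (λ p → lab (z p))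
    zgood = turn-good R good
    hit : ∀ w → image r w ≡ true → ∃ λ p → z p ≡ w
    hit w h = let (i , e) = image-elim r w h ; (p , f) = zonto i in p , trans f e
    cycle : Model (E G) (insert v N) (image z) (position z)
    cycle = rootedCycle z zinj (λ w → ⇒-intro _ _ (λ h → let (p , e) = hit w (⇒-elim _ _ (X⊆r w) h) in subst (λ t → image z t ≡ true) e (image-intro z p)))
      (λ p → ymem _) (λ p ne → proj₂ lastPos (turn R p) (λ e → ne (turn-inj R p 4F (trans e (sym (turn-last R))))))

-- The exceptional pair

data Reached {n} (next : Fin n → Fin n → Bool) (P : VertexSet n) : Fin n → Set where
  start : ∀ {v} → P v ≡ true → Reached next P v
  more : ∀ {u v} → Reached next P u → next u v ≡ true → Reached next P v

record Closure {n} (next : Fin n → Fin n → Bool) (P : VertexSet n) : Set where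
  field
    set : VertexSet n
    base : ∀ v → P v ≡ true → set v ≡ true
    stable : ∀ u v → set u ≡ true → next u v ≡ true → set v ≡ true
    reached : ∀ v → set v ≡ true → Reached next P v

open Closure public

closure : ∀ {n} (next : Fin n → Fin n → Bool) (P : VertexSet n) → Closure next P
closure {n} next P = grow n P (≤-trans (card-mono {P = λ v → not (P v)} {λ _ → true} (λ v _ → refl)) (≤-reflexive (all n))) (λ v h → h) (λ v h → start h)
  where
  all : ∀ n → card {n} (λ _ → true) ≡ n
  all zero = refl
  all (suc n) = cong suc (all n)
  grow : ∀ k (Q : VertexSet n) → card (λ v → not (Q v)) ≤ k → (∀ v → P v ≡ true → Q v ≡ true) → (∀ v → Q v ≡ true → Reached next P v) → Closure next P
  grow k Q le P⊆Q re with any? (λ u → any? (λ v → (Q u ∧ next u v ∧ not (Q v)) B.≟ true))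
  ... | no none = record { set = Q ; base = P⊆Q ; reached = re
          ; stable = λ u v qu e → taut 3 (λ a b c → not (a ∧ b ∧ not c) ⊃ a ⊃ b ⊃ [ c ]) (Q u) (next u v) (Q v) (notB (λ h → none (u , v , h))) qu e }
  grow zero Q le P⊆Q re | yes (u , v , h) = ⊥-elim (<⇒≱ (member⇒card (λ w → not (Q w)) v (∧-right {next u v} (∧-right {Q u} h))) le)
  grow (suc k) Q le P⊆Q re | yes (u , v , h) = grow k (insert v Q)
      (≤-pred (≤-trans (card-strict {P = λ w → not (insert v Q w)} {λ w → not (Q w)} (λ w → taut 2 (λ a b → not (a ∨ b) ⊃ [ not b ]) (w ≟ᵇ v) (Q w)) v qv
        (cong (λ b → not (b ∨ Q v)) (≟ᵇ-refl v))) le))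
      (λ w p → taut 2 (λ a b → b ⊃ [ a ∨ b ]) (w ≟ᵇ v) (Q w) (P⊆Q w p)) re′
    where
    qv : not (Q v) ≡ true
    qv = ∧-right {next u v} (∧-right {Q u} h)
    re′ : ∀ w → insert v Q w ≡ true → Reached next P w
    re′ w e with ∨-elim {w ≟ᵇ v} e
    ... | inj₁ k rewrite ≟ᵇ⇒≡ w v k = more (re u (∧-left h)) (∧-left (∧-right {Q u} h))
    ... | inj₂ k = re w k

within : ∀ {n} → Graph′ n → VertexSet n → Fin n → Fin n → Bool
within G W u v = E G u v ∧ W v

reached-walk : ∀ {n c} (G : Graph′ n) (W P : VertexSet n) (β : Labelling n c) l (C : Closure (within G W) P) → (∀ v → set C v ≡ true → β v ≡ just l) →
  ∀ {v} → set C v ≡ true → ∃ λ u → P u ≡ true × set C u ≡ true × Walk (E G) β u v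
reached-walk G W P β l C lab {v} h = go (reached C v h)
  where
  inC : ∀ {v} → Reached (within G W) P v → set C v ≡ true
  inC (start p) = base C _ p
  inC (more r e) = stable C _ _ (inC r) e
  go : ∀ {v} → Reached (within G W) P v → ∃ λ u → P u ≡ true × set C u ≡ true × Walk (E G) β u v
  go (start p) = _ , p , base C _ p , done
  go (more {u} {v} r e) with go r
  ... | w , p , c , k = w , p , c , k ++ʷ hop (∧-left e) (trans (lab u (inC r)) (sym (lab v (inC (more r e))))) done

record CompletePair {n} (G : Graph′ n) (S X : VertexSet n) (a b : Fin n) : Set where
  field
    distinct : a ≢ b
    a∈S : S a ≡ true
    b∈S : S b ≡ true
    a-full : ∀ x → X x ≡ true → E G a x ≡ true
    b-full : ∀ x → X x ≡ true → E G b x ≡ true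

open CompletePair public

record LabelledRoots {n} (X : VertexSet n) (lab : Fin n → Fin 5) (r : Fin 5 → Fin n) : Set where
  field
    enum : Enumerates r X
    lab-r : ∀ i → lab (r i) ≡ i

open LabelledRoots public

Exceptional : ∀ {n} → Graph′ n → (S X : VertexSet n) → (Fin n → Fin 5) → Set
Exceptional G S X lab = (∃ λ r → LabelledRoots X lab r) × (∃ λ a → ∃ λ b → CompletePair G S X a b)

reroot : ∀ {n c E} {P X X′ : VertexSet n} {lab : Fin n → Fin c} → (∀ v → X′ v ≡ true → X v ≡ true) → Model E P X lab → Model E P X′ lab
reroot f M = record { β = β M ; supp = supp M ; root = λ x h → root M x (f x h)
  ; same = λ x y hx hy → same M x y (f x hx) (f y hy) ; link = λ x y hx hy → link M x y (f x hx) (f y hy) }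

succ-irreflexive : ∀ {c} → 2 ≤ c → (l : Fin c) → CycSucc l l → ⊥
succ-irreflexive lo l (inj₁ e) = <⇒≢ (n<1+n (toℕ l)) (sym e)
succ-irreflexive lo l (inj₂ (e , z)) rewrite z = <⇒≢ lo e

-- A complete pair is exceptional unless it can be used to link the roots.
star : ∀ {n c} (G : Graph′ n) {S X : VertexSet n} → Disjoint S X → 2 ≤ c → c ≤ 5 → card X ≡ 5 → ∀ {a b} → CompletePair G S X a b → (lab : Fin n → Fin c) →
  Model (E G) (S ∪ˢ X) X lab ⊎ (∃ λ r → Enumerates r X × Injective {5} (λ i → lab (r i)))
star {n} {c} G {S} {X} dis lo hi five {a} {b} cp lab with enumeration′ X five
... | r , en with cover-labels c lo hi (λ i → lab (r i))
...   | inj₁ inj = inj₂ (r , en , inj)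
...   | inj₂ (k , l , cov) = inj₁ (reroot (λ v → ⇒-elim _ _ (proj₁ (image⇔ en v))) M)
  where
  h : Fin 2 → Fin n
  h zero = a
  h (suc zero) = b
  hl : Fin 2 → Fin c
  hl zero = k
  hl (suc zero) = l
  full : ∀ t i → E G (h t) (r i) ≡ true
  full zero i = a-full cp (r i) (member en i)
  full (suc zero) i = b-full cp (r i) (member en i)
  full′ : ∀ t i → E G (r i) (h t) ≡ true
  full′ t i = adjacent-sym G (h t) (r i) (full t i)
  hS : ∀ t → S (h t) ≡ true
  hS zero = a∈S cp
  hS (suc zero) = b∈S cp
  h-inj : Injective h
  h-inj zero zero e = refl
  h-inj zero (suc zero) e = ⊥-elim (distinct cp e)
  h-inj (suc zero) zero e = ⊥-elim (distinct cp (sym e))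
  h-inj (suc zero) (suc zero) e = refl
  pick : ∀ i j → (k ≡ lab (r i) ⊎ k ≡ lab (r j)) ⊎ (l ≡ lab (r i) ⊎ l ≡ lab (r j)) → ∃ λ t → hl t ≡ lab (r i) ⊎ hl t ≡ lab (r j)
  pick i j (inj₁ q) = zero , q
  pick i j (inj₂ q) = suc zero , q
  rel-same : ∀ {i j} → lab (r i) ≡ lab (r j) → related (lab (r i)) (lab (r j)) ≡ true
  rel-same {i} {j} e rewrite ≡⇒≟ᵇ e = refl
  rel-succ : ∀ {i j} → CycSucc (lab (r i)) (lab (r j)) → related (lab (r i)) (lab (r j)) ≡ true
  rel-succ {i} {j} e = taut 2 (λ a b → b ⊃ [ a ∨ b ]) (lab (r i) ≟ᵇ lab (r j)) _ (succᵇ-complete _ _ e)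
  M : Model (E G) (S ∪ˢ X) (image r) lab
  M = helperModel G r h (λ i → lab (r i)) hl lab (injective en) h-inj
    (λ i t e → absurdB (member en i) (⇒-elim _ _ (dis (r i)) (subst (λ w → S w ≡ true) (sym e) (hS t))))
    (λ i → taut 2 (λ s x → x ⊃ [ s ∨ x ]) (S (r i)) (X (r i)) (member en i)) (λ t → taut 2 (λ s x → s ⊃ [ s ∨ x ]) (S (h t)) (X (h t)) (hS t)) (λ i → refl)
    (λ i j ne e → tog i j e (pick i j (cov i j ne (rel-same {i} {j} e))))
    (λ i j s → jn i j s)
    where
    tog : ∀ i j → lab (r i) ≡ lab (r j) → (∃ λ t → hl t ≡ lab (r i) ⊎ hl t ≡ lab (r j)) → ∃ λ t → hl t ≡ lab (r i) × E G (r i) (h t) ≡ true × E G (h t) (r j) ≡ true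
    tog i j e (t , inj₁ q) = t , q , full′ t i , full t j
    tog i j e (t , inj₂ q) = t , trans q (sym e) , full′ t i , full t j
    jn : ∀ i j → CycSucc (lab (r i)) (lab (r j)) → Join G r h (λ i → lab (r i)) hl i j
    jn i j s with i F.≟ j
    ... | no ne = let (t , q) = pick i j (cov i j ne (rel-succ {i} {j} s)) in via t q (full′ t i) (full t j)
    ... | yes refl = ⊥-elim (succ-irreflexive lo (lab (r i)) s)

labelled-roots : ∀ {n} {X : VertexSet n} {lab : Fin n → Fin 5} {r : Fin 5 → Fin n} → Enumerates r X → Injective (λ i → lab (r i)) → ∃ λ r′ → LabelledRoots X lab r′
labelled-roots {n} {X} {lab} {r} en inj = r′ , record
  { enum = record { injective = λ i j e → trans (sym (lab-r′ i)) (trans (cong lab e) (lab-r′ j)) ; member = λ i → member en _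
                  ; hits = λ v h → lab v , back v (hits en v h) }
  ; lab-r = lab-r′ }
  where
  full : card {5} (λ _ → true) ≤ 5
  full = ≤-refl
  inv : ∀ i → ∃ λ j → lab (r j) ≡ i
  inv i = exhausts (λ _ → true) (λ j → lab (r j)) inj (λ _ → refl) full i refl
  r′ : Fin 5 → Fin n
  r′ i = r (proj₁ (inv i))
  lab-r′ : ∀ i → lab (r′ i) ≡ i
  lab-r′ i = proj₂ (inv i)
  back : ∀ v → (∃ λ j → r j ≡ v) → r′ (lab v) ≡ v
  back v (j , refl) = cong r (inj _ _ (lab-r′ (lab (r j))))

suitsᵇ : Bool → Bool → Bool → Bool → Bool → Fin 5 → Bool
suitsᵇ a b c d e j = allF (λ i → tuple a b c d e i ⇒ ((i ≟ᵇ j) ∨ (i ≟ᵇ sh (sh j))))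

chooseᵇ : Bool → Bool → Bool → Bool → Bool → Fin 5
chooseᵇ a b c d e with suitsᵇ a b c d e 0F | suitsᵇ a b c d e 1F | suitsᵇ a b c d e 2F | suitsᵇ a b c d e 3F
... | true | _ | _ | _ = 0F
... | false | true | _ | _ = 1F
... | false | false | true | _ = 2F
... | false | false | false | true = 3F
... | false | false | false | false = 4F

choose : (Fin 5 → Bool) → Fin 5
choose m = chooseᵇ (m 0F) (m 1F) (m 2F) (m 3F) (m 4F)

choose-cong : ∀ {m m′ : Fin 5 → Bool} → (∀ i → m i ≡ m′ i) → choose m ≡ choose m′
choose-cong {m} {m′} e = lem (e 0F) (e 1F) (e 2F) (e 3F) (e 4F)
  where
  lem : ∀ {a b c d f a′ b′ c′ d′ f′} → a ≡ a′ → b ≡ b′ → c ≡ c′ → d ≡ d′ → f ≡ f′ → chooseᵇ a b c d f ≡ chooseᵇ a′ b′ c′ d′ f′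
  lem refl refl refl refl refl = refl

-- An independent set of the 5-cycle lies in some pair {j, j + 2}. This is the origin of the
-- neighbourhoods in (2) of the theorem.
choose-suits : ∀ m → (∀ i → m i ≡ true → m (sh i) ≡ true → ⊥) → ∀ i → m i ≡ true → i ≡ choose m ⊎ i ≡ sh (sh (choose m))
choose-suits m sep i h = lem
  where
  table : ∀ a b c d e → not (a ∧ b) ≡ true → not (b ∧ c) ≡ true → not (c ∧ d) ≡ true → not (d ∧ e) ≡ true → not (e ∧ a) ≡ true → suitsᵇ a b c d e (chooseᵇ a b c d e) ≡ true
  table = taut 5 (λ a b c d e → not (a ∧ b) ⊃ not (b ∧ c) ⊃ not (c ∧ d) ⊃ not (d ∧ e) ⊃ not (e ∧ a) ⊃ [ suitsᵇ a b c d e (chooseᵇ a b c d e) ])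
  no-two : ∀ i → not (m i ∧ m (sh i)) ≡ true
  no-two i = notB (λ h → sep i (∧-left h) (∧-right {m i} h))
  lem : i ≡ chooseᵇ (m 0F) (m 1F) (m 2F) (m 3F) (m 4F) ⊎ i ≡ sh (sh (chooseᵇ (m 0F) (m 1F) (m 2F) (m 3F) (m 4F)))
  lem with chooseᵇ (m 0F) (m 1F) (m 2F) (m 3F) (m 4F) | table (m 0F) (m 1F) (m 2F) (m 3F) (m 4F) (no-two 0F) (no-two 1F) (no-two 2F) (no-two 3F) (no-two 4F)
  ... | j | t with ∨-elim {i ≟ᵇ j} (⇒-elim (tuple (m 0F) (m 1F) (m 2F) (m 3F) (m 4F) i) _ (allF-sound (λ i → tuple (m 0F) (m 1F) (m 2F) (m 3F) (m 4F) i ⇒ ((i ≟ᵇ j) ∨ (i ≟ᵇ sh (sh j)))) t i) (trans (tuple-η m i) h))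
  ...   | inj₁ k = inj₁ (≟ᵇ⇒≡ i j k)
  ...   | inj₂ k = inj₂ (≟ᵇ⇒≡ i _ k)

module OneMoreLink {n} (G : Graph′ n) {S X : VertexSet n} (dis : Disjoint S X) {lab : Fin n → Fin 5} {r : Fin 5 → Fin n} (lr : LabelledRoots X lab r)
  {a b : Fin n} (cp : CompletePair G S X a b) where

  rest : VertexSet n
  rest v = S v ∧ not (v ≟ᵇ a) ∧ not (v ≟ᵇ b)

  -- a serves the root two places after i and b the one before i, so that only the link from i to sh i is missing.
  bags : VertexSet n → Fin 5 → Labelling n 5
  bags C i v = if X v then just (lab v) else (if v ≟ᵇ a then just (sh (sh i)) else (if v ≟ᵇ b then just (unsh i) else (if C v then just i else nothing)))

  private
    r-S : ∀ {v} → S v ≡ true → X v ≡ false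
    r-S {v} h = not⁻ (⇒-elim _ _ (dis v) h)

  bag-r : ∀ C i p → bags C i (r p) ≡ just p
  bag-r C i p rewrite member (enum lr) p = cong just (lab-r lr p)

  bag-a : ∀ C i → bags C i a ≡ just (sh (sh i))
  bag-a C i rewrite r-S (a∈S cp) | ≟ᵇ-refl a = refl

  bag-b : ∀ C i → bags C i b ≡ just (unsh i)
  bag-b C i rewrite r-S (b∈S cp) | not⁻ (≢⇒≟ᵇ b a (λ e → distinct cp (sym e))) | ≟ᵇ-refl b = refl

  bag-C : ∀ C i → (∀ v → C v ≡ true → rest v ≡ true) → ∀ v → C v ≡ true → bags C i v ≡ just i
  bag-C C i sub v h = lem (r-S (∧-left (sub v h))) va vb h
    where
    va : (v ≟ᵇ a) ≡ false
    va = not⁻ (∧-left {not (v ≟ᵇ a)} (∧-right {S v} (sub v h)))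
    vb : (v ≟ᵇ b) ≡ false
    vb = not⁻ (∧-right {not (v ≟ᵇ a)} (∧-right {S v} (sub v h)))
    lem : X v ≡ false → (v ≟ᵇ a) ≡ false → (v ≟ᵇ b) ≡ false → C v ≡ true → bags C i v ≡ just i
    lem e₁ e₂ e₃ e₄ rewrite e₁ | e₂ | e₃ | e₄ = refl

  completeModel : ∀ C i → (∀ v → C v ≡ true → rest v ≡ true) → Link (E G) (bags C i) (r i) (r (sh i)) → Model (E G) (S ∪ˢ X) X lab
  completeModel C i sub lk = record
    { β = β′ ; supp = sup
    ; root = λ x hx → let (p , e) = hits (enum lr) x hx in subst (λ w → β′ w ≡ just (lab w)) e (trans (bag-r C i p) (cong just (sym (lab-r lr p))))
    ; same = λ x y hx hy e → let (p , f) = hits (enum lr) x hx ; (q , g) = hits (enum lr) y hy in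
         subst (Walk (E G) β′ x) (trans (sym f) (trans (cong r (trans (sym (lab-r lr p)) (trans (cong lab f) (trans e (trans (cong lab (sym g)) (lab-r lr q)))))) g)) done
    ; link = λ x y hx hy s → let (p , f) = hits (enum lr) x hx ; (q , g) = hits (enum lr) y hy in
         subst₂ (Link (E G) β′) f g (subst (λ t → Link (E G) β′ (r p) (r t)) (succ⇒sh p q (subst₂ CycSucc (trans (cong lab (sym f)) (lab-r lr p)) (trans (cong lab (sym g)) (lab-r lr q)) s)) (links p)) }
    where
    β′ = bags C i
    sup : ∀ v l → β′ v ≡ just l → (S v ∨ X v) ≡ true
    sup v l h with X v in x
    ... | true = taut 1 (λ s → [ s ∨ true ]) (S v)
    ... | false with v F.≟ a
    ...   | yes refl rewrite a∈S cp = refl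
    ...   | no _ with v F.≟ b
    ...     | yes refl rewrite b∈S cp = refl
    ...     | no _ with C v in cv
    ...       | true rewrite ∧-left {S v} (sub v cv) = refl
    -- Let link p be the one from root p to the next. In bag i + 2 the vertex a provides the links i
    -- + 1 and i + 2, and in bag i - 1 the vertex b provides i + 3 and i + 4.
    table : ∀ i p → ((p ≟ᵇ i) ∨ ((sh (sh i) ≟ᵇ p) ∨ (sh (sh i) ≟ᵇ sh p)) ∨ ((unsh i ≟ᵇ p) ∨ (unsh i ≟ᵇ sh p))) ≡ true
    table = allPairsᵇ-sound (λ i p → (p ≟ᵇ i) ∨ ((sh (sh i) ≟ᵇ p) ∨ (sh (sh i) ≟ᵇ sh p)) ∨ ((unsh i ≟ᵇ p) ∨ (unsh i ≟ᵇ sh p))) refl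
    through : ∀ h l p → (∀ x → X x ≡ true → E G h x ≡ true) → β′ h ≡ just l → ((l ≟ᵇ p) ∨ (l ≟ᵇ sh p)) ≡ true → Link (E G) β′ (r p) (r (sh p))
    through h l p full bh e with ∨-elim {l ≟ᵇ p} e
    ... | inj₁ k = _ , _ , hop (adjacent-sym G h (r p) (full _ (member (enum lr) p))) (trans (bag-r C i p) (trans (cong just (sym (≟ᵇ⇒≡ l p k))) (sym bh))) done , full _ (member (enum lr) (sh p)) , done
    ... | inj₂ k = _ , _ , done , adjacent-sym G h (r p) (full _ (member (enum lr) p)) , hop (full _ (member (enum lr) (sh p))) (trans bh (trans (cong just (≟ᵇ⇒≡ l (sh p) k)) (sym (bag-r C i (sh p))))) done
    links : ∀ p → Link (E G) β′ (r p) (r (sh p))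
    links p with ∨-elim {p ≟ᵇ i} (table i p)
    ... | inj₁ e rewrite ≟ᵇ⇒≡ p i e = lk
    ... | inj₂ e with ∨-elim {(sh (sh i) ≟ᵇ p) ∨ (sh (sh i) ≟ᵇ sh p)} e
    ...   | inj₁ k = through a (sh (sh i)) p (a-full cp) (bag-a C i) k
    ...   | inj₂ k = through b (unsh i) p (b-full cp) (bag-b C i) k

  nonadjacent : ¬ Model (E G) (S ∪ˢ X) X lab → ∀ i → E G (r i) (r (sh i)) ≡ true → ⊥
  nonadjacent nm i e = nm (completeModel (λ _ → false) i (λ v ()) (_ , _ , done , e , done))

  from : Fin 5 → VertexSet n
  from i v = rest v ∧ E G (r i) v

  attached : ∀ i → Closure (within G rest) (from i)
  attached i = closure (within G rest) (from i)

  attached⊆ : ∀ i v → set (attached i) v ≡ true → rest v ≡ true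
  attached⊆ i v h = go (reached (attached i) v h)
    where
    go : ∀ {v} → Reached (within G rest) (from i) v → rest v ≡ true
    go (start p) = ∧-left p
    go (more {u} {v} _ e) = ∧-right {E G u v} e

  -- A vertex reachable from both roots through the rest would supply the missing link. The path
  -- back to the root `r (sh i)` never leaves the set attached to `r i`, so that whole set can serve
  -- as part of bag i.
  separate : ¬ Model (E G) (S ∪ˢ X) X lab → ∀ i w → set (attached i) w ≡ true → set (attached (sh i)) w ≡ true → ⊥
  separate nm i w hi hj = nm (completeModel C i (attached⊆ i) lk)
    where
    C = set (attached i)
    back : ∀ {v} → Reached (within G rest) (from (sh i)) v → C v ≡ true → ∃ λ u → from (sh i) u ≡ true × C u ≡ true
    back (start p) c = _ , p , c
    back (more {u} {v} r e) c = back r (stable (attached i) v u c (∧-intro (adjacent-sym G u v (∧-left e)) (attached-rest r)))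
      where
      attached-rest : ∀ {u} → Reached (within G rest) (from (sh i)) u → rest u ≡ true
      attached-rest (start p) = ∧-left p
      attached-rest (more {u} {v} _ e) = ∧-right {E G u v} e
    lk : Link (E G) (bags C i) (r i) (r (sh i))
    lk with back (reached (attached (sh i)) w hj) hi
    ... | u , f , cu with reached-walk G rest (from i) (bags C i) i (attached i) (bag-C C i (attached⊆ i)) cu
    ...   | u′ , f′ , cu′ , k = u , r (sh i) , hop (∧-right {rest u′} f′) (trans (bag-r C i i) (sym (bag-C C i (attached⊆ i) u′ cu′))) k ,
                adjacent-sym G (r (sh i)) u (∧-right {rest u} f) , done

  -- Every component of the rest receives an index i such that it touches no roots but i and i + 2.
  -- Components are never formed: it suffices that the index is constant along edges.
  record Grouping : Set where
    field
      group : Fin n → Fin 5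
      group-root : ∀ w i → rest w ≡ true → E G w (r i) ≡ true → i ≡ group w ⊎ i ≡ sh (sh (group w))
      group-edge : ∀ u w → rest u ≡ true → rest w ≡ true → E G u w ≡ true → group u ≡ group w

  touches : Fin n → Fin 5 → Bool
  touches w i = set (attached i) w

  groupingBy : (∀ i w → set (attached i) w ≡ true → set (attached (sh i)) w ≡ true → ⊥) → Grouping
  groupingBy sep = record { group = λ w → choose (touches w) ; group-root = gr ; group-edge = ge }
    where
    gr : ∀ w i → rest w ≡ true → E G w (r i) ≡ true → i ≡ choose (touches w) ⊎ i ≡ sh (sh (choose (touches w)))
    gr w i h e = choose-suits (touches w) (λ i → sep i w) i (base (attached i) w (∧-intro h (adjacent-sym G w (r i) e)))
    ge : ∀ u w → rest u ≡ true → rest w ≡ true → E G u w ≡ true → choose (touches u) ≡ choose (touches w)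
    ge u w hu hw e = choose-cong (λ i → bool-ext (λ h → stable (attached i) u w h (∧-intro e hw)) (λ h → stable (attached i) w u h (∧-intro (adjacent-sym G u w e) hu)))

  grouping : ¬ Model (E G) (S ∪ˢ X) X lab → Grouping
  grouping nm = groupingBy (separate nm)

open OneMoreLink public using (Grouping)
open Grouping public

-- Three vertices with many edges to the roots

hasLink : (Fin 3 → Fin 5 → Bool) → (Fin 3 → Fin 5) → Fin 5 → Bool
hasLink e l p = anyF (λ t → ((l t ≟ᵇ p) ∨ (l t ≟ᵇ sh p)) ∧ e t p ∧ e t (sh p))

triple : ∀ {A : Set} → A → A → A → Fin 3 → A
triple a b c zero = a
triple a b c (suc zero) = b
triple a b c (suc (suc zero)) = c

search₃ : ∀ {m} → (Fin m → Fin m → Fin m → Bool) → Bool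
search₃ P = anyF λ i → anyF λ j → anyF λ k → P i j k

search₃-sound : ∀ {m} (P : Fin m → Fin m → Fin m → Bool) → search₃ P ≡ true → ∃ λ i → ∃ λ j → ∃ λ k → P i j k ≡ true
search₃-sound P h with anyF-sound (λ i → anyF λ j → anyF λ k → P i j k) h
... | i , s with anyF-sound (λ j → anyF λ k → P i j k) s
...   | j , s′ with anyF-sound (λ k → P i j k) s′
...     | k , s″ = i , j , k , s″

links : (Fin 3 → Fin 5 → Bool) → Fin 5 → Fin 5 → Fin 5 → Bool
links e i j k = allF (hasLink e (triple i j k))

hasLink-cong : ∀ {e e′ : Fin 3 → Fin 5 → Bool} → (∀ t p → e t p ≡ e′ t p) → ∀ l p → hasLink e l p ≡ hasLink e′ l p
hasLink-cong h l p rewrite h 0F p | h 1F p | h 2F p | h 0F (sh p) | h 1F (sh p) | h 2F (sh p) = refl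

hits′ misses′ : ∀ {k} → Vec Bool k → ℕ
hits′ [] = 0
hits′ (b ∷ bs) = ⟦ b ⟧ + hits′ bs
misses′ [] = 0
misses′ (b ∷ bs) = ⟦ not b ⟧ + misses′ bs

hits+misses : ∀ {k} (bs : Vec Bool k) → hits′ bs + misses′ bs ≡ k
hits+misses [] = refl
hits+misses (true ∷ bs) = cong suc (hits+misses bs)
hits+misses (false ∷ bs) = trans (+-suc (hits′ bs) (misses′ bs)) (cong suc (hits+misses bs))

hits-++ : ∀ {k l} (bs : Vec Bool k) (cs : Vec Bool l) → hits′ (bs Vec.++ cs) ≡ hits′ bs + hits′ cs
hits-++ [] cs = refl
hits-++ (b ∷ bs) cs = trans (cong (⟦ b ⟧ +_) (hits-++ bs cs)) (sym (+-assoc ⟦ b ⟧ _ _))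

-- Only vectors with at most m false entries are visited. In `three-table` these are 121 of the 2^15
-- adjacency matrices.
almostAll : ∀ k → ℕ → (Vec Bool k → Bool) → Bool
almostAll zero m f = f []
almostAll (suc k) zero f = almostAll k zero (λ bs → f (true ∷ bs))
almostAll (suc k) (suc m) f = almostAll k (suc m) (λ bs → f (true ∷ bs)) ∧ almostAll k m (λ bs → f (false ∷ bs))

almostAll-sound : ∀ k m f → almostAll k m f ≡ true → ∀ bs → misses′ bs ≤ m → f bs ≡ true
almostAll-sound zero m f h [] le = h
almostAll-sound (suc k) zero f h (true ∷ bs) le = almostAll-sound k zero _ h bs le
almostAll-sound (suc k) (suc m) f h (true ∷ bs) le = almostAll-sound k (suc m) (λ bs → f (true ∷ bs)) (∧-left h) bs le
almostAll-sound (suc k) (suc m) f h (false ∷ bs) (s≤s le) = almostAll-sound k m (λ bs → f (false ∷ bs)) (∧-right {almostAll k (suc m) (λ bs → f (true ∷ bs))} h) bs le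

matrix : Vec Bool 15 → Fin 3 → Fin 5 → Bool
matrix (a₀ ∷ a₁ ∷ a₂ ∷ a₃ ∷ a₄ ∷ b₀ ∷ b₁ ∷ b₂ ∷ b₃ ∷ b₄ ∷ c₀ ∷ c₁ ∷ c₂ ∷ c₃ ∷ c₄ ∷ []) =
  triple (tuple a₀ a₁ a₂ a₃ a₄) (tuple b₀ b₁ b₂ b₃ b₄) (tuple c₀ c₁ c₂ c₃ c₄)

rowVec : (Fin 5 → Bool) → Vec Bool 5
rowVec f = f 0F ∷ f 1F ∷ f 2F ∷ f 3F ∷ f 4F ∷ []

three-table : ∀ bs → misses′ bs ≤ 2 → search₃ (links (matrix bs)) ≡ true
three-table = almostAll-sound 15 2 (λ bs → search₃ (links (matrix bs))) refl

three-labels : ∀ bs → misses′ bs ≤ 2 → ∃ λ l → ∀ p → hasLink (matrix bs) l p ≡ true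
three-labels bs le = extract (search₃-sound (links (matrix bs)) (three-table bs le))
  where
  extract : (∃ λ i → ∃ λ j → ∃ λ k → links (matrix bs) i j k ≡ true) → ∃ λ l → ∀ p → hasLink (matrix bs) l p ≡ true
  extract (i , j , k , h) = triple i j k , allF-sound (hasLink (matrix bs) (triple i j k)) h

three-links : ∀ (e : Fin 3 → Fin 5 → Bool) → 13 ≤ ∑ (λ t → ∑ (λ p → ⟦ e t p ⟧)) → ∃ λ l → ∀ p → hasLink e l p ≡ true
three-links e many = let (l , ok) = three-labels bs few in l , λ p → trans (hasLink-cong (λ t p → sym (same-e t p)) l p) (ok p)
  where
  bs : Vec Bool 15
  bs = rowVec (e 0F) Vec.++ rowVec (e 1F) Vec.++ rowVec (e 2F) Vec.++ []
  count : hits′ bs ≡ ∑ (λ t → ∑ (λ p → ⟦ e t p ⟧))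
  count = trans (hits-++ (rowVec (e 0F)) (rowVec (e 1F) Vec.++ rowVec (e 2F) Vec.++ [])) (cong (hits′ (rowVec (e 0F)) +_)
    (trans (hits-++ (rowVec (e 1F)) (rowVec (e 2F) Vec.++ [])) (cong (hits′ (rowVec (e 1F)) +_) (hits-++ (rowVec (e 2F)) []))))
  few : misses′ bs ≤ 2
  few = +-cancelˡ-≤ 13 _ _ (≤-trans (+-monoˡ-≤ (misses′ bs) (≤-trans many (≤-reflexive (sym count)))) (≤-reflexive (hits+misses bs)))
  same-e : ∀ t p → matrix bs t p ≡ e t p
  same-e 0F p = tuple-η (e 0F) p
  same-e 1F p = tuple-η (e 1F) p
  same-e 2F p = tuple-η (e 2F) p

-- At most two of the fifteen edges are missing, and then the three vertices can be distributed over
-- the bags so that each of the five links passes through one of them. This excludes that a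
-- contraction creates a complete pair next to the contracted vertex.
threeHelpers : ∀ {n} (G : Graph′ n) {S X : VertexSet n} → Disjoint S X → {lab : Fin n → Fin 5} {r : Fin 5 → Fin n} → LabelledRoots X lab r →
  (h : Fin 3 → Fin n) → Injective h → (∀ t → S (h t) ≡ true) → 13 ≤ ∑ (λ t → ∑ (λ p → ⟦ E G (h t) (r p) ⟧)) → Model (E G) (S ∪ˢ X) X lab
threeHelpers {n} G {S} {X} dis {lab} {r} lr h h-inj hS many = go (three-links e many)
  where
  e : Fin 3 → Fin 5 → Bool
  e t p = E G (h t) (r p)
  go : (∃ λ l → ∀ p → hasLink e l p ≡ true) → Model (E G) (S ∪ˢ X) X lab
  go (l , ok) = reroot (λ v → ⇒-elim _ _ (proj₁ (image⇔ (enum lr) v)))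
    (helperModel G r h (λ i → i) l lab (injective (enum lr)) h-inj
      (λ i t e → absurdB (member (enum lr) i) (⇒-elim _ _ (dis (r i)) (subst (λ w → S w ≡ true) (sym e) (hS t))))
      (λ i → taut 2 (λ s x → x ⊃ [ s ∨ x ]) (S (r i)) (X (r i)) (member (enum lr) i)) (λ t → taut 2 (λ s x → s ⊃ [ s ∨ x ]) (S (h t)) (X (h t)) (hS t)) (lab-r lr)
      (λ i j ne e → ⊥-elim (ne e)) (λ i j s → subst (Join G r h (λ i → i) l i) (succ⇒sh i j s) (jn i)))
    where
    jn : ∀ p → Join G r h (λ i → i) l p (sh p)
    jn p with anyF-sound (λ t → ((l t ≟ᵇ p) ∨ (l t ≟ᵇ sh p)) ∧ e t p ∧ e t (sh p)) (ok p)
    ... | t , q = via t (lab2 (∨-elim {l t ≟ᵇ p} (∧-left q))) (adjacent-sym G (h t) (r p) (∧-left (∧-right {(l t ≟ᵇ p) ∨ (l t ≟ᵇ sh p)} q))) (∧-right {e t p} (∧-right {(l t ≟ᵇ p) ∨ (l t ≟ᵇ sh p)} q))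
      where
      lab2 : (l t ≟ᵇ p) ≡ true ⊎ (l t ≟ᵇ sh p) ≡ true → l t ≡ p ⊎ l t ≡ sh p
      lab2 (inj₁ k) = inj₁ (≟ᵇ⇒≡ (l t) p k)
      lab2 (inj₂ k) = inj₂ (≟ᵇ⇒≡ (l t) (sh p) k)

-- Double counting of edges, and the effect of edge deletion and contraction

≟ᵇ-sym : ∀ {n} (i j : Fin n) → i ≟ᵇ j ≡ j ≟ᵇ i
≟ᵇ-sym i j with i F.≟ j | j F.≟ i
... | yes _ | yes _ = refl
... | yes p | no q = ⊥-elim (q (sym p))
... | no p | yes q = ⊥-elim (p (sym q))
... | no _ | no _ = refl

∑-swap : ∀ {a b} (f : Fin a → Fin b → ℕ) → ∑ (λ i → ∑ (f i)) ≡ ∑ (λ j → ∑ (λ i → f i j))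
∑-swap = ∑-comm

∑-pick : ∀ {n} (u : Fin n) (f : Fin n → ℕ) → ∑ (λ v → ⟦ v ≟ᵇ u ⟧ * f v) ≡ f u
∑-pick u f = trans (∑-cong pt) (trans (∑-* (f u) (λ v → ⟦ v ≟ᵇ u ⟧)) (trans (cong (f u *_) (∑-one u)) (*-identityʳ (f u))))
  where
  pt : ∀ v → ⟦ v ≟ᵇ u ⟧ * f v ≡ f u * ⟦ v ≟ᵇ u ⟧
  pt v with v F.≟ u
  ... | yes refl = *-comm 1 (f v)
  ... | no _ = sym (*-zeroʳ (f u))

∑-enum : ∀ {n m} {r : Fin m → Fin n} {P : VertexSet n} → Enumerates r P → (f : Fin n → ℕ) → ∑ (λ v → ⟦ P v ⟧ * f v) ≡ ∑ (λ i → f (r i))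
∑-enum {n} {m} {r} {P} en f = begin
  ∑ (λ v → ⟦ P v ⟧ * f v) ≡⟨ ∑-cong pt ⟩
  ∑ (λ v → ∑ (λ i → ⟦ v ≟ᵇ r i ⟧ * f v)) ≡⟨ ∑-swap (λ v i → ⟦ v ≟ᵇ r i ⟧ * f v) ⟩
  ∑ (λ i → ∑ (λ v → ⟦ v ≟ᵇ r i ⟧ * f v)) ≡⟨ ∑-cong (λ i → ∑-pick (r i) f) ⟩
  ∑ (λ i → f (r i)) ∎
  where
  open Relation.Binary.PropositionalEquality.≡-Reasoning
  pt : ∀ v → ⟦ P v ⟧ * f v ≡ ∑ (λ i → ⟦ v ≟ᵇ r i ⟧ * f v)
  pt v with any? (λ i → r i F.≟ v)
  ... | yes (j , refl) rewrite member en j = trans (+-identityʳ _) (sym (trans (∑-cong (λ i → eq i)) (∑-pick j (λ _ → f (r j)))))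
    where
    eq : ∀ i → ⟦ r j ≟ᵇ r i ⟧ * f (r j) ≡ ⟦ i ≟ᵇ j ⟧ * f (r j)
    eq i with r j F.≟ r i | i F.≟ j
    ... | yes _ | yes _ = refl
    ... | yes p | no q = ⊥-elim (q (sym (injective en j i p)))
    ... | no p | yes q = ⊥-elim (p (cong r (sym q)))
    ... | no _ | no _ = refl
  ... | no none with P v in pv
  ...   | true = ⊥-elim (none (hits en v pv))
  ...   | false = sym (∑-zero (λ i → zz i))
    where
    zz : ∀ i → ⟦ v ≟ᵇ r i ⟧ * f v ≡ 0
    zz i with v F.≟ r i
    ... | yes p = ⊥-elim (none (i , sym p))
    ... | no _ = refl

∑∑-row : ∀ {n} (u : Fin n) (P : VertexSet n) → ∑∑ (λ z w → ⟦ (z ≟ᵇ u) ∧ P w ⟧) ≡ card P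
∑∑-row u P = trans (∑-cong pt) (∑-pick u (λ _ → card P))
  where
  pt : ∀ z → ∑ (λ w → ⟦ (z ≟ᵇ u) ∧ P w ⟧) ≡ ⟦ z ≟ᵇ u ⟧ * card P
  pt z with z ≟ᵇ u
  ... | true = sym (+-identityʳ (card P))
  ... | false = ∑-zero {f = λ w → ⟦ false ∧ P w ⟧} (λ w → refl)

∑∑-col : ∀ {n} (u : Fin n) (P : VertexSet n) → ∑∑ (λ z w → ⟦ (w ≟ᵇ u) ∧ P z ⟧) ≡ card P
∑∑-col u P = trans (∑-swap (λ z w → ⟦ (w ≟ᵇ u) ∧ P z ⟧)) (∑∑-row u P)

∑∑-+₃ : ∀ {n} (f g h : Fin n → Fin n → ℕ) → ∑∑ (λ u v → f u v + (g u v + h u v)) ≡ ∑∑ f + (∑∑ g + ∑∑ h)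
∑∑-+₃ f g h = trans (∑∑-+ f (λ u v → g u v + h u v)) (cong (∑∑ f +_) (∑∑-+ g h))

edgesBetween : ∀ {n} → Graph′ n → VertexSet n → VertexSet n → ℕ
edgesBetween G P Q = ∑∑ (λ u v → ⟦ P u ∧ Q v ∧ E G u v ⟧)

D-parts : ∀ {n} (G : Graph′ n) {S X : VertexSet n} → Disjoint S X → D G S X ≡ edgesBetween G S S + 2 * edgesBetween G S X
D-parts G {S} {X} dis = begin
  D G S X ≡⟨ ∑-cong (λ u → ∑-cong (λ v → pt u v)) ⟩
  ∑∑ (λ u v → ⟦ S u ∧ S v ∧ E G u v ⟧ + (⟦ S u ∧ X v ∧ E G u v ⟧ + ⟦ S v ∧ X u ∧ E G v u ⟧)) ≡⟨ ∑∑-+₃ (λ u v → ⟦ S u ∧ S v ∧ E G u v ⟧) (λ u v → ⟦ S u ∧ X v ∧ E G u v ⟧) (λ u v → ⟦ S v ∧ X u ∧ E G v u ⟧) ⟩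
  edgesBetween G S S + (edgesBetween G S X + ∑∑ (λ u v → ⟦ S v ∧ X u ∧ E G v u ⟧)) ≡⟨ cong (λ t → edgesBetween G S S + (edgesBetween G S X + t)) (∑-swap (λ u v → ⟦ S v ∧ X u ∧ E G v u ⟧)) ⟩
  edgesBetween G S S + (edgesBetween G S X + edgesBetween G S X) ≡⟨ cong (λ t → edgesBetween G S S + (edgesBetween G S X + t)) (sym (+-identityʳ _)) ⟩
  edgesBetween G S S + 2 * edgesBetween G S X ∎
  where
  open Relation.Binary.PropositionalEquality.≡-Reasoning
  pt : ∀ u v → ⟦ countedPair G S X u v ⟧ ≡ ⟦ S u ∧ S v ∧ E G u v ⟧ + (⟦ S u ∧ X v ∧ E G u v ⟧ + ⟦ S v ∧ X u ∧ E G v u ⟧)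
  pt u v = ≡ᵇ⇒≡ _ _ (≡⇒T (taut 6 (λ e e′ su xu sv xv → (e ⇒ e′) ⊃ (e′ ⇒ e) ⊃ (su ⇒ not xu) ⊃ (sv ⇒ not xv) ⊃
    [ ⟦ counted e su xu sv xv ⟧ ≡ᵇ ⟦ su ∧ sv ∧ e ⟧ + (⟦ su ∧ xv ∧ e ⟧ + ⟦ sv ∧ xu ∧ e′ ⟧) ]) (E G u v) (E G v u) (S u) (X u) (S v) (X v) (symE G u v) (symE G v u) (dis u) (dis v)))

edgesBetween-enum : ∀ {n k m} (G : Graph′ n) {K X : VertexSet n} {h : Fin k → Fin n} {r : Fin m → Fin n} → Enumerates h K → Enumerates r X →
  edgesBetween G K X ≡ ∑ (λ t → ∑ (λ p → ⟦ E G (h t) (r p) ⟧))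
edgesBetween-enum {n} G {K} {X} {h} {r} eh er = begin
  edgesBetween G K X ≡⟨ ∑-cong (λ u → row u) ⟩
  ∑ (λ u → ⟦ K u ⟧ * ∑ (λ v → ⟦ X v ⟧ * ⟦ E G u v ⟧)) ≡⟨ ∑-enum eh (λ u → ∑ (λ v → ⟦ X v ⟧ * ⟦ E G u v ⟧)) ⟩
  ∑ (λ t → ∑ (λ v → ⟦ X v ⟧ * ⟦ E G (h t) v ⟧)) ≡⟨ ∑-cong (λ t → ∑-enum er (λ v → ⟦ E G (h t) v ⟧)) ⟩
  ∑ (λ t → ∑ (λ p → ⟦ E G (h t) (r p) ⟧)) ∎
  where
  open Relation.Binary.PropositionalEquality.≡-Reasoning
  row : ∀ u → ∑ (λ v → ⟦ K u ∧ X v ∧ E G u v ⟧) ≡ ⟦ K u ⟧ * ∑ (λ v → ⟦ X v ⟧ * ⟦ E G u v ⟧)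
  row u with K u
  ... | true = trans (∑-cong (λ v → pt (X v) (E G u v))) (sym (+-identityʳ _))
    where
    pt : ∀ a b → ⟦ a ∧ b ⟧ ≡ ⟦ a ⟧ * ⟦ b ⟧
    pt true b = sym (+-identityʳ ⟦ b ⟧)
    pt false b = refl
  ... | false = ∑-zero {f = λ v → ⟦ false ∧ X v ∧ E G u v ⟧} (λ v → refl)

edgesBetween-self : ∀ {n m} (G : Graph′ n) {K : VertexSet n} → card K ≡ suc m → edgesBetween G K K ≤ suc m * m
edgesBetween-self {n} {m} G {K} eq = begin
  edgesBetween G K K ≤⟨ ∑-mono row ⟩
  ∑ (λ u → m * ⟦ K u ⟧) ≡⟨ ∑-* m (λ u → ⟦ K u ⟧) ⟩
  m * card K ≡⟨ cong (m *_) eq ⟩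
  m * suc m ≡⟨ *-comm m (suc m) ⟩
  suc m * m ∎
  where
  open ≤-Reasoning
  row : ∀ u → ∑ (λ v → ⟦ K u ∧ K v ∧ E G u v ⟧) ≤ m * ⟦ K u ⟧
  row u with K u in ku
  ... | false = ≤-trans (≤-reflexive (∑-zero {f = λ v → ⟦ false ∧ K v ∧ E G u v ⟧} (λ v → refl))) z≤n
  ... | true = ≤-trans (card-mono {P = λ v → K v ∧ E G u v} {delete u K} (λ v h → ∧-intro (∧-left h) (≢⇒≟ᵇ v u (λ { refl → false≢true (irrE G v) (∧-right {K v} h) }))))
                 (≤-reflexive (trans (suc-injective (trans (sym (card-delete K u ku)) eq)) (sym (*-identityʳ m))))

D-core : ∀ {n k m} (G : Graph′ n) {K X : VertexSet n} {h : Fin (suc k) → Fin n} {r : Fin m → Fin n} → Disjoint K X → Enumerates h K → Enumerates r X →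
  D G K X ≤ suc k * k + 2 * ∑ (λ t → ∑ (λ p → ⟦ E G (h t) (r p) ⟧))
D-core G {K} {X} dis eh er = ≤-trans (≤-reflexive (D-parts G {K} {X} dis)) (+-mono-≤ (edgesBetween-self G {K} (enumerates-card eh)) (≤-reflexive (cong (2 *_) (edgesBetween-enum G {K} {X} eh er))))

degIn : ∀ {n} → Graph′ n → VertexSet n → Fin n → ℕ
degIn G P u = card (λ v → P v ∧ E G u v)

D-degrees : ∀ {n} (G : Graph′ n) {S X : VertexSet n} → Disjoint S X → D G S X ≡ ∑ (λ u → ⟦ S u ⟧ * (degIn G S u + 2 * degIn G X u))
D-degrees G {S} {X} dis = trans (D-parts G {S} {X} dis) (trans (cong₂ (λ a b → a + 2 * b) (∑-cong (row S)) (∑-cong (row X)))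
  (trans (cong (∑ (λ u → ⟦ S u ⟧ * degIn G S u) +_) (sym (∑-* 2 (λ u → ⟦ S u ⟧ * degIn G X u))))
  (trans (sym (∑-+ (λ u → ⟦ S u ⟧ * degIn G S u) (λ u → 2 * (⟦ S u ⟧ * degIn G X u)))) (∑-cong (λ u → ring ⟦ S u ⟧ (degIn G S u) (degIn G X u))))))
  where
  ring : ∀ s a b → s * a + 2 * (s * b) ≡ s * (a + 2 * b)
  ring = solve-∀
  row : ∀ P u → ∑ (λ v → ⟦ S u ∧ P v ∧ E G u v ⟧) ≡ ⟦ S u ⟧ * degIn G P u
  row P u with S u
  ... | true = sym (+-identityʳ _)
  ... | false = ∑-zero {f = λ v → ⟦ false ∧ P v ∧ E G u v ⟧} (λ v → refl)

D-extra : ∀ {n} (G H : Graph′ n) (S X : VertexSet n) p q → p ≢ q →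
  (∀ u v → (countedPair G S X u v ⇒ E H u v) ≡ true) →
  countedPair G S X p q ≡ false → countedPair H S X p q ≡ true → D G S X + 2 ≤ D H S X
D-extra {n} G H S X p q p≢q sub out inn = begin
  D G S X + 2 ≡⟨ cong (D G S X +_) (sym (cong₂ _+_ (trans (∑∑-row p (λ w → w ≟ᵇ q)) (∑-one q)) (trans (∑∑-row q (λ w → w ≟ᵇ p)) (∑-one p)))) ⟩
  D G S X + (∑∑ (λ z w → ⟦ (z ≟ᵇ p) ∧ (w ≟ᵇ q) ⟧) + ∑∑ (λ z w → ⟦ (z ≟ᵇ q) ∧ (w ≟ᵇ p) ⟧)) ≡⟨ sym (∑∑-+₃ (λ z w → ⟦ countedPair G S X z w ⟧) _ _) ⟩
  ∑∑ (λ z w → ⟦ countedPair G S X z w ⟧ + (⟦ (z ≟ᵇ p) ∧ (w ≟ᵇ q) ⟧ + ⟦ (z ≟ᵇ q) ∧ (w ≟ᵇ p) ⟧)) ≤⟨ ∑∑-mono pt ⟩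
  D H S X ∎
  where
  open ≤-Reasoning
  counted-sym : ∀ (G : Graph′ n) u v → (countedPair G S X u v ⇒ countedPair G S X v u) ≡ true
  counted-sym G u v = taut 6 (λ e e′ su xu sv xv → (e ⇒ e′) ⊃ [ counted e su xu sv xv ⇒ counted e′ sv xv su xu ]) (E G u v) (E G v u) (S u) (X u) (S v) (X v) (symE G u v)
  out′ : countedPair G S X q p ≡ false
  out′ = not⁻ (notB (λ h → false≢true out (⇒-elim _ _ (counted-sym G q p) h)))
  inn′ : countedPair H S X q p ≡ true
  inn′ = ⇒-elim _ _ (counted-sym H p q) inn
  mono : ∀ z w → ⟦ countedPair G S X z w ⟧ ≤ ⟦ countedPair H S X z w ⟧
  mono z w = ⟦⟧-mono (λ c → taut 6 (λ e e′ a b c d → (counted e a b c d ⇒ e′) ⊃ counted e a b c d ⊃ [ counted e′ a b c d ])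
    (E G z w) (E H z w) (S z) (X z) (S w) (X w) (sub z w) c)
  pt : ∀ z w → ⟦ countedPair G S X z w ⟧ + (⟦ (z ≟ᵇ p) ∧ (w ≟ᵇ q) ⟧ + ⟦ (z ≟ᵇ q) ∧ (w ≟ᵇ p) ⟧) ≤ ⟦ countedPair H S X z w ⟧
  pt z w with case-bool ((z ≟ᵇ p) ∧ (w ≟ᵇ q)) | case-bool ((z ≟ᵇ q) ∧ (w ≟ᵇ p))
  ... | inj₁ a | inj₁ b = ⊥-elim (p≢q (trans (sym (≟ᵇ⇒≡ z p (∧-left a))) (≟ᵇ⇒≡ z q (∧-left b))))
  ... | inj₁ a | inj₂ b rewrite a | not⁻ b | ≟ᵇ⇒≡ z p (∧-left a) | ≟ᵇ⇒≡ w q (∧-right {z ≟ᵇ p} a) | out | inn = ≤-refl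
  ... | inj₂ a | inj₁ b rewrite b | not⁻ a | ≟ᵇ⇒≡ z q (∧-left b) | ≟ᵇ⇒≡ w p (∧-right {z ≟ᵇ q} b) | out′ | inn′ = ≤-refl
  ... | inj₂ a | inj₂ b rewrite not⁻ a | not⁻ b = ≤-trans (≤-reflexive (+-identityʳ _)) (mono z w)

removeEdge : ∀ {n} → Graph′ n → Fin n → Fin n → Graph′ n
removeEdge G p q = record
  { E = λ u v → E G u v ∧ not ((u ≟ᵇ p ∧ v ≟ᵇ q) ∨ (u ≟ᵇ q ∧ v ≟ᵇ p))
  ; symE = λ u v → taut 6 (λ e e′ a b c d → (e ⇒ e′) ⊃ [ e ∧ not ((a ∧ b) ∨ (c ∧ d)) ⇒ e′ ∧ not ((d ∧ c) ∨ (b ∧ a)) ])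
      (E G u v) (E G v u) (u ≟ᵇ p) (v ≟ᵇ q) (u ≟ᵇ q) (v ≟ᵇ p) (symE G u v)
  ; irrE = λ v → not⁻ (taut 2 (λ e x → not e ⊃ [ not (e ∧ x) ]) (E G v v) _ (cong not (irrE G v)))
  }

D-removeEdge : ∀ {n} (G : Graph′ n) (S X : VertexSet n) p q → D G S X ≤ D (removeEdge G p q) S X + 2
D-removeEdge G S X p q = begin
  D G S X ≤⟨ ∑∑-mono pt ⟩
  ∑∑ (λ z w → ⟦ countedPair (removeEdge G p q) S X z w ⟧ + (⟦ (z ≟ᵇ p) ∧ (w ≟ᵇ q) ⟧ + ⟦ (z ≟ᵇ q) ∧ (w ≟ᵇ p) ⟧)) ≡⟨ ∑∑-+₃ (λ z w → ⟦ countedPair (removeEdge G p q) S X z w ⟧) _ _ ⟩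
  D (removeEdge G p q) S X + (∑∑ (λ z w → ⟦ (z ≟ᵇ p) ∧ (w ≟ᵇ q) ⟧) + ∑∑ (λ z w → ⟦ (z ≟ᵇ q) ∧ (w ≟ᵇ p) ⟧))
    ≡⟨ cong (D (removeEdge G p q) S X +_) (cong₂ _+_ (trans (∑∑-row p (λ w → w ≟ᵇ q)) (∑-one q)) (trans (∑∑-row q (λ w → w ≟ᵇ p)) (∑-one p))) ⟩
  D (removeEdge G p q) S X + 2 ∎
  where
  open ≤-Reasoning
  pt : ∀ z w → ⟦ countedPair G S X z w ⟧ ≤ ⟦ countedPair (removeEdge G p q) S X z w ⟧ + (⟦ (z ≟ᵇ p) ∧ (w ≟ᵇ q) ⟧ + ⟦ (z ≟ᵇ q) ∧ (w ≟ᵇ p) ⟧)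
  pt z w = ≤! (taut 7 (λ e a b c d x y → [ ⟦ counted e a b c d ⟧ ≤ᵇ ⟦ counted (e ∧ not (x ∨ y)) a b c d ⟧ + (⟦ x ⟧ + ⟦ y ⟧) ])
    (E G z w) (S z) (X z) (S w) (X w) ((z ≟ᵇ p) ∧ (w ≟ᵇ q)) ((z ≟ᵇ q) ∧ (w ≟ᵇ p)))

D-positive : ∀ {n} (G : Graph′ n) (S X : VertexSet n) → 0 < D G S X → ∃ λ p → ∃ λ q → countedPair G S X p q ≡ true
D-positive G S X h with ∑-positive (λ u → ∑ (λ v → ⟦ countedPair G S X u v ⟧)) h
... | p , h′ with card-positive (countedPair G S X p) h′
...   | q , e = p , q , e

nbhd : ∀ {n} → Graph′ n → (S X : VertexSet n) → Fin n → VertexSet n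
nbhd G S X v w = (S w ∨ X w) ∧ E G v w

-- Of the edges at v, the one to u vanishes and those to virtual neighbours of u are lost: they
-- become parallel to an edge at u, or fall inside X, where nothing is counted. All other edges
-- survive at u.
D-contract : ∀ {n} (G : Graph′ n) {S X : VertexSet n} {v u : Fin n} → Disjoint S X → S v ≡ true → nbhd G S X v u ≡ true →
  D G S X ≤ D (contract G v u) (delete v S) X + 2 * suc (card (λ w → nbhd G S X v w ∧ virtual G X u w))
D-contract {n} G {S} {X} {v} {u} dis v∈S nu = +-cancelʳ-≤ (card new + card new) _ _ (begin
  -- To avoid subtraction, the pairs gained at u are added on the left and the pairs lost at v on
  -- the right, each in both directions.
  D G S X + (card new + card new) ≡⟨ cong (D G S X +_) (sym (cong₂ _+_ (∑∑-row u new) (∑∑-col u new))) ⟩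
  D G S X + (∑∑ (λ z w → ⟦ (z ≟ᵇ u) ∧ new w ⟧) + ∑∑ (λ z w → ⟦ (w ≟ᵇ u) ∧ new z ⟧)) ≡⟨ sym (∑∑-+₃ (λ z w → ⟦ countedPair G S X z w ⟧) _ _) ⟩
  ∑∑ (λ z w → ⟦ countedPair G S X z w ⟧ + (⟦ (z ≟ᵇ u) ∧ new w ⟧ + ⟦ (w ≟ᵇ u) ∧ new z ⟧)) ≤⟨ ∑∑-mono pt ⟩
  ∑∑ (λ z w → ⟦ countedPair G′ S′ X z w ⟧ + (⟦ (z ≟ᵇ v) ∧ N w ⟧ + ⟦ (w ≟ᵇ v) ∧ N z ⟧)) ≡⟨ ∑∑-+₃ (λ z w → ⟦ countedPair G′ S′ X z w ⟧) _ _ ⟩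
  D G′ S′ X + (∑∑ (λ z w → ⟦ (z ≟ᵇ v) ∧ N w ⟧) + ∑∑ (λ z w → ⟦ (w ≟ᵇ v) ∧ N z ⟧)) ≡⟨ cong (D G′ S′ X +_) (cong₂ _+_ (∑∑-row v N) (∑∑-col v N)) ⟩
  D G′ S′ X + (card N + card N) ≡⟨ cong (λ t → D G′ S′ X + (t + t)) count ⟩
  D G′ S′ X + (suc (card common + card new) + suc (card common + card new)) ≡⟨ ring (D G′ S′ X) (card common) (card new) ⟩
  D G′ S′ X + 2 * suc (card common) + (card new + card new) ∎)
  where
  open ≤-Reasoning
  G′ = contract G v u
  S′ N common new : VertexSet n
  S′ = delete v S
  N = nbhd G S X v
  common w = N w ∧ virtual G X u w
  new w = delete u N w ∧ not (virtual G X u w)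
  ring : ∀ d c m → d + (suc (c + m) + suc (c + m)) ≡ d + 2 * suc c + (m + m)
  ring = solve-∀
  uv : E G v u ≡ true
  uv = ∧-right {S u ∨ X u} nu
  Nv : N v ≡ false
  Nv = not⁻ (taut 2 (λ a e → not e ⊃ [ not (a ∧ e) ]) (S v ∨ X v) (E G v v) (cong not (irrE G v)))
  irr-virtual : virtual G X u u ≡ false
  irr-virtual rewrite irrE G u | ≟ᵇ-refl u with X u
  ... | true = refl
  ... | false = refl
  u≢v : u ≢ v
  u≢v refl = false≢true (irrE G u) uv
  count : card N ≡ suc (card common + card new)
  count = trans (card-delete N u nu) (cong suc (card-+ (delete u N) common new split))
    where
    split : ∀ w → ⟦ delete u N w ⟧ ≡ ⟦ common w ⟧ + ⟦ new w ⟧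
    split w with w F.≟ u
    ... | yes refl rewrite irr-virtual = ≡ᵇ⇒≡ _ _ (≡⇒T (taut 1 (λ a → [ ⟦ a ∧ false ⟧ ≡ᵇ ⟦ a ∧ false ⟧ + ⟦ (a ∧ false) ∧ true ⟧ ]) (N w)))
    ... | no _ = ≡ᵇ⇒≡ _ _ (≡⇒T (taut 2 (λ a b → [ ⟦ a ∧ true ⟧ ≡ᵇ ⟦ a ∧ b ⟧ + ⟦ (a ∧ true) ∧ not b ⟧ ]) (N w) (virtual G X u w)))
  newv : new v ≡ false
  newv rewrite Nv = refl
  newu : new u ≡ false
  newu = cong (_∧ not (virtual G X u u)) (delete-self N u)
  c : Fin n → Fin n → Bool
  c = countedPair G S X
  c′ : Fin n → Fin n → Bool
  c′ = countedPair G′ S′ X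
  Xv : X v ≡ false
  Xv = not⁻ (⇒-elim _ _ (dis v) v∈S)
  cv : ∀ w → c v w ≡ true → N w ≡ true
  cv w h = taut 6 (λ e s x sw xw d → counted e s x sw xw ⊃ not x ⊃ [ (sw ∨ xw) ∧ e ]) (E G v w) (S v) (X v) (S w) (X w) true h (cong not Xv)
  cv′ : ∀ z → c z v ≡ true → N z ≡ true
  cv′ z h = taut 6 (λ e e′ s x sz xz → counted e sz xz s x ⊃ not x ⊃ (e ⇒ e′) ⊃ [ (sz ∨ xz) ∧ e′ ]) (E G z v) (E G v z) (S v) (X v) (S z) (X z) h (cong not Xv) (symE G z v)
  keep : ∀ z w → z ≢ v → w ≢ v → c z w ≡ true → c′ z w ≡ true
  keep z w z≢v w≢v h = taut 9 (λ e d rest sz xz sw xw dz dw → counted e sz xz sw xw ⊃ d ⊃ dz ⊃ dw ⊃ [ counted (d ∧ (e ∨ rest)) (sz ∧ dz) xz (sw ∧ dw) xw ])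
      (E G z w) (not (z ≟ᵇ w)) _ (S z) (X z) (S w) (X w) (not (z ≟ᵇ v)) (not (w ≟ᵇ v)) h (≢⇒≟ᵇ z w (λ { refl → false≢true (irrE G z) (∧-left h) })) (≢⇒≟ᵇ z v z≢v) (≢⇒≟ᵇ w v w≢v)
  fresh : ∀ w → new w ≡ true → c u w ≡ false × c′ u w ≡ true
  fresh w h = not⁻ (taut 6 (λ e v su xu sw xw → not (e ∨ v) ⊃ [ not (counted e su xu sw xw) ]) (E G u w) _ (S u) (X u) (S w) (X w) (∧-right {delete u N w} h)) ,
    subst₂ (λ a b → counted (not a ∧ (E G u w ∨ (b ∧ E G v w) ∨ (w ≟ᵇ u ∧ E G u v))) (S u ∧ not (u ≟ᵇ v)) (X u) (S w ∧ not (w ≟ᵇ v)) (X w) ≡ true) (≟ᵇ-sym w u) (sym (≟ᵇ-refl u))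
      (taut 10 (λ su xu sw xw e euw d dv du rest → ((((sw ∨ xw) ∧ e) ∧ d) ∧ not (euw ∨ (xu ∧ xw ∧ d))) ⊃ (su ∨ xu) ⊃ dv ⊃ du ⊃
        [ counted (d ∧ (euw ∨ (true ∧ e) ∨ rest)) (su ∧ du) xu (sw ∧ dv) xw ])
      (S u) (X u) (S w) (X w) (E G v w) (E G u w) (not (w ≟ᵇ u)) (not (w ≟ᵇ v)) (not (u ≟ᵇ v)) (w ≟ᵇ u ∧ E G u v)
      (subst (λ b → (((((S w ∨ X w) ∧ E G v w) ∧ not (w ≟ᵇ u)) ∧ not (E G u w ∨ (X u ∧ X w ∧ not b)))) ≡ true) (≟ᵇ-sym u w) h)
      (∧-left nu) (≢⇒≟ᵇ w v (λ { refl → false≢true newv h })) (≢⇒≟ᵇ u v u≢v))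
  c-sym : ∀ z w → c z w ≡ c w z
  c-sym z w = bool-ext (sy z w) (sy w z)
    where
    sy : ∀ z w → c z w ≡ true → c w z ≡ true
    sy z w = taut 6 (λ e e′ su xu sv xv → (e ⇒ e′) ⊃ counted e su xu sv xv ⊃ [ counted e′ sv xv su xu ]) (E G z w) (E G w z) (S z) (X z) (S w) (X w) (symE G z w)
  c′-sym : ∀ z w → c′ z w ≡ true → c′ w z ≡ true
  c′-sym z w = taut 6 (λ e e′ su xu sv xv → (e ⇒ e′) ⊃ counted e su xu sv xv ⊃ [ counted e′ sv xv su xu ]) (E G′ z w) (E G′ w z) (S′ z) (X z) (S′ w) (X w) (symE G′ z w)
  -- The cases z = u and w = u use that the pairs u , w with new w are counted only after the contraction.
  pt : ∀ z w → ⟦ c z w ⟧ + (⟦ (z ≟ᵇ u) ∧ new w ⟧ + ⟦ (w ≟ᵇ u) ∧ new z ⟧) ≤ ⟦ c′ z w ⟧ + (⟦ (z ≟ᵇ v) ∧ N w ⟧ + ⟦ (w ≟ᵇ v) ∧ N z ⟧)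
  pt z w = go (z F.≟ u) (w F.≟ u) (z F.≟ v) (w F.≟ v)
    where
    R = ⟦ c′ z w ⟧ + (⟦ (z ≟ᵇ v) ∧ N w ⟧ + ⟦ (w ≟ᵇ v) ∧ N z ⟧)
    old : Dec (z ≡ v) → Dec (w ≡ v) → ⟦ c z w ⟧ ≤ R
    old (yes refl) _ = ≤-trans (⟦⟧-mono (cv w)) (≤-trans (≤-reflexive (sym (cong (λ b → ⟦ b ∧ N w ⟧) (≟ᵇ-refl v)))) (≤-trans (m≤m+n ⟦ (v ≟ᵇ v) ∧ N w ⟧ ⟦ (w ≟ᵇ v) ∧ N v ⟧) (m≤n+m _ ⟦ c′ v w ⟧)))
    old (no _) (yes refl) = ≤-trans (⟦⟧-mono (cv′ z)) (≤-trans (≤-reflexive (sym (cong (λ b → ⟦ b ∧ N z ⟧) (≟ᵇ-refl v)))) (≤-trans (m≤n+m ⟦ (v ≟ᵇ v) ∧ N z ⟧ ⟦ (z ≟ᵇ v) ∧ N v ⟧) (m≤n+m _ ⟦ c′ z v ⟧)))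
    old (no p) (no q) = ≤-trans (⟦⟧-mono (keep z w p q)) (m≤m+n _ _)
    off : ∀ a {b} → b ≡ false → a ∧ b ≡ false
    off true refl = refl
    off false refl = refl
    drop : ∀ {a p q} → p ≡ false → q ≡ false → ⟦ a ⟧ + (⟦ p ⟧ + ⟦ q ⟧) ≡ ⟦ a ⟧
    drop refl refl = +-identityʳ _
    single : ∀ {a p q} → a ≡ false → p ≡ false ⊎ q ≡ false → ⟦ a ⟧ + (⟦ p ⟧ + ⟦ q ⟧) ≤ 1
    single {q = q} refl (inj₁ refl) = ⟦⟧≤1 q
    single {p = p} refl (inj₂ refl) = ≤-trans (≤-reflexive (+-identityʳ ⟦ p ⟧)) (⟦⟧≤1 p)
    go : Dec (z ≡ u) → Dec (w ≡ u) → Dec (z ≡ v) → Dec (w ≡ v) → ⟦ c z w ⟧ + (⟦ (z ≟ᵇ u) ∧ new w ⟧ + ⟦ (w ≟ᵇ u) ∧ new z ⟧) ≤ R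
    go (yes refl) (yes refl) zv wv = ≤-trans (≤-reflexive (drop (off (u ≟ᵇ u) newu) (off (u ≟ᵇ u) newu))) (old zv wv)
    go (yes refl) (no q) zv wv with case-bool (new w)
    ... | inj₂ k = ≤-trans (≤-reflexive (drop (off (u ≟ᵇ u) (not⁻ k)) (cong (_∧ new u) (not⁻ (≢⇒≟ᵇ w u q))))) (old zv wv)
    ... | inj₁ k = ≤-trans (single (proj₁ (fresh w k)) (inj₂ (cong (_∧ new u) (not⁻ (≢⇒≟ᵇ w u q))))) (≤-trans (≤-reflexive (sym (cong ⟦_⟧ (proj₂ (fresh w k))))) (m≤m+n _ _))
    go (no p) (yes refl) zv wv with case-bool (new z)
    ... | inj₂ k = ≤-trans (≤-reflexive (drop (cong (_∧ new u) (not⁻ (≢⇒≟ᵇ z u p))) (off (u ≟ᵇ u) (not⁻ k)))) (old zv wv)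
    ... | inj₁ k = ≤-trans (single (trans (c-sym z u) (proj₁ (fresh z k))) (inj₁ (cong (_∧ new u) (not⁻ (≢⇒≟ᵇ z u p))))) (≤-trans (≤-reflexive (sym (cong ⟦_⟧ (c′-sym u z (proj₂ (fresh z k)))))) (m≤m+n _ _))
    go (no p) (no q) zv wv = ≤-trans (≤-reflexive (drop (cong (_∧ new w) (not⁻ (≢⇒≟ᵇ z u p))) (cong (_∧ new z) (not⁻ (≢⇒≟ᵇ w u q))))) (old zv wv)

-- When u lies on the boundary, the edges gained by contracting v into u are edges at v.
D-uncontract : ∀ {n} (G : Graph′ n) {S Q : VertexSet n} {v u : Fin n} → Q u ≡ true → Disjoint S Q → S v ≡ false → Q v ≡ false →
  D (contract G v u) S Q ≤ D G S (insert v Q)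
D-uncontract {n} G {S} {Q} {v} {u} qu dis Sv Qv = begin
  D G′ S Q ≤⟨ ∑∑-mono upper ⟩
  ∑∑ (λ z w → ⟦ countedPair G S Q z w ⟧ + (⟦ (z ≟ᵇ u) ∧ new w ⟧ + ⟦ (w ≟ᵇ u) ∧ new z ⟧)) ≡⟨ ∑∑-+₃ (λ z w → ⟦ countedPair G S Q z w ⟧) _ _ ⟩
  D G S Q + (∑∑ (λ z w → ⟦ (z ≟ᵇ u) ∧ new w ⟧) + ∑∑ (λ z w → ⟦ (w ≟ᵇ u) ∧ new z ⟧)) ≡⟨ cong (D G S Q +_) (cong₂ _+_ (trans (∑∑-row u new) (sym (∑∑-row v new))) (trans (∑∑-col u new) (sym (∑∑-col v new)))) ⟩
  D G S Q + (∑∑ (λ z w → ⟦ (z ≟ᵇ v) ∧ new w ⟧) + ∑∑ (λ z w → ⟦ (w ≟ᵇ v) ∧ new z ⟧)) ≡⟨ sym (∑∑-+₃ (λ z w → ⟦ countedPair G S Q z w ⟧) _ _) ⟩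
  ∑∑ (λ z w → ⟦ countedPair G S Q z w ⟧ + (⟦ (z ≟ᵇ v) ∧ new w ⟧ + ⟦ (w ≟ᵇ v) ∧ new z ⟧)) ≤⟨ ∑∑-mono lower ⟩
  D G S (insert v Q) ∎
  where
  open ≤-Reasoning
  G′ = contract G v u
  new : VertexSet n
  new z = S z ∧ E G v z
  Su : S u ≡ false
  Su = not⁻ (notB (λ h → absurdB qu (⇒-elim _ _ (dis u) h)))
  upper : ∀ z w → ⟦ countedPair G′ S Q z w ⟧ ≤ ⟦ countedPair G S Q z w ⟧ + (⟦ (z ≟ᵇ u) ∧ new w ⟧ + ⟦ (w ≟ᵇ u) ∧ new z ⟧)
  upper z w = ≤! (taut 11 (λ d e a b sz qz sw qw zu wu b′ → (zu ⇒ not sz) ⊃ (wu ⇒ not sw) ⊃ (b ⇒ b′) ⊃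
      [ ⟦ counted (d ∧ (e ∨ (zu ∧ a) ∨ (wu ∧ b))) sz qz sw qw ⟧ ≤ᵇ ⟦ counted e sz qz sw qw ⟧ + (⟦ zu ∧ (sw ∧ a) ⟧ + ⟦ wu ∧ (sz ∧ b′) ⟧) ])
      (not (z ≟ᵇ w)) (E G z w) (E G v w) (E G z v) (S z) (Q z) (S w) (Q w) (z ≟ᵇ u) (w ≟ᵇ u) (E G v z) (noS z) (noS w) (symE G z v))
    where
    noS : ∀ z → (z ≟ᵇ u ⇒ not (S z)) ≡ true
    noS z = ⇒-intro _ _ (λ h → subst (λ t → not (S t) ≡ true) (sym (≟ᵇ⇒≡ z u h)) (cong not Su))
  lower : ∀ z w → ⟦ countedPair G S Q z w ⟧ + (⟦ (z ≟ᵇ v) ∧ new w ⟧ + ⟦ (w ≟ᵇ v) ∧ new z ⟧) ≤ ⟦ countedPair G S (insert v Q) z w ⟧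
  lower z w = go (z F.≟ v) (w F.≟ v)
    where
    go : Dec (z ≡ v) → Dec (w ≡ v) → ⟦ countedPair G S Q z w ⟧ + (⟦ (z ≟ᵇ v) ∧ new w ⟧ + ⟦ (w ≟ᵇ v) ∧ new z ⟧) ≤ ⟦ countedPair G S (insert v Q) z w ⟧
    go (yes refl) (yes refl) rewrite irrE G z | Sv | ≟ᵇ-refl z = z≤n
    go (yes refl) (no q) rewrite Sv | Qv | ≟ᵇ-refl z | not⁻ (≢⇒≟ᵇ w z q) = ≤! (taut 3 (λ e sw qw →
        [ ⟦ counted e false false sw qw ⟧ + (⟦ sw ∧ e ⟧ + 0) ≤ᵇ ⟦ counted e false true sw qw ⟧ ]) (E G z w) (S w) (Q w))
    go (no p) (yes refl) rewrite Sv | Qv | ≟ᵇ-refl w | not⁻ (≢⇒≟ᵇ z w p) = ≤! (taut 4 (λ e e′ sz qz → (e′ ⇒ e) ⊃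
        [ ⟦ counted e sz qz false false ⟧ + (0 + ⟦ sz ∧ e′ ⟧) ≤ᵇ ⟦ counted e sz qz false true ⟧ ]) (E G z w) (E G w z) (S z) (Q z) (symE G w z))
    go (no p) (no q) rewrite not⁻ (≢⇒≟ᵇ z v p) | not⁻ (≢⇒≟ᵇ w v q) = ≤-reflexive (+-identityʳ _)

-- The induction

-- As an indexed family it is empty unless c is 5, so the claim can be stated for all c at once.
data Exc {n} (G : Graph′ n) (S X : VertexSet n) : ∀ {c} → (Fin n → Fin c) → Set where
  exc : {lab : Fin n → Fin 5} → Exceptional G S X lab → Exc G S X lab

record Instance {n} (G : Graph′ n) (S X : VertexSet n) : Set where
  constructor inst
  field
    disjoint : Disjoint S X
    small : card X ≤ 5
    massed : Massed G S X

open Instance public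

-- Refuting the absence of a model is all the induction ever needs; its hypothesis can therefore be
-- applied to every smaller pair without deciding whether a model exists.
Claim : ℕ → ℕ → ℕ → Set
Claim n c k = (G : Graph′ n) (S X : VertexSet n) (lab : Fin n → Fin c) → Instance G S X → card S + card X ≤ k →
  ¬ Model (E G) (S ∪ˢ X) X lab → ¬ Exc G S X lab → ⊥

-- Arbitrary labellings are required, including non-injective ones: a clique edge may join two
-- separator vertices in the same bag as well as in consecutive bags.
Simulates : ∀ {n} → ℕ → Graph′ n → (S Q : VertexSet n) → Set
Simulates {n} c G S Q = ∀ (lab : Fin n → Fin c) → ¬ ¬ Model (E G) (S ∪ˢ Q) Q lab

sep-size : ∀ {n} (G : Graph′ n) {S X S′ Q : VertexSet n} → Sep G S X S′ Q → card S′ + card Q ≤ card S + card X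
sep-size G {S} {X} {S′} {Q} s = ≤-trans (≤-reflexive (sym (∑-+ (λ v → ⟦ S′ v ⟧) (λ v → ⟦ Q v ⟧))))
  (≤-trans (∑-mono (λ v → ≤! (taut 4 (λ s x s′ q → (s′ ⇒ s) ⊃ (q ⇒ s ∨ x) ⊃ (s′ ⇒ not q) ⊃ [ ⟦ s′ ⟧ + ⟦ q ⟧ ≤ᵇ ⟦ s ⟧ + ⟦ x ⟧ ])
      (S v) (X v) (S′ v) (Q v) (inner s v) (outer s v) (apart s v))))
    (≤-reflexive (∑-+ (λ v → ⟦ S v ⟧) (λ v → ⟦ X v ⟧))))

dense⇒nonempty : ∀ {n} (G : Graph′ n) (S X : VertexSet n) {k} → k < D G S X → ∃ λ v → S v ≡ true
dense⇒nonempty G S X lt with D-positive G S X (≤-trans (s≤s z≤n) lt)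
... | p , q , h with S p in sp
...   | true = p , sp
...   | false = q , taut 4 (λ e xp sq xq → counted e false xp sq xq ⊃ [ sq ]) (E G p q) (X p) (S q) (X q) h

sum≤ : ∀ {k} (f : Fin k → ℕ) b → (∀ i → f i ≤ b) → ∑ f ≤ k * b
sum≤ {zero} f b h = z≤n
sum≤ {suc k} f b h = +-mono-≤ (h zero) (sum≤ (λ i → f (suc i)) b (λ i → h (suc i)))

pairOf : ∀ {n} → Fin n → Fin n → Fin 2 → Fin n
pairOf a b zero = a
pairOf a b (suc zero) = b

pairSet : ∀ {n} → Fin n → Fin n → VertexSet n
pairSet a b = insert a (λ v → v ≟ᵇ b)

pair-enumerates : ∀ {n} {a b : Fin n} → a ≢ b → Enumerates (pairOf a b) (pairSet a b)
pair-enumerates {n} {a} {b} a≢b = record { injective = inj ; member = mem ; hits = λ v h → hit v (∨-elim {v ≟ᵇ a} h) }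
  where
  inj : Injective (pairOf a b)
  inj zero zero e = refl
  inj zero (suc zero) e = ⊥-elim (a≢b e)
  inj (suc zero) zero e = ⊥-elim (a≢b (sym e))
  inj (suc zero) (suc zero) e = refl
  mem : ∀ i → pairSet a b (pairOf a b i) ≡ true
  mem zero rewrite ≟ᵇ-refl a = refl
  mem (suc zero) rewrite ≟ᵇ-refl b with b ≟ᵇ a
  ... | true = refl
  ... | false = refl
  hit : ∀ v → (v ≟ᵇ a) ≡ true ⊎ (v ≟ᵇ b) ≡ true → ∃ λ i → pairOf a b i ≡ v
  hit v (inj₁ e) = zero , sym (≟ᵇ⇒≡ v a e)
  hit v (inj₂ e) = suc zero , sym (≟ᵇ⇒≡ v b e)

fence : ∀ {n} → (Fin 5 → Fin n) → Fin n → Fin n → Fin 5 → VertexSet n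
fence r a b i = insert a (insert b (insert (r i) (λ v → v ≟ᵇ r (sh (sh i)))))

fence-card : ∀ {n} (r : Fin 5 → Fin n) a b i → card (fence r a b i) ≤ 4
fence-card r a b i = ≤-trans (card-insert≤ _ a) (s≤s (≤-trans (card-insert≤ _ b) (s≤s (≤-trans (card-insert≤ _ (r i)) (s≤s (≤-reflexive (∑-one (r (sh (sh i))))))))))

D-cong : ∀ {n} (G : Graph′ n) {S₁ S₂ Q : VertexSet n} → (∀ v → S₁ v ≡ S₂ v) → D G S₁ Q ≡ D G S₂ Q
D-cong G {S₁} {S₂} {Q} e = ∑-cong (λ u → ∑-cong (λ v → cong₂ (λ s t → ⟦ counted (E G u v) s (Q u) t (Q v) ⟧) (e u) (e v)))

module _ {n} (G : Graph′ n) {S X : VertexSet n} (dis : Disjoint S X) {lab : Fin n → Fin 5} {r : Fin 5 → Fin n} (lr : LabelledRoots X lab r)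
  {a b : Fin n} (cp : CompletePair G S X a b) (Γ : Grouping G dis lr cp) where

  private
    rest = OneMoreLink.rest G {S} dis lr cp

  part : VertexSet n → Fin 5 → VertexSet n
  part Z i v = Z v ∧ (group Γ v ≟ᵇ i)

  -- Any union of components of the rest splits into parts with at most four neighbours.
  part-sep : ∀ (Z : VertexSet n) → (∀ v → (Z v ⇒ rest v) ≡ true) → (∀ u v → (Z u ∧ E G u v ∧ rest v ⇒ Z v) ≡ true) → ∀ i → Sep G S X (part Z i) (fence r a b i)
  part-sep Z Z⊆ cl i = record
    { inner = λ v → taut 5 (λ s a b z g → (z ⇒ s ∧ not a ∧ not b) ⊃ [ z ∧ g ⇒ s ]) (S v) (v ≟ᵇ a) (v ≟ᵇ b) (Z v) (group Γ v ≟ᵇ i) (Z⊆ v)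
    ; outer = λ v → ⇒-intro _ _ (λ h → out v h)
    ; apart = λ v → ⇒-intro _ _ (λ h → notB (λ q → ap v h q))
    ; closed = λ u v → ⇒-intro _ _ (λ h → clo u v (∧-left {Z u ∧ (group Γ u ≟ᵇ i)} h) (∧-left (∧-right {part Z i u} h)) (∧-right {E G u v} (∧-right {part Z i u} h))) }
    where
    fence-elim : ∀ v → fence r a b i v ≡ true → v ≡ a ⊎ v ≡ b ⊎ X v ≡ true
    fence-elim v h with ∨-elim {v ≟ᵇ a} h
    ... | inj₁ e = inj₁ (≟ᵇ⇒≡ v a e)
    ... | inj₂ h′ with ∨-elim {v ≟ᵇ b} h′
    ...   | inj₁ e = inj₂ (inj₁ (≟ᵇ⇒≡ v b e))
    ...   | inj₂ h″ with ∨-elim {v ≟ᵇ r i} h″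
    ...     | inj₁ e = inj₂ (inj₂ (subst (λ w → X w ≡ true) (sym (≟ᵇ⇒≡ v (r i) e)) (member (enum lr) i)))
    ...     | inj₂ e = inj₂ (inj₂ (subst (λ w → X w ≡ true) (sym (≟ᵇ⇒≡ v _ e)) (member (enum lr) (sh (sh i)))))
    out : ∀ v → fence r a b i v ≡ true → (S v ∨ X v) ≡ true
    out v h with fence-elim v h
    ... | inj₁ refl = taut 2 (λ s x → s ⊃ [ s ∨ x ]) (S v) (X v) (a∈S cp)
    ... | inj₂ (inj₁ refl) = taut 2 (λ s x → s ⊃ [ s ∨ x ]) (S v) (X v) (b∈S cp)
    ... | inj₂ (inj₂ x) = taut 2 (λ s x → x ⊃ [ s ∨ x ]) (S v) (X v) x
    restZ : ∀ v → part Z i v ≡ true → rest v ≡ true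
    restZ v h = ⇒-elim _ _ (Z⊆ v) (∧-left h)
    ap : ∀ v → part Z i v ≡ true → fence r a b i v ≡ true → ⊥
    ap v h q with fence-elim v q
    ... | inj₁ e = absurdB (≡⇒≟ᵇ e) (∧-left {not (v ≟ᵇ a)} (∧-right {S v} (restZ v h)))
    ... | inj₂ (inj₁ e) = absurdB (≡⇒≟ᵇ e) (∧-right {not (v ≟ᵇ a)} (∧-right {S v} (restZ v h)))
    ... | inj₂ (inj₂ x) = absurdB x (⇒-elim _ _ (dis v) (∧-left (restZ v h)))
    clo : ∀ u v → part Z i u ≡ true → E G u v ≡ true → (S v ∨ X v) ≡ true → (part Z i v ∨ fence r a b i v) ≡ true
    clo u v hu e sx with v F.≟ a
    ... | yes _ = taut 1 (λ p → [ p ∨ true ]) (part Z i v)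
    ... | no va with v F.≟ b
    ...   | yes _ = taut 1 (λ p → [ p ∨ true ]) (part Z i v)
    ...   | no vb with ∨-elim {S v} sx
    ...     | inj₂ x with hits (enum lr) v x
    ...       | p , refl with group-root Γ u p (restZ u hu) e
    ...         | inj₁ g rewrite trans g (≟ᵇ⇒≡ (group Γ u) i (∧-right {Z u} hu)) | ≟ᵇ-refl (r i) = taut 1 (λ p → [ p ∨ true ]) _
    ...         | inj₂ g rewrite trans g (cong (λ t → sh (sh t)) (≟ᵇ⇒≡ (group Γ u) i (∧-right {Z u} hu))) | ≟ᵇ-refl (r (sh (sh i))) = taut 2 (λ p q → [ p ∨ (q ∨ true) ]) (part Z i (r (sh (sh i)))) (r (sh (sh i)) ≟ᵇ r i)
    clo u v hu e sx | no va | no vb | inj₁ s = taut 2 (λ p q → p ⊃ [ p ∨ q ]) (part Z i v) _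
        (∧-intro (⇒-elim _ _ (cl u v) (∧-intro (∧-left {Z u} hu) (∧-intro e rv))) (≡⇒≟ᵇ (trans (sym (group-edge Γ u v (restZ u hu) rv e)) (≟ᵇ⇒≡ (group Γ u) i (∧-right {Z u} hu)))))
      where
      rv : rest v ≡ true
      rv = ∧-intro s (∧-intro (≢⇒≟ᵇ v a va) (≢⇒≟ᵇ v b vb))

  pair⊆S : ∀ v → pairSet a b v ≡ true → S v ≡ true
  pair⊆S v h with ∨-elim {v ≟ᵇ a} h
  ... | inj₁ e = subst (λ w → S w ≡ true) (sym (≟ᵇ⇒≡ v a e)) (a∈S cp)
  ... | inj₂ e = subst (λ w → S w ≡ true) (sym (≟ᵇ⇒≡ v b e)) (b∈S cp)

  card-pair : card S ≡ 2 + card (S ∖ˢ pairSet a b)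
  card-pair = trans (card-split S (pairSet a b) (λ v → ⇒-intro _ _ (pair⊆S v))) (cong (_+ card (S ∖ˢ pairSet a b)) (enumerates-card (pair-enumerates (distinct cp))))

  -- The grouped edge count with core {a, b}: each group in Z lies behind a fence of order at most
  -- four, where (M2) applies. Taking the whole rest for Z bounds the total; taking the rest without
  -- one component isolates the count of that component.
  closed-split : ∀ (Z : VertexSet n) → (∀ v → (Z v ⇒ rest v) ≡ true) → (∀ u v → (Z u ∧ E G u v ∧ rest v ⇒ Z v) ≡ true) →
    (∀ S′ Q → Sep G S X S′ Q → card Q < card X → D G S′ Q ≤ 10 * card S′) → D G (Z ∪ˢ pairSet a b) X ≤ 10 * card Z + D G (pairSet a b) X
  closed-split Z Z⊆ zcl sp = ≤-trans (D-groups G K (group Γ) (fence r a b) (λ v → taut 2 (λ z k → [ k ⇒ z ∨ k ]) (Z v) (K v)) cl sparse-parts)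
      (≤-reflexive (cong (λ t → 10 * t + D G K X) (card-cong {P = Z⁺ ∖ˢ K} {Z} (λ v → strip v))))
    where
    K = pairSet a b
    Z⁺ = Z ∪ˢ K
    apartK : ∀ v → (Z v ⇒ not (K v)) ≡ true
    apartK v = taut 4 (λ s a b z → (z ⇒ s ∧ not a ∧ not b) ⊃ [ z ⇒ not (a ∨ b) ]) (S v) (v ≟ᵇ a) (v ≟ᵇ b) (Z v) (Z⊆ v)
    strip′ : ∀ z k → (z ⇒ not k) ≡ true → (z ∨ k) ∧ not k ≡ z
    strip′ true false _ = refl
    strip′ false true _ = refl
    strip′ false false _ = refl
    strip : ∀ v → (Z⁺ ∖ˢ K) v ≡ Z v
    strip v = strip′ (Z v) (K v) (apartK v)
    same-part : ∀ i v → part Z i v ≡ (Z⁺ v ∧ not (K v) ∧ (group Γ v ≟ᵇ i))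
    same-part i v = lem (Z v) (K v) _ (apartK v)
      where
      lem : ∀ z k g → (z ⇒ not k) ≡ true → z ∧ g ≡ ((z ∨ k) ∧ not k ∧ g)
      lem true false g _ = refl
      lem false true g _ = refl
      lem false false g _ = refl
    ps : ∀ i → Sep G S X (part Z i) (fence r a b i)
    ps = part-sep Z Z⊆ zcl
    cl : ∀ i u v → ((Z⁺ u ∧ not (K u) ∧ (group Γ u ≟ᵇ i)) ∧ E G u v ∧ (Z⁺ v ∨ X v) ⇒ (Z⁺ v ∧ not (K v) ∧ (group Γ v ≟ᵇ i)) ∨ fence r a b i v) ≡ true
    cl i u v rewrite sym (same-part i u) | sym (same-part i v) = taut 7 (λ w e z k x s t → (z ⇒ s) ⊃ (k ⇒ s) ⊃ (w ∧ e ∧ (s ∨ x) ⇒ t) ⊃ [ w ∧ e ∧ ((z ∨ k) ∨ x) ⇒ t ])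
      (part Z i u) (E G u v) (Z v) (K v) (X v) (S v) (part Z i v ∨ fence r a b i v)
      (taut 4 (λ s a b z → (z ⇒ s ∧ not a ∧ not b) ⊃ [ z ⇒ s ]) (S v) (v ≟ᵇ a) (v ≟ᵇ b) (Z v) (Z⊆ v)) (⇒-intro _ _ (pair⊆S v)) (closed (ps i) u v)
    sparse-parts : ∀ i → D G (λ v → Z⁺ v ∧ not (K v) ∧ (group Γ v ≟ᵇ i)) (fence r a b i) ≤ 10 * card (λ v → Z⁺ v ∧ not (K v) ∧ (group Γ v ≟ᵇ i))
    sparse-parts i = subst₂ _≤_ (D-cong G (same-part i)) (cong (10 *_) (card-cong (same-part i)))
      (sp _ _ (ps i) (≤-trans (s≤s (fence-card r a b i)) (≤-reflexive (sym (enumerates-card (enum lr))))))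

  rest∪pair : ∀ v → S v ≡ (rest ∪ˢ pairSet a b) v
  rest∪pair v = lem (S v) (v ≟ᵇ a) (v ≟ᵇ b) (⇒-intro _ _ (pair⊆S v))
    where
    lem : ∀ s a b → (a ∨ b ⇒ s) ≡ true → s ≡ (s ∧ not a ∧ not b) ∨ (a ∨ b)
    lem true true b _ = refl
    lem true false true _ = refl
    lem true false false _ = refl
    lem false false false _ = refl

  card-rest : card rest ≡ card (S ∖ˢ pairSet a b)
  card-rest = card-cong {P = rest} {S ∖ˢ pairSet a b} (λ v → lem (S v) (v ≟ᵇ a) (v ≟ᵇ b))
    where
    lem : ∀ s a b → s ∧ not a ∧ not b ≡ s ∧ not (a ∨ b)
    lem s true b = refl
    lem s false b = refl

  exceptional-split : (∀ S′ Q → Sep G S X S′ Q → card Q < card X → D G S′ Q ≤ 10 * card S′) → D G S X ≤ 10 * card (S ∖ˢ pairSet a b) + D G (pairSet a b) X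
  exceptional-split sp = subst₂ _≤_ (D-cong G (λ v → sym (rest∪pair v))) (cong (λ t → 10 * t + D G (pairSet a b) X) card-rest)
    (closed-split rest (λ v → taut 1 (λ a → [ a ⇒ a ]) (rest v)) (λ u v → taut 3 (λ a b c → [ a ∧ b ∧ c ⇒ c ]) (rest u) (E G u v) (rest v)) sp)

  crossing-bound : edgesBetween G (pairSet a b) X ≤ 10
  crossing-bound = ≤-trans (≤-reflexive (edgesBetween-enum G {pairSet a b} {X} (pair-enumerates (distinct cp)) (enum lr)))
    (sum≤ _ 5 (λ t → sum≤ (λ p → ⟦ E G (pairOf a b t) (r p) ⟧) 1 (λ p → ⟦⟧≤1 _)))

  pair-disjoint : Disjoint (pairSet a b) X
  pair-disjoint v = ⇒-intro _ _ (λ h → ⇒-elim _ _ (dis v) (pair⊆S v h))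

  -- At most the edge ab and ten edges to X, each counted twice.
  pair-bound : D G (pairSet a b) X ≤ 22
  pair-bound = ≤-trans (≤-reflexive (D-parts G {pairSet a b} {X} pair-disjoint))
    (+-mono-≤ (edgesBetween-self G {pairSet a b} (enumerates-card (pair-enumerates (distinct cp)))) (*-monoʳ-≤ 2 crossing-bound))

  -- Everything outside {a, b} keeps to its budget, and 22 exceeds the budget of two vertices by 2.
  -- Together with density this forces equality, so an exceptional pair admits no further counted
  -- edge.
  exceptional-bound : (∀ S′ Q → Sep G S X S′ Q → card Q < card X → D G S′ Q ≤ 10 * card S′) → D G S X ≤ 10 * card S + 2
  exceptional-bound sp = begin
    D G S X ≤⟨ exceptional-split sp ⟩
    10 * card (S ∖ˢ K) + D G K X ≤⟨ +-monoʳ-≤ (10 * card (S ∖ˢ K)) pair-bound ⟩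
    10 * card (S ∖ˢ K) + 22 ≡⟨ ring (card (S ∖ˢ K)) ⟩
    10 * (2 + card (S ∖ˢ K)) + 2 ≡⟨ cong (λ t → 10 * t + 2) (sym card-pair) ⟩
    10 * card S + 2 ∎
    where
    open ≤-Reasoning
    K = pairSet a b
    ring : ∀ s → 10 * s + 22 ≡ 10 * (2 + s) + 2
    ring = solve-∀

  -- Without the edge ab the pair contributes at most 20, its budget, which contradicts density.
  pair-adjacent : (∀ S′ Q → Sep G S X S′ Q → card Q < card X → D G S′ Q ≤ 10 * card S′) → 10 * card S < D G S X → E G a b ≡ true
  pair-adjacent sp dn with E G a b in e
  ... | true = refl
  ... | false = ⊥-elim (<⇒≱ dn (begin
    D G S X ≤⟨ exceptional-split sp ⟩
    10 * card (S ∖ˢ K) + D G K X ≡⟨ cong (10 * card (S ∖ˢ K) +_) (D-parts G {K} {X} pair-disjoint) ⟩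
    10 * card (S ∖ˢ K) + (edgesBetween G K K + 2 * edgesBetween G K X) ≡⟨ cong (λ t → 10 * card (S ∖ˢ K) + (t + 2 * edgesBetween G K X)) empty ⟩
    10 * card (S ∖ˢ K) + 2 * edgesBetween G K X ≤⟨ +-monoʳ-≤ (10 * card (S ∖ˢ K)) (*-monoʳ-≤ 2 crossing-bound) ⟩
    10 * card (S ∖ˢ K) + 20 ≡⟨ ring (card (S ∖ˢ K)) ⟩
    10 * (2 + card (S ∖ˢ K)) ≡⟨ cong (10 *_) (sym card-pair) ⟩
    10 * card S ∎))
    where
    open ≤-Reasoning
    K = pairSet a b
    ring : ∀ s → 10 * s + 20 ≡ 10 * (2 + s)
    ring = solve-∀
    e′ : E G b a ≡ false
    e′ = not⁻ (notB (λ h → false≢true e (adjacent-sym G b a h)))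
    none : ∀ u v → (K u ∧ K v ∧ E G u v) ≡ true → ⊥
    none u v h with hits (pair-enumerates (distinct cp)) u (∧-left h) | hits (pair-enumerates (distinct cp)) v (∧-left (∧-right {K u} h))
    ... | zero , refl | zero , refl = false≢true (irrE G a) (∧-right {K a} (∧-right {K a} h))
    ... | zero , refl | suc zero , refl = false≢true e (∧-right {K b} (∧-right {K a} h))
    ... | suc zero , refl | zero , refl = false≢true e′ (∧-right {K a} (∧-right {K b} h))
    ... | suc zero , refl | suc zero , refl = false≢true (irrE G b) (∧-right {K b} (∧-right {K b} h))
    empty : edgesBetween G K K ≡ 0
    empty = ∑-zero (λ u → ∑-zero (λ v → cong ⟦_⟧ (not⁻ (notB (none u v)))))

Exc⇒5 : ∀ {n c} {G : Graph′ n} {S X : VertexSet n} {lab : Fin n → Fin c} → Exc G S X lab → card X ≡ 5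
Exc⇒5 (exc ((r , lr) , _)) = enumerates-card (enum lr)

module Reduce {n c} (l₀ : Fin c) (k : ℕ) (IH : Claim n c k) where

  -- A separator of at most four vertices cannot be exceptional, so the induction hypothesis applies
  -- to every labelling of it.
  small⇒simulates : ∀ (G : Graph′ n) {S Q : VertexSet n} → Disjoint S Q → card S + card Q ≤ k → card Q ≤ 4 → Massed G S Q → Simulates c G S Q
  small⇒simulates G dis le le4 m lab nm = IH G _ _ lab (inst dis (≤-trans le4 (n≤1+n 4)) m) le nm (λ x → <⇒≢ (s≤s le4) (Exc⇒5 x))

  -- A separation whose far side simulates a clique on the separator Q₁ is replaced by that clique; S₁ grows until this is massed.
  reduceRigid : ∀ j (G : Graph′ n) {S X : VertexSet n} {lab : Fin n → Fin c} → Instance G S X → card S + card X ≤ suc k →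
    ¬ Model (E G) (S ∪ˢ X) X lab → ¬ Exc G S X lab → ∀ (S₁ Q₁ : VertexSet n) → card (S ∖ˢ S₁) ≤ j →
    Sep G S X S₁ Q₁ → card Q₁ < card X → (∃ λ v → S₁ v ≡ true) → Simulates c G S₁ Q₁ → ⊥
  reduceRigid j G {S} {X} {lab} I size nm ne S₁ Q₁ le s lt (v₁ , hv₁) sim =
    IH G′ A X lab (inst A-dis (small I) massed′) sizeA nm′ ne′
    where
    G′ = cliqueOn G Q₁
    A = S ∖ˢ S₁
    A-dis : Disjoint A X
    A-dis v = taut 3 (λ s t x → (s ⇒ not x) ⊃ [ s ∧ not t ⇒ not x ]) (S v) (S₁ v) (X v) (disjoint I v)
    splitS : card S ≡ card S₁ + card A
    splitS = card-split S S₁ (inner s)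
    sizeA : card A + card X ≤ k
    sizeA = ≤-pred (≤-trans (+-monoˡ-≤ (card X) (≤-trans (+-monoˡ-≤ (card A) (member⇒card S₁ v₁ hv₁)) (≤-reflexive (sym splitS)))) size)
    denseA : 10 * card A < D G A X
    denseA = +-cancelʳ-< (10 * card S₁) (10 * card A) (D G A X) (begin-strict
      10 * card A + 10 * card S₁ ≡⟨ ring (card A) (card S₁) ⟩
      10 * (card S₁ + card A) ≡⟨ cong (10 *_) (sym splitS) ⟩
      10 * card S <⟨ dense (massed I) ⟩
      D G S X ≤⟨ D-split G s ⟩
      D G A X + D G S₁ Q₁ ≤⟨ +-monoʳ-≤ (D G A X) (sparse (massed I) S₁ Q₁ s lt) ⟩
      D G A X + 10 * card S₁ ∎)
      where
      open ≤-Reasoning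
      ring : ∀ a b → 10 * a + 10 * b ≡ 10 * (b + a)
      ring = solve-∀
    monoA : D G A X ≤ D G′ A X
    monoA = D-mono G G′ A X (λ u v → taut 6 (λ e a b c d r → [ counted e a b c d ⇒ e ∨ r ]) (E G u v) (A u) (X u) (A v) (X v) (Q₁ u ∧ Q₁ v ∧ not (u ≟ᵇ v)))
    Q₁⊆A : ∀ v → (Q₁ v ⇒ A v ∨ X v) ≡ true
    Q₁⊆A v = taut 4 (λ q s x t → (q ⇒ s ∨ x) ⊃ (t ⇒ not q) ⊃ [ q ⇒ (s ∧ not t) ∨ x ]) (Q₁ v) (S v) (X v) (S₁ v) (outer s v) (apart s v)
    S₁A : Disjoint S₁ (A ∪ˢ X)
    S₁A v = taut 3 (λ t s x → (t ⇒ s) ⊃ (s ⇒ not x) ⊃ [ t ⇒ not ((s ∧ not t) ∨ x) ]) (S₁ v) (S v) (X v) (inner s v) (disjoint I v)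
    sparseA : ∀ S″ Q″ → Acc _<_ (card Q″) → Sep G′ A X S″ Q″ → card Q″ < card X → D G′ S″ Q″ ≤ 10 * card S″
    sparseA S″ Q″ (acc rec) s″ lt″ with D G′ S″ Q″ ≤? 10 * card S″
    ... | yes le = le
    ... | no gt = ⊥-elim bad
      where
      -- A dense far side is massed as well, since violations of smaller order are already excluded
      -- by recursion on the order.
      massed″ : Massed G′ S″ Q″
      massed″ = record { dense = ≰⇒> gt ; sparse = λ S‴ Q‴ s‴ lt‴ → sparseA S‴ Q‴ (rec lt‴) (sep-trans G′ s″ s‴) (<-trans lt‴ lt″) }
      sim″ : Simulates c G′ S″ Q″
      sim″ = small⇒simulates G′ (apart s″) (≤-trans (sep-size G′ s″) sizeA) (≤-pred (≤-trans lt″ (small I))) massed″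
      bad : ⊥
      bad with any? (λ q → (Q₁ q ∧ S″ q) B.≟ true)
      -- If S″ contains no vertex of the clique, no clique edge is counted at S″ and the same sets
      -- separate G, against (M2).
      ... | no none = gt (≤-trans (D-mono G′ G S″ Q″ onlyG) (sparse (massed I) S″ Q″ sepG lt″))
        where
        off : ∀ v → (Q₁ v ⇒ not (S″ v)) ≡ true
        off v = taut 2 (λ q s → not (q ∧ s) ⊃ [ q ⇒ not s ]) (Q₁ v) (S″ v) (notB (λ h → none (v , h)))
        onlyG : ∀ u v → (countedPair G′ S″ Q″ u v ⇒ E G u v) ≡ true
        onlyG u v = taut 8 (λ e qu qv d su xu sv xv → (qu ⇒ not su) ⊃ (qv ⇒ not sv) ⊃ [ counted (e ∨ (qu ∧ qv ∧ d)) su xu sv xv ⇒ e ])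
          (E G u v) (Q₁ u) (Q₁ v) (not (u ≟ᵇ v)) (S″ u) (Q″ u) (S″ v) (Q″ v) (off u) (off v)
        sepG : Sep G S X S″ Q″
        sepG = record
          { inner = λ v → taut 3 (λ s t s″ → (s″ ⇒ s ∧ not t) ⊃ [ s″ ⇒ s ]) (S v) (S₁ v) (S″ v) (inner s″ v)
          ; outer = λ v → taut 4 (λ s t x q → (q ⇒ (s ∧ not t) ∨ x) ⊃ [ q ⇒ s ∨ x ]) (S v) (S₁ v) (X v) (Q″ v) (outer s″ v)
          ; apart = apart s″
          ; closed = λ u v → taut 13 (λ e e′ extra su tu xu s″u qu sv tv xv s″v q″v →
                (s″u ⇒ su ∧ not tu) ⊃ (qu ⇒ not s″u) ⊃ (s″u ∧ (e ∨ extra) ∧ ((sv ∧ not tv) ∨ xv) ⇒ s″v ∨ q″v) ⊃ (e ⇒ e′) ⊃ (tv ∧ e′ ∧ (su ∨ xu) ⇒ tu ∨ qu) ⊃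
                [ s″u ∧ e ∧ (sv ∨ xv) ⇒ s″v ∨ q″v ])
              (E G u v) (E G v u) (Q₁ u ∧ Q₁ v ∧ not (u ≟ᵇ v)) (S u) (S₁ u) (X u) (S″ u) (Q₁ u) (S v) (S₁ v) (X v) (S″ v) (Q″ v)
              (inner s″ u) (off u) (closed s″ u v) (symE G u v) (closed s v u) }
      -- Otherwise the clique lies in S″ ∪ Q″. Then S₁ may be added to S″: the union lies behind Q″
      -- and still simulates, because a model for S″ can be filled in by S₁. The replacement starts
      -- again with this larger far side.
      ... | yes (q , hq) = again j le
        where
        Q₁⊆ : ∀ v → (Q₁ v ⇒ S″ v ∨ Q″ v) ≡ true
        Q₁⊆ v with v F.≟ q
        ... | yes refl = taut 3 (λ a s b → s ⊃ [ a ⇒ s ∨ b ]) (Q₁ q) (S″ q) (Q″ q) (∧-right {Q₁ q} hq)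
        ... | no ne = taut 8 (λ e qq qv d s″q ax s″v q″v → qq ⊃ s″q ⊃ d ⊃ (s″q ∧ (e ∨ (qq ∧ qv ∧ d)) ∧ ax ⇒ s″v ∨ q″v) ⊃ (qv ⇒ ax) ⊃ [ qv ⇒ s″v ∨ q″v ])
            (E G q v) (Q₁ q) (Q₁ v) (not (q ≟ᵇ v)) (S″ q) (A v ∨ X v) (S″ v) (Q″ v)
            (∧-left hq) (∧-right {Q₁ q} hq) (≢⇒≟ᵇ q v (λ e → ne (sym e))) (closed s″ q v) (Q₁⊆A v)
        bigger : VertexSet n
        bigger = S″ ∪ˢ S₁
        sep-bigger : Sep G S X bigger Q″
        sep-bigger = record
          { inner = λ v → taut 3 (λ s t s″ → (s″ ⇒ s ∧ not t) ⊃ (t ⇒ s) ⊃ [ s″ ∨ t ⇒ s ]) (S v) (S₁ v) (S″ v) (inner s″ v) (inner s v)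
          ; outer = λ v → taut 4 (λ s t x q → (q ⇒ (s ∧ not t) ∨ x) ⊃ [ q ⇒ s ∨ x ]) (S v) (S₁ v) (X v) (Q″ v) (outer s″ v)
          ; apart = λ v → taut 5 (λ s t x s″ q → (s″ ⇒ not q) ⊃ (q ⇒ (s ∧ not t) ∨ x) ⊃ (t ⇒ s) ⊃ (s ⇒ not x) ⊃ [ s″ ∨ t ⇒ not q ])
              (S v) (S₁ v) (X v) (S″ v) (Q″ v) (apart s″ v) (outer s″ v) (inner s v) (disjoint I v)
          ; closed = λ u v → taut 10 (λ e extra s″u tu sv tv xv q₁v s″v q″v →
                (s″u ∧ (e ∨ extra) ∧ ((sv ∧ not tv) ∨ xv) ⇒ s″v ∨ q″v) ⊃ (tu ∧ e ∧ (sv ∨ xv) ⇒ tv ∨ q₁v) ⊃ (q₁v ⇒ s″v ∨ q″v) ⊃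
                [ (s″u ∨ tu) ∧ e ∧ (sv ∨ xv) ⇒ (s″v ∨ tv) ∨ q″v ])
              (E G u v) (Q₁ u ∧ Q₁ v ∧ not (u ≟ᵇ v)) (S″ u) (S₁ u) (S v) (S₁ v) (X v) (Q₁ v) (S″ v) (Q″ v)
              (closed s″ u v) (closed s u v) (Q₁⊆ v) }
        sim-bigger : Simulates c G bigger Q″
        sim-bigger lab′ nm″ = sim″ lab′ (λ M → sim (λ v → fromMaybe l₀ (β M v)) (λ N → nm″
          (enlarge (λ u v h → h) (λ v → taut 3 (λ a q t → ((a ∨ q) ∨ t) ⊃ [ (a ∨ t) ∨ q ]) (S″ v) (Q″ v) (S₁ v)) (fillClique G l₀ dis″ M N Q₁⊆))))
          where
          dis″ : Disjoint S₁ (S″ ∪ˢ Q″)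
          dis″ v = taut 5 (λ s t x s″ q → (s″ ⇒ s ∧ not t) ⊃ (q ⇒ (s ∧ not t) ∨ x) ⊃ (t ⇒ not ((s ∧ not t) ∨ x)) ⊃ [ t ⇒ not (s″ ∨ q) ])
            (S v) (S₁ v) (X v) (S″ v) (Q″ v) (inner s″ v) (outer s″ v) (S₁A v)
        fewer : card (S ∖ˢ bigger) < card (S ∖ˢ S₁)
        fewer = card-strict {P = S ∖ˢ bigger} {S ∖ˢ S₁} (λ v → taut 3 (λ s t s″ → (s ∧ not (s″ ∨ t)) ⊃ [ s ∧ not t ]) (S v) (S₁ v) (S″ v)) q
          (⇒-elim _ _ (inner s″ q) (∧-right {Q₁ q} hq)) (not⁻ (taut 3 (λ s t s″ → s″ ⊃ [ not (s ∧ not (s″ ∨ t)) ]) (S q) (S₁ q) (S″ q) (∧-right {Q₁ q} hq)))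
        again : ∀ j → card (S ∖ˢ S₁) ≤ j → ⊥
        again zero le = <⇒≱ fewer (≤-trans le z≤n)
        again (suc j) le = reduceRigid j G I size nm ne bigger Q″ (≤-pred (≤-trans fewer le)) sep-bigger lt″
          (v₁ , taut 2 (λ a b → b ⊃ [ a ∨ b ]) (S″ v₁) (S₁ v₁) hv₁) sim-bigger
    massed′ : Massed G′ A X
    massed′ = record { dense = ≤-trans denseA monoA ; sparse = λ S″ Q″ → sparseA S″ Q″ (<-wellFounded _) }
    nm′ : ¬ Model (E G′) (A ∪ˢ X) X lab
    nm′ M = sim (λ v → fromMaybe l₀ (β M v)) (λ N → nm (enlarge (λ u v h → h)
      (λ v → taut 3 (λ s t x → (t ⇒ s) ⊃ (((s ∧ not t) ∨ x) ∨ t) ⊃ [ s ∨ x ]) (S v) (S₁ v) (X v) (inner s v)) (fillClique G l₀ S₁A M N Q₁⊆A)))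
    ne′ : ¬ Exc G′ A X lab
    ne′ (exc ((r , lr) , a , b , cp)) = ne (exc ((r , lr) , a , b , record
      { distinct = distinct cp ; a∈S = ∧-left (a∈S cp) ; b∈S = ∧-left (b∈S cp)
      ; a-full = λ x hx → old a x (a∈S cp) hx (a-full cp x hx) ; b-full = λ x hx → old b x (b∈S cp) hx (b-full cp x hx) }))
      where
      bound : D G′ A X ≤ 10 * card A + 2
      bound = exceptional-bound G′ A-dis lr cp (OneMoreLink.grouping G′ A-dis lr cp nm′) (sparse massed′)
      -- Edges of the clique with an end in A would make the smaller graph too dense.
      old : ∀ a x → A a ≡ true → X x ≡ true → E G′ a x ≡ true → E G a x ≡ true
      old a x ha hx e′ with E G a x in e
      ... | true = refl
      ... | false = ⊥-elim (<⇒≱ (≤-trans (+-monoˡ-≤ 2 denseA) (D-extra G G′ A X a x a≢x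
            (λ u v → taut 6 (λ e a b c d r → [ counted e a b c d ⇒ e ∨ r ]) (E G u v) (A u) (X u) (A v) (X v) (Q₁ u ∧ Q₁ v ∧ not (u ≟ᵇ v)))
            (cong (_∧ ((A a ∧ (A x ∨ X x)) ∨ (X a ∧ A x))) e) inn)) bound)
        where
        a≢x : a ≢ x
        a≢x refl = absurdB hx (⇒-elim _ _ (A-dis a) ha)
        inn : countedPair G′ A X a x ≡ true
        inn = taut 5 (λ q aa ax xa xx → q ⊃ aa ⊃ xx ⊃ [ counted q aa xa ax xx ]) (E G a x ∨ (Q₁ a ∧ Q₁ x ∧ not (a ≟ᵇ x))) (A a) (A x) (X a) (X x)
          (subst (λ b → b ∨ (Q₁ a ∧ Q₁ x ∧ not (a ≟ᵇ x)) ≡ true) (sym e) e′) ha hx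

-- Contraction of an edge, and separations of order `card X`

snoc-enumerates : ∀ {n m} {r : Fin m → Fin n} {P : VertexSet n} v → Enumerates r P → P v ≡ false → Enumerates (snoc v r) (insert v P)
snoc-enumerates {n} {m} {r} {P} v en pv = record { injective = inj ; member = mem ; hits = λ w h → hit w (∨-elim {w ≟ᵇ v} h) }
  where
  new : ∀ i → r i ≢ v
  new i e = false≢true pv (subst (λ w → P w ≡ true) e (member en i))
  inj : Injective (snoc v r)
  inj zero zero e = refl
  inj zero (suc j) e = ⊥-elim (new j (sym e))
  inj (suc i) zero e = ⊥-elim (new i e)
  inj (suc i) (suc j) e = cong suc (injective en i j e)
  mem : ∀ i → insert v P (snoc v r i) ≡ true
  mem zero rewrite ≟ᵇ-refl v = refl
  mem (suc i) = taut 2 (λ a b → b ⊃ [ a ∨ b ]) (r i ≟ᵇ v) (P (r i)) (member en i)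
  hit : ∀ w → (w ≟ᵇ v) ≡ true ⊎ P w ≡ true → ∃ λ i → snoc v r i ≡ w
  hit w (inj₁ e) = zero , sym (≟ᵇ⇒≡ w v e)
  hit w (inj₂ e) = let (i , p) = hits en w e in suc i , p

-- The separations that (M2) does not control when v is contracted into u. Undoing the contraction
-- raises the order by one, so a dense far side may appear behind a separator of order exactly
-- `card X`, which contains v, and u unless u is a root.
Handler : ∀ {n} → Graph′ n → (S X : VertexSet n) → Fin n → Fin n → Set
Handler G S X v u = ∀ S″ Q → Sep G S X S″ Q → card Q ≡ card X → 10 * card S″ < D G S″ Q → Q v ≡ true → (S u ≡ true → Q u ≡ true) → ⊥

module Contraction {n c} (l₀ : Fin c) (k : ℕ) (IH : Claim n c k) where

  open Reduce l₀ k IH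

  module Contracted (G : Graph′ n) {S X : VertexSet n} {lab : Fin n → Fin c} (I : Instance G S X) (size : card S + card X ≤ suc k)
    (nm : ¬ Model (E G) (S ∪ˢ X) X lab) (ne : ¬ Exc G S X lab) (v u : Fin n) (v∈S : S v ≡ true) (nu : nbhd G S X v u ≡ true)
    (few : card (λ w → nbhd G S X v w ∧ virtual G X u w) ≤ 4) (handler : Handler G S X v u) where

    G′ = contract G v u
    S′ = delete v S

    uv : E G u v ≡ true
    uv = adjacent-sym G v u (∧-right {S u ∨ X u} nu)

    vu : E G v u ≡ true
    vu = ∧-right {S u ∨ X u} nu

    Xv : X v ≡ false
    Xv = not⁻ (⇒-elim _ _ (disjoint I v) v∈S)

    u≢v : u ≢ v
    u≢v refl = false≢true (irrE G u) uv

    S′-dis : Disjoint S′ X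
    S′-dis w = taut 3 (λ s d x → (s ⇒ not x) ⊃ [ s ∧ d ⇒ not x ]) (S w) (not (w ≟ᵇ v)) (X w) (disjoint I w)

    size′ : card S′ + card X ≤ k
    size′ = ≤-pred (≤-trans (≤-reflexive (cong (_+ card X) (sym (card-delete S v v∈S)))) size)

    dense′ : 10 * card S′ < D G′ S′ X
    dense′ = +-cancelʳ-< 10 (10 * card S′) (D G′ S′ X) (begin-strict
      10 * card S′ + 10 ≡⟨ ring (card S′) ⟩
      10 * suc (card S′) ≡⟨ cong (10 *_) (sym (card-delete S v v∈S)) ⟩
      10 * card S <⟨ dense (massed I) ⟩
      D G S X ≤⟨ D-contract G {S} {X} (disjoint I) v∈S nu ⟩
      -- The loss is at most 2 · (1 + 4), which is the budget of the vertex v that leaves S.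
      D G′ S′ X + 2 * suc (card (λ w → nbhd G S X v w ∧ virtual G X u w)) ≤⟨ +-monoʳ-≤ (D G′ S′ X) (*-monoʳ-≤ 2 (s≤s few)) ⟩
      D G′ S′ X + 10 ∎)
      where
      open ≤-Reasoning
      ring : ∀ s → 10 * s + 10 ≡ 10 * suc s
      ring = solve-∀

    keepEdge : ∀ x y → E G x y ≡ true → E G′ x y ≡ true
    keepEdge x y e = taut 3 (λ d e r → d ⊃ e ⊃ [ d ∧ (e ∨ r) ]) (not (x ≟ᵇ y)) (E G x y) _ (≢⇒≟ᵇ x y (λ { refl → false≢true (irrE G x) e })) e

    viaV : ∀ x → x ≢ u → E G x v ≡ true → E G′ x u ≡ true
    viaV x ne e rewrite ≟ᵇ-refl u = taut 4 (λ d e a f → d ⊃ f ⊃ [ d ∧ (e ∨ a ∨ f) ]) (not (x ≟ᵇ u)) (E G x u) ((x ≟ᵇ u) ∧ E G v u) (E G x v) (≢⇒≟ᵇ x u ne) e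

    inRegion : ∀ y → y ≢ v → (S y ∨ X y) ≡ true → (S′ y ∨ X y) ≡ true
    inRegion y ne h = taut 3 (λ s d x → d ⊃ (s ∨ x) ⊃ [ (s ∧ d) ∨ x ]) (S y) (not (y ≟ᵇ v)) (X y) (≢⇒≟ᵇ y v ne) h

    outsideV : ∀ {S″ Q″} → Sep G′ S′ X S″ Q″ → S″ v ≡ false × Q″ v ≡ false
    outsideV {S″} {Q″} s = not⁻ (notB (λ h → false≢true (delete-self S v) (⇒-elim _ _ (inner s v) h))) ,
      not⁻ (notB (λ h → no-v (⇒-elim _ _ (outer s v) h)))
      where
      no-v : (S′ v ∨ X v) ≡ true → ⊥
      no-v h with ∨-elim {S′ v} h
      ... | inj₁ x = false≢true (delete-self S v) x
      ... | inj₂ x = false≢true Xv x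

    weaken : ∀ {S″ Q″} → Sep G′ S′ X S″ Q″ → ∀ w → (Q″ w ⇒ S w ∨ X w) ≡ true
    weaken {S″} {Q″} s w = taut 4 (λ s d x q → (q ⇒ (s ∧ d) ∨ x) ⊃ [ q ⇒ s ∨ x ]) (S w) (not (w ≟ᵇ v)) (X w) (Q″ w) (outer s w)

    sparse′ : ∀ S″ Q″ → Acc _<_ (card Q″) → Sep G′ S′ X S″ Q″ → card Q″ < card X → D G′ S″ Q″ ≤ 10 * card S″
    sparse′ S″ Q″ (acc rec) s lt with D G′ S″ Q″ ≤? 10 * card S″
    ... | yes le = le
    ... | no gt = ⊥-elim (split (case-bool (Q″ u)))
      where
      ∉ = outsideV s
      massed″ : Massed G′ S″ Q″
      massed″ = record { dense = ≰⇒> gt ; sparse = λ S‴ Q‴ s‴ lt‴ → sparse′ S‴ Q‴ (rec lt‴) (sep-trans G′ s s‴) (<-trans lt‴ lt) }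
      sim″ : Simulates c G′ S″ Q″
      sim″ = small⇒simulates G′ (apart s) (≤-trans (sep-size G′ s) size′) (≤-pred (≤-trans lt (small I))) massed″
      split : Q″ u ≡ true ⊎ not (Q″ u) ≡ true → ⊥
      -- If u lies in the separator, v is added to it. By `D-uncontract` no counted edge is lost,
      -- and the new order is either still small, against (M2), or equal to `card X`, which is left
      -- to the handler.
      split (inj₁ qu) = compare (card (insert v Q″) N.<? card X)
        where
        Q⁺ = insert v Q″
        sep⁺ : Sep G S X S″ Q⁺
        sep⁺ = record
          { inner = λ w → taut 3 (λ s d s″ → (s″ ⇒ s ∧ d) ⊃ [ s″ ⇒ s ]) (S w) (not (w ≟ᵇ v)) (S″ w) (inner s w)
          ; outer = λ w → ⇒-intro _ _ (λ h → out w (∨-elim {w ≟ᵇ v} h))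
          ; apart = λ w → ⇒-intro _ _ (λ h → notB (λ q → ap w h (∨-elim {w ≟ᵇ v} q)))
          ; closed = λ x y → ⇒-intro _ _ (λ h → clo x y (∧-left {S″ x} h) (∧-left (∧-right {S″ x} h)) (∧-right {E G x y} (∧-right {S″ x} h))) }
          where
          out : ∀ w → (w ≟ᵇ v) ≡ true ⊎ Q″ w ≡ true → (S w ∨ X w) ≡ true
          out w (inj₁ e) rewrite ≟ᵇ⇒≡ w v e | v∈S = refl
          out w (inj₂ q) = ⇒-elim _ _ (weaken s w) q
          ap : ∀ w → S″ w ≡ true → (w ≟ᵇ v) ≡ true ⊎ Q″ w ≡ true → ⊥
          ap w h (inj₁ e) rewrite ≟ᵇ⇒≡ w v e = false≢true (proj₁ ∉) h
          ap w h (inj₂ q) = absurdB q (⇒-elim _ _ (apart s w) h)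
          clo : ∀ x y → S″ x ≡ true → E G x y ≡ true → (S y ∨ X y) ≡ true → (S″ y ∨ Q⁺ y) ≡ true
          clo x y hx e r with y F.≟ v
          ... | yes _ = taut 1 (λ a → [ a ∨ true ]) (S″ y)
          ... | no y≢v = ⇒-elim _ _ (closed s x y) (∧-intro hx (∧-intro (keepEdge x y e) (inRegion y y≢v r)))
        D⁺ : 10 * card S″ < D G S″ Q⁺
        D⁺ = ≤-trans (≰⇒> gt) (D-uncontract G qu (apart s) (proj₁ ∉) (proj₂ ∉))
        compare : Dec (card Q⁺ < card X) → ⊥
        compare (yes small⁺) = <⇒≱ D⁺ (sparse (massed I) S″ Q⁺ sep⁺ small⁺)
        compare (no big) = handler S″ Q⁺ sep⁺ (≤-antisym (≤-trans (≤-reflexive (card-insert Q″ v (proj₂ ∉))) lt) (≮⇒≥ big)) D⁺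
          (subst (λ b → b ∨ Q″ v ≡ true) (sym (≟ᵇ-refl v)) (taut 1 (λ q → [ true ∨ q ]) (Q″ v))) (λ _ → taut 2 (λ a q → q ⊃ [ a ∨ q ]) (u ≟ᵇ v) (Q″ u) qu)
      -- If u avoids the separator, v follows u to its side and the order is unchanged. The far side
      -- simulates in the contracted graph, hence also in G.
      split (inj₂ qu) = reduceRigid (card (S ∖ˢ S⁺)) G I size nm ne S⁺ Q″ ≤-refl sep⁺ lt
          (let (w , h) = dense⇒nonempty G′ S″ Q″ (≰⇒> gt) in w , taut 2 (λ a b → a ⊃ [ a ∨ b ]) (S″ w) (S″ u ∧ (w ≟ᵇ v)) h)
          (λ lab′ no-model → sim″ lab′ (λ M → no-model (enlarge (λ x y h → h) region (uncontract G v u uv v∉ M))))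
        where
        S⁺ : VertexSet n
        S⁺ w = S″ w ∨ (S″ u ∧ (w ≟ᵇ v))
        v∉ : (S″ v ∨ Q″ v) ≡ false
        v∉ rewrite proj₁ ∉ | proj₂ ∉ = refl
        region : ∀ w → ((S″ w ∨ Q″ w) ∨ ((S″ u ∨ Q″ u) ∧ (w ≟ᵇ v))) ≡ true → (S⁺ w ∨ Q″ w) ≡ true
        region w = taut 5 (λ s q su qu d → not qu ⊃ ((s ∨ q) ∨ ((su ∨ qu) ∧ d)) ⊃ [ (s ∨ (su ∧ d)) ∨ q ]) (S″ w) (Q″ w) (S″ u) (Q″ u) (w ≟ᵇ v) qu
        enter : ∀ w → S″ w ≡ true → S⁺ w ≡ true
        enter w h rewrite h = refl
        atV : S″ u ≡ true → S⁺ v ≡ true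
        atV h rewrite h | ≟ᵇ-refl v = taut 1 (λ a → [ a ∨ true ]) (S″ v)
        leave : ∀ w → S⁺ w ≡ true → S″ w ≡ true ⊎ (S″ u ≡ true × w ≡ v)
        leave w h with ∨-elim {S″ w} h
        ... | inj₁ a = inj₁ a
        ... | inj₂ a = inj₂ (∧-left a , ≟ᵇ⇒≡ w v (∧-right {S″ u} a))
        target : ∀ y → (S″ y ∨ Q″ y) ≡ true → (S⁺ y ∨ Q″ y) ≡ true
        target y = taut 3 (λ s q t → (s ∨ q) ⊃ [ (s ∨ t) ∨ q ]) (S″ y) (Q″ y) (S″ u ∧ (y ≟ᵇ v))
        inS : ∀ y → S⁺ y ≡ true → (S⁺ y ∨ Q″ y) ≡ true
        inS y h rewrite h = refl
        clo : ∀ x y → S⁺ x ≡ true → E G x y ≡ true → (S y ∨ X y) ≡ true → (S⁺ y ∨ Q″ y) ≡ true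
        clo x y hx e r = go (leave x hx) (y F.≟ v)
          where
          go : S″ x ≡ true ⊎ (S″ u ≡ true × x ≡ v) → Dec (y ≡ v) → (S⁺ y ∨ Q″ y) ≡ true
          go (inj₁ sx) (no y≢v) = target y (⇒-elim _ _ (closed s x y) (∧-intro sx (∧-intro (keepEdge x y e) (inRegion y y≢v r))))
          go (inj₁ sx) (yes refl) = fromU (x F.≟ u)
            where
            fromU : Dec (x ≡ u) → (S⁺ y ∨ Q″ y) ≡ true
            fromU (yes refl) = inS y (atV sx)
            fromU (no x≢u) = inS y (atV (taut 2 (λ a q → not q ⊃ (a ∨ q) ⊃ [ a ]) (S″ u) (Q″ u) qu
                  (⇒-elim _ _ (closed s x u) (∧-intro sx (∧-intro (viaV x x≢u e) (inRegion u u≢v (∧-left nu)))))))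
          go (inj₂ (su , refl)) (yes refl) = false≢true (irrE G x) e
          go (inj₂ (su , refl)) (no y≢v) = toU (y F.≟ u)
            where
            toU : Dec (y ≡ u) → (S⁺ y ∨ Q″ y) ≡ true
            toU (yes refl) = inS y (enter y su)
            toU (no y≢u) = target y (⇒-elim _ _ (closed s u y) (∧-intro su (∧-intro (adjacent-sym G′ y u (viaV y y≢u (adjacent-sym G x y e))) (inRegion y y≢v r))))
        sep⁺ : Sep G S X S⁺ Q″
        sep⁺ = record
          { inner = λ w → ⇒-intro _ _ (λ h → inn w (leave w h))
          ; outer = weaken s
          ; apart = λ w → ⇒-intro _ _ (λ h → notB (λ q → ap w q (leave w h)))
          ; closed = λ x y → ⇒-intro _ _ (λ h → clo x y (∧-left {S⁺ x} h) (∧-left (∧-right {S⁺ x} h)) (∧-right {E G x y} (∧-right {S⁺ x} h))) }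
          where
          inn : ∀ w → S″ w ≡ true ⊎ (S″ u ≡ true × w ≡ v) → S w ≡ true
          inn w (inj₁ h) = ∧-left (⇒-elim (S″ w) (S′ w) (inner s w) h)
          inn w (inj₂ (_ , refl)) = v∈S
          ap : ∀ w → Q″ w ≡ true → S″ w ≡ true ⊎ (S″ u ≡ true × w ≡ v) → ⊥
          ap w q (inj₁ h) = absurdB q (⇒-elim _ _ (apart s w) h)
          ap w q (inj₂ (_ , refl)) = false≢true (proj₂ ∉) q

    massed′ : Massed G′ S′ X
    massed′ = record { dense = dense′ ; sparse = λ S″ Q″ → sparse′ S″ Q″ (<-wellFounded _) }

    nm′ : ¬ Model (E G′) (S′ ∪ˢ X) X lab
    nm′ M = nm (enlarge (λ x y h → h) region (uncontract G v u uv v∉ M))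
      where
      v∉ : (S′ v ∨ X v) ≡ false
      v∉ rewrite delete-self S v = Xv
      region : ∀ w → ((S′ w ∨ X w) ∨ ((S′ u ∨ X u) ∧ (w ≟ᵇ v))) ≡ true → (S w ∨ X w) ≡ true
      region w h with w F.≟ v
      ... | yes refl rewrite v∈S = refl
      ... | no _ = taut 3 (λ s x r → (((s ∧ true) ∨ x) ∨ (r ∧ false)) ⊃ [ s ∨ x ]) (S w) (X w) (S′ u ∨ X u) h

  -- In an exceptional contracted graph, v together with the pair a , b receives at least 13 edges from X.
  thirdHelper : (G : Graph′ n) {S X : VertexSet n} {lab : Fin n → Fin 5} (I : Instance G S X) → ¬ Model (E G) (S ∪ˢ X) X lab →
    (v u : Fin n) → S v ≡ true → Handler G S X v u → (S′-dis : Disjoint (delete v S) X) {r : Fin 5 → Fin n} (lr : LabelledRoots X lab r)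
    {a b : Fin n} (cp : CompletePair (contract G v u) (delete v S) X a b) → Grouping (contract G v u) S′-dis lr cp → not (S u ∧ not (u ≟ᵇ a) ∧ not (u ≟ᵇ b)) ≡ true → ⊥
  thirdHelper G {S} {X} {lab} I nm v u v∈S handler S′-dis {r} lr {a} {b} cp Γ near = nm (threeHelpers G (disjoint I) lr h (injective hK) (λ t → K⊆S (h t) (member hK t)) many)
    where
    S′ = delete v S
    G′ = contract G v u
    g = group Γ
    h = snoc v (pairOf a b)
    K = insert v (pairSet a b)
    v∉ab : pairSet a b v ≡ false
    v∉ab = not⁻ (notB (λ q → lem (∨-elim {v ≟ᵇ a} q)))
      where
      lem : (v ≟ᵇ a) ≡ true ⊎ (v ≟ᵇ b) ≡ true → ⊥
      lem (inj₁ e) = false≢true (delete-self S v) (subst (λ w → S′ w ≡ true) (sym (≟ᵇ⇒≡ v a e)) (a∈S cp))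
      lem (inj₂ e) = false≢true (delete-self S v) (subst (λ w → S′ w ≡ true) (sym (≟ᵇ⇒≡ v b e)) (b∈S cp))
    hK : Enumerates h K
    hK = snoc-enumerates v (pair-enumerates (distinct cp)) v∉ab
    K-elim : ∀ w → K w ≡ true → w ≡ v ⊎ w ≡ a ⊎ w ≡ b
    K-elim w q with ∨-elim {w ≟ᵇ v} q
    ... | inj₁ e = inj₁ (≟ᵇ⇒≡ w v e)
    ... | inj₂ q′ with ∨-elim {w ≟ᵇ a} q′
    ...   | inj₁ e = inj₂ (inj₁ (≟ᵇ⇒≡ w a e))
    ...   | inj₂ e = inj₂ (inj₂ (≟ᵇ⇒≡ w b e))
    K⊆S : ∀ w → K w ≡ true → S w ≡ true
    K⊆S w q with K-elim w q
    ... | inj₁ refl = v∈S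
    ... | inj₂ (inj₁ refl) = ∧-left (a∈S cp)
    ... | inj₂ (inj₂ refl) = ∧-left (b∈S cp)
    W Q : Fin 5 → VertexSet n
    W i w = S w ∧ not (K w) ∧ (g w ≟ᵇ i)
    -- In G a group may also be adjacent to v, so v joins its fence. The order is then at most five:
    -- below five (M2) applies, and at five the handler does, since u is a root or one of a, b.
    Q i = insert v (fence r a b i)
    rest : VertexSet n
    rest = OneMoreLink.rest G′ {S′} S′-dis lr cp
    W-rest : ∀ i w → W i w ≡ true → rest w ≡ true
    W-rest i w = taut 5 (λ s v a b g → (s ∧ not (v ∨ (a ∨ b)) ∧ g) ⊃ [ (s ∧ not v) ∧ not a ∧ not b ]) (S w) (w ≟ᵇ v) (w ≟ᵇ a) (w ≟ᵇ b) (g w ≟ᵇ i)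
    W-group : ∀ i w → W i w ≡ true → g w ≡ i
    W-group i w q = ≟ᵇ⇒≡ (g w) i (∧-right {not (K w)} (∧-right {S w} q))
    keepEdge : ∀ x y → E G x y ≡ true → E G′ x y ≡ true
    keepEdge x y e = taut 3 (λ d e r → d ⊃ e ⊃ [ d ∧ (e ∨ r) ]) (not (x ≟ᵇ y)) (E G x y) _ (≢⇒≟ᵇ x y (λ { refl → false≢true (irrE G x) e })) e
    clo : ∀ i x y → W i x ≡ true → E G x y ≡ true → (S y ∨ X y) ≡ true → (W i y ∨ Q i y) ≡ true
    clo i x y hx e sx with case-bool (K y)
    ... | inj₁ ky = taut 6 (λ w v a b p q → (v ∨ (a ∨ b)) ⊃ [ w ∨ (v ∨ (a ∨ (b ∨ (p ∨ q)))) ]) (W i y) (y ≟ᵇ v) (y ≟ᵇ a) (y ≟ᵇ b) (y ≟ᵇ r i) (y ≟ᵇ r (sh (sh i))) ky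
    ... | inj₂ ky with ∨-elim {S y} sx
    ...   | inj₁ s = taut 2 (λ a b → a ⊃ [ a ∨ b ]) (W i y) (Q i y) (∧-intro s (∧-intro ky (≡⇒≟ᵇ (trans (sym (group-edge Γ x y (W-rest i x hx)
              (taut 4 (λ s v a b → s ⊃ not (v ∨ (a ∨ b)) ⊃ [ (s ∧ not v) ∧ not a ∧ not b ]) (S y) (y ≟ᵇ v) (y ≟ᵇ a) (y ≟ᵇ b) s ky) (keepEdge x y e))) (W-group i x hx)))))
    ...   | inj₂ x∈ with hits (enum lr) y x∈
    ...     | p , refl with group-root Γ x p (W-rest i x hx) (keepEdge x (r p) e)
    ...       | inj₁ q = taut 6 (λ w v a b p q → p ⊃ [ w ∨ (v ∨ (a ∨ (b ∨ (p ∨ q)))) ]) (W i (r p)) (r p ≟ᵇ v) (r p ≟ᵇ a) (r p ≟ᵇ b) (r p ≟ᵇ r i) (r p ≟ᵇ r (sh (sh i)))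
                    (≡⇒≟ᵇ (cong r (trans q (W-group i x hx))))
    ...       | inj₂ q = taut 6 (λ w v a b p q → q ⊃ [ w ∨ (v ∨ (a ∨ (b ∨ (p ∨ q)))) ]) (W i (r p)) (r p ≟ᵇ v) (r p ≟ᵇ a) (r p ≟ᵇ b) (r p ≟ᵇ r i) (r p ≟ᵇ r (sh (sh i)))
                    (≡⇒≟ᵇ (cong r (trans q (cong (λ t → sh (sh t)) (W-group i x hx)))))
    Q-elim : ∀ i w → Q i w ≡ true → K w ≡ true ⊎ X w ≡ true
    Q-elim i w q with case-bool (K w)
    ... | inj₁ k = inj₁ k
    ... | inj₂ k with ∨-elim {w ≟ᵇ r i} (taut 5 (λ v a b p q → (v ∨ (a ∨ (b ∨ (p ∨ q)))) ⊃ not (v ∨ (a ∨ b)) ⊃ [ p ∨ q ]) (w ≟ᵇ v) (w ≟ᵇ a) (w ≟ᵇ b) (w ≟ᵇ r i) (w ≟ᵇ r (sh (sh i))) q k)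
    ...   | inj₁ e = inj₂ (subst (λ t → X t ≡ true) (sym (≟ᵇ⇒≡ w (r i) e)) (member (enum lr) i))
    ...   | inj₂ e = inj₂ (subst (λ t → X t ≡ true) (sym (≟ᵇ⇒≡ w _ e)) (member (enum lr) (sh (sh i))))
    sepW : ∀ i → Sep G S X (W i) (Q i)
    sepW i = record
      { inner = λ w → taut 2 (λ s r → [ s ∧ r ⇒ s ]) (S w) _
      ; outer = λ w → ⇒-intro _ _ (λ q → out w (Q-elim i w q))
      ; apart = λ w → ⇒-intro _ _ (λ hw → notB (λ q → ap w hw (Q-elim i w q)))
      ; closed = λ x y → ⇒-intro _ _ (λ q → clo i x y (∧-left {W i x} q) (∧-left (∧-right {W i x} q)) (∧-right {E G x y} (∧-right {W i x} q))) }
      where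
      out : ∀ w → K w ≡ true ⊎ X w ≡ true → (S w ∨ X w) ≡ true
      out w (inj₁ k) rewrite K⊆S w k = refl
      out w (inj₂ x) = taut 2 (λ s x → x ⊃ [ s ∨ x ]) (S w) (X w) x
      ap : ∀ w → W i w ≡ true → K w ≡ true ⊎ X w ≡ true → ⊥
      ap w hw (inj₁ k) = absurdB k (∧-left {not (K w)} (∧-right {S w} hw))
      ap w hw (inj₂ x) = absurdB x (⇒-elim _ _ (disjoint I w) (∧-left hw))
    Q-card : ∀ i → card (Q i) ≤ card X
    Q-card i = ≤-trans (card-insert≤ (fence r a b i) v) (≤-trans (s≤s (fence-card r a b i)) (≤-reflexive (sym (enumerates-card (enum lr)))))
    u∈ : S u ≡ true → ∀ i → Q i u ≡ true
    u∈ su i = taut 6 (λ s v a b p q → s ⊃ not (s ∧ not a ∧ not b) ⊃ [ v ∨ (a ∨ (b ∨ (p ∨ q))) ]) (S u) (u ≟ᵇ v) (u ≟ᵇ a) (u ≟ᵇ b) (u ≟ᵇ r i) (u ≟ᵇ r (sh (sh i))) su near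
    v∈ : ∀ i → Q i v ≡ true
    v∈ i rewrite ≟ᵇ-refl v = refl
    sparseW : ∀ i → D G (W i) (Q i) ≤ 10 * card (W i)
    sparseW i with D G (W i) (Q i) ≤? 10 * card (W i)
    ... | yes le = le
    ... | no gt with card (Q i) N.<? card X
    ...   | yes lt = sparse (massed I) (W i) (Q i) (sepW i) lt
    ...   | no big = ⊥-elim (handler (W i) (Q i) (sepW i) (≤-antisym (Q-card i) (≮⇒≥ big)) (≰⇒> gt) (v∈ i) (λ su → u∈ su i))
    e = ∑ (λ t → ∑ (λ p → ⟦ E G (h t) (r p) ⟧))
    -- The set K = {v, a, b} has budget 30 and at most 6 ordered pairs inside it. Density gives 30 <
    -- 6 + 2e, where e counts the edges from K to X.
    many : 13 ≤ e
    many = *-cancelˡ-< 2 12 e (+-cancelʳ-< (10 * card (S ∖ˢ K) + 6) 24 (2 * e) (begin-strict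
      24 + (10 * card (S ∖ˢ K) + 6) ≡⟨ ring (card (S ∖ˢ K)) ⟩
      10 * (3 + card (S ∖ˢ K)) ≡⟨ cong (λ t → 10 * t) (trans (cong (_+ card (S ∖ˢ K)) (sym (enumerates-card hK))) (sym (card-split S K (λ w → ⇒-intro _ _ (K⊆S w))))) ⟩
      10 * card S <⟨ dense (massed I) ⟩
      D G S X ≤⟨ D-groups G K g Q (λ w → ⇒-intro _ _ (K⊆S w)) (λ i x y → closed (sepW i) x y) sparseW ⟩
      10 * card (S ∖ˢ K) + D G K X ≤⟨ +-monoʳ-≤ (10 * card (S ∖ˢ K)) (D-core {k = 2} G (λ w → ⇒-intro _ _ (λ q → ⇒-elim _ _ (disjoint I w) (K⊆S w q))) hK (enum lr)) ⟩
      10 * card (S ∖ˢ K) + (6 + 2 * e) ≡⟨ ring′ (card (S ∖ˢ K)) e ⟩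
      2 * e + (10 * card (S ∖ˢ K) + 6) ∎))
      where
      open ≤-Reasoning
      ring : ∀ s → 24 + (10 * s + 6) ≡ 10 * (3 + s)
      ring = solve-∀
      ring′ : ∀ s e → 10 * s + (6 + 2 * e) ≡ 2 * e + (10 * s + 6)
      ring′ = solve-∀

  -- Contraction changes adjacencies only at u. If u lies in S and is neither a nor b, the pair was
  -- complete in G already; otherwise v is a third vertex with many edges to the roots.
  exceptionalContraction : (G : Graph′ n) {S X : VertexSet n} {lab : Fin n → Fin 5} (I : Instance G S X) →
    ¬ Model (E G) (S ∪ˢ X) X lab → ¬ Exc G S X lab → (v u : Fin n) → S v ≡ true → nbhd G S X v u ≡ true → Handler G S X v u →
    ¬ Model (E (contract G v u)) (delete v S ∪ˢ X) X lab → ¬ Exceptional (contract G v u) (delete v S) X lab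
  exceptionalContraction G {S} {X} {lab} I nm ne v u v∈S nu handler nm′ ((r , lr) , a , b , cp) with case-bool (S u ∧ not (u ≟ᵇ a) ∧ not (u ≟ᵇ b))
  ... | inj₁ away = ne (exc ((r , lr) , a , b , record
        { distinct = distinct cp ; a∈S = ∧-left (a∈S cp) ; b∈S = ∧-left (b∈S cp)
        ; a-full = λ x hx → old a x (≟ᵇ⇒≢ u a (∧-left (∧-right {S u} away))) hx (a-full cp x hx)
        ; b-full = λ x hx → old b x (≟ᵇ⇒≢ u b (∧-right {not (u ≟ᵇ a)} (∧-right {S u} away))) hx (b-full cp x hx) }))
    where
    old : ∀ a x → u ≢ a → X x ≡ true → E (contract G v u) a x ≡ true → E G a x ≡ true
    old a x u≢a hx e = taut 6 (λ d e p q f g → (d ∧ (e ∨ (p ∧ f) ∨ (q ∧ g))) ⊃ not p ⊃ not q ⊃ [ e ]) (not (a ≟ᵇ x)) (E G a x) (a ≟ᵇ u) (x ≟ᵇ u) (E G v x) (E G a v) e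
      (≢⇒≟ᵇ a u (λ p → u≢a (sym p))) (≢⇒≟ᵇ x u (λ { refl → absurdB hx (⇒-elim _ _ (disjoint I u) (∧-left away)) }))
  ... | inj₂ near = thirdHelper G I nm v u v∈S handler S′-dis lr cp (OneMoreLink.grouping (contract G v u) S′-dis lr cp nm′) near
    where
    S′-dis : Disjoint (delete v S) X
    S′-dis w = taut 3 (λ s d x → (s ⇒ not x) ⊃ [ s ∧ d ⇒ not x ]) (S w) (not (w ≟ᵇ v)) (X w) (disjoint I w)

  contractEdge : (G : Graph′ n) {S X : VertexSet n} {lab : Fin n → Fin c} → Instance G S X → card S + card X ≤ suc k →
    ¬ Model (E G) (S ∪ˢ X) X lab → ¬ Exc G S X lab → (v u : Fin n) → S v ≡ true → nbhd G S X v u ≡ true →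
    card (λ w → nbhd G S X v w ∧ virtual G X u w) ≤ 4 → Handler G S X v u → ⊥
  contractEdge G {S} {X} {lab} I size nm ne v u v∈S nu few handler = IH G′ S′ X lab (inst S′-dis (small I) massed′) size′ nm′ (no-exc nm nm′ ne)
    where
    open Contracted G I size nm ne v u v∈S nu few handler
    no-exc : ∀ {c} {lab : Fin n → Fin c} → ¬ Model (E G) (S ∪ˢ X) X lab → ¬ Model (E G′) (S′ ∪ˢ X) X lab → ¬ Exc G S X lab → ¬ Exc G′ S′ X lab
    no-exc nm nm′ ne (exc x) = exceptionalContraction G I nm ne v u v∈S nu handler nm′ x

-- A separator Y with nothing but an adjacent complete pair behind it, and no edges between consecutive vertices of Y.
record PairSep {n} (G : Graph′ n) (S X S₁ Y : VertexSet n) : Set where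
  field
    r₁ : Fin 5 → Fin n
    r₁-enum : Enumerates r₁ Y
    {p q} : Fin n
    pair : CompletePair G S₁ Y p q
    pq : E G p q ≡ true
    only : ∀ v → S₁ v ≡ true → v ≡ p ⊎ v ≡ q
    nonconsecutive : ∀ i → E G (r₁ i) (r₁ (sh i)) ≡ true → ⊥

open PairSep public

reached-in : ∀ {n} (G : Graph′ n) (W P : VertexSet n) {v} → (∀ u → P u ≡ true → W u ≡ true) → Reached (within G W) P v → W v ≡ true
reached-in G W P sub (start p) = sub _ p
reached-in G W P sub (more {u} {v} _ e) = ∧-right {E G u v} e

-- A component of the rest lies behind {a , b} and at most two roots, and simulates a clique on its separator.
module Component {n} (G : Graph′ n) {S X : VertexSet n} (dis : Disjoint S X) {lab₅ : Fin n → Fin 5} {r : Fin 5 → Fin n} (lr : LabelledRoots X lab₅ r)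
  {a b : Fin n} (cp : CompletePair G S X a b) (Γ : Grouping G dis lr cp) (ab : E G a b ≡ true) (z : Fin n) (z∈ : OneMoreLink.rest G {S} dis lr cp z ≡ true) where

  private
    rest = OneMoreLink.rest G {S} dis lr cp
    i = group Γ z

  comp : Closure (within G rest) (λ v → v ≟ᵇ z)
  comp = closure (within G rest) (λ v → v ≟ᵇ z)

  C = set comp

  start-rest : ∀ u → (u ≟ᵇ z) ≡ true → rest u ≡ true
  start-rest u e = subst (λ w → rest w ≡ true) (sym (≟ᵇ⇒≡ u z e)) z∈

  C-rest : ∀ v → C v ≡ true → rest v ≡ true
  C-rest v h = reached-in G rest (λ v → v ≟ᵇ z) start-rest (reached comp v h)

  C-group : ∀ v → C v ≡ true → group Γ v ≡ i
  C-group v h = go (reached comp v h)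
    where
    go : ∀ {v} → Reached (within G rest) (λ v → v ≟ᵇ z) v → group Γ v ≡ i
    go (start p) = cong (group Γ) (≟ᵇ⇒≡ _ z p)
    go (more {u} {v} re e) = trans (sym (group-edge Γ u v (reached-in G rest (λ v → v ≟ᵇ z) start-rest re) (∧-right {E G u v} e) (∧-left e))) (go re)

  touched : VertexSet n
  touched v = does (any? (λ w → (C w ∧ E G w v) B.≟ true))

  touched-elim : ∀ v → touched v ≡ true → ∃ λ w → C w ≡ true × E G w v ≡ true
  touched-elim v h with any? (λ w → (C w ∧ E G w v) B.≟ true)
  ... | yes (w , e) = w , ∧-left e , ∧-right {C w} e

  touched-intro : ∀ w v → C w ≡ true → E G w v ≡ true → touched v ≡ true
  touched-intro w v c e with any? (λ w → (C w ∧ E G w v) B.≟ true)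
  ... | yes _ = refl
  ... | no none = ⊥-elim (none (w , ∧-intro c e))

  Q : VertexSet n
  Q v = pairSet a b v ∨ (X v ∧ touched v)

  data Kind (v : Fin n) : Set where
    is-a : v ≡ a → Kind v
    is-b : v ≡ b → Kind v
    is-root : ∀ p → v ≡ r p → touched v ≡ true → p ≡ i ⊎ p ≡ sh (sh i) → Kind v

  kind : ∀ v → Q v ≡ true → Kind v
  kind v h with ∨-elim {pairSet a b v} h
  ... | inj₁ k with ∨-elim {v ≟ᵇ a} k
  ...   | inj₁ e = is-a (≟ᵇ⇒≡ v a e)
  ...   | inj₂ e = is-b (≟ᵇ⇒≡ v b e)
  kind v h | inj₂ k with hits (enum lr) v (∧-left k) | touched-elim v (∧-right {X v} k)
  ... | p , refl | w , cw , e with group-root Γ w p (C-rest w cw) e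
  ...   | inj₁ g = is-root p refl (∧-right {X (r p)} k) (inj₁ (trans g (C-group w cw)))
  ...   | inj₂ g = is-root p refl (∧-right {X (r p)} k) (inj₂ (trans g (cong (λ t → sh (sh t)) (C-group w cw))))

  Q-card : card Q ≤ 4
  Q-card = ≤-trans (card-mono {P = Q} {fence r a b i} (λ v h → lem v (kind v h))) (fence-card r a b i)
    where
    lem : ∀ v → Kind v → fence r a b i v ≡ true
    lem v (is-a refl) rewrite ≟ᵇ-refl v = refl
    lem v (is-b refl) rewrite ≟ᵇ-refl v = taut 1 (λ a → [ a ∨ true ]) (v ≟ᵇ a)
    lem v (is-root p refl _ (inj₁ refl)) rewrite ≟ᵇ-refl (r i) = taut 2 (λ a b → [ a ∨ (b ∨ true) ]) (r i ≟ᵇ a) (r i ≟ᵇ b)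
    lem v (is-root p refl _ (inj₂ refl)) rewrite ≟ᵇ-refl (r (sh (sh i))) = taut 3 (λ a b c → [ a ∨ (b ∨ (c ∨ true)) ]) (r (sh (sh i)) ≟ᵇ a) (r (sh (sh i)) ≟ᵇ b) (r (sh (sh i)) ≟ᵇ r i)

  sepC : Sep G S X C Q
  sepC = record
    { inner = λ v → ⇒-intro _ _ (λ h → ∧-left (C-rest v h))
    ; outer = λ v → ⇒-intro _ _ (λ h → out v (kind v h))
    ; apart = λ v → ⇒-intro _ _ (λ h → notB (λ q → ap v h (kind v q)))
    ; closed = λ u v → ⇒-intro _ _ (λ h → clo u v (∧-left {C u} h) (∧-left (∧-right {C u} h)) (∧-right {E G u v} (∧-right {C u} h))) }
    where
    out : ∀ v → Kind v → (S v ∨ X v) ≡ true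
    out v (is-a refl) rewrite a∈S cp = refl
    out v (is-b refl) rewrite b∈S cp = refl
    out v (is-root p refl _ _) = taut 2 (λ s x → x ⊃ [ s ∨ x ]) (S (r p)) (X (r p)) (member (enum lr) p)
    ap : ∀ v → C v ≡ true → Kind v → ⊥
    ap v h (is-a e) = absurdB (≡⇒≟ᵇ e) (∧-left {not (v ≟ᵇ a)} (∧-right {S v} (C-rest v h)))
    ap v h (is-b e) = absurdB (≡⇒≟ᵇ e) (∧-right {not (v ≟ᵇ a)} (∧-right {S v} (C-rest v h)))
    ap v h (is-root p refl _ _) = absurdB (member (enum lr) p) (⇒-elim _ _ (dis v) (∧-left (C-rest v h)))
    clo : ∀ u v → C u ≡ true → E G u v ≡ true → (S v ∨ X v) ≡ true → (C v ∨ Q v) ≡ true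
    clo u v hu e sx with case-bool (pairSet a b v)
    ... | inj₁ k = taut 3 (λ c p t → p ⊃ [ c ∨ (p ∨ t) ]) (C v) (pairSet a b v) (X v ∧ touched v) k
    ... | inj₂ k with ∨-elim {S v} sx
    ...   | inj₁ s = taut 2 (λ c q → c ⊃ [ c ∨ q ]) (C v) (Q v) (stable comp u v hu (∧-intro e (taut 3 (λ s a b → s ⊃ not (a ∨ b) ⊃ [ s ∧ not a ∧ not b ]) (S v) (v ≟ᵇ a) (v ≟ᵇ b) s k)))
    ...   | inj₂ x = taut 4 (λ c p x t → x ⊃ t ⊃ [ c ∨ (p ∨ (x ∧ t)) ]) (C v) (pairSet a b v) (X v) (touched v) x (touched-intro u v hu e)

  -- The vertices a and b are adjacent to each other and to all roots. The only pair in Q that may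
  -- be nonadjacent consists of the roots i and i + 2, and these are joined through C, which takes
  -- the label of root i.
  simulatesC : ∀ {c} → 2 ≤ c → Simulates c G C Q
  simulatesC {c} lo lab no-model = no-model (record
    { β = β′ ; supp = sup ; root = rt
    ; same = λ x y hx hy e → sm x y hx hy e (close x y (kind x hx) (kind y hy))
    ; link = λ x y hx hy s → lk x y hx hy s (close x y (kind x hx) (kind y hy)) })
    where
    l* = lab (r i)
    β′ : Labelling n c
    β′ v = if Q v then just (lab v) else (if C v then just l* else nothing)
    rt : ∀ x → Q x ≡ true → β′ x ≡ just (lab x)
    rt x h rewrite h = refl
    inC : ∀ v → C v ≡ true → β′ v ≡ just l*
    inC v h rewrite not⁻ (⇒-elim _ _ (apart sepC v) h) | h = refl
    sup : ∀ v l → β′ v ≡ just l → (C v ∨ Q v) ≡ true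
    sup v l h with Q v in q
    ... | true = taut 1 (λ c → [ c ∨ true ]) (C v)
    ... | false with C v
    ...   | true = refl
    data Close (x y : Fin n) : Set where
      eq : x ≡ y → Close x y
      adj : E G x y ≡ true → Close x y
      first : x ≡ r i → touched x ≡ true → touched y ≡ true → Close x y
      second : y ≡ r i → touched x ≡ true → touched y ≡ true → Close x y
    full : ∀ {h} p → (∀ x → X x ≡ true → E G h x ≡ true) → E G h (r p) ≡ true
    full p f = f (r p) (member (enum lr) p)
    close : ∀ x y → Kind x → Kind y → Close x y
    close x y (is-a refl) (is-a refl) = eq refl
    close x y (is-a refl) (is-b refl) = adj ab
    close x y (is-a refl) (is-root p refl _ _) = adj (full p (a-full cp))
    close x y (is-b refl) (is-a refl) = adj (adjacent-sym G a b ab)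
    close x y (is-b refl) (is-b refl) = eq refl
    close x y (is-b refl) (is-root p refl _ _) = adj (full p (b-full cp))
    close x y (is-root p refl _ _) (is-a refl) = adj (adjacent-sym G y (r p) (full p (a-full cp)))
    close x y (is-root p refl _ _) (is-b refl) = adj (adjacent-sym G y (r p) (full p (b-full cp)))
    close x y (is-root p refl t (inj₁ refl)) (is-root q refl t′ _) = first refl t t′
    close x y (is-root p refl t (inj₂ refl)) (is-root q refl t′ (inj₁ refl)) = second refl t t′
    close x y (is-root p refl t (inj₂ refl)) (is-root q refl t′ (inj₂ refl)) = eq refl
    walkC : ∀ {w w′} → C w ≡ true → C w′ ≡ true → Walk (E G) β′ w w′
    walkC {w} {w′} cw cw′ with reached-walk G rest (λ v → v ≟ᵇ z) β′ l* comp inC cw | reached-walk G rest (λ v → v ≟ᵇ z) β′ l* comp inC cw′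
    ... | u , e , _ , p | u′ , e′ , _ , p′ with ≟ᵇ⇒≡ u z e | ≟ᵇ⇒≡ u′ z e′
    ...   | refl | refl = reverse G p ++ʷ p′
    sm : ∀ x y → Q x ≡ true → Q y ≡ true → lab x ≡ lab y → Close x y → Walk (E G) β′ x y
    sm x y hx hy e (eq refl) = done
    sm x y hx hy e (adj k) = hop k (trans (rt x hx) (trans (cong just e) (sym (rt y hy)))) done
    sm x y hx hy e (first refl t t′) with touched-elim x t | touched-elim y t′
    ... | w , cw , k | w′ , cw′ , k′ = hop (adjacent-sym G w x k) (trans (rt x hx) (sym (inC w cw))) (walkC cw cw′ ++ʷ hop k′ (trans (inC w′ cw′) (trans (cong just e) (sym (rt y hy)))) done)
    sm x y hx hy e (second refl t t′) with touched-elim x t | touched-elim y t′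
    ... | w , cw , k | w′ , cw′ , k′ = hop (adjacent-sym G w x k) (trans (rt x hx) (trans (cong just e) (sym (inC w cw)))) (walkC cw cw′ ++ʷ hop k′ (trans (inC w′ cw′) (sym (rt y hy))) done)
    lk : ∀ x y → Q x ≡ true → Q y ≡ true → CycSucc (lab x) (lab y) → Close x y → Link (E G) β′ x y
    lk x y hx hy s (eq refl) = ⊥-elim (succ-irreflexive lo (lab x) s)
    lk x y hx hy s (adj k) = x , y , done , k , done
    lk x y hx hy s (first refl t t′) with touched-elim x t | touched-elim y t′
    ... | w , cw , k | w′ , cw′ , k′ = w′ , y , hop (adjacent-sym G w x k) (trans (rt x hx) (sym (inC w cw))) (walkC cw cw′) , k′ , done
    lk x y hx hy s (second refl t t′) with touched-elim x t | touched-elim y t′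
    ... | w , cw , k | w′ , cw′ , k′ = x , w , done , adjacent-sym G w x k , walkC cw cw′ ++ʷ hop k′ (trans (inC w′ cw′) (sym (rt y hy))) done

card-union : ∀ {n} (S X : VertexSet n) → Disjoint S X → card (S ∪ˢ X) ≡ card S + card X
card-union S X dis = card-+ (S ∪ˢ X) S X (λ v → ≡ᵇ⇒≡ _ _ (≡⇒T (taut 2 (λ s x → (s ⇒ not x) ⊃ [ ⟦ s ∨ x ⟧ ≡ᵇ ⟦ s ⟧ + ⟦ x ⟧ ]) (S v) (X v) (dis v))))

-- The labels of the starts carried along the paths; vertices of Y reached by no path receive d.
endLabels : ∀ {n c E m} {U Y : VertexSet n} {r : Fin m → Fin n} → Linkage E U Y m r → (Fin n → Fin c) → Fin c → Fin n → Fin c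
endLabels {r = r} L lab d v = fromMaybe d (Data.Maybe.map (λ i → lab (r i)) (index (end L) v))
  where import Data.Maybe

endLabels-end : ∀ {n c E m} {U Y : VertexSet n} {r : Fin m → Fin n} (L : Linkage E U Y m r) (lab : Fin n → Fin c) d i → endLabels L lab d (end L i) ≡ lab (r i)
endLabels-end {r = r} L lab d i rewrite index-complete (end L) (end-injective L) i = refl

endLabels-other : ∀ {n c E m} {U Y : VertexSet n} {r : Fin m → Fin n} (L : Linkage E U Y m r) (lab : Fin n → Fin c) d v → image (end L) v ≡ false → endLabels L lab d v ≡ d
endLabels-other L lab d v h with index (end L) v in e
... | nothing = refl
... | just i = false≢true h (subst (λ w → image (end L) w ≡ true) (index-sound (end L) v i e) (image-intro (end L) i))

-- A vertex behind Y other than a and b would lie in a component of the rest, whose separator has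
-- order at most four and is simulated as a clique; `rigid` excludes this.
toPairSep : ∀ {n} (G : Graph′ n) {S X S₁ Y : VertexSet n} {labY : Fin n → Fin 5} → Sep G S X S₁ Y → Massed G S₁ Y → ¬ Model (E G) (S₁ ∪ˢ Y) Y labY →
  Exceptional G S₁ Y labY →
  (∀ C Q → Sep G S₁ Y C Q → card Q < 5 → (∃ λ v → C v ≡ true) → (∀ {c} → 2 ≤ c → Simulates c G C Q) → ⊥) → ¬ ¬ PairSep G S X S₁ Y
toPairSep {n} G {S} {X} {S₁} {Y} s m nm ((r , lr) , a , b , cp) rigid cont = go (OneMoreLink.grouping G (apart s) lr cp nm)
  where
  rest = OneMoreLink.rest G {S₁} (apart s) lr cp
  go : Grouping G (apart s) lr cp → ⊥
  go Γ with any? (λ z → rest z B.≟ true)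
  ... | yes (z , hz) = rigid C Q sepC (s≤s Q-card) (z , base comp z (≟ᵇ-refl z)) simulatesC
    where open Component G (apart s) lr cp Γ (pair-adjacent G (apart s) lr cp Γ (sparse m) (dense m)) z hz
  ... | no none = cont (record
        { r₁ = r ; r₁-enum = enum lr ; pair = cp ; pq = pair-adjacent G (apart s) lr cp Γ (sparse m) (dense m)
        ; only = λ v h → pick v h ; nonconsecutive = OneMoreLink.nonadjacent G (apart s) lr cp nm })
    where
    pick : ∀ v → S₁ v ≡ true → v ≡ a ⊎ v ≡ b
    pick v h with v F.≟ a
    ... | yes e = inj₁ e
    ... | no va with v F.≟ b
    ...   | yes e = inj₂ e
    ...   | no vb = ⊥-elim (none (v , ∧-intro h (∧-intro (≢⇒≟ᵇ v a va) (≢⇒≟ᵇ v b vb))))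

-- The separator Y₂ obstructs the contraction of p into the vertex i of Y₁, so it contains both. The
-- second pair is adjacent to p, hence lies in Y₁ ∪ {q}. If it lies in Y₁, it forms a triangle with
-- vertex i, although consecutive vertices of Y₁ are nonadjacent. If it contains q, then Y₂ consists
-- of neighbours of q, which is refuted by counting.
module Nested {n} (G : Graph′ n) {S X S₁ Y₁ S₂ Y₂ : VertexSet n} (s₁ : Sep G S X S₁ Y₁) (s₂ : Sep G S X S₂ Y₂) (P₁ : PairSep G S X S₁ Y₁) (P₂ : PairSep G S X S₂ Y₂)
  (i : Fin 5) (p₁∈Y₂ : Y₂ (p P₁) ≡ true) (y∈Y₂ : Y₂ (r₁ P₁ i) ≡ true) where

  private
    near : Fin 5 → Fin 5 → Bool
    near x y = (x ≟ᵇ y) ∨ (sh x ≟ᵇ y) ∨ (sh y ≟ᵇ x)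

  near⇒⊥ : ∀ x y → near x y ≡ true → E G (r₁ P₁ x) (r₁ P₁ y) ≡ true → ⊥
  near⇒⊥ x y h e with ∨-elim {x ≟ᵇ y} h
  ... | inj₁ k = false≢true (irrE G (r₁ P₁ x)) (subst (λ t → E G (r₁ P₁ x) (r₁ P₁ t) ≡ true) (sym (≟ᵇ⇒≡ x y k)) e)
  ... | inj₂ h′ with ∨-elim {sh x ≟ᵇ y} h′
  ...   | inj₁ k = nonconsecutive P₁ x (subst (λ t → E G (r₁ P₁ x) (r₁ P₁ t) ≡ true) (sym (≟ᵇ⇒≡ (sh x) y k)) e)
  ...   | inj₂ k = nonconsecutive P₁ y (adjacent-sym G _ _ (subst (λ t → E G (r₁ P₁ t) (r₁ P₁ y) ≡ true) (sym (≟ᵇ⇒≡ (sh y) x k)) e))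

  neighbour : ∀ w → S₂ w ≡ true → E G w (p P₁) ≡ true → w ≡ q P₁ ⊎ ∃ λ j → r₁ P₁ j ≡ w
  neighbour w hw e with ∨-elim {S₁ w} (⇒-elim _ _ (closed s₁ (p P₁) w) (∧-intro (a∈S (pair P₁)) (∧-intro (adjacent-sym G w (p P₁) e) region)))
    where
    region : (S w ∨ X w) ≡ true
    region rewrite ⇒-elim _ _ (inner s₂ w) hw = refl
  ... | inj₂ y = inj₂ (hits (r₁-enum P₁) w y)
  ... | inj₁ s with only P₁ w s
  ...   | inj₂ refl = inj₁ refl
  ...   | inj₁ refl = absurdB p₁∈Y₂ (⇒-elim _ _ (apart s₂ w) hw)

  -- If one vertex of the second pair is the vertex q of the first, then its neighbours determine Y₂.
  viaQ : ∀ j → S₂ (r₁ P₁ j) ≡ true → (∀ y → Y₂ y ≡ true → E G (q P₁) y ≡ true) → (∀ y → Y₂ y ≡ true → E G (r₁ P₁ j) y ≡ true) → ⊥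
  viaQ j hj fullq fullj = nonconsecutive P₁ j (fullj _ (card-subset-≡ {P = Y₂} {T₂} sub (≤-reflexive cardT) (r₁ P₁ (sh j)) inT))
    where
    T₂ : VertexSet n
    T₂ = insert (p P₁) (delete (r₁ P₁ j) Y₁)
    cardT : card T₂ ≡ card Y₂
    cardT = trans (card-insert (delete (r₁ P₁ j) Y₁) (p P₁) (not⁻ (notB (λ h → absurdB (∧-left {Y₁ (p P₁)} h) (⇒-elim _ _ (apart s₁ (p P₁)) (a∈S (pair P₁)))))))
      (trans (sym (card-delete Y₁ (r₁ P₁ j) (member (r₁-enum P₁) j))) (trans (enumerates-card (r₁-enum P₁)) (sym (enumerates-card (r₁-enum P₂)))))
    sub : ∀ w → Y₂ w ≡ true → T₂ w ≡ true
    sub w hw = lem (∨-elim {S₁ w} (⇒-elim _ _ (closed s₁ (q P₁) w) (∧-intro (b∈S (pair P₁)) (∧-intro (fullq w hw) (⇒-elim _ _ (outer s₂ w) hw)))))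
      where
      lem : S₁ w ≡ true ⊎ Y₁ w ≡ true → T₂ w ≡ true
      lem (inj₂ y) = taut 2 (λ a b → b ⊃ [ a ∨ b ]) (w ≟ᵇ p P₁) _ (∧-intro y (≢⇒≟ᵇ w (r₁ P₁ j) (λ { refl → absurdB hw (⇒-elim _ _ (apart s₂ w) hj) })))
      lem (inj₁ s) with only P₁ w s
      ... | inj₁ e = taut 2 (λ a b → a ⊃ [ a ∨ b ]) (w ≟ᵇ p P₁) _ (≡⇒≟ᵇ e)
      ... | inj₂ e = false≢true (irrE G (q P₁)) (subst (λ t → E G (q P₁) t ≡ true) e (fullq w hw))
    sh≢ : sh j ≢ j
    sh≢ e = absurdB (≡⇒≟ᵇ e) (allF-sound (λ j → not (sh j ≟ᵇ j)) refl j)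
    inT : T₂ (r₁ P₁ (sh j)) ≡ true
    inT = taut 2 (λ a b → b ⊃ [ a ∨ b ]) (r₁ P₁ (sh j) ≟ᵇ p P₁) _ (∧-intro (member (r₁-enum P₁) (sh j)) (≢⇒≟ᵇ _ _ (λ e → sh≢ (injective (r₁-enum P₁) _ _ e))))

  contradiction : ⊥
  contradiction = go (neighbour (p P₂) (a∈S (pair P₂)) (a-full (pair P₂) _ p₁∈Y₂)) (neighbour (q P₂) (b∈S (pair P₂)) (b-full (pair P₂) _ p₁∈Y₂))
    where
    -- Among any three positions on a 5-cycle two are equal or consecutive.
    table : ∀ x y → (allF λ z → near x y ∨ near x z ∨ near y z) ≡ true
    table = allPairsᵇ-sound (λ x y → allF λ z → near x y ∨ near x z ∨ near y z) refl
    go : p P₂ ≡ q P₁ ⊎ (∃ λ j → r₁ P₁ j ≡ p P₂) → q P₂ ≡ q P₁ ⊎ (∃ λ j → r₁ P₁ j ≡ q P₂) → ⊥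
    go (inj₁ e) (inj₁ e′) = distinct (pair P₂) (trans e (sym e′))
    go (inj₁ e) (inj₂ (j , e′)) = viaQ j (subst (λ w → S₂ w ≡ true) (sym e′) (b∈S (pair P₂))) (λ y h → subst (λ w → E G w y ≡ true) e (a-full (pair P₂) y h)) (λ y h → subst (λ w → E G w y ≡ true) (sym e′) (b-full (pair P₂) y h))
    go (inj₂ (j , e)) (inj₁ e′) = viaQ j (subst (λ w → S₂ w ≡ true) (sym e) (a∈S (pair P₂))) (λ y h → subst (λ w → E G w y ≡ true) e′ (b-full (pair P₂) y h)) (λ y h → subst (λ w → E G w y ≡ true) (sym e) (a-full (pair P₂) y h))
    go (inj₂ (j , e)) (inj₂ (j′ , e′)) with ∨-elim {near j j′} (allF-sound (λ z → near j j′ ∨ near j z ∨ near j′ z) (table j j′) i)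
    ... | inj₁ h = near⇒⊥ j j′ h (subst₂ (λ a b → E G a b ≡ true) (sym e) (sym e′) (pq P₂))
    ... | inj₂ h with ∨-elim {near j i} h
    ...   | inj₁ k = near⇒⊥ j i k (subst (λ a → E G a (r₁ P₁ i) ≡ true) (sym e) (a-full (pair P₂) _ y∈Y₂))
    ...   | inj₂ k = near⇒⊥ j′ i k (subst (λ a → E G a (r₁ P₁ i) ≡ true) (sym e′) (b-full (pair P₂) _ y∈Y₂))

module Separators {n c} (lo : 2 ≤ c) (l₀ : Fin c) (k : ℕ) (IH : Claim n c k) where

  open Reduce l₀ k IH
  open Contraction l₀ k IH

  module _ (G : Graph′ n) {S X : VertexSet n} {lab : Fin n → Fin c} (I : Instance G S X) (size : card S + card X ≤ suc k)
    (nm : ¬ Model (E G) (S ∪ˢ X) X lab) (ne : ¬ Exc G S X lab) where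

    rigid⇒⊥ : ∀ S₁ Q₁ → Sep G S X S₁ Q₁ → card Q₁ < card X → (∃ λ v → S₁ v ≡ true) → Simulates c G S₁ Q₁ → ⊥
    rigid⇒⊥ S₁ Q₁ = reduceRigid (card (S ∖ˢ S₁)) G I size nm ne S₁ Q₁ ≤-refl

    -- If X is linked to Y in front of S₁, any model behind Y extends to X; so for the transported
    -- labels there is none, and the smaller far side must be exceptional. The root x₀ outside Y is
    -- what makes it smaller.
    pairSep : ∀ S₁ Y → Sep G S X S₁ Y → card Y ≡ card X → 10 * card S₁ < D G S₁ Y → (∃ λ x → X x ≡ true × Y x ≡ false) → ¬ ¬ PairSep G S X S₁ Y
    pairSep S₁ Y s same-card dn (x₀ , hx₀ , hy₀) cont with enumeration X
    ... | r , en = run (linkage-or-cut G U Y r (injective en) rU Y⊆U)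
      where
      U : VertexSet n
      U = (S ∪ˢ X) ∖ˢ S₁
      rU : ∀ i → U (r i) ≡ true
      rU i = taut 3 (λ s x t → x ⊃ (t ⇒ s) ⊃ (s ⇒ not x) ⊃ [ (s ∨ x) ∧ not t ]) (S (r i)) (X (r i)) (S₁ (r i)) (member en i) (inner s (r i)) (disjoint I (r i))
      Y⊆U : ∀ v → (Y v ⇒ U v) ≡ true
      Y⊆U v = taut 4 (λ s x t y → (y ⇒ s ∨ x) ⊃ (t ⇒ not y) ⊃ [ y ⇒ (s ∨ x) ∧ not t ]) (S v) (X v) (S₁ v) (Y v) (outer s v) (apart s v)
      m₁ : Massed G S₁ Y
      m₁ = sub-massed G (massed I) s (≤-reflexive same-card) dn
      I₁ : Instance G S₁ Y
      I₁ = inst (apart s) (≤-trans (≤-reflexive same-card) (small I)) m₁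
      size₁ : card S₁ + card Y ≤ k
      size₁ = ≤-pred (≤-trans (subst₂ _<_ (card-union S₁ Y (apart s)) (card-union S X (disjoint I))
        (card-strict {P = S₁ ∪ˢ Y} {S ∪ˢ X} (λ v → taut 4 (λ s x t y → (t ⇒ s) ⊃ (y ⇒ s ∨ x) ⊃ (t ∨ y) ⊃ [ s ∨ x ]) (S v) (X v) (S₁ v) (Y v) (inner s v) (outer s v)) x₀
          (taut 2 (λ s x → x ⊃ [ s ∨ x ]) (S x₀) (X x₀) hx₀) (not⁻ (taut 4 (λ s x t y → x ⊃ not y ⊃ (t ⇒ s) ⊃ (s ⇒ not x) ⊃ [ not (t ∨ y) ]) (S x₀) (X x₀) (S₁ x₀) (Y x₀) hx₀ (cong not hy₀) (inner s x₀) (disjoint I x₀))))) size)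
      run : Linkage (E G) U Y (card X) r ⊎ SmallCut G U Y r → ⊥
      run (inj₁ L) = IH G S₁ Y labY I₁ size₁ nm₁ (λ e → exceptional labY nm₁ e)
        where
        labY = endLabels L lab l₀
        nm₁ : ¬ Model (E G) (S₁ ∪ˢ Y) Y labY
        nm₁ M = nm (followLinkage G L M (end∈Y L) (endLabels-end L lab l₀) (hits en)
          (λ v → taut 3 (λ u t y → [ (u ∧ not t) ∧ (t ∨ y) ⇒ y ]) (S v ∨ X v) (S₁ v) (Y v))
          (λ v → taut 4 (λ s x t y → (t ⇒ s) ⊃ (y ⇒ s ∨ x) ⊃ [ ((s ∨ x) ∧ not t) ∨ (t ∨ y) ⇒ s ∨ x ]) (S v) (X v) (S₁ v) (Y v) (inner s v) (outer s v)))
        exceptional : ∀ {c′} (labY : Fin n → Fin c′) → ¬ Model (E G) (S₁ ∪ˢ Y) Y labY → Exc G S₁ Y labY → ⊥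
        exceptional labY nm₁ (exc x) = toPairSep G s m₁ nm₁ x (λ C Q sc lt nonempty sim → rigid⇒⊥ C Q (sep-trans G s sc)
          (≤-trans lt (≤-trans (≤-reflexive (sym (Exc⇒5 (exc x)))) (≤-reflexive same-card))) nonempty (sim lo)) cont
      -- The middle of a smallest cut is linked to Y, and everything behind it, S₁ included, forms
      -- one far side. Its labellings come from those of Y, so it simulates and can be replaced by a
      -- clique.
      run (inj₂ (A , B , cut , m′ , r′ , lt , en′ , L)) = rigid⇒⊥ S⁺ (A ∩ˢ B) sep⁺ (≤-trans (s≤s (≤-reflexive (enumerates-card en′))) lt) nonempty sim⁺
        where
        S⁺ : VertexSet n
        S⁺ = (B ∖ˢ A) ∪ˢ S₁
        nonempty : ∃ λ v → S⁺ v ≡ true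
        nonempty = let (v , h) = dense⇒nonempty G S₁ Y dn in v , taut 2 (λ a b → b ⊃ [ a ∨ b ]) _ (S₁ v) h
        X⊆A : ∀ v → (X v ⇒ A v) ≡ true
        X⊆A v = taut 3 (λ x i a → (x ⇒ i) ⊃ (i ⇒ a) ⊃ [ x ⇒ a ]) (X v) (image r v) (A v) (proj₁ (image⇔ en v)) (X⊆ cut v)
        sep⁺ : Sep G S X S⁺ (A ∩ˢ B)
        sep⁺ = record
          { inner = λ v → taut 5 (λ s x a b t → (x ⇒ a) ⊃ (b ⇒ (s ∨ x) ∧ not t) ⊃ (t ⇒ s) ⊃ [ (b ∧ not a) ∨ t ⇒ s ]) (S v) (X v) (A v) (B v) (S₁ v) (X⊆A v) (B⊆ cut v) (inner s v)
          ; outer = λ v → taut 4 (λ u a b t → (b ⇒ u ∧ not t) ⊃ [ a ∧ b ⇒ u ]) (S v ∨ X v) (A v) (B v) (S₁ v) (B⊆ cut v)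
          ; apart = λ v → taut 4 (λ u a b t → (b ⇒ u ∧ not t) ⊃ [ (b ∧ not a) ∨ t ⇒ not (a ∧ b) ]) (S v ∨ X v) (A v) (B v) (S₁ v) (B⊆ cut v)
          ; closed = λ u v → taut 10 (λ e e′ au bu tu av bv tv uv yv →
                (uv ∧ not tv ⇒ av ∨ bv) ⊃ (av ∧ e′ ∧ bu ⇒ bv ∨ au) ⊃ (e ⇒ e′) ⊃ (tu ∧ e ∧ uv ⇒ tv ∨ yv) ⊃ (yv ⇒ bv) ⊃
                [ ((bu ∧ not au) ∨ tu) ∧ e ∧ uv ⇒ ((bv ∧ not av) ∨ tv) ∨ (av ∧ bv) ])
              (E G u v) (E G v u) (A u) (B u) (S₁ u) (A v) (B v) (S₁ v) (S v ∨ X v) (Y v)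
              (cover cut v) (noEdge cut v u) (symE G u v) (closed s u v) (Y⊆ cut v) }
        sim⁺ : Simulates c G S⁺ (A ∩ˢ B)
        sim⁺ lab′ no-model = IH G S₁ Y labY I₁ size₁ nm₁ (λ e → noExc labY refl-ends (λ v w o o′ → trans (endLabels-other L lab′ d v o) (sym (endLabels-other L lab′ d w o′))) e)
          where
          -- Vertices of Y that no path reaches repeat the label of the first path; without any path
          -- all of Y shares l₀. A label therefore occurs twice on Y, which rules out the exception.
          default : ∀ m → (Fin m → Fin n) → Fin c
          default zero r = l₀
          default (suc m) r = lab′ (r zero)
          d = default m′ r′
          labY = endLabels L lab′ d
          nm₁ : ¬ Model (E G) (S₁ ∪ˢ Y) Y labY
          nm₁ M = no-model (followLinkage G L M (end∈Y L) (endLabels-end L lab′ d) (hits en′)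
            (λ v → taut 5 (λ u t y b a → (b ⇒ u ∧ not t) ⊃ [ b ∧ (t ∨ y) ⇒ y ]) (S v ∨ X v) (S₁ v) (Y v) (B v) (A v) (B⊆ cut v))
            (λ v → taut 4 (λ t y b a → (y ⇒ b) ⊃ [ b ∨ (t ∨ y) ⇒ ((b ∧ not a) ∨ t) ∨ (a ∧ b) ]) (S₁ v) (Y v) (B v) (A v) (Y⊆ cut v)))
          refl-ends : ∀ v → image (end L) v ≡ false → ∀ w → (∃ λ i → end L i ≡ w × toℕ i ≡ 0) → labY v ≡ labY w
          refl-ends v out w (i , refl , z) = trans (endLabels-other L lab′ d v out) (trans (lem m′ r′ i z) (sym (endLabels-end L lab′ d i)))
            where
            lem : ∀ m (r′ : Fin m → Fin n) (i : Fin m) → toℕ i ≡ 0 → default m r′ ≡ lab′ (r′ i)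
            lem (suc m) r′ zero _ = refl
          -- Fewer than five paths reach Y, so two vertices of Y carry the same label.
          noExc : ∀ {c′} (labY : Fin n → Fin c′) → (∀ v → image (end L) v ≡ false → ∀ w → (∃ λ i → end L i ≡ w × toℕ i ≡ 0) → labY v ≡ labY w) →
            (∀ v w → image (end L) v ≡ false → image (end L) w ≡ false → labY v ≡ labY w) → Exc G S₁ Y labY → ⊥
          noExc labY ends others (exc ((r₁ , lr) , _)) = two m′ refl
            where
            out : ∃ λ y → Y y ≡ true × image (end L) y ≡ false
            out = ∃-outside Y (image (end L)) (≤-trans (s≤s (≤-reflexive (card-image (end L) (end-injective L)))) (≤-trans lt (≤-reflexive (sym same-card))))
            label-inj : ∀ y z → Y y ≡ true → Y z ≡ true → labY y ≡ labY z → y ≡ z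
            label-inj y z hy hz e with hits (enum lr) y hy | hits (enum lr) z hz
            ... | i , refl | j , refl = cong r₁ (trans (sym (lab-r lr i)) (trans e (lab-r lr j)))
            two : ∀ m → m ≡ m′ → ⊥
            two (suc m) refl = let (y , hy , o) = out in
              false≢true o (subst (λ w → image (end L) w ≡ true) (sym (label-inj y (end L zero) hy (end∈Y L zero) (ends y o (end L zero) (zero , refl , refl)))) (image-intro (end L) zero))
            two zero refl = 0≢1 (injective (enum lr) 0F 1F (label-inj _ _ (member (enum lr) 0F) (member (enum lr) 1F) (others (r₁ 0F) (r₁ 1F) (none (r₁ 0F)) (none (r₁ 1F)))))
              where
              0≢1 : 0F ≢ 1F
              0≢1 ()
              none : ∀ v → image (end L) v ≡ false
              none v = not⁻ (notB (λ h → no-index (image-elim (end L) v h)))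
                where
                no-index : (∃ λ i → end L i ≡ v) → ⊥
                no-index (() , _)

    -- Contracting p into a vertex of Y outside X gives a smaller graph.
    separator⇒⊥ : ∀ S₁ Y → Sep G S X S₁ Y → card Y ≡ card X → 10 * card S₁ < D G S₁ Y → (∃ λ x → X x ≡ true × Y x ≡ false) → ⊥
    separator⇒⊥ S₁ Y s same-card dn (x₀ , hx₀ , hy₀) = pairSep S₁ Y s same-card dn (x₀ , hx₀ , hy₀) use
      where
      use : PairSep G S X S₁ Y → ⊥
      use P with any? (λ i → X (r₁ P i) B.≟ false)
      ... | no none = false≢true hy₀ (card-subset-≡ {P = Y} {X} (λ v h → inX v (hits (r₁-enum P) v h)) (≤-reflexive (sym same-card)) x₀ hx₀)
        where
        inX : ∀ v → (∃ λ i → r₁ P i ≡ v) → X v ≡ true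
        inX v (i , refl) with X (r₁ P i) in e
        ... | true = refl
        ... | false = ⊥-elim (none (i , e))
      ... | yes (i , y∉X) = contractEdge G I size nm ne a y a∈ ny few handler
        where
        a = p P
        b = q P
        y = r₁ P i
        a∈ : S a ≡ true
        a∈ = ⇒-elim _ _ (inner s a) (a∈S (pair P))
        ya : E G a y ≡ true
        ya = a-full (pair P) y (member (r₁-enum P) i)
        ny : nbhd G S X a y ≡ true
        ny = ∧-intro (⇒-elim _ _ (outer s y) (member (r₁-enum P) i)) ya
        common : VertexSet n
        common w = nbhd G S X a w ∧ virtual G X y w
        limit : VertexSet n
        -- Since y is outside X, virtual neighbours of y are neighbours. Besides b, the common
        -- neighbours of a and y lie in Y, and by nonadjacency they are among the two positions
        -- opposite i.
        limit = insert b (insert (r₁ P (sh (sh i))) (λ w → w ≟ᵇ r₁ P (sh (sh (sh i)))))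
        limit-card : card limit ≤ 4
        limit-card = ≤-trans (card-insert≤ _ b) (≤-trans (s≤s (≤-trans (card-insert≤ _ (r₁ P (sh (sh i)))) (s≤s (≤-reflexive (∑-one (r₁ P (sh (sh (sh i))))))))) (n≤1+n 3))
        cases : Fin 5 → Fin 5 → Bool
        cases i j = ((i ≟ᵇ j) ∨ (sh i ≟ᵇ j) ∨ (sh j ≟ᵇ i)) ∨ ((j ≟ᵇ sh (sh i)) ∨ (j ≟ᵇ sh (sh (sh i))))
        common⊆ : ∀ w → common w ≡ true → limit w ≡ true
        common⊆ w h = go (∨-elim {S₁ w} (⇒-elim _ _ (closed s a w) (∧-intro (a∈S (pair P)) (∧-intro aw (∧-left (∧-left {nbhd G S X a w} h))))))
          where
          aw : E G a w ≡ true
          aw = ∧-right {S w ∨ X w} (∧-left {nbhd G S X a w} h)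
          yw : E G y w ≡ true
          yw = taut 4 (λ e x x′ d → (e ∨ (x ∧ x′ ∧ d)) ⊃ not x ⊃ [ e ]) (E G y w) (X y) (X w) (not (y ≟ᵇ w)) (∧-right {nbhd G S X a w} h) (cong not y∉X)
          go : S₁ w ≡ true ⊎ Y w ≡ true → limit w ≡ true
          go (inj₁ sw) with only P w sw
          ... | inj₁ refl = false≢true (irrE G w) aw
          ... | inj₂ e = taut 3 (λ a b c → a ⊃ [ a ∨ (b ∨ c) ]) (w ≟ᵇ b) (w ≟ᵇ r₁ P (sh (sh i))) (w ≟ᵇ r₁ P (sh (sh (sh i)))) (≡⇒≟ᵇ e)
          go (inj₂ yw′) with hits (r₁-enum P) w yw′
          ... | j , refl with ∨-elim {(i ≟ᵇ j) ∨ (sh i ≟ᵇ j) ∨ (sh j ≟ᵇ i)} (allPairsᵇ-sound cases refl i j)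
          ...   | inj₁ nr = ⊥-elim (close nr)
            where
            close : ((i ≟ᵇ j) ∨ (sh i ≟ᵇ j) ∨ (sh j ≟ᵇ i)) ≡ true → ⊥
            close nr with ∨-elim {i ≟ᵇ j} nr
            ... | inj₁ e = false≢true (irrE G y) (subst (λ t → E G y (r₁ P t) ≡ true) (sym (≟ᵇ⇒≡ i j e)) yw)
            ... | inj₂ nr′ with ∨-elim {sh i ≟ᵇ j} nr′
            ...   | inj₁ e = nonconsecutive P i (subst (λ t → E G y (r₁ P t) ≡ true) (sym (≟ᵇ⇒≡ (sh i) j e)) yw)
            ...   | inj₂ e = nonconsecutive P j (adjacent-sym G _ _ (subst (λ t → E G (r₁ P t) (r₁ P j) ≡ true) (sym (≟ᵇ⇒≡ (sh j) i e)) yw))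
          ...   | inj₂ far with ∨-elim {j ≟ᵇ sh (sh i)} far
          ...     | inj₁ e = taut 3 (λ a b c → b ⊃ [ a ∨ (b ∨ c) ]) (r₁ P j ≟ᵇ b) _ _ (≡⇒≟ᵇ (cong (r₁ P) (≟ᵇ⇒≡ j _ e)))
          ...     | inj₂ e = taut 3 (λ a b c → c ⊃ [ a ∨ (b ∨ c) ]) (r₁ P j ≟ᵇ b) (r₁ P j ≟ᵇ r₁ P (sh (sh i))) _ (≡⇒≟ᵇ (cong (r₁ P) (≟ᵇ⇒≡ j _ e)))
        few : card common ≤ 4
        few = ≤-trans (card-mono {P = common} {limit} common⊆) limit-card
        -- A second obstructing separator differs from X, since it contains a. It is thus again a
        -- pair separator, and `Nested` refutes the two together.
        handler : Handler G S X a y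
        handler S₂ Y₂ s₂ same₂ dn₂ a∈Y₂ y∈ with any? (λ x → (X x ∧ not (Y₂ x)) B.≟ true)
        ... | yes (x , h) = pairSep S₂ Y₂ s₂ same₂ dn₂ (x , ∧-left h , not⁻ (∧-right {X x} h)) (λ P₂ → Nested.contradiction G s s₂ P P₂ i a∈Y₂ (y∈ y∈S))
          where
          y∈S : S y ≡ true
          y∈S = taut 2 (λ s x → (s ∨ x) ⊃ not x ⊃ [ s ]) (S y) (X y) (∧-left ny) (cong not y∉X)
        ... | no none = absurdB (card-subset-≡ {P = X} {Y₂} (λ x hx → taut 2 (λ a b → not (a ∧ not b) ⊃ a ⊃ [ b ]) (X x) (Y₂ x) (notB (λ h → none (x , h))) hx) (≤-reflexive same₂) a a∈Y₂)
            (⇒-elim _ _ (disjoint I a) a∈)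

-- At most two roots

trivialModel : ∀ {n c} → 2 ≤ c → (G : Graph′ n) {P X : VertexSet n} (lab : Fin n → Fin c) → (∀ v → X v ≡ true → P v ≡ true) →
  (∀ x y → X x ≡ true → X y ≡ true → x ≡ y) → Model (E G) P X lab
trivialModel {n} {c} lo G {P} {X} lab sub one = record
  { β = β′ ; supp = sup ; root = rt
  ; same = λ x y hx hy _ → subst (Walk (E G) β′ x) (one x y hx hy) done
  ; link = λ x y hx hy s → ⊥-elim (succ-irreflexive lo (lab y) (subst (λ t → CycSucc (lab t) (lab y)) (one x y hx hy) s)) }
  where
  β′ : Labelling n c
  β′ v = if X v then just (lab v) else nothing
  sup : ∀ v l → β′ v ≡ just l → P v ≡ true
  sup v l h with X v in e
  ... | true = sub v e
  rt : ∀ x → X x ≡ true → β′ x ≡ just (lab x)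
  rt x h rewrite h = refl

-- If x and y are not joined through S, the part of S reachable from x lies behind {x} and the
-- remaining part behind {y}. Both separators have order one, so (M2) bounds both parts, against
-- density.
twoRoots : ∀ {n c} → 2 ≤ c → (G : Graph′ n) {S X : VertexSet n} (lab : Fin n → Fin c) → Instance G S X → card X ≡ 2 → ¬ ¬ Model (E G) (S ∪ˢ X) X lab
twoRoots {n} {c} lo G {S} {X} lab I two nm = go (enumeration′ X two)
  where
  go : (∃ λ (r : Fin 2 → Fin n) → Enumerates r X) → ⊥
  go (r , en) = search (E G x y B.≟ true) (any? (λ u → (C u ∧ E G u y) B.≟ true))
    where
    x = r zero
    y = r (suc zero)
    comp : Closure (within G S) (λ w → S w ∧ E G x w)
    comp = closure (within G S) (λ w → S w ∧ E G x w)
    C = set comp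
    C⊆S : ∀ v → C v ≡ true → S v ≡ true
    C⊆S v h = reached-in G S (λ w → S w ∧ E G x w) (λ u → ∧-left) (reached comp v h)
    which : ∀ v → X v ≡ true → v ≡ x ⊎ v ≡ y
    which v h with hits en v h
    ... | zero , e = inj₁ (sym e)
    ... | suc zero , e = inj₂ (sym e)
    β′ : Labelling n c
    β′ v = if X v then just (lab v) else (if C v then just (lab x) else nothing)
    rt : ∀ v → X v ≡ true → β′ v ≡ just (lab v)
    rt v h rewrite h = refl
    inC : ∀ v → C v ≡ true → β′ v ≡ just (lab x)
    inC v h rewrite not⁻ (⇒-elim _ _ (disjoint I v) (C⊆S v h)) | h = refl
    sup : ∀ v l → β′ v ≡ just l → (S v ∨ X v) ≡ true
    sup v l h with X v
    ... | true = taut 1 (λ s → [ s ∨ true ]) (S v)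
    ... | false with C v in e
    ...   | true rewrite C⊆S v e = refl
    build : (∃ λ u → Walk (E G) β′ x u × E G u y ≡ true) → Model (E G) (S ∪ˢ X) X lab
    build (u , p , e) = record { β = β′ ; supp = sup ; root = rt ; same = sm ; link = lk }
      where
      bu : β′ u ≡ just (lab x)
      bu = trans (sym (walk-label p)) (rt x (member en zero))
      sm : ∀ v w → X v ≡ true → X w ≡ true → lab v ≡ lab w → Walk (E G) β′ v w
      sm v w hv hw l with which v hv | which w hw
      ... | inj₁ refl | inj₁ refl = done
      ... | inj₁ refl | inj₂ refl = p ++ʷ hop e (trans bu (trans (cong just l) (sym (rt y (member en (suc zero)))))) done
      ... | inj₂ refl | inj₁ refl = reverse G (p ++ʷ hop e (trans bu (trans (cong just (sym l)) (sym (rt y (member en (suc zero)))))) done)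
      ... | inj₂ refl | inj₂ refl = done
      lk : ∀ v w → X v ≡ true → X w ≡ true → CycSucc (lab v) (lab w) → Link (E G) β′ v w
      lk v w hv hw s with which v hv | which w hw
      ... | inj₁ refl | inj₁ refl = ⊥-elim (succ-irreflexive lo (lab x) s)
      ... | inj₁ refl | inj₂ refl = u , y , p , e , done
      ... | inj₂ refl | inj₁ refl = y , u , done , adjacent-sym G u y e , reverse G p
      ... | inj₂ refl | inj₂ refl = ⊥-elim (succ-irreflexive lo (lab y) s)
    search : Dec (E G x y ≡ true) → Dec (∃ λ u → (C u ∧ E G u y) ≡ true) → ⊥
    search (yes e) _ = nm (build (x , done , e))
    search (no _) (yes (u , h)) with reached-walk G S (λ w → S w ∧ E G x w) β′ (lab x) comp inC (∧-left h)
    ... | w , pw , cw , p = nm (build (u , hop (∧-right {S w} pw) (trans (rt x (member en zero)) (sym (inC w cw))) p , ∧-right {C u} h))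
    search (no nxy) (no ncy) = <⇒≱ (dense (massed I)) (begin
      D G S X ≤⟨ D-split G sepC ⟩
      D G (S ∖ˢ C) X + D G C (λ v → v ≟ᵇ x) ≤⟨ +-mono-≤ (∑∑-mono (λ u v → ⟦⟧-mono (swap u v))) (sparse (massed I) C (λ v → v ≟ᵇ x) sepC (single x)) ⟩
      D G (S ∖ˢ C) (λ v → v ≟ᵇ y) + 10 * card C ≤⟨ +-monoˡ-≤ (10 * card C) (sparse (massed I) (S ∖ˢ C) (λ v → v ≟ᵇ y) sepD (single y)) ⟩
      10 * card (S ∖ˢ C) + 10 * card C ≡⟨ ring (card (S ∖ˢ C)) (card C) ⟩
      10 * (card C + card (S ∖ˢ C)) ≡⟨ cong (10 *_) (sym (card-split S C (λ v → ⇒-intro _ _ (C⊆S v)))) ⟩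
      10 * card S ∎)
      where
      open ≤-Reasoning
      ring : ∀ a b → 10 * a + 10 * b ≡ 10 * (b + a)
      ring = solve-∀
      single : ∀ u → card (λ v → v ≟ᵇ u) < card X
      single u = ≤-trans (s≤s (≤-reflexive (∑-one u))) (≤-reflexive (sym two))
      toC : ∀ u v → C u ≡ true → E G u v ≡ true → S v ≡ true → C v ≡ true
      toC u v c e s = stable comp u v c (∧-intro e s)
      notY : ∀ u → C u ≡ true → E G u y ≡ true → ⊥
      notY u c e = ncy (u , ∧-intro c e)
      fromX : ∀ u → S u ≡ true → E G x u ≡ true → C u ≡ true
      fromX u s e = base comp u (∧-intro s e)
      region : ∀ u → (u ≟ᵇ x ≡ true) ⊎ (u ≟ᵇ y ≡ true) → (S u ∨ X u) ≡ true
      region u (inj₁ e) rewrite ≟ᵇ⇒≡ u x e = taut 2 (λ s x → x ⊃ [ s ∨ x ]) (S x) (X x) (member en zero)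
      region u (inj₂ e) rewrite ≟ᵇ⇒≡ u y e = taut 2 (λ s x → x ⊃ [ s ∨ x ]) (S y) (X y) (member en (suc zero))
      avoid : ∀ u → S u ≡ true → ∀ i → not (u ≟ᵇ r i) ≡ true
      avoid u s i = ≢⇒≟ᵇ u (r i) (λ e → absurdB (member en i) (⇒-elim _ _ (disjoint I (r i)) (subst (λ t → S t ≡ true) e s)))
      cloC : ∀ u v → C u ≡ true → E G u v ≡ true → (S v ∨ X v) ≡ true → (C v ∨ (v ≟ᵇ x)) ≡ true
      cloC u v c e sx with ∨-elim {S v} sx
      ... | inj₁ s = taut 2 (λ a b → a ⊃ [ a ∨ b ]) (C v) (v ≟ᵇ x) (toC u v c e s)
      ... | inj₂ hx with which v hx
      ...   | inj₁ q = taut 2 (λ a b → b ⊃ [ a ∨ b ]) (C v) (v ≟ᵇ x) (≡⇒≟ᵇ q)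
      ...   | inj₂ refl = ⊥-elim (notY u c e)
      cloD : ∀ u v → (S ∖ˢ C) u ≡ true → E G u v ≡ true → (S v ∨ X v) ≡ true → ((S ∖ˢ C) v ∨ (v ≟ᵇ y)) ≡ true
      cloD u v d e sx with ∨-elim {S v} sx
      ... | inj₁ s = taut 3 (λ s c b → s ⊃ not c ⊃ [ (s ∧ not c) ∨ b ]) (S v) (C v) (v ≟ᵇ y) s (notB (λ c → absurdB (toC v u c (adjacent-sym G u v e) (∧-left d)) (∧-right {S u} d)))
      ... | inj₂ hx with which v hx
      ...   | inj₁ refl = absurdB (fromX u (∧-left d) (adjacent-sym G u v e)) (∧-right {S u} d)
      ...   | inj₂ q = taut 2 (λ a b → b ⊃ [ a ∨ b ]) ((S ∖ˢ C) v) (v ≟ᵇ y) (≡⇒≟ᵇ q)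
      sepC : Sep G S X C (λ v → v ≟ᵇ x)
      sepC = record { inner = λ v → ⇒-intro _ _ (C⊆S v) ; outer = λ v → ⇒-intro _ _ (λ h → region v (inj₁ h))
        ; apart = λ v → ⇒-intro _ _ (λ h → avoid v (C⊆S v h) zero)
        ; closed = λ u v → ⇒-intro _ _ (λ h → cloC u v (∧-left {C u} h) (∧-left (∧-right {C u} h)) (∧-right {E G u v} (∧-right {C u} h))) }
      sepD : Sep G S X (S ∖ˢ C) (λ v → v ≟ᵇ y)
      sepD = record { inner = λ v → taut 2 (λ s c → [ s ∧ not c ⇒ s ]) (S v) (C v) ; outer = λ v → ⇒-intro _ _ (λ h → region v (inj₂ h))
        ; apart = λ v → ⇒-intro _ _ (λ h → avoid v (∧-left h) (suc zero))
        ; closed = λ u v → ⇒-intro _ _ (λ h → cloD u v (∧-left {(S ∖ˢ C) u} h) (∧-left (∧-right {(S ∖ˢ C) u} h)) (∧-right {E G u v} (∧-right {(S ∖ˢ C) u} h))) }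
      swap : ∀ u v → countedPair G (S ∖ˢ C) X u v ≡ true → countedPair G (S ∖ˢ C) (λ v → v ≟ᵇ y) u v ≡ true
      swap u v h = taut 9 (λ e e′ du xu yu dv xv yv _ → counted e du xu dv xv ⊃ (e ⇒ e′) ⊃ (du ∧ e ∧ xv ⇒ yv) ⊃ (dv ∧ e′ ∧ xu ⇒ yu) ⊃ [ counted e du yu dv yv ])
          (E G u v) (E G v u) ((S ∖ˢ C) u) (X u) (u ≟ᵇ y) ((S ∖ˢ C) v) (X v) (v ≟ᵇ y) true h (symE G u v) (onlyY u v) (onlyY v u)
        where
        onlyY : ∀ u v → ((S ∖ˢ C) u ∧ E G u v ∧ X v ⇒ v ≟ᵇ y) ≡ true
        onlyY u v = ⇒-intro _ _ (λ h → lem (∧-left {(S ∖ˢ C) u} h) (∧-left (∧-right {(S ∖ˢ C) u} h)) (which v (∧-right {E G u v} (∧-right {(S ∖ˢ C) u} h))))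
          where
          lem : (S ∖ˢ C) u ≡ true → E G u v ≡ true → v ≡ x ⊎ v ≡ y → v ≟ᵇ y ≡ true
          lem d e (inj₁ refl) = absurdB (fromX u (∧-left d) (adjacent-sym G u v e)) (∧-right {S u} d)
          lem d e (inj₂ q) = ≡⇒≟ᵇ q

-- The induction step: a vertex of low degree and the removal of surplus edges

∑-⟦⟧* : ∀ {n} (P : VertexSet n) (f g : Fin n → ℕ) → (∀ v → P v ≡ true → f v ≤ g v) → ∑ (λ v → ⟦ P v ⟧ * f v) ≤ ∑ (λ v → ⟦ P v ⟧ * g v)
∑-⟦⟧* P f g h = ∑-mono (λ v → pt v)
  where
  pt : ∀ v → ⟦ P v ⟧ * f v ≤ ⟦ P v ⟧ * g v
  pt v with P v in e
  ... | true = *-monoʳ-≤ 1 (h v e)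
  ... | false = z≤n

module Step {n c} (lo : 2 ≤ c) (hi : c ≤ 5) (l₀ : Fin c) (k : ℕ) (IH : Claim n c k) where

  open Reduce l₀ k IH
  open Contraction l₀ k IH
  open Separators lo l₀ k IH

  escape : ∀ {S X Y : VertexSet n} → Disjoint S X → card Y ≡ card X → ∀ v → S v ≡ true → Y v ≡ true → ∃ λ x → X x ≡ true × Y x ≡ false
  escape {S} {X} {Y} dis same v hs hy with any? (λ x → (X x ∧ not (Y x)) B.≟ true)
  ... | yes (x , h) = x , ∧-left h , not⁻ (∧-right {X x} h)
  ... | no none = absurdB (card-subset-≡ {P = X} {Y} (λ x hx → taut 2 (λ a b → not (a ∧ not b) ⊃ a ⊃ [ b ]) (X x) (Y x) (notB (λ h → none (x , h))) hx) (≤-reflexive same) v hy)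
            (⇒-elim _ _ (dis v) hs)

  module _ (G : Graph′ n) {S X : VertexSet n} {lab : Fin n → Fin c} (I : Instance G S X) (size : card S + card X ≤ suc k)
    (nm : ¬ Model (E G) (S ∪ˢ X) X lab) (ne : ¬ Exc G S X lab) (three : 3 ≤ card X) where

    private
      rigid = rigid⇒⊥ G I size nm ne
      separator = separator⇒⊥ G I size nm ne

    -- Separations of order `card X` having been refuted, every edge at v whose ends have at most
    -- four common neighbours can be contracted. So the neighbourhood is dense, or empty.
    module LowDegree (v : Fin n) (v∈S : S v ≡ true) (high : card (nbhd G S X v) ≤ 9) (few : card (nbhd G S X v) + card (nbhd G S X v ∩ˢ X) ≤ 10) where

      N = nbhd G S X v

      common : Fin n → VertexSet n
      common u w = N w ∧ virtual G X u w

      Xv : X v ≡ false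
      Xv = not⁻ (⇒-elim _ _ (disjoint I v) v∈S)

      -- A vertex without neighbours is a far side behind the empty separator, and it simulates for
      -- want of roots.
      isolated : (∀ u → N u ≡ true → ⊥) → ⊥
      isolated none = rigid (λ w → w ≟ᵇ v) (λ _ → false) sep (≤-trans (s≤s (≤-reflexive (card-empty {n} (λ _ → false) (λ _ ())))) (≤-trans (s≤s z≤n) three)) (v , ≟ᵇ-refl v)
          (λ lab′ no → no (trivialModel lo G lab′ (λ _ ()) (λ _ _ ())))
        where
        sep : Sep G S X (λ w → w ≟ᵇ v) (λ _ → false)
        sep = record
          { inner = λ w → ⇒-intro _ _ (λ h → subst (λ t → S t ≡ true) (sym (≟ᵇ⇒≡ w v h)) v∈S)
          ; outer = λ w → refl
          ; apart = λ w → taut 1 (λ a → [ a ⇒ true ]) (w ≟ᵇ v)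
          ; closed = λ u w → ⇒-intro _ _ (λ h → ⊥-elim (none w (∧-intro (∧-right {E G u w} (∧-right {u ≟ᵇ v} h))
               (subst (λ t → E G t w ≡ true) (≟ᵇ⇒≡ u v (∧-left h)) (∧-left (∧-right {u ≟ᵇ v} h)))))) }

      module Linked (deg : ∀ u → N u ≡ true → 5 ≤ card (common u)) (u₀ : Fin n) (hu₀ : N u₀ ≡ true) where

        low : 6 ≤ card N
        low = ≤-trans (s≤s (≤-trans (deg u₀ hu₀) (card-mono {P = common u₀} {delete u₀ N} (λ w h → ∧-intro (∧-left h) (≢⇒≟ᵇ w u₀ (λ { refl → notSelf (∧-right {N w} h) }))))))
                 (≤-reflexive (sym (card-delete N u₀ hu₀)))
          where
          notSelf : virtual G X u₀ u₀ ≡ true → ⊥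
          notSelf h = absurdB h (taut 3 (λ e x d → not e ⊃ d ⊃ [ not (e ∨ (x ∧ x ∧ not d)) ]) (E G u₀ u₀) (X u₀) (u₀ ≟ᵇ u₀) (cong not (irrE G u₀)) (≟ᵇ-refl u₀))

        dn : Dense G v N X
        dn = record { six≤ = low ; ≤nine = high ; fewRoots = few ; nbrs = λ w → taut 2 (λ a e → [ a ∧ e ⇒ e ]) (S w ∨ X w) (E G v w) ; degree = deg }

        Y : VertexSet n
        Y = insert v N

        linkedModel : ∀ {m} {U P Q : VertexSet n} {r : Fin m → Fin n} → m ≤ 5 → (L : Linkage (E G) U Y m r) → Enumerates r Q → (∀ w → X w ≡ true → Y w ≡ true → Q w ≡ true) →
          (∀ w → (U w ∨ Y w ⇒ P w) ≡ true) → (lab′ : Fin n → Fin c) → Model (E G) P Q lab′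
        linkedModel {m} {U} {P} {Q} {r} le L en X⊆ P⊇ lab′ = followLinkage G L M (λ i → image-intro (end L) i) (endLabels-end L lab′ l₀) (hits en)
            (λ w → taut 2 (λ u y → [ u ∧ y ⇒ y ]) (U w) (Y w)) P⊇
          where
          -- A vertex of X in the neighbourhood is itself a start. As it lies in Y, it is the end of
          -- its own path, so the roots of the dense model include it.
          ends : ∀ w → (N w ∧ X w) ≡ true → image (end L) w ≡ true
          ends w h = let (i , e) = hits en w (X⊆ w (∧-right {N w} h) yw) in
            subst (λ t → image (end L) t ≡ true) (sym (γ-Y L w i (subst (λ t → γ L t ≡ just i) e (γ-start L i)) yw)) (image-intro (end L) i)
            where
            yw : Y w ≡ true
            yw = taut 2 (λ a b → b ⊃ [ a ∨ b ]) (w ≟ᵇ v) (N w) (∧-left h)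
          M : Model (E G) Y (image (end L)) (endLabels L lab′ l₀)
          M = denseModel G v N X dn Xv le lo hi (end L) (end-injective L) (end∈Y L) (λ w → ⇒-intro _ _ (ends w)) (endLabels L lab′ l₀)

        U : VertexSet n
        U = S ∪ˢ X

        Y⊆U : ∀ w → (Y w ⇒ U w) ≡ true
        Y⊆U w = ⇒-intro _ _ (λ h → lem (∨-elim {w ≟ᵇ v} h))
          where
          lem : (w ≟ᵇ v) ≡ true ⊎ N w ≡ true → U w ≡ true
          lem (inj₁ e) rewrite ≟ᵇ⇒≡ w v e | v∈S = refl
          lem (inj₂ h) = ∧-left h

        conclude : ⊥
        conclude with enumeration X
        ... | r , en = run (linkage-or-cut G U Y r (injective en) (λ i → taut 2 (λ s x → x ⊃ [ s ∨ x ]) (S (r i)) (X (r i)) (member en i)) Y⊆U)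
          where
          run : Linkage (E G) U Y (card X) r ⊎ SmallCut G U Y r → ⊥
          run (inj₁ L) = nm (linkedModel (small I) L en (λ w hx _ → hx) (λ w → taut 2 (λ u y → (y ⇒ u) ⊃ [ u ∨ y ⇒ u ]) (U w) (Y w) (Y⊆U w)) lab)
          run (inj₂ (A , B , cut₀ , m′ , r′ , lt , en′ , L)) = rigid (B ∖ˢ A) (A ∩ˢ B) (cut⇒sep G cut) (≤-trans (s≤s (≤-reflexive (enumerates-card en′))) lt) nonempty
              (λ lab′ no → no (linkedModel (<⇒≤ (≤-trans lt (small I))) L en′ (λ w hx hy → ∧-intro (⇒-elim _ _ (X⊆ cut w) hx) (⇒-elim _ _ (Y⊆ cut w) hy))
                 (λ w → taut 3 (λ a b y → (y ⇒ b) ⊃ [ b ∨ y ⇒ (b ∧ not a) ∨ (a ∧ b) ]) (A w) (B w) (Y w) (Y⊆ cut w)) lab′))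
            where
            cut : Cut (E G) U X Y A B
            cut = record { cover = cover cut₀ ; A⊆ = A⊆ cut₀ ; B⊆ = B⊆ cut₀ ; Y⊆ = Y⊆ cut₀ ; noEdge = noEdge cut₀
              ; X⊆ = λ w → taut 3 (λ x i a → (x ⇒ i) ⊃ (i ⇒ a) ⊃ [ x ⇒ a ]) (X w) (image r w) (A w) (proj₁ (image⇔ en w)) (X⊆ cut₀ w) }
            nonempty : ∃ λ w → (B ∖ˢ A) w ≡ true
            nonempty = let (w , hy , out) = ∃-outside Y (A ∩ˢ B) (≤-trans (s≤s (≤-trans (≤-reflexive (enumerates-card en′)) (≤-pred (≤-trans lt (small I))))) (≤-trans (≤-trans (n≤1+n 5) low)
                               (card-mono {P = N} {Y} (λ w h → taut 2 (λ a b → b ⊃ [ a ∨ b ]) (w ≟ᵇ v) (N w) h)))) in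
                           w , taut 3 (λ a b y → (y ⇒ b) ⊃ y ⊃ not (a ∧ b) ⊃ [ b ∧ not a ]) (A w) (B w) (Y w) (Y⊆ cut w) hy (cong not out)

      impossible : ⊥
      impossible with any? (λ u → (N u ∧ (card (common u) ≤ᵇ 4)) B.≟ true)
      ... | yes (u , h) = contractEdge G I size nm ne v u v∈S (∧-left h) (≤! (∧-right {N u} h))
              (λ S″ Q s same dn v∈ _ → separator S″ Q s same dn (escape (disjoint I) same v v∈S v∈))
      ... | no none with any? (λ u → N u B.≟ true)
      ...   | no empty = isolated (λ u h → empty (u , h))
      ...   | yes (u₀ , hu₀) = Linked.conclude (λ u h → ≰⇒> (λ le → none (u , ∧-intro h (T⇒≡ (≤⇒≤ᵇ le))))) u₀ hu₀

    -- If every degree is large, only two vertices of S can be adjacent to X.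
    module HighDegrees (bound : D G S X ≤ 10 * card S + 2) (high : ∀ v → S v ≡ true → card (nbhd G S X v) ≤ 9 → card (nbhd G S X v) + card (nbhd G S X v ∩ˢ X) ≤ 10 → ⊥) where

      touching : VertexSet n
      touching v = S v ∧ (1 ≤ᵇ degIn G X v)

      deg-sum : ∀ v → card (nbhd G S X v) ≡ degIn G S v + degIn G X v
      deg-sum v = card-+ (nbhd G S X v) _ _ (λ w → ≡ᵇ⇒≡ _ _ (≡⇒T (taut 3 (λ s x e → (s ⇒ not x) ⊃ [ ⟦ (s ∨ x) ∧ e ⟧ ≡ᵇ ⟦ s ∧ e ⟧ + ⟦ x ∧ e ⟧ ]) (S w) (X w) (E G v w) (disjoint I w))))

      deg-X : ∀ v → card (nbhd G S X v ∩ˢ X) ≡ degIn G X v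
      deg-X v = card-cong (λ w → lem (S w) (X w) (E G v w))
        where
        lem : ∀ s x e → ((s ∨ x) ∧ e) ∧ x ≡ x ∧ e
        lem true true true = refl
        lem true true false = refl
        lem true false true = refl
        lem true false false = refl
        lem false true true = refl
        lem false true false = refl
        lem false false e = refl

      -- The right side is the degree of v plus the number of its neighbours in X. With degree at
      -- least ten the second term pays for the flag; with degree at most nine the sum is at least
      -- eleven, since otherwise v would have low degree.
      weight : ∀ v → S v ≡ true → 10 + ⟦ 1 ≤ᵇ degIn G X v ⟧ ≤ degIn G S v + 2 * degIn G X v
      weight v s = ≤-trans main (≤-reflexive (ring (degIn G S v) (degIn G X v)))
        where
        a = degIn G S v
        b = degIn G X v
        ring : ∀ a b → (a + b) + b ≡ a + 2 * b
        ring = solve-∀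
        flag : ∀ b → ⟦ 1 ≤ᵇ b ⟧ ≤ b
        flag zero = z≤n
        flag (suc b) = s≤s z≤n
        main : 10 + ⟦ 1 ≤ᵇ b ⟧ ≤ (a + b) + b
        main with a + b ≤? 9
        ... | no big = +-mono-≤ (≰⇒> big) (flag b)
        ... | yes le with (a + b) + b ≤? 10
        ...   | yes le′ = ⊥-elim (high v s (subst (_≤ 9) (sym (deg-sum v)) le) (subst₂ (λ x y → x + y ≤ 10) (sym (deg-sum v)) (sym (deg-X v)) le′))
        ...   | no big = ≤-trans (+-monoʳ-≤ 10 (⟦⟧≤1 _)) (≰⇒> big)

      touching-few : card touching ≤ 2
      touching-few = +-cancelˡ-≤ (10 * card S) _ _ (begin
        10 * card S + card touching ≡⟨ sym (cong₂ _+_ (∑-* 10 (λ v → ⟦ S v ⟧)) refl) ⟩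
        ∑ (λ v → 10 * ⟦ S v ⟧) + card touching ≡⟨ sym (∑-+ (λ v → 10 * ⟦ S v ⟧) (λ v → ⟦ touching v ⟧)) ⟩
        ∑ (λ v → 10 * ⟦ S v ⟧ + ⟦ touching v ⟧) ≡⟨ ∑-cong (λ v → factor (S v) (1 ≤ᵇ degIn G X v)) ⟩
        ∑ (λ v → ⟦ S v ⟧ * (10 + ⟦ 1 ≤ᵇ degIn G X v ⟧)) ≤⟨ ∑-⟦⟧* S _ _ weight ⟩
        ∑ (λ v → ⟦ S v ⟧ * (degIn G S v + 2 * degIn G X v)) ≡⟨ sym (D-degrees G {S} {X} (disjoint I)) ⟩
        D G S X ≤⟨ bound ⟩
        10 * card S + 2 ∎)
        where
        open ≤-Reasoning
        factor : ∀ s t → 10 * ⟦ s ⟧ + ⟦ s ∧ t ⟧ ≡ ⟦ s ⟧ * (10 + ⟦ t ⟧)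
        factor true true = refl
        factor true false = refl
        factor false t = refl

      S₁ : VertexSet n
      S₁ = S ∖ˢ touching

      noX : ∀ u v → S₁ u ≡ true → E G u v ≡ true → X v ≡ true → ⊥
      noX u v h e x = absurdB (∧-intro (∧-left h) (T⇒≡ (≤⇒≤ᵇ (member⇒card (λ w → X w ∧ E G u w) v (∧-intro x e))))) (∧-right {S u} h)

      -- The at most two vertices adjacent to X separate all others from X. As `card X` is at least
      -- three, (M2) applies to the others, so these two alone carry the density.
      sep₁ : Sep G S X S₁ touching
      sep₁ = record
        { inner = λ v → taut 2 (λ s t → [ s ∧ not t ⇒ s ]) (S v) (touching v)
        ; outer = λ v → taut 3 (λ s x t → [ s ∧ t ⇒ s ∨ x ]) (S v) (X v) (1 ≤ᵇ degIn G X v)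
        ; apart = λ v → taut 2 (λ s t → [ s ∧ not t ⇒ not t ]) (S v) (touching v)
        ; closed = λ u v → ⇒-intro _ _ (λ h → taut 3 (λ s x t → (s ∨ x) ⊃ not x ⊃ [ (s ∧ not t) ∨ t ]) (S v) (X v) (touching v) (∧-right {E G u v} (∧-right {S₁ u} h))
             (notB (noX u v (∧-left {S₁ u} h) (∧-left (∧-right {S₁ u} h))))) }

      rest : VertexSet n
      rest = S ∖ˢ S₁

      rest-few : card rest ≤ 2
      rest-few = ≤-trans (card-mono {P = rest} {touching} (λ v → taut 2 (λ s t → (s ∧ not (s ∧ not t)) ⊃ [ t ]) (S v) (touching v))) touching-few

      rest-dense : 10 * card rest < D G rest X
      rest-dense = +-cancelʳ-< (10 * card S₁) (10 * card rest) (D G rest X) (begin-strict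
        10 * card rest + 10 * card S₁ ≡⟨ ring (card rest) (card S₁) ⟩
        10 * (card S₁ + card rest) ≡⟨ cong (10 *_) (sym (card-split S S₁ (inner sep₁))) ⟩
        10 * card S <⟨ dense (massed I) ⟩
        D G S X ≤⟨ D-split G sep₁ ⟩
        D G rest X + D G S₁ touching ≤⟨ +-monoʳ-≤ (D G rest X) (sparse (massed I) S₁ touching sep₁ (≤-trans (s≤s touching-few) three)) ⟩
        D G rest X + 10 * card S₁ ∎)
        where
        open ≤-Reasoning
        ring : ∀ a b → 10 * a + 10 * b ≡ 10 * (b + a)
        ring = solve-∀

      rest-dis : Disjoint rest X
      rest-dis v = taut 3 (λ s x t → (s ⇒ not x) ⊃ [ s ∧ t ⇒ not x ]) (S v) (X v) (not (S₁ v)) (disjoint I v)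

      all-card : ∀ m → card {m} (λ _ → true) ≡ m
      all-card zero = refl
      all-card (suc m) = cong suc (all-card m)

      conclude : ⊥
      conclude with enumeration rest | enumeration X
      ... | h , eh | r , er = by-size (card rest) refl rest-few h eh
        where
        row : Fin n → ℕ
        row v = ∑ (λ i → ⟦ E G v (r i) ⟧)
        row≤ : ∀ v → row v ≤ card X
        row≤ v = ≤-trans (∑-mono (λ i → ⟦⟧≤1 (E G v (r i)))) (≤-reflexive (all-card (card X)))
        by-size : ∀ t → t ≡ card rest → t ≤ 2 → (h : Fin t → Fin n) → Enumerates h rest → ⊥
        by-size zero e _ h eh = <⇒≱ (member⇒card rest (proj₁ found) (proj₂ found)) (≤-reflexive (sym e))
          where
          found : ∃ λ v → rest v ≡ true
          found = dense⇒nonempty G rest X rest-dense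
        -- A single vertex has at most five edges to X, which is exactly its budget.
        by-size (suc zero) e _ h eh = <⇒≱ rest-dense (begin
          D G rest X ≤⟨ D-core {k = 0} G rest-dis eh er ⟩
          2 * (row (h zero) + 0) ≤⟨ *-monoʳ-≤ 2 (≤-trans (≤-reflexive (+-identityʳ _)) (≤-trans (row≤ (h zero)) (small I))) ⟩
          10 * 1 ≡⟨ cong (10 *_) e ⟩
          10 * card rest ∎)
          where open ≤-Reasoning
        by-size (suc (suc zero)) e _ h eh = found (star G (disjoint I) lo hi five pair₀ lab)
          where
          a = h zero
          b = h (suc zero)
          -- From 20 < 2 + 2e, where e counts the edges from the two vertices to X: all ten possible
          -- edges are present, so X has five vertices and the pair is complete to it.
          total : 10 ≤ row a + row b
          total = *-cancelˡ-< 2 9 (row a + row b) (+-cancelˡ-< 2 18 (2 * (row a + row b)) (begin-strict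
            20 ≡⟨ cong (10 *_) e ⟩
            10 * card rest <⟨ rest-dense ⟩
            D G rest X ≤⟨ D-core {k = 1} G rest-dis eh er ⟩
            2 + 2 * (row a + (row b + 0)) ≡⟨ cong (λ t → 2 + 2 * (row a + t)) (+-identityʳ (row b)) ⟩
            2 + 2 * (row a + row b) ∎))
            where open ≤-Reasoning
          row-a : 5 ≤ row a
          row-a = +-cancelʳ-≤ 5 5 (row a) (≤-trans total (+-monoʳ-≤ (row a) (≤-trans (row≤ b) (small I))))
          row-b : 5 ≤ row b
          row-b = +-cancelˡ-≤ 5 5 (row b) (≤-trans total (+-monoˡ-≤ (row b) (≤-trans (row≤ a) (small I))))
          five : card X ≡ 5
          five = ≤-antisym (small I) (≤-trans row-a (row≤ a))
          full : ∀ v → 5 ≤ row v → ∀ x → X x ≡ true → E G v x ≡ true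
          full v le x hx with hits er x hx
          ... | i , refl = card-subset-≡ {P = λ i → E G v (r i)} {λ _ → true} (λ _ _ → refl) (≤-trans (≤-reflexive (all-card (card X))) (≤-trans (small I) le)) i refl
          pair₀ : CompletePair G S X a b
          pair₀ = record { distinct = λ e → 0≢1 (injective eh _ _ e) ; a∈S = ∧-left (member eh zero) ; b∈S = ∧-left (member eh (suc zero))
            ; a-full = full a row-a ; b-full = full b row-b }
            where
            0≢1 : _≢_ {A = Fin 2} zero (suc zero)
            0≢1 ()
          found : Model (E G) (S ∪ˢ X) X lab ⊎ (∃ λ r → Enumerates r X × Injective {5} (λ i → lab (r i))) → ⊥
          found (inj₁ M) = nm M
          found (inj₂ (r , en , inj)) = fin lab ne r en inj (≤-antisym hi (injective⇒≤ {f = λ i → lab (r i)} (λ {i} {j} → inj i j)))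
            where
            fin : ∀ {c} (lab : Fin n → Fin c) → ¬ Exc G S X lab → ∀ r → Enumerates r X → Injective {5} (λ i → lab (r i)) → c ≡ 5 → ⊥
            fin lab ne r en inj refl = ne (exc (labelled-roots en inj , a , b , pair₀))
        by-size (suc (suc (suc t))) e (s≤s (s≤s ())) h eh

    balanced : D G S X ≤ 10 * card S + 2 → ⊥
    balanced bound with any? (λ v → (S v ∧ (card (nbhd G S X v) ≤ᵇ 9) ∧ (card (nbhd G S X v) + card (nbhd G S X v ∩ˢ X) ≤ᵇ 10)) B.≟ true)
    ... | yes (v , h) = LowDegree.impossible v (∧-left h) (≤! (∧-left (∧-right {S v} h))) (≤! (∧-right {card (nbhd G S X v) ≤ᵇ 9} (∧-right {S v} h)))
    ... | no none = HighDegrees.conclude bound (λ v s le le′ → none (v , ∧-intro s (∧-intro (T⇒≡ (≤⇒≤ᵇ le)) (T⇒≡ (≤⇒≤ᵇ le′)))))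

  -- Surplus edges inside S are removed one at a time.
  trim : ∀ j (G : Graph′ n) {S X : VertexSet n} {lab : Fin n → Fin c} → D G S X ≤ j → Instance G S X → card S + card X ≤ suc k →
    ¬ Model (E G) (S ∪ˢ X) X lab → ¬ Exc G S X lab → 3 ≤ card X → ⊥
  trim j G {S} {X} {lab} le I size nm ne three with D G S X ≤? 10 * card S + 2
  ... | yes bound = balanced G I size nm ne three bound
  ... | no above with any? (λ p → any? (λ q → (S p ∧ S q ∧ E G p q) B.≟ true))
  -- With no edge inside S, each vertex of S contributes at most five edges, all to X, and there is
  -- no surplus.
  ...   | no none = above (≤-trans (begin
          D G S X ≡⟨ D-parts G {S} {X} (disjoint I) ⟩
          edgesBetween G S S + 2 * edgesBetween G S X ≡⟨ cong (_+ 2 * edgesBetween G S X) (∑-zero (λ p → ∑-zero (λ q → cong ⟦_⟧ (not⁻ (notB (λ h → none (p , q , h))))))) ⟩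
          2 * edgesBetween G S X ≤⟨ *-monoʳ-≤ 2 (∑-mono row) ⟩
          2 * ∑ (λ u → 5 * ⟦ S u ⟧) ≡⟨ cong (2 *_) (∑-* 5 (λ u → ⟦ S u ⟧)) ⟩
          2 * (5 * card S) ≡⟨ sym (*-assoc 2 5 (card S)) ⟩
          10 * card S ∎) (m≤m+n _ 2))
    where
    open ≤-Reasoning
    row : ∀ u → ∑ (λ v → ⟦ S u ∧ X v ∧ E G u v ⟧) ≤ 5 * ⟦ S u ⟧
    row u with S u
    ... | true = ≤-trans (card-mono {P = λ v → X v ∧ E G u v} {X} (λ v → ∧-left)) (small I)
    ... | false = ≤-reflexive (∑-zero {f = λ v → ⟦ false ∧ X v ∧ E G u v ⟧} (λ v → refl))
  ...   | yes (p , q , h) = next j le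
    where
    G⁻ = removeEdge G p q
    hp : S p ≡ true
    hp = ∧-left h
    hq : S q ≡ true
    hq = ∧-left (∧-right {S p} h)
    e : E G p q ≡ true
    e = ∧-right {S q} (∧-right {S p} h)
    p≢q : p ≢ q
    p≢q refl = false≢true (irrE G p) e
    E⁻⊆ : ∀ u v → E G⁻ u v ≡ true → E G u v ≡ true
    E⁻⊆ u v = ∧-left
    fewer : D G⁻ S X + 2 ≤ D G S X
    fewer = D-extra G⁻ G S X p q p≢q (λ u v → taut 6 (λ e r a b c d → [ counted (e ∧ r) a b c d ⇒ e ]) (E G u v) (not ((u ≟ᵇ p ∧ v ≟ᵇ q) ∨ (u ≟ᵇ q ∧ v ≟ᵇ p))) (S u) (X u) (S v) (X v))
      (not⁻ (taut 7 (λ e x y a b c d → x ⊃ [ not (counted (e ∧ not (x ∨ y)) a b c d) ]) (E G p q) (p ≟ᵇ p ∧ q ≟ᵇ q) (p ≟ᵇ q ∧ q ≟ᵇ p) (S p) (X p) (S q) (X q) (∧-intro (≟ᵇ-refl p) (≟ᵇ-refl q))))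
      (taut 5 (λ e a b c d → e ⊃ a ⊃ c ⊃ [ counted e a b c d ]) (E G p q) (S p) (X p) (S q) (X q) e hp hq)
    split : ∀ u v → E G u v ≡ true → E G⁻ u v ≡ true ⊎ (u ≡ p × v ≡ q) ⊎ (u ≡ q × v ≡ p)
    split u v uv with case-bool ((u ≟ᵇ p ∧ v ≟ᵇ q) ∨ (u ≟ᵇ q ∧ v ≟ᵇ p))
    ... | inj₂ k = inj₁ (∧-intro uv k)
    ... | inj₁ k with ∨-elim {u ≟ᵇ p ∧ v ≟ᵇ q} k
    ...   | inj₁ l = inj₂ (inj₁ (≟ᵇ⇒≡ u p (∧-left l) , ≟ᵇ⇒≡ v q (∧-right {u ≟ᵇ p} l)))
    ...   | inj₂ l = inj₂ (inj₂ (≟ᵇ⇒≡ u q (∧-left l) , ≟ᵇ⇒≡ v p (∧-right {u ≟ᵇ q} l)))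
    sparse⁻ : ∀ S′ Q → Sep G⁻ S X S′ Q → card Q < card X → D G⁻ S′ Q ≤ 10 * card S′
    sparse⁻ S′ Q s lt with D G⁻ S′ Q ≤? 10 * card S′
    ... | yes le = le
    ... | no gt = ⊥-elim (cases (case-bool (S′ p ∧ not (S′ q ∨ Q q))) (case-bool (S′ q ∧ not (S′ p ∨ Q p))))
      where
      -- The removed edge joins S′ to a vertex o outside S′ ∪ Q, which is added to the separator.
      crossing : ∀ i o → S o ≡ true → S′ i ≡ true → (S′ o ∨ Q o) ≡ false → (∀ u v → E G u v ≡ true → E G⁻ u v ≡ true ⊎ (u ≡ i × v ≡ o) ⊎ (u ≡ o × v ≡ i)) → ⊥
      crossing i o ho hi out sp = compare (card Q⁺ N.<? card X)
        where
        Q⁺ = insert o Q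
        S′o : S′ o ≡ false
        S′o = not⁻ (taut 2 (λ a b → not (a ∨ b) ⊃ [ not a ]) (S′ o) (Q o) (cong not out))
        Qo : Q o ≡ false
        Qo = not⁻ (taut 2 (λ a b → not (a ∨ b) ⊃ [ not b ]) (S′ o) (Q o) (cong not out))
        clo : ∀ u v → S′ u ≡ true → E G u v ≡ true → (S v ∨ X v) ≡ true → (S′ v ∨ Q⁺ v) ≡ true
        clo u v hu uv r with sp u v uv
        ... | inj₁ e⁻ = taut 3 (λ s d q → (s ∨ q) ⊃ [ s ∨ (d ∨ q) ]) (S′ v) (v ≟ᵇ o) (Q v) (⇒-elim _ _ (closed s u v) (∧-intro hu (∧-intro e⁻ r)))
        ... | inj₂ (inj₁ (_ , v≡o)) = taut 3 (λ s d q → d ⊃ [ s ∨ (d ∨ q) ]) (S′ v) (v ≟ᵇ o) (Q v) (≡⇒≟ᵇ v≡o)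
        ... | inj₂ (inj₂ (refl , _)) = false≢true S′o hu
        s⁺ : Sep G S X S′ Q⁺
        s⁺ = record
          { inner = inner s
          ; outer = λ v → ⇒-intro _ _ (λ h → out⁺ v (∨-elim {v ≟ᵇ o} h))
          ; apart = λ v → ⇒-intro _ _ (λ h → notB (λ q → ap v h (∨-elim {v ≟ᵇ o} q)))
          ; closed = λ u v → ⇒-intro _ _ (λ h → clo u v (∧-left {S′ u} h) (∧-left (∧-right {S′ u} h)) (∧-right {E G u v} (∧-right {S′ u} h))) }
          where
          out⁺ : ∀ v → (v ≟ᵇ o) ≡ true ⊎ Q v ≡ true → (S v ∨ X v) ≡ true
          out⁺ v (inj₁ d) rewrite ≟ᵇ⇒≡ v o d | ho = refl
          out⁺ v (inj₂ q) = ⇒-elim _ _ (outer s v) q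
          ap : ∀ v → S′ v ≡ true → (v ≟ᵇ o) ≡ true ⊎ Q v ≡ true → ⊥
          ap v h (inj₁ d) = false≢true S′o (subst (λ t → S′ t ≡ true) (≟ᵇ⇒≡ v o d) h)
          ap v h (inj₂ q) = absurdB q (⇒-elim _ _ (apart s v) h)
        dn⁺ : 10 * card S′ < D G S′ Q⁺
        dn⁺ = ≤-trans (≰⇒> gt) (∑∑-mono (λ u v → ⟦⟧-mono (taut 8 (λ e r su qu sv qv du dv → counted (e ∧ r) su qu sv qv ⊃ [ counted e su (du ∨ qu) sv (dv ∨ qv) ])
          (E G u v) (not ((u ≟ᵇ p ∧ v ≟ᵇ q) ∨ (u ≟ᵇ q ∧ v ≟ᵇ p))) (S′ u) (Q u) (S′ v) (Q v) (u ≟ᵇ o) (v ≟ᵇ o))))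
        compare : Dec (card Q⁺ < card X) → ⊥
        compare (yes lt⁺) = <⇒≱ dn⁺ (sparse (massed I) S′ Q⁺ s⁺ lt⁺)
        compare (no big) = separator⇒⊥ G I size nm ne S′ Q⁺ s⁺ size-Q⁺ dn⁺ (escape (disjoint I) size-Q⁺ o ho (taut 2 (λ a b → a ⊃ [ a ∨ b ]) (o ≟ᵇ o) (Q o) (≟ᵇ-refl o)))
          where
          size-Q⁺ : card Q⁺ ≡ card X
          size-Q⁺ = ≤-antisym (≤-trans (≤-reflexive (card-insert Q o Qo)) lt) (≮⇒≥ big)
      outside : ∀ {a b x} → (a ∧ not (b ∨ x)) ≡ true → (b ∨ x) ≡ false
      outside {true} h = not⁻ h
      cases : (S′ p ∧ not (S′ q ∨ Q q)) ≡ true ⊎ not (S′ p ∧ not (S′ q ∨ Q q)) ≡ true → (S′ q ∧ not (S′ p ∨ Q p)) ≡ true ⊎ not (S′ q ∧ not (S′ p ∨ Q p)) ≡ true → ⊥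
      cases (inj₁ k) _ = crossing p q hq (∧-left k) (outside {S′ p} {S′ q} {Q q} k) split
      cases (inj₂ _) (inj₁ k) = crossing q p hp (∧-left k) (outside {S′ q} {S′ p} {Q p} k) (λ u v uv → flip (split u v uv))
        where
        flip : ∀ {A B C : Set} → A ⊎ B ⊎ C → A ⊎ C ⊎ B
        flip (inj₁ a) = inj₁ a
        flip (inj₂ (inj₁ b)) = inj₂ (inj₂ b)
        flip (inj₂ (inj₂ c)) = inj₂ (inj₁ c)
      -- Here the removed edge does not leave S′ ∪ Q from S′, so the separation was already one of
      -- G, and (M2) passes to the graph with fewer edges.
      cases (inj₂ k) (inj₂ l) = gt (≤-trans (D-mono G⁻ G S′ Q (λ u v → taut 6 (λ e r a b c d → [ counted (e ∧ r) a b c d ⇒ e ]) (E G u v) (not ((u ≟ᵇ p ∧ v ≟ᵇ q) ∨ (u ≟ᵇ q ∧ v ≟ᵇ p))) (S′ u) (Q u) (S′ v) (Q v)))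
          (sparse (massed I) S′ Q sepG lt))
        where
        clo : ∀ u v → S′ u ≡ true → E G u v ≡ true → (S v ∨ X v) ≡ true → (S′ v ∨ Q v) ≡ true
        clo u v hu uv r with split u v uv
        ... | inj₁ e⁻ = ⇒-elim _ _ (closed s u v) (∧-intro hu (∧-intro e⁻ r))
        ... | inj₂ (inj₁ (refl , refl)) = taut 2 (λ a b → not (a ∧ not b) ⊃ a ⊃ [ b ]) (S′ u) (S′ v ∨ Q v) k hu
        ... | inj₂ (inj₂ (refl , refl)) = taut 2 (λ a b → not (a ∧ not b) ⊃ a ⊃ [ b ]) (S′ u) (S′ v ∨ Q v) l hu
        sepG : Sep G S X S′ Q
        sepG = record { inner = inner s ; outer = outer s ; apart = apart s
          ; closed = λ u v → ⇒-intro _ _ (λ h → clo u v (∧-left {S′ u} h) (∧-left (∧-right {S′ u} h)) (∧-right {E G u v} (∧-right {S′ u} h))) }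
    I⁻ : Instance G⁻ S X
    -- Removal costs 2, and the count was above `10 * card S + 2`, so density survives.
    I⁻ = inst (disjoint I) (small I) (record { dense = +-cancelʳ-< 2 _ _ (≤-trans (≰⇒> above) (D-removeEdge G S X p q)) ; sparse = sparse⁻ })
    ne⁻ : ∀ {c} {lab : Fin n → Fin c} → ¬ Exc G S X lab → ¬ Exc G⁻ S X lab
    ne⁻ ne (exc (lr , a , b , cp)) = ne (exc (lr , a , b , record { distinct = distinct cp ; a∈S = a∈S cp ; b∈S = b∈S cp
      ; a-full = λ x hx → E⁻⊆ a x (a-full cp x hx) ; b-full = λ x hx → E⁻⊆ b x (b-full cp x hx) }))
    next : ∀ j → D G S X ≤ j → ⊥
    next zero le = above (≤-trans le z≤n)
    next (suc j) le = trim j G⁻ (≤-pred (≤-trans (≤-reflexive (+-comm 1 _)) (≤-trans fewer′ le))) I⁻ size (λ M → nm (enlarge E⁻⊆ (λ v h → h) M)) (ne⁻ ne) three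
      where
      fewer′ : D G⁻ S X + 1 ≤ D G S X
      fewer′ = ≤-trans (+-monoʳ-≤ (D G⁻ S X) (s≤s z≤n)) fewer

  claim : Claim n c (suc k)
  claim G S X lab I size nm ne with 3 ≤? card X
  ... | yes three = trim (D G S X) G ≤-refl I size nm ne three
  ... | no few with card X N.≟ 2
  ...   | yes two = twoRoots lo G lab I two nm
  ...   | no not2 = nm (trivialModel lo G lab (λ v h → taut 2 (λ s x → x ⊃ [ s ∨ x ]) (S v) (X v) h) (λ x y hx hy → unique x y hx hy (x F.≟ y)))
    where
    unique : ∀ x y → X x ≡ true → X y ≡ true → Dec (x ≡ y) → x ≡ y
    unique x y hx hy (yes e) = e
    unique x y hx hy (no ne) = ⊥-elim (<⇒≱ (≤-trans (s≤s (member⇒card (delete x X) y (∧-intro hy (≢⇒≟ᵇ y x (λ e → ne (sym e)))))) (≤-reflexive (sym (card-delete X x hx))))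
      (≤-pred (≤∧≢⇒< (≤-pred (≰⇒> few)) not2)))

main-claim : ∀ {n c} → 2 ≤ c → c ≤ 5 → ∀ k → Claim n c k
main-claim lo hi zero G S X lab I size nm ne = let (v , h) = dense⇒nonempty G S X (dense (massed I)) in
  <⇒≱ (member⇒card S v h) (≤-trans (m≤m+n (card S) (card X)) size)
main-claim {n} {suc c} lo hi (suc k) = Step.claim lo hi zero k (main-claim lo hi k)

-- Back to the given graph

lookup-card : ∀ {n} (p : Subset n) → card (lookup p) ≡ ∣ p ∣
lookup-card Vec.[] = refl
lookup-card (true Vec.∷ p) = cong suc (lookup-card p)
lookup-card (false Vec.∷ p) = lookup-card p

countB-++ : ∀ {A : Set} (p : A → Bool) xs ys → countB p (xs ++ ys) ≡ countB p xs + countB p ys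
countB-++ p [] ys = refl
countB-++ p (x ∷ xs) ys with p x
... | true = cong suc (countB-++ p xs ys)
... | false = countB-++ p xs ys

countB-map : ∀ {A B : Set} (p : B → Bool) (f : A → B) xs → countB p (map f xs) ≡ countB (λ x → p (f x)) xs
countB-map p f [] = refl
countB-map p f (x ∷ xs) with p (f x)
... | true = cong suc (countB-map p f xs)
... | false = countB-map p f xs

countB-tabulate : ∀ {A : Set} {m} (p : A → Bool) (f : Fin m → A) → countB p (tabulate f) ≡ ∑ (λ i → ⟦ p (f i) ⟧)
countB-tabulate {m = zero} p f = refl
countB-tabulate {m = suc m} p f with p (f zero)
... | true = cong suc (countB-tabulate p (λ i → f (suc i)))
... | false = countB-tabulate p (λ i → f (suc i))

countB-concatMap : ∀ {A B : Set} {m} (p : B → Bool) (g : A → List B) (f : Fin m → A) → countB p (concatMap g (tabulate f)) ≡ ∑ (λ i → countB p (g (f i)))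
countB-concatMap {m = zero} p g f = refl
countB-concatMap {m = suc m} p g f = trans (countB-++ p (g (f zero)) _) (cong (countB p (g (f zero)) +_) (countB-concatMap p g (λ i → f (suc i))))

countB-pairs : ∀ {m} (p : Fin m × Fin m → Bool) → countB p (allPairs m) ≡ ∑∑ (λ u v → ⟦ p (u , v) ⟧)
countB-pairs {m} p = trans (countB-concatMap p (λ i → map (λ j → (i , j)) (tabulate (λ j → j))) (λ i → i))
  (∑-cong (λ u → trans (countB-map p (λ j → (u , j)) (tabulate (λ j → j))) (countB-tabulate (λ j → p (u , j)) (λ j → j))))

∑∑-half : ∀ {n} (b : Fin n → Fin n → Bool) → (∀ u v → b u v ≡ b v u) → (∀ u → b u u ≡ false) →
  ∑∑ (λ u v → ⟦ b u v ⟧) ≡ 2 * ∑∑ (λ u v → ⟦ (toℕ u <ᵇ toℕ v) ∧ b u v ⟧)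
∑∑-half b bsym birr = trans (∑-cong (λ u → ∑-cong (λ v → pt u v))) (trans (∑∑-+ (λ u v → ⟦ (toℕ u <ᵇ toℕ v) ∧ b u v ⟧) (λ u v → ⟦ (toℕ v <ᵇ toℕ u) ∧ b v u ⟧))
  (cong₂ _+_ refl (trans (∑-swap (λ u v → ⟦ (toℕ v <ᵇ toℕ u) ∧ b v u ⟧)) (sym (+-identityʳ _)))))
  where
  order : ∀ i j → i ≢ j → (i <ᵇ j) ≡ not (j <ᵇ i)
  order zero zero ne = ⊥-elim (ne refl)
  order zero (suc j) ne = refl
  order (suc i) zero ne = refl
  order (suc i) (suc j) ne = order i j (λ e → ne (cong suc e))
  pt : ∀ u v → ⟦ b u v ⟧ ≡ ⟦ (toℕ u <ᵇ toℕ v) ∧ b u v ⟧ + ⟦ (toℕ v <ᵇ toℕ u) ∧ b v u ⟧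
  pt u v with u F.≟ v
  ... | yes refl rewrite birr u with toℕ u <ᵇ toℕ u
  ...   | true = refl
  ...   | false = refl
  pt u v | no ne rewrite bsym v u | order (toℕ u) (toℕ v) (λ e → ne (toℕ-injective e)) with toℕ v <ᵇ toℕ u
  ...   | true = refl
  ...   | false = sym (+-identityʳ _)

¬¬-∀Fin : ∀ {n} {P : Fin n → Set} → (∀ i → ¬ ¬ P i) → ¬ ¬ (∀ i → P i)
¬¬-∀Fin {zero} h k = k (λ ())
¬¬-∀Fin {suc n} {P} h k = h zero (λ p → ¬¬-∀Fin {n} {λ i → P (suc i)} (λ i → h (suc i)) (λ ps → k (λ { zero → p ; (suc i) → ps i })))

-- Double negation passes through quantifiers over finite types. Functions are rebuilt from their
-- values and agree with the originals only pointwise, hence `resp`. It yields branch sets for all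
-- orderings simultaneously.
¬¬-∀tuples : ∀ k {n} {P : (Fin k → Fin n) → Set} → (∀ f g → (∀ i → f i ≡ g i) → P f → P g) → (∀ f → ¬ ¬ P f) → ¬ ¬ (∀ f → P f)
¬¬-∀tuples zero resp h k = h (λ ()) (λ p → k (λ f → resp _ f (λ ()) p))
¬¬-∀tuples (suc m) {n} {P} resp h k = ¬¬-∀Fin {n} {λ a → ∀ g → P (snoc a g)}
  (λ a → ¬¬-∀tuples m (λ f g e → resp _ _ (λ { zero → refl ; (suc i) → e i })) (λ g → h (snoc a g)))
  (λ all → k (λ f → resp _ f (λ { zero → refl ; (suc i) → refl }) (all (f zero) (λ i → f (suc i)))))

Branches : (G : Graph) {k : ℕ} → (Fin k → V G) → Set
Branches G {k} x = Σ (Fin k → VSet G) λ Xs →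
  (∀ i j → ¬ i ≡ j → ∀ v → v ∈ Xs i → v ∉ Xs j) × (∀ i → Connected G (Xs i)) × (∀ i → x i ∈ Xs i) × (∀ i j → CycSucc i j → EdgeBetween G (Xs i) (Xs j))

Conclusion : (G : Graph) → VSet G → Set
Conclusion G X = ∣ X ∣ ≡ 5
  × ρ G (∁ X) ≡ 5 * ∣ ∁ X ∣ + 1
  × Σ (Fin 5 → V G) λ x → IsOrdering G X x
  × (∀ i → ¬ Adj G (x i) (x (sh i)))
  × ∃ λ a → ∃ λ b → a ∉ X × b ∉ X
  × Adj G a b × (∀ i → Adj G a (x i) × Adj G b (x i))
  × (∀ C → IsComponent G (∁ (X ∪ (⁅ a ⁆ ∪ ⁅ b ⁆))) C →
  ρ G C ≡ 5 * ∣ C ∣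
  × ∃ λ i → ∀ v → InN G C v → v ∈ (⁅ a ⁆ ∪ (⁅ b ⁆ ∪ (⁅ x i ⁆ ∪ ⁅ x (sh (sh i)) ⁆))))

module Translation (G : Graph) (X : VSet G) where

  m = Defs.n G

  H : Graph′ m
  H = record { E = Defs.E G ; symE = λ u v → subst (λ b → (Defs.E G u v ⇒ b) ≡ true) (Defs.sym G u v) (taut 1 (λ a → [ a ⇒ a ]) (Defs.E G u v)) ; irrE = Defs.irrefl G }

  roots inside : VertexSet m
  roots = lookup X
  inside v = not (roots v)

  dis : Disjoint inside roots
  dis v = taut 1 (λ x → [ not x ⇒ not x ]) (roots v)

  ∈⇒ : ∀ {p : Subset m} {v} → v ∈ p → lookup p v ≡ true
  ∈⇒ = []=⇒lookup

  ⇒∈ : ∀ (p : Subset m) {v} → lookup p v ≡ true → v ∈ p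
  ⇒∈ p {v} = lookup⇒[]= v p

  lookup-∁ : ∀ v → lookup (∁ X) v ≡ inside v
  lookup-∁ v = lookup-map v not X

  card-roots : card roots ≡ ∣ X ∣
  card-roots = lookup-card X

  card-inside : card inside ≡ ∣ ∁ X ∣
  card-inside = trans (card-cong {P = inside} {lookup (∁ X)} (λ v → sym (lookup-∁ v))) (lookup-card (∁ X))

  -- Closedness makes every edge of the graph with an end in P lie in P ∪ Q, so `D` misses none of
  -- the edges that `ρ` counts and counts each in both directions.
  2ρ : ∀ (Y : VSet G) (P Q : VertexSet m) → (∀ v → lookup Y v ≡ P v) → Disjoint P Q → (∀ u v → (P u ∧ Defs.E G u v ⇒ P v ∨ Q v) ≡ true) → D H P Q ≡ 2 * ρ G Y
  2ρ Y P Q eq d cl = trans (∑-cong (λ u → ∑-cong (λ v → cong ⟦_⟧ (pt u v)))) (trans (∑∑-half touch touch-sym touch-irr) (cong (2 *_) (sym (countB-pairs {m} _))))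
    where
    touch : Fin m → Fin m → Bool
    touch u v = Defs.E G u v ∧ (lookup Y u ∨ lookup Y v)
    touch-sym : ∀ u v → touch u v ≡ touch v u
    touch-sym u v rewrite Defs.sym G u v = lem (Defs.E G v u) (lookup Y u) (lookup Y v)
      where
      lem : ∀ e a b → e ∧ (a ∨ b) ≡ e ∧ (b ∨ a)
      lem true true true = refl
      lem true true false = refl
      lem true false true = refl
      lem true false false = refl
      lem false a b = refl
    touch-irr : ∀ u → touch u u ≡ false
    touch-irr u rewrite Defs.irrefl G u = refl
    pt : ∀ u v → countedPair H P Q u v ≡ touch u v
    pt u v rewrite eq u | eq v = bool-ext
      (taut 5 (λ e a q b r → counted e a q b r ⊃ [ e ∧ (a ∨ b) ]) (Defs.E G u v) (P u) (Q u) (P v) (Q v))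
      (λ h → taut 6 (λ e e′ a q b r → (e ⇒ e′) ⊃ (a ∧ e ⇒ b ∨ r) ⊃ (b ∧ e′ ⇒ a ∨ q) ⊃ (e ∧ (a ∨ b)) ⊃ [ counted e a q b r ])
        (Defs.E G u v) (Defs.E G v u) (P u) (Q u) (P v) (Q v) (symE H u v) (cl u v) (cl v u) h)

  2ρ-inside : D H inside roots ≡ 2 * ρ G (∁ X)
  2ρ-inside = 2ρ (∁ X) inside roots lookup-∁ dis (λ u v → taut 3 (λ p e x → [ p ∧ e ⇒ not x ∨ x ]) (inside u) (Defs.E G u v) (roots v))

  lookup-─ : ∀ {n} (p q : Subset n) v → lookup (p ─ q) v ≡ lookup p v ∧ not (lookup q v)
  lookup-─ (x Vec.∷ p) (true Vec.∷ q) zero with x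
  ... | true = refl
  ... | false = refl
  lookup-─ (x Vec.∷ p) (false Vec.∷ q) zero with x
  ... | true = refl
  ... | false = refl
  lookup-─ (x Vec.∷ p) (y Vec.∷ q) (suc v) = lookup-─ p q v

  fully : ∀ {Z Q : VertexSet m} → Sep H inside roots Z Q → ∀ u v → (Z u ∧ Defs.E G u v ⇒ Z v ∨ Q v) ≡ true
  fully {Z} {Q} s u v = taut 5 (λ z e x w q → (z ∧ e ∧ (not x ∨ x) ⇒ w ∨ q) ⊃ [ z ∧ e ⇒ w ∨ q ]) (Z u) (Defs.E G u v) (roots v) (Z v) (Q v) (closed s u v)

  massedH : FiveMassed G X → Massed H inside roots
  massedH (M1 , M2) = record
    { dense = subst₂ _<_ (trans (sym (*-assoc 2 5 ∣ ∁ X ∣)) (cong (10 *_) (sym card-inside))) (sym 2ρ-inside) (*-monoʳ-< 2 M1)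
    ; sparse = λ Z Q s lt → sp Z Q s lt }
    where
    sp : ∀ Z Q → Sep H inside roots Z Q → card Q < card roots → D H Z Q ≤ 10 * card Z
    sp Z Q s lt = begin
      D H Z Q ≡⟨ 2ρ (B ─ A) Z Q lookup-B─A (apart s) (fully s) ⟩
      2 * ρ G (B ─ A) ≤⟨ *-monoʳ-≤ 2 (M2 A B separation (subst₂ _<_ (sym order≡) card-roots lt)) ⟩
      2 * (5 * ∣ B ─ A ∣) ≡⟨ sym (*-assoc 2 5 ∣ B ─ A ∣) ⟩
      10 * ∣ B ─ A ∣ ≡⟨ cong (10 *_) (trans (sym (lookup-card (B ─ A))) (card-cong lookup-B─A)) ⟩
      10 * card Z ∎
      where
      open ≤-Reasoning
      A B : VSet G
      -- With A the complement of Z and B = Z ∪ Q, the difference B ∖ A is Z and the intersection is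
      -- Q, as Z and Q are disjoint.
      A = Vec.tabulate (λ v → not (Z v))
      B = Vec.tabulate (λ v → Z v ∨ Q v)
      inA : ∀ v → lookup A v ≡ not (Z v)
      inA v = lookup∘tabulate (λ v → not (Z v)) v
      inB : ∀ v → lookup B v ≡ Z v ∨ Q v
      inB v = lookup∘tabulate (λ v → Z v ∨ Q v) v
      lookup-B─A : ∀ v → lookup (B ─ A) v ≡ Z v
      lookup-B─A v = trans (lookup-─ B A v) (trans (cong₂ (λ b a → b ∧ not a) (inB v) (inA v)) (lem (Z v) (Q v)))
        where
        lem : ∀ z q → (z ∨ q) ∧ not (not z) ≡ z
        lem true q = refl
        lem false true = refl
        lem false false = refl
      order≡ : Defs.order A B ≡ card Q
      order≡ = trans (sym (lookup-card (A ∩ B))) (card-cong (λ v → trans (lookup-zipWith _∧_ v A B) (trans (cong₂ _∧_ (inA v) (inB v)) (lem (Z v) (Q v) (apart s v)))))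
        where
        lem : ∀ z q → (z ⇒ not q) ≡ true → not z ∧ (z ∨ q) ≡ q
        lem true false _ = refl
        lem false q _ = refl
      separation : Separation G X A B
      separation = record { cover = cov ; X⊆A = λ {v} h → ⇒∈ A (trans (inA v) (taut 2 (λ z x → (z ⇒ not x) ⊃ x ⊃ [ not z ]) (Z v) (roots v) (inner s v) (∈⇒ h))) ; noEdge = ne }
        where
        cov : ∀ v → v ∈ A ⊎ v ∈ B
        cov v with case-bool (Z v)
        ... | inj₁ z = inj₂ (⇒∈ B (trans (inB v) (taut 2 (λ z q → z ⊃ [ z ∨ q ]) (Z v) (Q v) z)))
        ... | inj₂ z = inj₁ (⇒∈ A (trans (inA v) z))
        ne : ∀ u v → u ∈ A → u ∉ B → v ∈ B → v ∉ A → ¬ Adj G u v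
        ne u v _ u∉B _ v∉A e = u∉B (⇒∈ B (trans (inB u) (⇒-elim _ _ (fully s v u) (∧-intro zv (trans (Defs.sym G v u) e)))))
          where
          zv : Z v ≡ true
          zv with case-bool (Z v)
          ... | inj₁ z = z
          ... | inj₂ z = ⊥-elim (v∉A (⇒∈ A (trans (inA v) z)))

  reach-snoc : ∀ {S : VSet G} {u w v} → Reach G S u w → Adj G w v → v ∈ S → Reach G S u v
  reach-snoc (here u∈) e v∈ = step u∈ e (here v∈)
  reach-snoc (step u∈ a r) e v∈ = step u∈ a (reach-snoc r e v∈)

  reach-++ : ∀ {S : VSet G} {u w v} → Reach G S u w → Reach G S w v → Reach G S u v
  reach-++ (here _) q = q
  reach-++ (step u∈ a r) q = step u∈ a (reach-++ r q)

  reach-source : ∀ {S : VSet G} {u v} → Reach G S u v → u ∈ S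
  reach-source (here u∈) = u∈
  reach-source (step u∈ _ _) = u∈

  reach-sym : ∀ {S : VSet G} {u v} → Reach G S u v → Reach G S v u
  reach-sym (here u∈) = here u∈
  reach-sym (step {u} {w} u∈ a r) = reach-snoc (reach-sym r) (trans (Defs.sym G w u) a) u∈

  orderingLabel : ∀ {k} → Fin k → (Fin k → Fin m) → Fin m → Fin k
  orderingLabel d x v = fromMaybe d (index x v)

  ordering⇒enumerates : ∀ {k} {x : Fin k → Fin m} → IsOrdering G X x → Enumerates x roots
  ordering⇒enumerates {x = x} (_ , inj , hit , mem) = record { injective = λ i j e → inj e ; member = λ i → ∈⇒ (mem i) ; hits = λ v h → hit v (⇒∈ X h) }

  label-root : ∀ {k} (d : Fin k) {x : Fin k → Fin m} → Enumerates x roots → ∀ i → orderingLabel d x (x i) ≡ i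
  label-root d {x} en i rewrite index-complete x (injective en) i = refl

  -- The branch sets are the components of the roots in their bags.
  model⇒branches : ∀ {k} {x : Fin k → Fin m} (d : Fin k) → Enumerates x roots → Model (Defs.E G) (inside ∪ˢ roots) roots (orderingLabel d x) → Branches G x
  model⇒branches {k} {x} d en M = Xs , disj , conn , (λ i → intro i (x i) (start∈ i)) , edge
    where
    bag : Fin k → VertexSet m
    bag i v = does (MP.≡-dec F._≟_ (β M v) (just i))
    bag-elim : ∀ i v → bag i v ≡ true → β M v ≡ just i
    bag-elim i v h with MP.≡-dec F._≟_ (β M v) (just i)
    ... | yes e = e
    bag-intro : ∀ i v → β M v ≡ just i → bag i v ≡ true
    bag-intro i v e with MP.≡-dec F._≟_ (β M v) (just i)
    ... | yes _ = refl
    ... | no ne = ⊥-elim (ne e)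
    comp : ∀ i → Closure (within H (bag i)) (λ v → v ≟ᵇ x i)
    comp i = closure (within H (bag i)) (λ v → v ≟ᵇ x i)
    Xs : Fin k → VSet G
    Xs i = Vec.tabulate (set (comp i))
    elim : ∀ i v → v ∈ Xs i → set (comp i) v ≡ true
    elim i v h = trans (sym (lookup∘tabulate (set (comp i)) v)) (∈⇒ h)
    intro : ∀ i v → set (comp i) v ≡ true → v ∈ Xs i
    intro i v h = ⇒∈ (Xs i) (trans (lookup∘tabulate (set (comp i)) v) h)
    start∈ : ∀ i → set (comp i) (x i) ≡ true
    start∈ i = base (comp i) (x i) (≟ᵇ-refl (x i))
    rootβ : ∀ i → β M (x i) ≡ just i
    rootβ i = trans (root M (x i) (member en i)) (cong just (label-root d en i))
    inBag : ∀ i v → set (comp i) v ≡ true → β M v ≡ just i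
    inBag i v h = bag-elim i v (reached-in H (bag i) (λ v → v ≟ᵇ x i) (λ u e → bag-intro i u (subst (λ t → β M t ≡ just i) (sym (≟ᵇ⇒≡ u (x i) e)) (rootβ i))) (reached (comp i) v h))
    disj : ∀ i j → ¬ i ≡ j → ∀ v → v ∈ Xs i → v ∉ Xs j
    disj i j ne v hi hj = ne (MP.just-injective (trans (sym (inBag i v (elim i v hi))) (inBag j v (elim j v hj))))
    fromRoot : ∀ i {v} → Reached (within H (bag i)) (λ v → v ≟ᵇ x i) v → set (comp i) v ≡ true × Reach G (Xs i) (x i) v
    fromRoot i (start {v} p) rewrite ≟ᵇ⇒≡ v (x i) p = start∈ i , here (intro i (x i) (start∈ i))
    fromRoot i (more {u} {v} r e) with fromRoot i r
    ... | cu , re = cv , reach-snoc re (∧-left e) (intro i v cv)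
      where
      cv : set (comp i) v ≡ true
      cv = stable (comp i) u v cu e
    conn : ∀ i → Connected G (Xs i)
    conn i u v hu hv = reach-++ (reach-sym (proj₂ (fromRoot i (reached (comp i) u (elim i u hu))))) (proj₂ (fromRoot i (reached (comp i) v (elim i v hv))))
    along : ∀ i {u v} → Walk (Defs.E G) (β M) u v → set (comp i) u ≡ true → set (comp i) v ≡ true
    along i done h = h
    along i (hop {u} {w} e b p) h = along i p (stable (comp i) u w h (∧-intro e (bag-intro i w (trans (sym b) (inBag i u h)))))
    edge : ∀ i j → CycSucc i j → EdgeBetween G (Xs i) (Xs j)
    edge i j s with link M (x i) (x j) (member en i) (member en j) (subst₂ CycSucc (sym (label-root d en i)) (sym (label-root d en j)) s)
    ... | u , v , p , e , q = u , v , intro i u (along i p (start∈ i)) , intro j v (along j (reverse H q) (start∈ j)) , e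

  walk⇒reach : ∀ {c} {β : Labelling m c} {u v} → Walk (Defs.E G) β u v → Reach G ⊤ u v
  walk⇒reach done = here ∈⊤
  walk⇒reach (hop e _ p) = step ∈⊤ e (walk⇒reach p)

  branches-cong : ∀ {k} {x y : Fin k → Fin m} → (∀ i → x i ≡ y i) → Branches G x → Branches G y
  branches-cong e (Xs , a , b , c , d) = Xs , a , b , (λ i → subst (λ t → t ∈ Xs i) (e i) (c i)) , d

  ordering-cong : ∀ {k} {x y : Fin k → Fin m} → (∀ i → x i ≡ y i) → IsOrdering G X x → IsOrdering G X y
  ordering-cong {x = x} {y} e (k≡ , inj , hit , mem) = k≡ , (λ {i} {j} f → inj (trans (e i) (trans f (sym (e j))))) ,
    (λ v h → let (i , p) = hit v h in i , trans (sym (e i)) p) , λ i → subst (_∈ X) (e i) (mem i)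

  AllBranches : ℕ → Set
  AllBranches k = ∀ (x : Fin k → Fin m) → IsOrdering G X x → Branches G x

  allBranches⇒linked : ∀ k → ∣ X ∣ ≡ k → 3 ≤ k → AllBranches k → CycleLinked G X
  allBranches⇒linked k refl three all = inj₁ (three , all)

  module WithMassed (fm : FiveMassed G X) (few : ∣ X ∣ ≤ 5) where

    I : Instance H inside roots
    I = inst dis (≤-trans (≤-reflexive card-roots) few) (massedH fm)

    ¬¬model : ∀ {c} → 2 ≤ c → c ≤ 5 → (lab : Fin m → Fin c) → ¬ Exc H inside roots lab → ¬ ¬ Model (Defs.E G) (inside ∪ˢ roots) roots lab
    ¬¬model lo hi lab ne nm = main-claim lo hi (card inside + card roots) H inside roots lab I ≤-refl nm ne

    unexceptional⇒linked : ∀ k → ∣ X ∣ ≡ k → 3 ≤ k → k ≤ 5 → (∀ (lab : Fin m → Fin k) → ¬ Exc H inside roots lab) → ¬ ¬ CycleLinked G X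
    unexceptional⇒linked zero _ () _ _ _
    unexceptional⇒linked (suc k) eq three hi ne nl = ¬¬-∀tuples (suc k) {P = λ x → IsOrdering G X x → Branches G x}
      (λ f g e h o → branches-cong e (h (ordering-cong (λ i → sym (e i)) o)))
      (λ x nb → nb (λ o → ⊥-elim (nm x o nb)))
      (λ all → nl (allBranches⇒linked (suc k) eq three all))
      where
      nm : ∀ x → IsOrdering G X x → ¬ (IsOrdering G X x → Branches G x) → ⊥
      nm x o nb = ¬¬model (≤-trans (n≤1+n 2) three) hi (orderingLabel zero x) (ne _) (λ M → nb (λ _ → model⇒branches zero (ordering⇒enumerates o) M))

    oneRoot : ∣ X ∣ ≡ 1 → CycleLinked G X
    oneRoot eq with enumeration′ roots (trans card-roots eq)
    ... | r , en = inj₂ (inj₁ eq , λ u v hu hv → subst (Reach G ⊤ u) (trans (sym (proj₂ (at u hu))) (proj₂ (at v hv))) (here ∈⊤))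
      where
      at : ∀ u → u ∈ X → ∃ λ (i : Fin 1) → r zero ≡ u
      at u h with hits en u (∈⇒ h)
      ... | zero , e = zero , e

    twoRoots-linked : ∣ X ∣ ≡ 2 → ¬ ¬ CycleLinked G X
    twoRoots-linked eq nl with enumeration′ roots (trans card-roots eq)
    ... | r , en = ¬¬model ≤-refl (s≤s (s≤s z≤n)) lab (λ x → 2≢5 (trans (sym (trans card-roots eq)) (Exc⇒5 x))) (λ M → nl (inj₂ (inj₂ eq , λ u v hu hv → go M u v (hits en u (∈⇒ hu)) (hits en v (∈⇒ hv)))))
      where
      lab : Fin m → Fin 2
      lab = orderingLabel zero r
      2≢5 : 2 ≢ 5
      2≢5 ()
      conn : Model (Defs.E G) (inside ∪ˢ roots) roots lab → ∀ i j → CycSucc i j → Reach G ⊤ (r i) (r j)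
      conn M i j s with link M (r i) (r j) (member en i) (member en j) (subst₂ CycSucc (sym (label-root zero en i)) (sym (label-root zero en j)) s)
      ... | u , v , p , e , q = reach-++ (walk⇒reach p) (step ∈⊤ e (walk⇒reach q))
      go : Model (Defs.E G) (inside ∪ˢ roots) roots lab → ∀ u v → (∃ λ i → r i ≡ u) → (∃ λ i → r i ≡ v) → Reach G ⊤ u v
      go M u v (zero , refl) (zero , refl) = here ∈⊤
      go M u v (zero , refl) (suc zero , refl) = conn M zero (suc zero) (inj₁ refl)
      go M u v (suc zero , refl) (zero , refl) = conn M (suc zero) zero (inj₂ (refl , refl))
      go M u v (suc zero , refl) (suc zero , refl) = here ∈⊤

    module Five (five : ∣ X ∣ ≡ 5) (nl : ¬ CycleLinked G X) where

      full : Fin m → Bool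
      full a = not (does (any? (λ x → (roots x ∧ not (Defs.E G a x)) B.≟ true)))

      full-sound : ∀ a → full a ≡ true → ∀ x → roots x ≡ true → Defs.E G a x ≡ true
      full-sound a h x hx with any? (λ x → (roots x ∧ not (Defs.E G a x)) B.≟ true)
      ... | no none = taut 2 (λ r e → not (r ∧ not e) ⊃ r ⊃ [ e ]) (roots x) (Defs.E G a x) (notB (λ q → none (x , q))) hx

      full-complete : ∀ a → (∀ x → roots x ≡ true → Defs.E G a x ≡ true) → full a ≡ true
      full-complete a f with any? (λ x → (roots x ∧ not (Defs.E G a x)) B.≟ true)
      ... | no _ = refl
      ... | yes (x , h) = absurdB (f x (∧-left h)) (∧-right {roots x} h)

      completeᵇ : Fin m → Fin m → Bool
      completeᵇ a b = not (a ≟ᵇ b) ∧ inside a ∧ inside b ∧ full a ∧ full b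

      -- The search over pairs is finite, so an actual pair comes out although the failure of
      -- cycle-linkage is only a negation: without a pair no labelling would be exceptional.
      complete-pair : ∃ λ a → ∃ λ b → CompletePair H inside roots a b
      complete-pair with any? (λ a → any? (λ b → completeᵇ a b B.≟ true))
      ... | yes (a , b , h) = a , b , record
            { distinct = ≟ᵇ⇒≢ a b (∧-left h) ; a∈S = ∧-left h₁ ; b∈S = ∧-left h₂ ; a-full = full-sound a (∧-left h₃) ; b-full = full-sound b (∧-right {full a} h₃) }
        where
        h₁ : (inside a ∧ inside b ∧ full a ∧ full b) ≡ true
        h₁ = ∧-right {not (a ≟ᵇ b)} h
        h₂ : (inside b ∧ full a ∧ full b) ≡ true
        h₂ = ∧-right {inside a} h₁
        h₃ : (full a ∧ full b) ≡ true
        h₃ = ∧-right {inside b} h₂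
      ... | no none = ⊥-elim (unexceptional⇒linked 5 five (s≤s (s≤s (s≤s z≤n))) ≤-refl (λ { lab (exc (_ , a , b , cp)) →
              none (a , b , ∧-intro (≢⇒≟ᵇ a b (distinct cp)) (∧-intro (a∈S cp) (∧-intro (b∈S cp) (∧-intro (full-complete a (a-full cp)) (full-complete b (b-full cp)))))) }) nl)

      module WithPair {a b : Fin m} (cp : CompletePair H inside roots a b) where

        rest : VertexSet m
        rest v = inside v ∧ not (v ≟ᵇ a) ∧ not (v ≟ᵇ b)

        attachedTo : ∀ x → Closure (within H rest) (λ v → rest v ∧ Defs.E G x v)
        attachedTo x = closure (within H rest) (λ v → rest v ∧ Defs.E G x v)

        apartᵇ : Fin m → Fin m → Bool
        apartᵇ x y = not (Defs.E G x y) ∧ not (does (any? (λ w → (set (attachedTo x) w ∧ set (attachedTo y) w) B.≟ true)))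

        -- The absence of branch sets is not decided. Its consequences for an ordering are
        -- decidable, and they suffice for the conclusion, so an ordering with these properties is
        -- searched for instead.
        goodOrder : (Fin 5 → Fin m) → Bool
        goodOrder x = injectiveᵇ x ∧ allF (λ i → roots (x i)) ∧ allF (λ i → apartᵇ (x i) (x (sh i)))

        record Separated (x : Fin 5 → Fin m) : Set where
          field
            enumerates : Enumerates x roots
            nonadjacent : ∀ i → ¬ Adj G (x i) (x (sh i))
            unlinked : ∀ i w → set (attachedTo (x i)) w ≡ true → set (attachedTo (x (sh i))) w ≡ true → ⊥

        goodOrder-sound : ∀ x → goodOrder x ≡ true → Separated x
        goodOrder-sound x h = record
          { enumerates = record { injective = inj ; member = mem ; hits = exhausts roots x inj mem (≤-reflexive (trans card-roots five)) }
          ; nonadjacent = λ i e → absurdB e (∧-left (ap i)) ; unlinked = λ i w c d → none (x i) (x (sh i)) (∧-right {not (Defs.E G (x i) (x (sh i)))} (ap i)) w c d }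
          where
          inj : Injective x
          inj = injectiveᵇ-sound x (∧-left h)
          mem : ∀ i → roots (x i) ≡ true
          mem = allF-sound (λ i → roots (x i)) (∧-left (∧-right {injectiveᵇ x} h))
          ap : ∀ i → apartᵇ (x i) (x (sh i)) ≡ true
          ap = allF-sound (λ i → apartᵇ (x i) (x (sh i))) (∧-right {allF (λ i → roots (x i))} (∧-right {injectiveᵇ x} h))
          none : ∀ x y → not (does (any? (λ w → (set (attachedTo x) w ∧ set (attachedTo y) w) B.≟ true))) ≡ true → ∀ w → set (attachedTo x) w ≡ true → set (attachedTo y) w ≡ true → ⊥
          none x y h w c d with any? (λ w → (set (attachedTo x) w ∧ set (attachedTo y) w) B.≟ true)
          ... | no n = n (w , ∧-intro c d)

        goodOrder-complete : ∀ x → Separated x → goodOrder x ≡ true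
        goodOrder-complete x s = ∧-intro (allF-complete (λ i → allF (λ j → (x i ≟ᵇ x j) ⇒ (i ≟ᵇ j))) (λ i → allF-complete (λ j → (x i ≟ᵇ x j) ⇒ (i ≟ᵇ j)) (λ j → ⇒-intro _ _ (λ e → ≡⇒≟ᵇ (injective (enumerates s) i j (≟ᵇ⇒≡ (x i) (x j) e))))))
            (∧-intro (allF-complete (λ i → roots (x i)) (member (enumerates s))) (allF-complete (λ i → apartᵇ (x i) (x (sh i))) (λ i → ∧-intro (notB (nonadjacent s i)) (none (x i) (x (sh i)) (unlinked s i)))))
          where
          open Separated
          allF-complete : ∀ {k} (f : Fin k → Bool) → (∀ i → f i ≡ true) → allF f ≡ true
          allF-complete {zero} f h = refl
          allF-complete {suc k} f h = ∧-intro (h zero) (allF-complete (λ i → f (suc i)) (λ i → h (suc i)))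
          none : ∀ x y → (∀ w → set (attachedTo x) w ≡ true → set (attachedTo y) w ≡ true → ⊥) → not (does (any? (λ w → (set (attachedTo x) w ∧ set (attachedTo y) w) B.≟ true))) ≡ true
          none x y f with any? (λ w → (set (attachedTo x) w ∧ set (attachedTo y) w) B.≟ true)
          ... | no _ = refl
          ... | yes (w , h) = ⊥-elim (f w (∧-left h) (∧-right {set (attachedTo x) w} h))

        lab : (Fin 5 → Fin m) → Fin m → Fin 5
        lab = orderingLabel 0F

        labelled : ∀ {x} → Enumerates x roots → LabelledRoots roots (lab x) x
        labelled en = record { enum = en ; lab-r = label-root 0F en }

        -- An ordering without branch sets is separated.
        unbranched : ∀ x → IsOrdering G X x → ¬ Branches G x → Separated x
        unbranched x o nb = record { enumerates = en ; nonadjacent = OneMoreLink.nonadjacent H dis (labelled en) cp nm ; unlinked = OneMoreLink.separate H dis (labelled en) cp nm }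
          where
          en = ordering⇒enumerates o
          nm : ¬ Model (Defs.E G) (inside ∪ˢ roots) roots (lab x)
          nm M = nb (model⇒branches 0F en M)

        separated-order : ∃ λ x → Separated x
        separated-order with any? (λ i → any? (λ j → any? (λ k → any? (λ l → any? (λ h → goodOrder (tuple i j k l h) B.≟ true)))))
        ... | yes (i , j , k , l , h , g) = tuple i j k l h , goodOrder-sound _ g
        ... | no none = ⊥-elim (¬¬-∀tuples 5 {P = λ x → IsOrdering G X x → Branches G x}
                (λ f g e h o → branches-cong e (h (ordering-cong (λ i → sym (e i)) o)))
                (λ x nb → nb (λ o → ⊥-elim (bad x o (λ br → nb (λ _ → br)))))
                (λ all → nl (allBranches⇒linked 5 five (s≤s (s≤s (s≤s z≤n))) all)))
          where
          bad : ∀ x → IsOrdering G X x → ¬ Branches G x → ⊥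
          bad x o nb = none (x 0F , x 1F , x 2F , x 3F , x 4F , goodOrder-complete _ (unbranched (tuple (x 0F) (x 1F) (x 2F) (x 3F) (x 4F)) (ordering-cong (λ i → sym (tuple-η x i)) o) (λ br → nb (branches-cong (tuple-η x) br))))

        module Conclude {x : Fin 5 → Fin m} (s : Separated x) (Γ : Grouping H dis (labelled (Separated.enumerates s)) cp) where

          lr = labelled (Separated.enumerates s)
          sp = sparse (massed I)
          K = pairSet a b

          -- The upper bound is the one for exceptional pairs and the lower bound is (M1).
          ρ-total : ρ G (∁ X) ≡ 5 * ∣ ∁ X ∣ + 1
          ρ-total = ≤-antisym (*-cancelˡ-≤ 2 (begin
            2 * ρ G (∁ X) ≡⟨ sym 2ρ-inside ⟩
            D H inside roots ≤⟨ exceptional-bound H dis lr cp Γ sp ⟩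
            10 * card inside + 2 ≡⟨ cong (λ t → 10 * t + 2) card-inside ⟩
            10 * ∣ ∁ X ∣ + 2 ≡⟨ ring ∣ ∁ X ∣ ⟩
            2 * (5 * ∣ ∁ X ∣ + 1) ∎)) (≤-trans (≤-reflexive (+-comm (5 * ∣ ∁ X ∣) 1)) (proj₁ fm))
            where
            open ≤-Reasoning
            ring : ∀ c → 10 * c + 2 ≡ 2 * (5 * c + 1)
            ring = solve-∀

          D-total : D H inside roots ≡ 10 * card inside + 2
          D-total = trans 2ρ-inside (trans (cong (2 *_) ρ-total) (trans (ring ∣ ∁ X ∣) (cong (λ t → 10 * t + 2) (sym card-inside))))
            where
            ring : ∀ c → 2 * (5 * c + 1) ≡ 10 * c + 2
            ring = solve-∀

          lookup-⁅⁆ : ∀ y v → lookup ⁅ y ⁆ v ≡ v ≟ᵇ y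
          lookup-⁅⁆ y v with v F.≟ y
          ... | yes refl = ∈⇒ (x∈⁅x⁆ v)
          ... | no ne = not⁻ (notB (λ h → ne (x∈⁅y⁆⇒x≡y y (⇒∈ ⁅ y ⁆ h))))

          R : VSet G
          R = ∁ (X ∪ (⁅ a ⁆ ∪ ⁅ b ⁆))

          lookup-R : ∀ v → lookup R v ≡ rest v
          lookup-R v = trans (lookup-map v not (X ∪ (⁅ a ⁆ ∪ ⁅ b ⁆))) (trans (cong not (trans (lookup-zipWith _∨_ v X (⁅ a ⁆ ∪ ⁅ b ⁆)) (cong (roots v ∨_) (trans (lookup-zipWith _∨_ v ⁅ a ⁆ ⁅ b ⁆) (cong₂ _∨_ (lookup-⁅⁆ a v) (lookup-⁅⁆ b v))))))
            (lem (roots v) (v ≟ᵇ a) (v ≟ᵇ b)))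
            where
            lem : ∀ r a b → not (r ∨ (a ∨ b)) ≡ not r ∧ not a ∧ not b
            lem true a b = refl
            lem false true b = refl
            lem false false b = refl

          module _ (C : VSet G) (comp : IsComponent G R C) where

            Z : VertexSet m
            Z = lookup C

            Z-rest : ∀ v → (Z v ⇒ rest v) ≡ true
            Z-rest v = ⇒-intro _ _ (λ h → trans (sym (lookup-R v)) (∈⇒ (proj₁ comp (⇒∈ C h))))

            Z-closed : ∀ u v → (Z u ∧ Defs.E G u v ∧ rest v ⇒ Z v) ≡ true
            Z-closed u v = ⇒-intro _ _ (λ h → lem (∧-left {Z u} h) (∧-left (∧-right {Z u} h)) (∧-right {Defs.E G u v} (∧-right {Z u} h)) (case-bool (Z v)))
              where
              lem : Z u ≡ true → Defs.E G u v ≡ true → rest v ≡ true → Z v ≡ true ⊎ not (Z v) ≡ true → Z v ≡ true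
              lem zu e r (inj₁ z) = z
              lem zu e r (inj₂ z) = ⊥-elim (proj₂ (proj₂ (proj₂ comp)) u v (⇒∈ C zu) (⇒∈ R (trans (lookup-R v) r)) (λ h → absurdB (∈⇒ h) z) e)

            v₀ : Fin m
            v₀ = proj₁ (proj₁ (proj₂ comp))

            i : Fin 5
            i = group Γ v₀

            one-group : ∀ v → Z v ≡ true → group Γ v ≡ i
            one-group v h = sym (go (proj₁ (proj₂ (proj₂ comp)) v₀ v (proj₂ (proj₁ (proj₂ comp))) (⇒∈ C h)))
              where
              rest∈ : ∀ {u} → u ∈ C → rest u ≡ true
              rest∈ {u} h = ⇒-elim _ _ (Z-rest u) (∈⇒ h)
              go : ∀ {u v} → Reach G C u v → group Γ u ≡ group Γ v
              go (here _) = refl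
              go (step {u} {w} u∈ e r) = trans (group-edge Γ u w (rest∈ u∈) (rest∈ (reach-source r)) e) (go r)

            P : VertexSet m
            P = part H dis lr cp Γ Z i

            P≡Z : ∀ v → P v ≡ Z v
            P≡Z v = lem (Z v) refl
              where
              lem : ∀ z → Z v ≡ z → P v ≡ z
              lem true h = ∧-intro h (≡⇒≟ᵇ (one-group v h))
              lem false h = cong (_∧ (group Γ v ≟ᵇ i)) h

            sepP : Sep H inside roots P (fence x a b i)
            sepP = part-sep H dis lr cp Γ Z Z-rest Z-closed i

            fence<5 : card (fence x a b i) < card roots
            fence<5 = ≤-trans (s≤s (fence-card x a b i)) (≤-reflexive (sym (trans card-roots five)))

            others : VertexSet m
            others = rest ∖ˢ Z

            others-closed : ∀ u v → (others u ∧ Defs.E G u v ∧ rest v ⇒ others v) ≡ true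
            others-closed u v = taut 6 (λ ru zu e e′ rv zv → (e ⇒ e′) ⊃ (zv ∧ e′ ∧ ru ⇒ zu) ⊃ [ (ru ∧ not zu) ∧ e ∧ rv ⇒ rv ∧ not zv ]) (rest u) (Z u) (Defs.E G u v) (Defs.E G v u) (rest v) (Z v) (symE H u v) (Z-closed v u)

            remainder : ∀ v → (inside ∖ˢ P) v ≡ (others ∪ˢ K) v
            remainder v rewrite P≡Z v = lem (inside v) (v ≟ᵇ a) (v ≟ᵇ b) (Z v) (⇒-intro _ _ (pair⊆S H dis lr cp Γ v)) (Z-rest v)
              where
              lem : ∀ s a b z → (a ∨ b ⇒ s) ≡ true → (z ⇒ s ∧ not a ∧ not b) ≡ true → s ∧ not z ≡ ((s ∧ not a ∧ not b) ∧ not z) ∨ (a ∨ b)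
              lem true true b false _ _ = refl
              lem true false true false _ _ = refl
              lem true false false true _ _ = refl
              lem true false false false _ _ = refl
              lem false false false z _ _ = refl

            card-all : card inside ≡ 2 + (card Z + card others)
            card-all = trans (card-pair H dis lr cp Γ) (cong (2 +_) (trans (sym (card-rest H dis lr cp Γ)) (card-split rest Z Z-rest)))

            -- The total is exactly `10 * card inside + 2`. The pair {a, b} with the other
            -- components accounts for at most `10 * card others + 22`, where 22 is the budget of
            -- the pair plus 2, so the component must use its whole budget; (M2) gives the converse.
            D-lower : 10 * card Z ≤ D H P (fence x a b i)
            D-lower = +-cancelˡ-≤ (10 * card others + 22) _ _ (begin
              (10 * card others + 22) + 10 * card Z ≡⟨ ring (card others) (card Z) ⟩
              10 * (2 + (card Z + card others)) + 2 ≡⟨ cong (λ t → 10 * t + 2) (sym card-all) ⟩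
              10 * card inside + 2 ≡⟨ sym D-total ⟩
              D H inside roots ≤⟨ D-split H sepP ⟩
              D H (inside ∖ˢ P) roots + D H P (fence x a b i) ≡⟨ cong (_+ D H P (fence x a b i)) (D-cong H remainder) ⟩
              D H (others ∪ˢ K) roots + D H P (fence x a b i)
                ≤⟨ +-monoˡ-≤ _ (≤-trans (closed-split H dis lr cp Γ others (λ v → taut 2 (λ r z → [ r ∧ not z ⇒ r ]) (rest v) (Z v)) others-closed sp) (+-monoʳ-≤ (10 * card others) (pair-bound H dis lr cp Γ))) ⟩
              (10 * card others + 22) + D H P (fence x a b i) ∎)
              where
              open ≤-Reasoning
              ring : ∀ o z → (10 * o + 22) + 10 * z ≡ 10 * (2 + (z + o)) + 2
              ring = solve-∀

            ρ-component : ρ G C ≡ 5 * ∣ C ∣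
            ρ-component = *-cancelˡ-≡ (ρ G C) (5 * ∣ C ∣) 2 (trans (sym (2ρ C P (fence x a b i) (λ v → sym (P≡Z v)) (apart sepP) (fully sepP)))
              (trans (≤-antisym (≤-trans (sp P _ sepP fence<5) (≤-reflexive (cong (10 *_) (card-cong P≡Z)))) D-lower) (trans (cong (10 *_) (lookup-card C)) (*-assoc 2 5 ∣ C ∣))))

            neighbours : ∀ v → InN G C v → v ∈ (⁅ a ⁆ ∪ (⁅ b ⁆ ∪ (⁅ x i ⁆ ∪ ⁅ x (sh (sh i)) ⁆)))
            neighbours v (v∉C , u , u∈C , e) = go (∨-elim {P v} (⇒-elim _ _ (fully sepP u v) (∧-intro (trans (P≡Z u) (∈⇒ u∈C)) e)))
              where
              single : ∀ y → v ≟ᵇ y ≡ true → v ∈ ⁅ y ⁆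
              single y h rewrite ≟ᵇ⇒≡ v y h = x∈⁅x⁆ y
              go : P v ≡ true ⊎ fence x a b i v ≡ true → v ∈ (⁅ a ⁆ ∪ (⁅ b ⁆ ∪ (⁅ x i ⁆ ∪ ⁅ x (sh (sh i)) ⁆)))
              go (inj₁ h) = ⊥-elim (v∉C (⇒∈ C (trans (sym (P≡Z v)) h)))
              go (inj₂ h) with ∨-elim {v ≟ᵇ a} h
              ... | inj₁ p = x∈p∪q⁺ (inj₁ (single a p))
              ... | inj₂ h′ with ∨-elim {v ≟ᵇ b} h′
              ...   | inj₁ p = x∈p∪q⁺ (inj₂ (x∈p∪q⁺ (inj₁ (single b p))))
              ...   | inj₂ h″ with ∨-elim {v ≟ᵇ x i} h″
              ...     | inj₁ p = x∈p∪q⁺ (inj₂ (x∈p∪q⁺ (inj₂ (x∈p∪q⁺ (inj₁ (single (x i) p))))))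
              ...     | inj₂ p = x∈p∪q⁺ (inj₂ (x∈p∪q⁺ (inj₂ (x∈p∪q⁺ (inj₂ (single _ p))))))

          conclusion : Conclusion G X
          conclusion = five , ρ-total , x ,
            (sym five , (λ {i} {j} e → injective (enum lr) i j e) , (λ v h → hits (enum lr) v (∈⇒ h)) , (λ i → ⇒∈ X (member (enum lr) i))) ,
            Separated.nonadjacent s , a , b , (λ h → absurdB (∈⇒ h) (a∈S cp)) , (λ h → absurdB (∈⇒ h) (b∈S cp)) ,
            pair-adjacent H dis lr cp Γ sp (dense (massed I)) , (λ i → a-full cp (x i) (member (enum lr) i) , b-full cp (x i) (member (enum lr) i)) ,
            (λ C comp → ρ-component C comp , i C comp , neighbours C comp)

theorem1p2 : (G : Graph) (X : VSet G) → 1 ≤ ∣ X ∣ → ∣ X ∣ ≤ 5 → FiveMassed G X → ¬ CycleLinked G X →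
    ∣ X ∣ ≡ 5
    × ρ G (∁ X) ≡ 5 * ∣ ∁ X ∣ + 1
    × Σ (Fin 5 → V G) λ x → IsOrdering G X x
    × (∀ i → ¬ Adj G (x i) (x (sh i)))
    × ∃ λ a → ∃ λ b → a ∉ X × b ∉ X
    × Adj G a b × (∀ i → Adj G a (x i) × Adj G b (x i))
    × (∀ C → IsComponent G (∁ (X ∪ (⁅ a ⁆ ∪ ⁅ b ⁆))) C →
    ρ G C ≡ 5 * ∣ C ∣
    × ∃ λ i → ∀ v → InN G C v → v ∈ (⁅ a ⁆ ∪ (⁅ b ⁆ ∪ (⁅ x i ⁆ ∪ ⁅ x (sh (sh i)) ⁆))))
theorem1p2 G X lo hi fm nl = by-size ∣ X ∣ refl lo hi
  where
  open Translation G X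
  open WithMassed fm hi
  linked-small : ∀ k → ∣ X ∣ ≡ k → 3 ≤ k → k ≤ 5 → k ≢ 5 → ⊥
  linked-small k eq three five ne = unexceptional⇒linked k eq three five (λ lab e → ne (trans (sym (trans card-roots eq)) (Exc⇒5 e))) nl
  by-size : ∀ k → ∣ X ∣ ≡ k → 1 ≤ k → k ≤ 5 → Conclusion G X
  by-size 1 eq _ _ = ⊥-elim (nl (oneRoot eq))
  by-size 2 eq _ _ = ⊥-elim (twoRoots-linked eq nl)
  by-size 3 eq _ h = ⊥-elim (linked-small 3 eq ≤-refl h (λ ()))
  by-size 4 eq _ h = ⊥-elim (linked-small 4 eq (n≤1+n 3) h (λ ()))
  by-size 5 eq _ _ = finish complete-pair
    where
    open Five eq nl
    finish : (∃ λ a → ∃ λ b → CompletePair H inside roots a b) → Conclusion G X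
    finish (a , b , cp) = order separated-order
      where
      open WithPair cp
      order : (∃ λ x → Separated x) → Conclusion G X
      order (x , s) = Conclude.conclusion s (OneMoreLink.groupingBy H dis (labelled (Separated.enumerates s)) cp (Separated.unlinked s))
  by-size (suc (suc (suc (suc (suc (suc k)))))) _ _ (s≤s (s≤s (s≤s (s≤s (s≤s ())))))
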